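{- For any coprime positive integers $m,n$ and any integer $k\ge1$, the symmetric function $$\frac{[k]_q}{[km]_q}\,e_{kn}\big[X[km]_q\big]$$ is a Schur positive symmetric polynomial, i.e. it equals $\sum_{\lambda\vdash kn}c_\lambda(q)\,s_\lambda[X]$ with every $c_\lambda(q)\in\mathbb{Z}_{\ge0}[q]$.
   Context: $[s]_q=1+q+\cdots+q^{s-1}$ for integers $s\ge0$. Plethystic notation: $e_{kn}[X[km]_q]$ denotes the elementary symmetric function $e_{kn}$ evaluated on the alphabet $\{q^jx_i:0\le j\le km-1,\ i\ge1\}$, where $X=x_1+x_2+\cdots$. -}

module Defs where

open import Data.Bool using (Bool; true; false; if_then_else_; _∧_)
open import Data.Nat using (ℕ; zero; suc; _+_; _*_; _<_; _≤ᵇ_; _<ᵇ_)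
open import Data.Nat.Properties using () renaming (_≟_ to _≟ℕ_)
open import Data.Nat.ListAction using (sum)
open import Data.Integer as ℤ using (ℤ)
open import Data.Fin using (Fin; toℕ)
open import Data.Fin.Properties using () renaming (_≟_ to _≟F_)
open import Data.List using (List; []; _∷_; _++_; map; cartesianProductWith; filterᵇ; upTo; foldr; length; concatMap; allFin)
open import Data.List.Relation.Unary.All using (All)
open import Data.List.Relation.Unary.Linked using (Linked)
open import Data.Vec as Vec using (Vec; replicate; tabulate; zipWith)
open import Data.Vec.Properties using (≡-dec)
open import Data.Product using (_×_; _,_; proj₁; proj₂)
open import Relation.Nullary.Decidable using (⌊_⌋; does)
open import Relation.Binary.PropositionalEquality using (_≡_)

-- Polynomials in Z[q, x_0, ..., x_{N-1}], represented as finite formal sums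
-- of terms (coefficient, monomial).  A monomial is (exponent of q, exponents of x).
Mono : ℕ → Set
Mono N = ℕ × Vec ℕ N

Poly : ℕ → Set
Poly N = List (ℤ × Mono N)

monoMul : ∀ {N} → Mono N → Mono N → Mono N
monoMul (a , u) (b , v) = (a + b , zipWith _+_ u v)

_⊕_ : ∀ {N} → Poly N → Poly N → Poly N
p ⊕ r = p ++ r

_⊗_ : ∀ {N} → Poly N → Poly N → Poly N
p ⊗ r = cartesianProductWith (λ s t → (proj₁ s ℤ.* proj₁ t , monoMul (proj₂ s) (proj₂ t))) p r

one : ∀ {N} → Poly N
one {N} = (ℤ.+ 1 , (0 , replicate N 0)) ∷ []

monoEq? : ∀ {N} → Mono N → Mono N → Bool
monoEq? (a , u) (b , v) = does (a ≟ℕ b) ∧ does (≡-dec _≟ℕ_ u v)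

coeff : ∀ {N} → Poly N → Mono N → ℤ
coeff p μ = foldr (λ t acc → (if monoEq? (proj₂ t) μ then proj₁ t else ℤ.+ 0) ℤ.+ acc) (ℤ.+ 0) p

_≈_ : ∀ {N} → Poly N → Poly N → Set
p ≈ r = ∀ μ → coeff p μ ≡ coeff r μ

unitVec : ∀ {N} → Fin N → Vec ℕ N
unitVec i = tabulate (λ j → if does (i ≟F j) then 1 else 0)

qInt : ∀ N → ℕ → Poly N
qInt N s = map (λ j → (ℤ.+ 1 , (j , replicate N 0))) (upTo s)

qPoly : ∀ N → List ℕ → Poly N
qPoly N c = go 0 c
  where
  go : ℕ → List ℕ → Poly N
  go i []       = []
  go i (a ∷ as) = (ℤ.+ a , (i , replicate N 0)) ∷ go (suc i) as

-- the alphabet X[s]_q = { q^j x_i : 0 ≤ j < s, 0 ≤ i < N } (as monomial terms)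
alphabet : ∀ N → ℕ → Poly N
alphabet N s = concatMap (λ j → map (λ i → (ℤ.+ 1 , (j , unitVec i))) (allFin N)) (upTo s)

-- elementary symmetric function e_r evaluated on a list of monomials (plethystically)
elem : ∀ {N} → ℕ → Poly N → Poly N
elem zero    _        = one
elem (suc r) []       = []
elem (suc r) (t ∷ ts) = ((t ∷ []) ⊗ elem r ts) ⊕ elem (suc r) ts

-- Schur polynomial s_λ(x_0, ..., x_{N-1}) as sum over semistandard Young tableaux
-- (English notation: rows weakly increasing, columns strictly increasing)
words : ∀ N → ℕ → List (List (Fin N))
words N zero    = [] ∷ []
words N (suc l) = cartesianProductWith _∷_ (allFin N) (words N l)

fillings : ∀ N → List ℕ → List (List (List (Fin N)))
fillings N []       = [] ∷ []
fillings N (l ∷ ls) = cartesianProductWith _∷_ (words N l) (fillings N ls)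

rowOK : ∀ {N} → List (Fin N) → Bool
rowOK (a ∷ b ∷ r) = (toℕ a ≤ᵇ toℕ b) ∧ rowOK (b ∷ r)
rowOK _           = true

colOK : ∀ {N} → List (Fin N) → List (Fin N) → Bool
colOK (a ∷ as) (b ∷ bs) = (toℕ a <ᵇ toℕ b) ∧ colOK as bs
colOK _        []       = true
colOK []       (_ ∷ _)  = false

isSSYT : ∀ {N} → List (List (Fin N)) → Bool
isSSYT []              = true
isSSYT (r ∷ [])        = rowOK r
isSSYT (r ∷ r' ∷ rs)   = rowOK r ∧ colOK r r' ∧ isSSYT (r' ∷ rs)

weight : ∀ {N} → List (List (Fin N)) → Vec ℕ N
weight {N} T = foldr (λ row acc → foldr (λ i v → zipWith _+_ (unitVec i) v) acc row) (replicate N 0) T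

schur : ∀ N → List ℕ → Poly N
schur N λ' = map (λ T → (ℤ.+ 1 , (0 , weight T))) (filterᵇ isSSYT (fillings N λ'))

IsPartitionOf : ℕ → List ℕ → Set
IsPartitionOf n λ' = All (0 <_) λ' × Linked (λ a b → b Data.Nat.≤ a) λ' × sum λ' ≡ n

schurExpansion : ∀ N → List (List ℕ × List ℕ) → Poly N
schurExpansion N L = foldr (λ p acc → (qPoly N (proj₂ p) ⊗ schur N (proj₁ p)) ⊕ acc) [] L

-- By the dual Cauchy identity (an iterated Pieri rule), e_r[X[s]_q] = Σ_λ G_λ(q) s_λ[X], where G_λ counts the
-- chains ∅ = λ^0 ⊂ ... ⊂ λ^s = λ of vertical strips by a weight. So with s = km and r = kn it is enough to find
-- Q_λ with nonnegative coefficients and [k]_q G_λ = [km]_q Q_λ.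
--
-- Divisibility: the Bender–Knuth symmetry lets one rotate the contents of the chains, which shifts the weight by
-- r modulo s; hence the numbers of chains of weight i modulo s have period r, so period k = gcd(r, s).
--
-- Positivity: the chains to λ index a Gelfand–Tsetlin basis, on which a principal sl₂-triple acts by explicit
-- rational matrices. Its raising and lowering operators are injective towards the middle weight, so the
-- coefficients of G_λ are unimodal around the middle. Therefore the power series (1 - q^k) G_λ / (1 - q^s) has
-- nonnegative coefficients up to the middle, and by divisibility also beyond it.
module Submission where

-- A single expansion must serve every number `N` of variables. The coefficients are therefore read
-- off chains of shapes, and `N` enters only when the two sides are compared. Shapes are vectors
-- with exactly `k * n` rows, enough in degree `k * n`; with so few rows the Pieri rule can fail in
-- higher degree, hence the comparison modulo monomials of larger `x`-degree.
--
-- `G_λ` is the principal specialization of the Schur function of the conjugate shape, so its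
-- coefficients are dimensions of weight spaces. The representation itself is never built: the
-- matrix coefficients are written down in an unnormalized form, which avoids the square roots of an
-- orthonormal basis, and only the commutator of the two operators is verified. Its off-diagonal
-- entries cancel in pairs; its diagonal entries are sums of residues of a rational function, whose
-- value depends on the sizes of the shapes alone. The zeros of the coefficients keep the operators
-- inside the set of chains of partitions, and the distinctness of shifted parts keeps the
-- denominators nonzero.

-- Rational sums and products; partial fractions.

module Rationals where

  open import Data.Rational using (ℚ; 0ℚ; 1ℚ; _+_; _*_; -_; _-_; 1/_; ≢-nonZero)
  open import Data.Rational.Properties as ℚP using (_≟_)
  open import Data.Nat as ℕ using (ℕ; zero; suc; _<_)
  import Data.Nat.Properties as ℕP
  open import Relation.Nullary using (yes; no; contradiction)
  open import Relation.Nullary.Decidable using (dec⇒maybe)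
  open import Tactic.RingSolver using (solve-∀)
  open import Tactic.RingSolver.Core.AlmostCommutativeRing using (AlmostCommutativeRing; fromCommutativeRing)
  open import Level using (0ℓ)
  open import Relation.Binary.PropositionalEquality
  open ≡-Reasoning

  ringℚ : AlmostCommutativeRing 0ℓ 0ℓ
  ringℚ = fromCommutativeRing ℚP.+-*-commutativeRing (λ x → dec⇒maybe (0ℚ ≟ x))

  -- inv 0 = 0, so that below the factor of a product at its own index is 1.
  inv : ℚ → ℚ
  inv p with p ≟ 0ℚ
  ... | yes _   = 0ℚ
  ... | no p≢0 = (1/ p) {{≢-nonZero p≢0}}

  *-inv : ∀ {p} → p ≢ 0ℚ → p * inv p ≡ 1ℚ
  *-inv {p} p≢0 with p ≟ 0ℚ
  ... | yes p≡0 = contradiction p≡0 p≢0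
  ... | no  p≢0 = ℚP.*-inverseʳ p {{≢-nonZero p≢0}}

  inverse-unique : ∀ {p} u → p * u ≡ 1ℚ → u ≡ inv p
  inverse-unique {p} u pu≡1 with p ≟ 0ℚ
  ... | yes refl = contradiction (trans (sym pu≡1) (ℚP.*-zeroˡ u)) (λ ())
  ... | no  p≢0 = begin
    u                  ≡⟨ ℚP.*-identityʳ u ⟨
    u * 1ℚ             ≡⟨ cong (u *_) (ℚP.*-inverseʳ p {{≢-nonZero p≢0}}) ⟨
    u * (p * v)        ≡⟨ assoc u p v ⟩
    (p * u) * v        ≡⟨ cong (_* v) pu≡1 ⟩
    1ℚ * v             ≡⟨ ℚP.*-identityˡ v ⟩
    v                  ∎
    where
    v = (1/ p) {{≢-nonZero p≢0}}
    assoc : ∀ a b c → a * (b * c) ≡ (b * a) * c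
    assoc = solve-∀ ringℚ

  inv-neg : ∀ p → inv (- p) ≡ - inv p
  inv-neg p with p ≟ 0ℚ
  ... | yes refl = refl
  ... | no  p≢0 = sym (inverse-unique {p = - p} (- v) (trans (swap p v) (ℚP.*-inverseʳ p {{≢-nonZero p≢0}})))
    where
    v = (1/ p) {{≢-nonZero p≢0}}
    swap : ∀ a b → (- a) * (- b) ≡ a * b
    swap = solve-∀ ringℚ

  x-y≢0 : ∀ {x y} → x ≢ y → x - y ≢ 0ℚ
  x-y≢0 {x} {y} x≢y x-y≡0 = x≢y (trans (sym (lem x y)) (trans (cong (_+ y) x-y≡0) (ℚP.+-identityˡ y)))
    where
    lem : ∀ a b → (a - b) + b ≡ a
    lem = solve-∀ ringℚ

  inv-swap : ∀ x y → inv (x - y) ≡ - inv (y - x)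
  inv-swap x y = trans (cong inv (lem x y)) (inv-neg (y - x))
    where
    lem : ∀ a b → a - b ≡ - (b - a)
    lem = solve-∀ ringℚ

  ∑ : ℕ → (ℕ → ℚ) → ℚ
  ∑ zero    f = 0ℚ
  ∑ (suc n) f = ∑ n f + f n

  ∏ : ℕ → (ℕ → ℚ) → ℚ
  ∏ zero    f = 1ℚ
  ∏ (suc n) f = ∏ n f * f n

  ∑-cong : ∀ n {f g} → (∀ {i} → i < n → f i ≡ g i) → ∑ n f ≡ ∑ n g
  ∑-cong zero    eq = refl
  ∑-cong (suc n) eq = cong₂ _+_ (∑-cong n λ i<n → eq (ℕP.m<n⇒m<1+n i<n)) (eq ℕP.≤-refl)

  ∏-cong : ∀ n {f g} → (∀ {i} → i < n → f i ≡ g i) → ∏ n f ≡ ∏ n g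
  ∏-cong zero    eq = refl
  ∏-cong (suc n) eq = cong₂ _*_ (∏-cong n λ i<n → eq (ℕP.m<n⇒m<1+n i<n)) (eq ℕP.≤-refl)

  ∑-+ : ∀ n f g → ∑ n (λ i → f i + g i) ≡ ∑ n f + ∑ n g
  ∑-+ zero    f g = refl
  ∑-+ (suc n) f g = trans (cong (_+ (f n + g n)) (∑-+ n f g)) (lem (∑ n f) (∑ n g) (f n) (g n))
    where
    lem : ∀ a b c d → (a + b) + (c + d) ≡ (a + c) + (b + d)
    lem = solve-∀ ringℚ

  ∑-*ˡ : ∀ n c f → ∑ n (λ i → c * f i) ≡ c * ∑ n f
  ∑-*ˡ zero    c f = sym (ℚP.*-zeroʳ c)
  ∑-*ˡ (suc n) c f = trans (cong (_+ c * f n) (∑-*ˡ n c f)) (sym (ℚP.*-distribˡ-+ c (∑ n f) (f n)))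

  ∑-zero : ∀ n {f} → (∀ {i} → i < n → f i ≡ 0ℚ) → ∑ n f ≡ 0ℚ
  ∑-zero zero    eq = refl
  ∑-zero (suc n) eq = cong₂ _+_ (∑-zero n λ i<n → eq (ℕP.m<n⇒m<1+n i<n)) (eq ℕP.≤-refl)

  ∑-swap : ∀ m n (f : ℕ → ℕ → ℚ) → ∑ m (λ i → ∑ n (f i)) ≡ ∑ n (λ j → ∑ m (λ i → f i j))
  ∑-swap zero    n f = sym (∑-zero n λ _ → refl)
  ∑-swap (suc m) n f = trans (cong (_+ ∑ n (f m)) (∑-swap m n f)) (sym (∑-+ n (λ j → ∑ m (λ i → f i j)) (f m)))

  ∏-zero : ∀ n {f i} → i < n → f i ≡ 0ℚ → ∏ n f ≡ 0ℚ
  ∏-zero (suc n) {f} {i} i<1+n fi≡0 with i ℕ.≟ n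
  ... | yes refl = trans (cong (∏ n f *_) fi≡0) (ℚP.*-zeroʳ (∏ n f))
  ... | no  i≢n  = trans (cong (_* f n) (∏-zero n (ℕP.≤∧≢⇒< (ℕP.≤-pred i<1+n) i≢n) fi≡0)) (ℚP.*-zeroˡ (f n))

  ∏-* : ∀ n f g → ∏ n (λ i → f i * g i) ≡ ∏ n f * ∏ n g
  ∏-* zero    f g = refl
  ∏-* (suc n) f g = trans (cong (_* (f n * g n)) (∏-* n f g)) (lem (∏ n f) (∏ n g) (f n) (g n))
    where
    lem : ∀ a b c d → (a * b) * (c * d) ≡ (a * c) * (b * d)
    lem = solve-∀ ringℚ

  -- Two products that differ only at `k` are in the ratio of their factors there; cross-multiplied,
  -- because either factor may be zero.
  ∏-exchange : ∀ n {f g} k → k < n → (∀ {i} → i ≢ k → f i ≡ g i) → ∏ n f * g k ≡ ∏ n g * f k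
  ∏-exchange (suc n) {f} {g} k k<1+n eq with k ℕ.≟ n
  ... | yes refl = trans (cong (λ z → z * f n * g n) (∏-cong n λ i<n → eq (ℕP.<⇒≢ i<n))) (lem (∏ n g) (f n) (g n))
    where
    lem : ∀ a b c → a * b * c ≡ a * c * b
    lem = solve-∀ ringℚ
  ... | no k≢n = begin
    ∏ n f * f n * g k    ≡⟨ lem (∏ n f) (f n) (g k) ⟩
    (∏ n f * g k) * f n  ≡⟨ cong₂ _*_ (∏-exchange n k (ℕP.≤∧≢⇒< (ℕP.≤-pred k<1+n) k≢n) eq) (eq (λ n≡k → k≢n (sym n≡k))) ⟩
    (∏ n g * f k) * g n  ≡⟨ lem (∏ n g) (f k) (g n) ⟩
    ∏ n g * g n * f k    ∎
    where
    lem : ∀ a b c → a * b * c ≡ a * c * b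
    lem = solve-∀ ringℚ

  -- The residues of Π_j (1 + ε_j / (z - x_j)) sum to Σ_j ε_j.
  module PartialFractions (ε x : ℕ → ℚ) where

    Distinct : ℕ → Set
    Distinct n = ∀ {i j} → i < n → j < n → i ≢ j → x i ≢ x j

    restrict : ∀ {n} → Distinct (suc n) → Distinct n
    restrict d i<n j<n = d (ℕP.m<n⇒m<1+n i<n) (ℕP.m<n⇒m<1+n j<n)

    residue : ℕ → ℕ → ℚ
    residue n i = ε i * ∏ n (λ j → 1ℚ + ε j * inv (x i - x j))

    split : ∀ {z xi xn} → z ≢ xi → z ≢ xn → xi ≢ xn →
            inv (z - xi) * inv (z - xn) ≡ inv (xi - xn) * (inv (z - xi) - inv (z - xn))
    split {z} {xi} {xn} z≢xi z≢xn xi≢xn = begin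
      vi * vn                            ≡⟨ ℚP.*-identityˡ _ ⟨
      1ℚ * (vi * vn)                     ≡⟨ cong (_* (vi * vn)) (*-inv (x-y≢0 xi≢xn)) ⟨
      ((xi - xn) * u) * (vi * vn)        ≡⟨ lem z xi xn u vi vn ⟩
      u * (vi * ((z - xn) * vn) - vn * ((z - xi) * vi))
        ≡⟨ cong₂ (λ p q → u * (vi * p - vn * q)) (*-inv (x-y≢0 z≢xn)) (*-inv (x-y≢0 z≢xi)) ⟩
      u * (vi * 1ℚ - vn * 1ℚ)            ≡⟨ cong₂ (λ p q → u * (p - q)) (ℚP.*-identityʳ vi) (ℚP.*-identityʳ vn) ⟩
      u * (vi - vn)                      ∎
      where
      vi = inv (z - xi)
      vn = inv (z - xn)
      u = inv (xi - xn)
      lem : ∀ z xi xn u vi vn →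
            ((xi - xn) * u) * (vi * vn) ≡ u * (vi * ((z - xn) * vn) - vn * ((z - xi) * vi))
      lem = solve-∀ ringℚ

    -- Partial fractions of a product that tends to 1 as `z` grows. One factor is added at a time:
    -- `split` separates each product of two poles, and the new pole collects the residue computed
    -- by `residue-last`. That lemma uses this one for the earlier factors, so the two are proved
    -- together.
    expansion : ∀ n → Distinct n → ∀ z → (∀ {i} → i < n → z ≢ x i) →
                ∏ n (λ j → 1ℚ + ε j * inv (z - x j)) ≡ 1ℚ + ∑ n (λ i → residue n i * inv (z - x i))

    -- The residue at the new point is the product of the earlier factors at `z = x n`, which
    -- `expansion` rewrites as a sum over the earlier points.
    residue-last : ∀ n → Distinct (suc n) →
                   residue (suc n) n ≡ ε n * (1ℚ - ∑ n (λ i → residue n i * inv (x i - x n)))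
    residue-last n d = begin
      ε n * (∏ n (λ j → 1ℚ + ε j * inv (x n - x j)) * (1ℚ + ε n * inv (x n - x n)))
        ≡⟨ cong (λ p → ε n * (P * (1ℚ + ε n * inv p))) (ℚP.+-inverseʳ (x n)) ⟩
      ε n * (∏ n (λ j → 1ℚ + ε j * inv (x n - x j)) * (1ℚ + ε n * 0ℚ))
        ≡⟨ cong (ε n *_) (lem P (ε n)) ⟩
      ε n * ∏ n (λ j → 1ℚ + ε j * inv (x n - x j))
        ≡⟨ cong (ε n *_) (expansion n (restrict d) (x n) λ i<n → d ℕP.≤-refl (ℕP.m<n⇒m<1+n i<n) (λ n≡i → ℕP.<⇒≢ i<n (sym n≡i))) ⟩
      ε n * (1ℚ + ∑ n (λ i → residue n i * inv (x n - x i)))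
        ≡⟨ cong (λ s → ε n * (1ℚ + s)) (trans (∑-cong n λ {i} _ → flip (residue n i) (x n) (x i)) (∑-*ˡ n (- 1ℚ) (λ i → residue n i * inv (x i - x n)))) ⟩
      ε n * (1ℚ + (- 1ℚ) * ∑ n (λ i → residue n i * inv (x i - x n)))
        ≡⟨ neg (ε n) (∑ n (λ i → residue n i * inv (x i - x n))) ⟩
      ε n * (1ℚ - ∑ n (λ i → residue n i * inv (x i - x n))) ∎
      where
      P = ∏ n (λ j → 1ℚ + ε j * inv (x n - x j))
      lem : ∀ p e → p * (1ℚ + e * 0ℚ) ≡ p
      lem = solve-∀ ringℚ
      neg : ∀ e s → e * (1ℚ + (- 1ℚ) * s) ≡ e * (1ℚ - s)
      neg = solve-∀ ringℚ
      flip : ∀ a p q → a * inv (p - q) ≡ (- 1ℚ) * (a * inv (q - p))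
      flip a p q = trans (cong (a *_) (inv-swap p q)) (lem′ a (inv (q - p)))
        where
        lem′ : ∀ a b → a * (- b) ≡ (- 1ℚ) * (a * b)
        lem′ = solve-∀ ringℚ

    residue-step : ∀ n i → residue (suc n) i ≡ residue n i + ε n * (residue n i * inv (x i - x n))
    residue-step n i = lem (ε i) (∏ n (λ j → 1ℚ + ε j * inv (x i - x j))) (ε n) (inv (x i - x n))
      where
      lem : ∀ e p en u → e * (p * (1ℚ + en * u)) ≡ e * p + en * (e * p * u)
      lem = solve-∀ ringℚ

    expansion zero    d z z≢ = refl
    expansion (suc n) d z z≢ = begin
      ∏ n (λ j → 1ℚ + ε j * inv (z - x j)) * (1ℚ + ε n * vn)
        ≡⟨ cong (_* (1ℚ + ε n * vn)) (expansion n (restrict d) z (λ i<n → z≢ (ℕP.m<n⇒m<1+n i<n))) ⟩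
      (1ℚ + S) * (1ℚ + ε n * vn)
        ≡⟨ expand S (ε n) vn ⟩
      1ℚ + (S + ε n * (vn * S)) + ε n * vn
        ≡⟨ cong (λ t → 1ℚ + (S + ε n * t) + ε n * vn) vS ⟩
      1ℚ + (S + ε n * (T₁ - vn * T₂)) + ε n * vn
        ≡⟨ collect S (ε n) T₁ vn T₂ ⟩
      1ℚ + ((S + ε n * T₁) + (ε n * (1ℚ - T₂)) * vn)
        ≡⟨ cong₂ (λ p q → 1ℚ + (p + q * vn)) sumStep (sym (residue-last n d)) ⟩
      1ℚ + (∑ n (λ i → residue (suc n) i * inv (z - x i)) + residue (suc n) n * vn) ∎
      where
      vn = inv (z - x n)
      v : ℕ → ℚ
      v i = inv (z - x i)
      S = ∑ n (λ i → residue n i * v i)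
      T₁ = ∑ n (λ i → residue n i * inv (x i - x n) * v i)
      T₂ = ∑ n (λ i → residue n i * inv (x i - x n))
      expand : ∀ S e v → (1ℚ + S) * (1ℚ + e * v) ≡ 1ℚ + (S + e * (v * S)) + e * v
      expand = solve-∀ ringℚ
      collect : ∀ S e T₁ v T₂ → 1ℚ + (S + e * (T₁ - v * T₂)) + e * v ≡ 1ℚ + ((S + e * T₁) + (e * (1ℚ - T₂)) * v)
      collect = solve-∀ ringℚ
      term : ∀ {i} → i < n → vn * (residue n i * v i)
                           ≡ residue n i * inv (x i - x n) * v i + (- vn) * (residue n i * inv (x i - x n))
      term {i} i<n = begin
        vn * (residue n i * v i)                         ≡⟨ re vn (residue n i) (v i) ⟩
        residue n i * (v i * vn)
          ≡⟨ cong (residue n i *_) (split (z≢ (ℕP.m<n⇒m<1+n i<n)) (z≢ ℕP.≤-refl)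
                                          (d (ℕP.m<n⇒m<1+n i<n) ℕP.≤-refl (ℕP.<⇒≢ i<n))) ⟩
        residue n i * (inv (x i - x n) * (v i - vn))     ≡⟨ re′ (residue n i) (inv (x i - x n)) (v i) vn ⟩
        residue n i * inv (x i - x n) * v i + (- vn) * (residue n i * inv (x i - x n)) ∎
        where
        re : ∀ a b c → a * (b * c) ≡ b * (c * a)
        re = solve-∀ ringℚ
        re′ : ∀ a b c d → a * (b * (c - d)) ≡ a * b * c + (- d) * (a * b)
        re′ = solve-∀ ringℚ
      vS : vn * S ≡ T₁ - vn * T₂
      vS = begin
        vn * S                       ≡⟨ ∑-*ˡ n vn (λ i → residue n i * v i) ⟨
        ∑ n (λ i → vn * (residue n i * v i)) ≡⟨ ∑-cong n term ⟩
        ∑ n (λ i → residue n i * inv (x i - x n) * v i + (- vn) * (residue n i * inv (x i - x n)))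
          ≡⟨ ∑-+ n (λ i → residue n i * inv (x i - x n) * v i) (λ i → (- vn) * (residue n i * inv (x i - x n))) ⟩
        T₁ + ∑ n (λ i → (- vn) * (residue n i * inv (x i - x n))) ≡⟨ cong (T₁ +_) (∑-*ˡ n (- vn) (λ i → residue n i * inv (x i - x n))) ⟩
        T₁ + (- vn) * T₂             ≡⟨ re T₁ vn T₂ ⟩
        T₁ - vn * T₂                 ∎
        where
        re : ∀ a b c → a + (- b) * c ≡ a - b * c
        re = solve-∀ ringℚ
      sumStep : S + ε n * T₁ ≡ ∑ n (λ i → residue (suc n) i * inv (z - x i))
      sumStep = begin
        S + ε n * T₁                  ≡⟨ cong (S +_) (∑-*ˡ n (ε n) (λ i → residue n i * inv (x i - x n) * v i)) ⟨
        S + ∑ n (λ i → ε n * (residue n i * inv (x i - x n) * v i))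
          ≡⟨ ∑-+ n (λ i → residue n i * v i) (λ i → ε n * (residue n i * inv (x i - x n) * v i)) ⟨
        ∑ n (λ i → residue n i * v i + ε n * (residue n i * inv (x i - x n) * v i))
          ≡⟨ ∑-cong n (λ {i} _ → trans (re (residue n i) (ε n) (inv (x i - x n)) (v i)) (cong (_* v i) (sym (residue-step n i)))) ⟩
        ∑ n (λ i → residue (suc n) i * v i) ∎
        where
        re : ∀ r e u v → r * v + e * (r * u * v) ≡ (r + e * (r * u)) * v
        re = solve-∀ ringℚ

    ∑-residue : ∀ n → Distinct n → ∑ n (residue n) ≡ ∑ n ε
    ∑-residue zero    d = refl
    ∑-residue (suc n) d = begin
      ∑ n (residue (suc n)) + residue (suc n) n
        ≡⟨ cong₂ _+_ (trans (∑-cong n λ {i} _ → residue-step n i) (trans (∑-+ n (residue n) (λ i → ε n * (residue n i * inv (x i - x n))))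
                                                                    (cong (∑ n (residue n) +_) (∑-*ˡ n (ε n) (λ i → residue n i * inv (x i - x n))))))
                     (residue-last n d) ⟩
      (∑ n (residue n) + ε n * T) + ε n * (1ℚ - T)  ≡⟨ lem (∑ n (residue n)) (ε n) T ⟩
      ∑ n (residue n) + ε n                         ≡⟨ cong (_+ ε n) (∑-residue n (restrict d)) ⟩
      ∑ n ε + ε n                                   ∎
      where
      T = ∑ n (λ i → residue n i * inv (x i - x n))
      lem : ∀ a e t → (a + e * t) + e * (1ℚ - t) ≡ a + e
      lem = solve-∀ ringℚ

-- Natural numbers inside the rationals; summation by parts.

module NaturalsInRationals where

  open Rationals
  open import Data.Bool using (Bool; true; false)
  open import Data.Rational using (ℚ; 0ℚ; 1ℚ; _+_; _*_; -_; _-_)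
  import Data.Rational as ℚ
  open import Data.Rational.Properties as ℚP using (_≟_)
  open import Data.Nat as ℕ using (ℕ; zero; suc; _<_)
  import Data.Nat.Properties as ℕP
  open import Relation.Nullary using (yes; no; contradiction)
  open import Tactic.RingSolver using (solve-∀)
  open import Relation.Binary.PropositionalEquality
  open ≡-Reasoning

  ι : ℕ → ℚ
  ι zero    = 0ℚ
  ι (suc n) = 1ℚ + ι n

  ι-+ : ∀ m n → ι (m ℕ.+ n) ≡ ι m + ι n
  ι-+ zero    n = sym (ℚP.+-identityˡ (ι n))
  ι-+ (suc m) n = trans (cong (1ℚ +_) (ι-+ m n)) (sym (ℚP.+-assoc 1ℚ (ι m) (ι n)))

  ι-* : ∀ m n → ι (m ℕ.* n) ≡ ι m * ι n
  ι-* zero    n = sym (ℚP.*-zeroˡ (ι n))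
  ι-* (suc m) n = trans (ι-+ n (m ℕ.* n)) (trans (cong (ι n +_) (ι-* m n)) (lem (ι m) (ι n)))
    where
    lem : ∀ a b → b + a * b ≡ (1ℚ + a) * b
    lem = solve-∀ ringℚ

  ι-nonneg : ∀ n → 0ℚ ℚ.≤ ι n
  ι-nonneg zero    = ℚP.≤-refl
  ι-nonneg (suc n) = ℚP.+-mono-≤ {0ℚ} {1ℚ} {0ℚ} {ι n} (ℚP.<⇒≤ (ℚP.positive⁻¹ 1ℚ)) (ι-nonneg n)

  ι-suc≢0 : ∀ n → ι (suc n) ≢ 0ℚ
  ι-suc≢0 n eq = ℚP.<-irrefl (sym eq) (ℚP.+-mono-<-≤ {0ℚ} {1ℚ} {0ℚ} {ι n} (ℚP.positive⁻¹ 1ℚ) (ι-nonneg n))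

  ι-injective : ∀ {m n} → ι m ≡ ι n → m ≡ n
  ι-injective {zero}  {zero}  eq = refl
  ι-injective {zero}  {suc n} eq = contradiction (sym eq) (ι-suc≢0 n)
  ι-injective {suc m} {zero}  eq = contradiction eq (ι-suc≢0 m)
  ι-injective {suc m} {suc n} eq = cong suc (ι-injective (begin
    ι m                   ≡⟨ lem (ι m) ⟩
    (1ℚ + ι m) - 1ℚ       ≡⟨ cong (_- 1ℚ) eq ⟩
    (1ℚ + ι n) - 1ℚ       ≡⟨ lem (ι n) ⟨
    ι n                   ∎))
    where
    lem : ∀ a → a ≡ (1ℚ + a) - 1ℚ
    lem = solve-∀ ringℚ

  *-nonzero : ∀ {p q} → p ≢ 0ℚ → p * q ≡ 0ℚ → q ≡ 0ℚ
  *-nonzero {p} {q} p≢0 pq≡0 = begin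
    q                 ≡⟨ ℚP.*-identityˡ q ⟨
    1ℚ * q            ≡⟨ cong (_* q) (*-inv p≢0) ⟨
    (p * inv p) * q   ≡⟨ lem p (inv p) q ⟩
    inv p * (p * q)   ≡⟨ cong (inv p *_) pq≡0 ⟩
    inv p * 0ℚ        ≡⟨ ℚP.*-zeroʳ (inv p) ⟩
    0ℚ                ∎
    where
    lem : ∀ a b c → (a * b) * c ≡ b * (a * c)
    lem = solve-∀ ringℚ

  δ : Bool → ℚ
  δ true  = 1ℚ
  δ false = 0ℚ

  ∑-single : ∀ n {f} k → k < n → (∀ {i} → i < n → i ≢ k → f i ≡ 0ℚ) → ∑ n f ≡ f k
  ∑-single (suc n) {f} k k<1+n off with k ℕP.≟ n
  ... | yes refl = trans (cong (_+ f n) (∑-zero n λ i<n → off (ℕP.m<n⇒m<1+n i<n) (ℕP.<⇒≢ i<n))) (ℚP.+-identityˡ (f n))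
  ... | no k≢n   = trans (cong₂ _+_ (∑-single n k (ℕP.≤∧≢⇒< (ℕP.≤-pred k<1+n) k≢n) λ i<n → off (ℕP.m<n⇒m<1+n i<n))
                                    (off ℕP.≤-refl λ n≡k → k≢n (sym n≡k))) (ℚP.+-identityʳ (f k))

  -- The weights u (s - u) have second difference -2, so Abel summation leaves a plain sum and boundary terms.
  ∑-second-difference : ∀ (s : ℚ) (x : ℕ → ℚ) n →
    ∑ n (λ u → (ι (suc u) * (s - ι (suc u))) * (x (suc (suc u)) - (1ℚ + 1ℚ) * x (suc u) + x u))
      ≡ (ι n * (s - ι n)) * x (suc n) - ((1ℚ + ι n) * (s - (1ℚ + ι n))) * x n + (s - 1ℚ) * x 0
        - (1ℚ + 1ℚ) * ∑ n (λ u → x (suc u))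
  ∑-second-difference s x zero    = lem s (x 1) (x 0)
    where
    lem : ∀ s x₁ x₀ → 0ℚ ≡ (0ℚ * (s - 0ℚ)) * x₁ - ((1ℚ + 0ℚ) * (s - (1ℚ + 0ℚ))) * x₀ + (s - 1ℚ) * x₀ - (1ℚ + 1ℚ) * 0ℚ
    lem = solve-∀ ringℚ
  ∑-second-difference s x (suc n) =
    trans (cong (_+ (ι (suc n) * (s - ι (suc n))) * (x (suc (suc n)) - (1ℚ + 1ℚ) * x (suc n) + x n)) (∑-second-difference s x n)) (lem s (ι n) (x (suc (suc n))) (x (suc n)) (x n) (x 0) (∑ n (λ u → x (suc u))))
    where
    lem : ∀ s t x₂ x₁ xₙ x₀ S →
      ((t * (s - t)) * x₁ - ((1ℚ + t) * (s - (1ℚ + t))) * xₙ + (s - 1ℚ) * x₀ - (1ℚ + 1ℚ) * S)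
        + ((1ℚ + t) * (s - (1ℚ + t))) * (x₂ - (1ℚ + 1ℚ) * x₁ + xₙ)
      ≡ ((1ℚ + t) * (s - (1ℚ + t))) * x₂ - ((1ℚ + (1ℚ + t)) * (s - (1ℚ + (1ℚ + t)))) * x₁ + (s - 1ℚ) * x₀
        - (1ℚ + 1ℚ) * (S + x₁)
    lem = solve-∀ ringℚ

-- Dimension counting by elimination.

module CommonKernel where

  open Rationals
  open NaturalsInRationals
  open import Data.Rational using (ℚ; 0ℚ; 1ℚ; _+_; _*_; -_; _-_)
  open import Data.Rational.Properties as ℚP using (_≟_)
  open import Data.Nat as ℕ using (zero; suc; _<_; s≤s)
  open import Data.Fin using (Fin; zero; suc; punchIn; punchOut)
  open import Data.Fin.Properties using (any?; punchIn-punchOut) renaming (_≟_ to _≟F_)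
  open import Data.List using (List; _∷_; length)
  open import Data.List.Membership.Propositional using (_∈_; _∉_)
  open import Data.List.Relation.Unary.Any using (here; there)
  open import Data.List.Relation.Unary.All as All using (All)
  open import Data.List.Relation.Unary.AllPairs using (_∷_)
  open import Data.List.Relation.Unary.Unique.Propositional using (Unique)
  open import Relation.Nullary using (¬_; yes; no; contradiction; Dec)
  open import Relation.Nullary.Decidable using (does; ¬?; dec-true; dec-false)
  open import Tactic.RingSolver using (solve-∀)
  open import Data.Product using (_×_; _,_; ∃-syntax)
  open import Relation.Binary using (DecidableEquality)
  open import Relation.Binary.PropositionalEquality
  open ≡-Reasoning

  record Linear {S : Set} (φ : (S → ℚ) → ℚ) : Set where
    field
      linear : ∀ c f g → φ (λ x → f x + c * g x) ≡ φ f + c * φ g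

  module Kernel {S : Set} (_≟S_ : DecidableEquality S) where

    point : S → S → ℚ
    point x y = δ (does (y ≟S x))

    point-same : ∀ x → point x x ≡ 1ℚ
    point-same x = cong δ (dec-true (x ≟S x) refl)

    point-other : ∀ {x y} → y ≢ x → point x y ≡ 0ℚ
    point-other {x} {y} y≢x = cong δ (dec-false (y ≟S x) y≢x)

    -- Elimination: a functional that is nonzero on the first point is used up to clear that point
    -- from the others.
    common-kernel : ∀ {n} (φ : Fin n → (S → ℚ) → ℚ) → (∀ k → Linear (φ k)) → ∀ {X} → Unique X → n < length X →
      ∃[ f ] (∃[ x ] x ∈ X × f x ≢ 0ℚ) × (∀ {y} → y ∉ X → f y ≡ 0ℚ) × (∀ k → φ k f ≡ 0ℚ)
    common-kernel φ lin {x ∷ X} (x∉X ∷ uniq) n<1+m with any? (λ k → ¬? (φ k (point x) ≟ 0ℚ))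
    -- When every functional kills the first point mass, that function is itself a solution.
    ... | no none = point x , (x , here refl , λ e → contradiction (trans (sym (point-same x)) e) λ ())
                  , (λ {y} y∉ → point-other λ y≡x → y∉ (here y≡x))
                  , λ k → decide (φ k (point x) ≟ 0ℚ) (λ ne → none (k , ne))
      where
      decide : ∀ {p} → Dec (p ≡ 0ℚ) → ¬ (p ≢ 0ℚ) → p ≡ 0ℚ
      decide (yes e)  _  = e
      decide (no ne)  nn = contradiction ne nn
    common-kernel {suc n} φ lin {x ∷ X} (x∉X ∷ uniq) (s≤s n<m) | yes (i , φᵢx≢0)
      with common-kernel ψ ψ-linear uniq n<m
      where
      ratio : Fin n → ℚ
      ratio k = - (φ (punchIn i k) (point x) * inv (φ i (point x)))
      ψ : Fin n → (S → ℚ) → ℚ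
      ψ k f = φ (punchIn i k) f + ratio k * φ i f
      ψ-linear : ∀ k → Linear (ψ k)
      ψ-linear k .Linear.linear c f g = trans
        (cong₂ (λ a b → a + ratio k * b) (Linear.linear (lin (punchIn i k)) c f g) (Linear.linear (lin i) c f g))
        (lem (φ (punchIn i k) f) c (φ (punchIn i k) g) (ratio k) (φ i f) (φ i g))
        where
        lem : ∀ a c b r d e → (a + c * b) + r * (d + c * e) ≡ (a + r * d) + c * (b + r * e)
        lem = solve-∀ ringℚ
    ... | f , (y , y∈X , fy≢0) , support , ker = h , (y , there y∈X , λ e → fy≢0 (trans (sym (h-on y∈X)) e)) , h-support , h-ker
      where
      p = φ i (point x)
      -- This multiple of the first point mass makes the pivot functional vanish on `h`, while `h`
      -- still agrees with `f` on the remaining points.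
      c = - (φ i f * inv p)
      h : S → ℚ
      h z = f z + c * point x z
      h-on : ∀ {z} → z ∈ X → h z ≡ f z
      h-on {z} z∈X = trans (cong (λ w → f z + c * w) (point-other λ z≡x → All.lookup x∉X z∈X (sym z≡x))) (lem (f z) c)
        where
        lem : ∀ a c → a + c * 0ℚ ≡ a
        lem = solve-∀ ringℚ
      h-support : ∀ {z} → z ∉ x ∷ X → h z ≡ 0ℚ
      h-support {z} z∉ = trans (cong₂ (λ a w → a + c * w) (support λ z∈ → z∉ (there z∈)) (point-other λ z≡x → z∉ (here z≡x))) (lem c)
        where
        lem : ∀ c → 0ℚ + c * 0ℚ ≡ 0ℚ
        lem = solve-∀ ringℚ
      h-i : φ i h ≡ 0ℚ
      h-i = begin
        φ i h                              ≡⟨ Linear.linear (lin i) c f (point x) ⟩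
        φ i f + (- (φ i f * inv p)) * p    ≡⟨ lem (φ i f) p (inv p) ⟩
        φ i f * (1ℚ - p * inv p)           ≡⟨ cong (λ z → φ i f * (1ℚ - z)) (*-inv φᵢx≢0) ⟩
        φ i f * (1ℚ - 1ℚ)                  ≡⟨ ℚP.*-zeroʳ (φ i f) ⟩
        0ℚ                                 ∎
        where
        lem : ∀ a p v → a + (- (a * v)) * p ≡ a * (1ℚ - p * v)
        lem = solve-∀ ringℚ
      h-ker : ∀ k → φ k h ≡ 0ℚ
      h-ker k with i ≟F k
      ... | yes refl = h-i
      ... | no i≢k  = subst (λ j → φ j h ≡ 0ℚ) (punchIn-punchOut i≢k) (begin
        φ j h                                          ≡⟨ Linear.linear (lin j) c f (point x) ⟩
        φ j f + c * φ j (point x)                      ≡⟨ lem (φ j f) (φ i f) (inv p) (φ j (point x)) ⟩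
        φ j f + (- (φ j (point x) * inv p)) * φ i f    ≡⟨ ker (punchOut i≢k) ⟩
        0ℚ                                             ∎)
        where
        j = punchIn i (punchOut i≢k)
        lem : ∀ a b v d → a + (- (b * v)) * d ≡ a + (- (d * v)) * b
        lem = solve-∀ ringℚ

-- The ladder relation of sl₂ and injectivity.

module SlTwoLadder where

  open Rationals
  open NaturalsInRationals
  open import Data.Rational using (ℚ; 0ℚ; _+_; _*_)
  open import Data.Rational.Properties as ℚP using ()
  open import Data.Nat as ℕ using (ℕ; zero; suc)
  open import Tactic.RingSolver using (solve-∀)
  open import Relation.Binary.PropositionalEquality
  open ≡-Reasoning

  module _ {S : Set} (Good : S → Set) where

    infix 4 _≃_
    -- Functions are compared at good points only, because the commutator identity is available only
    -- at genuine chains of partitions.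
    _≃_ : (S → ℚ) → (S → ℚ) → Set
    f ≃ g = ∀ {x} → Good x → f x ≡ g x

    iterate : ((S → ℚ) → S → ℚ) → (S → ℚ) → ℕ → S → ℚ
    iterate B f zero    = f
    iterate B f (suc i) = B (iterate B f i)

    module _ (A B : (S → ℚ) → S → ℚ)
             (A-cong : ∀ {f g} → f ≃ g → A f ≃ A g) (B-cong : ∀ {f g} → f ≃ g → B f ≃ B g)
             (A-zero : A (λ _ → 0ℚ) ≃ λ _ → 0ℚ) (B-scale : ∀ c f → B (λ x → c * f x) ≃ λ x → c * B f x)
             (f : S → ℚ) (h : ℕ → ℚ)
             (commutator : ∀ i → A (B (iterate B f i)) ≃ λ x → B (A (iterate B f i)) x + h i * iterate B f i x) where

      -- Moving `A` to the right past each `B` collects one eigenvalue `h i` of the commutator per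
      -- step, until `A` meets `f` and kills it.
      ladder : A f ≃ (λ _ → 0ℚ) → ∀ i → A (iterate B f (suc i)) ≃ λ x → ∑ (suc i) h * iterate B f i x
      ladder Af≃0 zero {x} gx = begin
        A (B f) x                         ≡⟨ commutator 0 gx ⟩
        B (A f) x + h 0 * f x             ≡⟨ cong (_+ h 0 * f x) (B-cong (λ g → trans (Af≃0 g) (sym (ℚP.*-zeroˡ 0ℚ))) gx) ⟩
        B (λ _ → 0ℚ * 0ℚ) x + h 0 * f x   ≡⟨ cong (_+ h 0 * f x) (B-scale 0ℚ (λ _ → 0ℚ) gx) ⟩
        0ℚ * B (λ _ → 0ℚ) x + h 0 * f x   ≡⟨ lem (B (λ _ → 0ℚ) x) (h 0) (f x) ⟩
        (0ℚ + h 0) * f x                  ∎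
        where
        lem : ∀ b h f → 0ℚ * b + h * f ≡ (0ℚ + h) * f
        lem = solve-∀ ringℚ
      ladder Af≃0 (suc i) {x} gx = begin
        A (B (iterate B f (suc i))) x                             ≡⟨ commutator (suc i) gx ⟩
        B (A (iterate B f (suc i))) x + h (suc i) * B fᵢ x        ≡⟨ cong (_+ h (suc i) * B fᵢ x) (B-cong (ladder Af≃0 i) gx) ⟩
        B (λ y → ∑ (suc i) h * fᵢ y) x + h (suc i) * B fᵢ x       ≡⟨ cong (_+ h (suc i) * B fᵢ x) (B-scale (∑ (suc i) h) fᵢ gx) ⟩
        ∑ (suc i) h * B fᵢ x + h (suc i) * B fᵢ x                 ≡⟨ ℚP.*-distribʳ-+ (B fᵢ x) (∑ (suc i) h) (h (suc i)) ⟨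
        ∑ (suc (suc i)) h * B fᵢ x                                ∎
        where
        fᵢ = iterate B f i

      -- Applying `A` to a vanishing power of `B` on `f` gives, by `ladder`, a nonzero multiple of
      -- the previous power. So the exponent can be lowered until `f` itself vanishes.
      injective : A f ≃ (λ _ → 0ℚ) → (∀ i → ∑ (suc i) h ≢ 0ℚ) → ∀ K → iterate B f K ≃ (λ _ → 0ℚ) → f ≃ λ _ → 0ℚ
      injective Af≃0 h≢0 zero    end = end
      injective Af≃0 h≢0 (suc K) end = injective Af≃0 h≢0 K λ {x} gx → *-nonzero (h≢0 K) (begin
        ∑ (suc K) h * iterate B f K x   ≡⟨ ladder Af≃0 K gx ⟨
        A (iterate B f (suc K)) x       ≡⟨ A-cong end gx ⟩
        A (λ _ → 0ℚ) x                  ≡⟨ A-zero gx ⟩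
        0ℚ                              ∎)

-- Finite and guarded sums in a commutative semiring.

module ListSums where

  open import Algebra.Bundles using (CommutativeSemiring)
  open import Data.Bool using (Bool; true; false; if_then_else_; _∧_)
  open import Data.List using (List; []; _∷_; _++_; map; concatMap; filterᵇ; cartesianProductWith)
  open import Data.List.Membership.Propositional using (_∈_)
  open import Data.List.Relation.Unary.Any using (here; there)
  open import Level using (0ℓ)
  open import Relation.Binary.PropositionalEquality as ≡ using (_≡_)

  module ListSum (R : CommutativeSemiring 0ℓ 0ℓ) where

    open CommutativeSemiring R
    open import Relation.Binary.Reasoning.Setoid setoid

    private variable
      A B C : Set

    Σ : List A → (A → Carrier) → Carrier
    Σ []       g = 0#
    Σ (x ∷ xs) g = g x + Σ xs g

    guard : Bool → Carrier → Carrier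
    guard b x = if b then x else 0#

    interchange : ∀ a b c d → (a + b) + (c + d) ≈ (a + c) + (b + d)
    interchange a b c d = begin
      (a + b) + (c + d)   ≈⟨ +-assoc a b (c + d) ⟩
      a + (b + (c + d))   ≈⟨ +-congˡ (sym (+-assoc b c d)) ⟩
      a + ((b + c) + d)   ≈⟨ +-congˡ (+-congʳ (+-comm b c)) ⟩
      a + ((c + b) + d)   ≈⟨ +-congˡ (+-assoc c b d) ⟩
      a + (c + (b + d))   ≈⟨ sym (+-assoc a c (b + d)) ⟩
      (a + c) + (b + d)   ∎

    *-swap : ∀ a b c → a * (b * c) ≈ b * (a * c)
    *-swap a b c = begin
      a * (b * c)   ≈⟨ sym (*-assoc a b c) ⟩
      (a * b) * c   ≈⟨ *-congʳ (*-comm a b) ⟩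
      (b * a) * c   ≈⟨ *-assoc b a c ⟩
      b * (a * c)   ∎

    *-interchange : ∀ a b c d → (a * b) * (c * d) ≈ (a * c) * (b * d)
    *-interchange a b c d = begin
      (a * b) * (c * d)   ≈⟨ *-assoc a b (c * d) ⟩
      a * (b * (c * d))   ≈⟨ *-congˡ (*-swap b c d) ⟩
      a * (c * (b * d))   ≈⟨ sym (*-assoc a c (b * d)) ⟩
      (a * c) * (b * d)   ∎

    Σ-cong∈ : ∀ (xs : List A) {g h} → (∀ {x} → x ∈ xs → g x ≈ h x) → Σ xs g ≈ Σ xs h
    Σ-cong∈ []       eq = refl
    Σ-cong∈ (x ∷ xs) eq = +-cong (eq (here ≡.refl)) (Σ-cong∈ xs λ x∈ → eq (there x∈))

    Σ-cong : ∀ (xs : List A) {g h} → (∀ x → g x ≈ h x) → Σ xs g ≈ Σ xs h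
    Σ-cong xs eq = Σ-cong∈ xs λ {x} _ → eq x

    Σ-zero : ∀ (xs : List A) {g} → (∀ {x} → x ∈ xs → g x ≈ 0#) → Σ xs g ≈ 0#
    Σ-zero []       z = refl
    Σ-zero (x ∷ xs) z = trans (+-cong (z (here ≡.refl)) (Σ-zero xs λ x∈ → z (there x∈))) (+-identityˡ 0#)

    Σ-++ : ∀ (xs ys : List A) {g} → Σ (xs ++ ys) g ≈ Σ xs g + Σ ys g
    Σ-++ []       ys     = sym (+-identityˡ _)
    Σ-++ (x ∷ xs) ys {g} = trans (+-congˡ (Σ-++ xs ys)) (sym (+-assoc (g x) (Σ xs g) (Σ ys g)))

    Σ-map : ∀ (f : A → B) xs {g} → Σ (map f xs) g ≈ Σ xs (λ x → g (f x))
    Σ-map f []       = refl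
    Σ-map f (x ∷ xs) = +-congˡ (Σ-map f xs)

    Σ-concatMap : ∀ (f : A → List B) xs {g} → Σ (concatMap f xs) g ≈ Σ xs (λ x → Σ (f x) g)
    Σ-concatMap f []       = refl
    Σ-concatMap f (x ∷ xs) = trans (Σ-++ (f x) (concatMap f xs)) (+-congˡ (Σ-concatMap f xs))

    Σ-+ : ∀ (xs : List A) g h → Σ xs (λ x → g x + h x) ≈ Σ xs g + Σ xs h
    Σ-+ []       g h = sym (+-identityˡ 0#)
    Σ-+ (x ∷ xs) g h = trans (+-congˡ (Σ-+ xs g h)) (interchange (g x) (h x) (Σ xs g) (Σ xs h))

    Σ-*ˡ : ∀ (xs : List A) c g → Σ xs (λ x → c * g x) ≈ c * Σ xs g
    Σ-*ˡ []       c g = sym (zeroʳ c)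
    Σ-*ˡ (x ∷ xs) c g = trans (+-congˡ (Σ-*ˡ xs c g)) (sym (distribˡ c (g x) (Σ xs g)))

    Σ-*ʳ : ∀ (xs : List A) c g → Σ xs (λ x → g x * c) ≈ Σ xs g * c
    Σ-*ʳ xs c g = trans (Σ-cong xs λ x → *-comm (g x) c) (trans (Σ-*ˡ xs c g) (*-comm c (Σ xs g)))

    Σ-swap : ∀ (xs : List A) (ys : List B) (g : A → B → Carrier) → Σ xs (λ x → Σ ys (g x)) ≈ Σ ys (λ y → Σ xs (λ x → g x y))
    Σ-swap []       ys g = sym (Σ-zero ys λ _ → refl)
    Σ-swap (x ∷ xs) ys g = trans (+-congˡ (Σ-swap xs ys g)) (sym (Σ-+ ys (g x) (λ y → Σ xs (λ x → g x y))))

    Σ-cartesian : ∀ (f : A → B → C) xs ys {g} → Σ (cartesianProductWith f xs ys) g ≈ Σ xs (λ x → Σ ys (λ y → g (f x y)))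
    Σ-cartesian f []       ys = refl
    Σ-cartesian f (x ∷ xs) ys = trans (Σ-++ (map (f x) ys) _) (+-cong (Σ-map (f x) ys) (Σ-cartesian f xs ys))

    Σ-filter : ∀ (p : A → Bool) xs {g} → Σ (filterᵇ p xs) g ≈ Σ xs (λ x → guard (p x) (g x))
    Σ-filter p []       = refl
    Σ-filter p (x ∷ xs) with p x
    ... | true  = +-congˡ (Σ-filter p xs)
    ... | false = trans (Σ-filter p xs) (sym (+-identityˡ _))

    guard-cong : ∀ b {x y} → (b ≡ true → x ≈ y) → guard b x ≈ guard b y
    guard-cong true  eq = eq ≡.refl
    guard-cong false eq = refl

    guard-vanish : ∀ b {x} → x ≈ 0# → guard b x ≈ 0#
    guard-vanish true  z = z
    guard-vanish false z = refl

    guard-∧ : ∀ b c x → guard (b ∧ c) x ≈ guard b (guard c x)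
    guard-∧ true  c x = refl
    guard-∧ false c x = refl

    guard-*ˡ : ∀ b c x → guard b (c * x) ≈ c * guard b x
    guard-*ˡ true  c x = refl
    guard-*ˡ false c x = sym (zeroʳ c)

    guard-+ : ∀ b x y → guard b (x + y) ≈ guard b x + guard b y
    guard-+ true  x y = refl
    guard-+ false x y = sym (+-identityˡ 0#)

    Σ-guard : ∀ (xs : List A) b g → Σ xs (λ x → guard b (g x)) ≈ guard b (Σ xs g)
    Σ-guard xs true  g = refl
    Σ-guard xs false g = Σ-zero xs λ _ → refl

    guard-swap : ∀ b c x → guard b (guard c x) ≈ guard c (guard b x)
    guard-swap true  c x = refl
    guard-swap false true  x = refl
    guard-swap false false x = refl

-- The Bender-Knuth symmetry of two consecutive vertical strips.

module BenderKnuth where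

  open ListSums
  open import Data.Bool using (true; false; _∧_; T)
  open import Data.Nat using (ℕ; zero; suc; _+_; _≤_; _<_; s≤s; _≤ᵇ_)
  import Data.Nat.Properties as ℕP
  open import Data.Nat.Tactic.RingSolver using (solve-∀)
  open import Data.Vec using (Vec; []; _∷_)
  open import Relation.Nullary using (yes; no; contradiction)
  open import Relation.Binary.PropositionalEquality
  open ≡-Reasoning

  module Nat = ListSum ℕP.+-*-commutativeSemiring
  open Nat using (guard)

  ≤ᵇ-true : ∀ {a b} → a ≤ b → (a ≤ᵇ b) ≡ true
  ≤ᵇ-true {a} {b} a≤b with a ≤ᵇ b | ℕP.≤⇒≤ᵇ a≤b
  ... | true | _ = refl

  ≤ᵇ-false : ∀ {a b} → b < a → (a ≤ᵇ b) ≡ false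
  ≤ᵇ-false {a} {b} b<a with a ≤ᵇ b in e
  ... | false = refl
  ... | true  = contradiction (ℕP.≤ᵇ⇒≤ a b (subst T (sym e) _)) (ℕP.<⇒≱ b<a)

  -- Sums over the pairs a + b = m; the second one omits a = m.
  antidiag antidiag⁻ : ℕ → (ℕ → ℕ → ℕ) → ℕ
  antidiag  zero    h = h 0 0
  antidiag  (suc m) h = h 0 (suc m) + antidiag m (λ a b → h (suc a) b)
  antidiag⁻ zero    h = 0
  antidiag⁻ (suc m) h = h 0 (suc m) + antidiag⁻ m (λ a b → h (suc a) b)

  antidiag-cong : ∀ m {h g} → (∀ a b → h a b ≡ g a b) → antidiag m h ≡ antidiag m g
  antidiag-cong zero    eq = eq 0 0
  antidiag-cong (suc m) eq = cong₂ _+_ (eq 0 (suc m)) (antidiag-cong m λ a b → eq (suc a) b)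

  antidiag⁻-cong : ∀ m {h g} → (∀ a b → h a b ≡ g a b) → antidiag⁻ m h ≡ antidiag⁻ m g
  antidiag⁻-cong zero    eq = refl
  antidiag⁻-cong (suc m) eq = cong₂ _+_ (eq 0 (suc m)) (antidiag⁻-cong m λ a b → eq (suc a) b)

  antidiag⁻-+ : ∀ m h g → antidiag⁻ m (λ a b → h a b + g a b) ≡ antidiag⁻ m h + antidiag⁻ m g
  antidiag⁻-+ zero    h g = refl
  antidiag⁻-+ (suc m) h g = trans (cong (h 0 (suc m) + g 0 (suc m) +_) (antidiag⁻-+ m (λ a b → h (suc a) b) (λ a b → g (suc a) b)))
    (lem (h 0 (suc m)) (g 0 (suc m)) (antidiag⁻ m (λ a b → h (suc a) b)) (antidiag⁻ m (λ a b → g (suc a) b)))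
    where
    lem : ∀ a b c d → a + b + (c + d) ≡ (a + c) + (b + d)
    lem = solve-∀

  antidiag-last : ∀ m h → antidiag m h ≡ antidiag⁻ m h + h m 0
  antidiag-last zero    h = refl
  antidiag-last (suc m) h = trans (cong (h 0 (suc m) +_) (antidiag-last m (λ a b → h (suc a) b)))
    (sym (ℕP.+-assoc (h 0 (suc m)) (antidiag⁻ m (λ a b → h (suc a) b)) (h (suc m) 0)))

  antidiag⁻-suc : ∀ m h → antidiag⁻ (suc m) h ≡ antidiag m (λ a b → h a (suc b))
  antidiag⁻-suc zero    h = ℕP.+-identityʳ (h 0 1)
  antidiag⁻-suc (suc m) h = cong (h 0 (suc (suc m)) +_) (antidiag⁻-suc m (λ a b → h (suc a) b))

  antidiag-flip : ∀ m h → antidiag m h ≡ antidiag m (λ a b → h b a)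
  antidiag-flip zero    h = refl
  antidiag-flip (suc m) h = begin
    antidiag (suc m) h                                    ≡⟨ antidiag-last (suc m) h ⟩
    antidiag⁻ (suc m) h + h (suc m) 0                     ≡⟨ cong (_+ h (suc m) 0) (antidiag⁻-suc m h) ⟩
    antidiag m (λ a b → h a (suc b)) + h (suc m) 0        ≡⟨ cong (_+ h (suc m) 0) (antidiag-flip m (λ a b → h a (suc b))) ⟩
    antidiag m (λ a b → h b (suc a)) + h (suc m) 0        ≡⟨ ℕP.+-comm (antidiag m (λ a b → h b (suc a))) (h (suc m) 0) ⟩
    antidiag (suc m) (λ a b → h b a)                      ∎

  -- The rows of κ, from the top, receive a first strip (bits c) and a second one (bits d);
  -- P and Q are the lengths of the previous row after one and after both strips.
  twoStrips : ∀ {ℓ} → ℕ → ℕ → Vec ℕ ℓ → (ℕ → ℕ → Vec ℕ ℓ → ℕ) → ℕ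
  twoStrips P Q []      Φ = Φ 0 0 []
  twoStrips P Q (a ∷ κ) Φ =
    guard ((a ≤ᵇ P) ∧ (a ≤ᵇ Q)) (twoStrips a a κ λ i j v → Φ i j (a ∷ v)) +
    guard ((a ≤ᵇ P) ∧ (suc a ≤ᵇ Q)) (twoStrips a (suc a) κ λ i j v → Φ i (suc j) (suc a ∷ v)) +
    (guard ((suc a ≤ᵇ P) ∧ (suc a ≤ᵇ Q)) (twoStrips (suc a) (suc a) κ λ i j v → Φ (suc i) j (suc a ∷ v)) +
     guard ((suc a ≤ᵇ P) ∧ (suc (suc a) ≤ᵇ Q)) (twoStrips (suc a) (suc (suc a)) κ λ i j v → Φ (suc i) (suc j) (suc (suc a) ∷ v)))

  data Dominant : ∀ {ℓ} → ℕ → Vec ℕ ℓ → Set where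
    []  : ∀ {p} → Dominant p []
    _∷_ : ∀ {ℓ p a} {κ : Vec ℕ ℓ} → a ≤ p → Dominant a κ → Dominant p (a ∷ κ)

  twoStrips-cong : ∀ {ℓ} P Q (κ : Vec ℕ ℓ) {Φ Ψ} → (∀ i j v → Φ i j v ≡ Ψ i j v) → twoStrips P Q κ Φ ≡ twoStrips P Q κ Ψ
  twoStrips-cong P Q []      eq = eq 0 0 []
  twoStrips-cong P Q (a ∷ κ) eq = cong₂ _+_
    (cong₂ _+_ (cong (guard ((a ≤ᵇ P) ∧ (a ≤ᵇ Q))) (twoStrips-cong a a κ λ i j v → eq i j (a ∷ v)))
               (cong (guard ((a ≤ᵇ P) ∧ (suc a ≤ᵇ Q))) (twoStrips-cong a (suc a) κ λ i j v → eq i (suc j) (suc a ∷ v))))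
    (cong₂ _+_ (cong (guard ((suc a ≤ᵇ P) ∧ (suc a ≤ᵇ Q))) (twoStrips-cong (suc a) (suc a) κ λ i j v → eq (suc i) j (suc a ∷ v)))
               (cong (guard ((suc a ≤ᵇ P) ∧ (suc (suc a) ≤ᵇ Q))) (twoStrips-cong (suc a) (suc (suc a)) κ λ i j v → eq (suc i) (suc j) (suc (suc a) ∷ v))))

  module _ {ℓ : ℕ} where

    shift : ℕ → ℕ → (ℕ → ℕ → Vec ℕ ℓ → ℕ) → ℕ → ℕ → Vec ℕ ℓ → ℕ
    shift a b Φ i j v = Φ (a + i) (b + j) v

    swap : (ℕ → ℕ → Vec ℕ ℓ → ℕ) → ℕ → ℕ → Vec ℕ ℓ → ℕ
    swap Φ i j v = Φ j i v

    with-row : ℕ → (ℕ → ℕ → Vec ℕ (suc ℓ) → ℕ) → ℕ → ℕ → Vec ℕ ℓ → ℕ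
    with-row q Φ i j v = Φ i j (q ∷ v)

  -- Inside a run of m + 1 equal rows that each receive exactly one box, the first strip occupies
  -- the top a of them.
  run : ∀ {ℓ} → ℕ → ℕ → Vec ℕ ℓ → (ℕ → ℕ → Vec ℕ ℓ → ℕ) → ℕ
  run m p κ Φ = twoStrips (suc p) (suc p) κ (shift m 0 Φ) + antidiag⁻ m (λ a b → twoStrips p (suc p) κ (shift a b Φ))

  -- The ways to fill a row that the row above does not constrain, grouped by the number of boxes:
  -- none, exactly one (which opens a run), two.
  free : ∀ {ℓ} → ℕ → Vec ℕ ℓ → (ℕ → ℕ → Vec ℕ (suc ℓ) → ℕ) → ℕ
  free a κ Φ = twoStrips a a κ (with-row a Φ) + run 1 a κ (with-row (suc a) Φ) +
               twoStrips (suc a) (suc (suc a)) κ (shift 1 1 (with-row (suc (suc a)) Φ))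

  unblocked : ∀ {ℓ} P Q a (κ : Vec ℕ ℓ) Φ → suc a ≤ P → suc (suc a) ≤ Q → twoStrips P Q (a ∷ κ) Φ ≡ free a κ Φ
  unblocked P Q a κ Φ a<P a+1<Q
    rewrite ≤ᵇ-true a<P | ≤ᵇ-true a+1<Q | ≤ᵇ-true (ℕP.<⇒≤ a<P) | ≤ᵇ-true (ℕP.<⇒≤ a+1<Q) | ≤ᵇ-true (ℕP.<⇒≤ (ℕP.<⇒≤ a+1<Q))
    = lem (twoStrips a a κ (with-row a Φ)) (twoStrips a (suc a) κ (shift 0 1 (with-row (suc a) Φ)))
          (twoStrips (suc a) (suc a) κ (shift 1 0 (with-row (suc a) Φ))) (twoStrips (suc a) (suc (suc a)) κ (shift 1 1 (with-row (suc (suc a)) Φ)))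
    where
    lem : ∀ x y z w → x + y + (z + w) ≡ x + (z + (y + 0)) + w
    lem = solve-∀

  module Symmetry where

    -- The state left by the rows above falls into three classes, each symmetric under exchanging
    -- the strips: the last row took no box (`symmetric₀`), two boxes (`symmetric₂`), or it ends a
    -- run of equal rows with one box each (`symmetric-run`). A single row with one box is not
    -- symmetric alone, which is why whole runs are kept together. The three claims are proved by
    -- one induction on the rows.
    symmetric₀ : ∀ {ℓ p} {κ : Vec ℕ ℓ} → Dominant p κ → ∀ Φ → twoStrips p p κ Φ ≡ twoStrips p p κ (swap Φ)
    symmetric₂ : ∀ {ℓ p} {κ : Vec ℕ ℓ} → Dominant p κ → ∀ Φ → twoStrips (suc p) (suc (suc p)) κ Φ ≡ twoStrips (suc p) (suc (suc p)) κ (swap Φ)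
    symmetric-run : ∀ {ℓ p} {κ : Vec ℕ ℓ} → Dominant p κ → ∀ m Φ → run (suc m) p κ Φ ≡ run (suc m) p κ (swap Φ)
    symmetric-free : ∀ {ℓ a} {κ : Vec ℕ ℓ} → Dominant a κ → ∀ Φ → free a κ Φ ≡ free a κ (swap Φ)

    symmetric-free d Φ = cong₂ _+_ (cong₂ _+_ (symmetric₀ d (with-row _ Φ)) (symmetric-run d 0 (with-row _ Φ)))
                                   (symmetric₂ d (shift 1 1 (with-row _ Φ)))

    symmetric₂ []       Φ = refl
    symmetric₂ {p = p} {a ∷ κ} (a≤p ∷ d) Φ = begin
      twoStrips (suc p) (suc (suc p)) (a ∷ κ) Φ   ≡⟨ unblocked _ _ a κ Φ (s≤s a≤p) (s≤s (s≤s a≤p)) ⟩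
      free a κ Φ                                  ≡⟨ symmetric-free d Φ ⟩
      free a κ (swap Φ)                           ≡⟨ unblocked _ _ a κ (swap Φ) (s≤s a≤p) (s≤s (s≤s a≤p)) ⟨
      twoStrips (suc p) (suc (suc p)) (a ∷ κ) (swap Φ) ∎

    symmetric₀ []       Φ = refl
    -- Below a row of length `p` that took no box, a row of the same length takes none either, a row
    -- shorter by one takes at most one, and a shorter row is unconstrained.
    symmetric₀ {p = p} {a ∷ κ} (a≤p ∷ d) Φ with a ℕP.≟ p
    ... | yes refl = trans (blocked Φ) (trans (symmetric₀ d (with-row a Φ)) (sym (blocked (swap Φ))))
      where
      blocked : ∀ Φ → twoStrips a a (a ∷ κ) Φ ≡ twoStrips a a κ (with-row a Φ)
      blocked Φ rewrite ≤ᵇ-true (ℕP.≤-refl {a}) | ≤ᵇ-false (ℕP.n<1+n a)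
        = trans (ℕP.+-identityʳ _) (ℕP.+-identityʳ _)
    ... | no a≢p with suc a ℕP.≟ p
    ...   | yes refl = trans (blocked Φ) (trans (cong₂ _+_ (symmetric₀ d (with-row a Φ)) (symmetric-run d 0 (with-row (suc a) Φ))) (sym (blocked (swap Φ))))
      where
      blocked : ∀ Φ → twoStrips (suc a) (suc a) (a ∷ κ) Φ ≡ twoStrips a a κ (with-row a Φ) + run 1 a κ (with-row (suc a) Φ)
      blocked Φ rewrite ≤ᵇ-true a≤p | ≤ᵇ-true (ℕP.≤-refl {suc a}) | ≤ᵇ-false (ℕP.n<1+n (suc a))
        = lem (twoStrips a a κ (with-row a Φ)) (twoStrips a (suc a) κ (shift 0 1 (with-row (suc a) Φ)))
              (twoStrips (suc a) (suc a) κ (shift 1 0 (with-row (suc a) Φ)))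
        where
        lem : ∀ x y z → x + y + (z + 0) ≡ x + (z + (y + 0))
        lem = solve-∀
    ...   | no 1+a≢p = trans (unblocked p p a κ Φ a<p a+1<p) (trans (symmetric-free d Φ) (sym (unblocked p p a κ (swap Φ) a<p a+1<p)))
      where
      a<p = ℕP.≤∧≢⇒< a≤p a≢p
      a+1<p = ℕP.≤∧≢⇒< a<p 1+a≢p

    symmetric-antidiag : ∀ {ℓ} m (g : (ℕ → ℕ → Vec ℕ ℓ → ℕ) → ℕ) Φ → (∀ Φ → g Φ ≡ g (swap Φ)) →
                         antidiag m (λ a b → g (shift a b Φ)) ≡ antidiag m (λ a b → g (shift a b (swap Φ)))
    symmetric-antidiag m g Φ sy = trans (antidiag-flip m (λ a b → g (shift a b Φ))) (antidiag-cong m λ a b → sy (shift b a Φ))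

    -- With no rows left, only the division of the run between the strips matters, and exchanging
    -- the strips reverses it.
    symmetric-run {p = p} [] m Φ = begin
      Φ (suc m + 0) 0 [] + antidiag⁻ (suc m) h          ≡⟨ cong (λ z → Φ z 0 [] + antidiag⁻ (suc m) h) (ℕP.+-identityʳ (suc m)) ⟩
      Φ (suc m) 0 [] + antidiag⁻ (suc m) h              ≡⟨ total Φ ⟩
      antidiag (suc m) (λ a b → Φ a b [])               ≡⟨ antidiag-flip (suc m) (λ a b → Φ a b []) ⟩
      antidiag (suc m) (λ a b → Φ b a [])               ≡⟨ total (swap Φ) ⟨
      Φ 0 (suc m) [] + antidiag⁻ (suc m) h′             ≡⟨ cong (λ z → Φ 0 z [] + antidiag⁻ (suc m) h′) (ℕP.+-identityʳ (suc m)) ⟨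
      Φ 0 (suc m + 0) [] + antidiag⁻ (suc m) h′         ∎
      where
      h h′ : ℕ → ℕ → ℕ
      h a b = Φ (a + 0) (b + 0) []
      h′ a b = Φ (b + 0) (a + 0) []
      total : ∀ Φ → Φ (suc m) 0 [] + antidiag⁻ (suc m) (λ a b → Φ (a + 0) (b + 0) []) ≡ antidiag (suc m) (λ a b → Φ a b [])
      total Φ = trans (ℕP.+-comm (Φ (suc m) 0 []) _) (trans (cong (_+ Φ (suc m) 0 [])
                  (antidiag⁻-cong (suc m) λ a b → cong₂ (λ x y → Φ x y []) (ℕP.+-identityʳ a) (ℕP.+-identityʳ b)))
                  (sym (antidiag-last (suc m) (λ a b → Φ a b []))))
    -- A further row of length `p` either takes no box and closes the run or takes one and lengthens
    -- it; two boxes would exceed the bound `suc p`. A shorter row closes the run and is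
    -- unconstrained.
    symmetric-run {ℓ = suc ℓ} {p = p} {a ∷ κ} (a≤p ∷ d) m Φ with a ℕP.≟ p
    ... | yes refl = trans (expand Φ) (trans (cong₂ _+_
          (symmetric-antidiag (suc m) (λ Ψ → twoStrips a a κ Ψ) (with-row a Φ) (symmetric₀ d))
          (symmetric-run d (suc m) (with-row (suc a) Φ))) (sym (expand (swap Φ))))
      where
      expand : ∀ Φ → run (suc m) a (a ∷ κ) Φ ≡
                     antidiag (suc m) (λ i j → twoStrips a a κ (shift i j (with-row a Φ))) + run (suc (suc m)) a κ (with-row (suc a) Φ)
      expand Φ = begin
        twoStrips (suc a) (suc a) (a ∷ κ) (shift (suc m) 0 Φ) + antidiag⁻ (suc m) (λ i j → twoStrips a (suc a) (a ∷ κ) (shift i j Φ))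
          ≡⟨ cong₂ _+_ top (trans (antidiag⁻-cong (suc m) lower) (antidiag⁻-+ (suc m) X Y)) ⟩
        X (suc m) 0 + Y (suc m) 0 + Z + (antidiag⁻ (suc m) X + antidiag⁻ (suc m) Y)
          ≡⟨ lem (X (suc m) 0) (Y (suc m) 0) Z (antidiag⁻ (suc m) X) (antidiag⁻ (suc m) Y) ⟩
        (antidiag⁻ (suc m) X + X (suc m) 0) + (Z + (antidiag⁻ (suc m) Y + Y (suc m) 0))
          ≡⟨ cong₂ (λ x y → x + (Z + y)) (sym (antidiag-last (suc m) X)) (trans (sym (antidiag-last (suc m) Y)) (sym (antidiag⁻-suc (suc m) Y′))) ⟩
        antidiag (suc m) X + (Z + antidiag⁻ (suc (suc m)) Y′) ∎
        where
        X Y Y′ : ℕ → ℕ → ℕ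
        X i j = twoStrips a a κ (shift i j (with-row a Φ))
        Y i j = twoStrips a (suc a) κ (shift i (suc j) (with-row (suc a) Φ))
        Y′ i j = twoStrips a (suc a) κ (shift i j (with-row (suc a) Φ))
        Z = twoStrips (suc a) (suc a) κ (shift (suc (suc m)) 0 (with-row (suc a) Φ))
        lem : ∀ x y z w v → x + y + z + (w + v) ≡ (w + x) + (z + (v + y))
        lem = solve-∀
        lower : ∀ i j → twoStrips a (suc a) (a ∷ κ) (shift i j Φ) ≡ X i j + Y i j
        lower i j rewrite ≤ᵇ-true (ℕP.≤-refl {a}) | ≤ᵇ-true (ℕP.n≤1+n a) | ≤ᵇ-true (ℕP.≤-refl {suc a}) | ≤ᵇ-false (ℕP.n<1+n a)
          = trans (ℕP.+-identityʳ _) (cong (X i j +_) (twoStrips-cong a (suc a) κ λ i′ j′ v → cong (λ z → Φ (i + i′) z (suc a ∷ v)) (ℕP.+-suc j j′)))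
        top : twoStrips (suc a) (suc a) (a ∷ κ) (shift (suc m) 0 Φ) ≡ X (suc m) 0 + Y (suc m) 0 + Z
        top rewrite ≤ᵇ-true (ℕP.n≤1+n a) | ≤ᵇ-true (ℕP.≤-refl {suc a}) | ≤ᵇ-false (ℕP.n<1+n (suc a))
          = cong (X (suc m) 0 + Y (suc m) 0 +_) (trans (ℕP.+-identityʳ _)
              (twoStrips-cong (suc a) (suc a) κ λ i′ j′ v → cong (λ z → Φ z j′ (suc a ∷ v)) (ℕP.+-suc (suc m) i′)))
    ... | no a≢p = trans (expand Φ) (trans (symmetric-antidiag (suc m) (free a κ) Φ (symmetric-free d)) (sym (expand (swap Φ))))
      where
      a<p = ℕP.≤∧≢⇒< a≤p a≢p
      expand : ∀ Φ → run (suc m) p (a ∷ κ) Φ ≡ antidiag (suc m) (λ i j → free a κ (shift i j Φ))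
      expand Φ = trans (ℕP.+-comm (twoStrips (suc p) (suc p) (a ∷ κ) (shift (suc m) 0 Φ)) _)
        (trans (cong₂ _+_ (antidiag⁻-cong (suc m) λ i j → unblocked p (suc p) a κ (shift i j Φ) a<p (s≤s a<p))
                          (unblocked (suc p) (suc p) a κ (shift (suc m) 0 Φ) (s≤s a≤p) (s≤s a<p)))
               (sym (antidiag-last (suc m) (λ i j → free a κ (shift i j Φ)))))

-- Chains of shapes as arrays; moving single boxes.

module Arrays where

  open import Data.Nat using (ℕ; zero; suc; pred; _<_; s≤s)
  import Data.Nat.Properties as ℕP
  open import Data.Vec using (Vec; []; _∷_)
  open import Data.Sum using (_⊎_; inj₁; inj₂)
  open import Relation.Nullary using (contradiction; yes; no)
  open import Relation.Binary.PropositionalEquality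

  -- Entries beyond the end of a vector are read as 0.
  at : ∀ {n} → Vec ℕ n → ℕ → ℕ
  at []       _       = 0
  at (x ∷ v)  zero    = x
  at (x ∷ v)  (suc i) = at v i

  entry : ∀ {m ℓ} → Vec (Vec ℕ ℓ) m → ℕ → ℕ → ℕ
  entry []       _       _ = 0
  entry (r ∷ M)  zero    i = at r i
  entry (r ∷ M)  (suc t) i = entry M t i

  modify : ∀ {A : Set} {n} → ℕ → (A → A) → Vec A n → Vec A n
  modify _       f []      = []
  modify zero    f (x ∷ v) = f x ∷ v
  modify (suc i) f (x ∷ v) = x ∷ modify i f v

  modify-swap : ∀ {A : Set} {n} i j (f g : A → A) (v : Vec A n) → i ≢ j →
                modify i f (modify j g v) ≡ modify j g (modify i f v)
  modify-swap i       j       f g []      i≢j = refl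
  modify-swap zero    zero    f g (x ∷ v) i≢j = contradiction refl i≢j
  modify-swap zero    (suc j) f g (x ∷ v) i≢j = refl
  modify-swap (suc i) zero    f g (x ∷ v) i≢j = refl
  modify-swap (suc i) (suc j) f g (x ∷ v) i≢j = cong (x ∷_) (modify-swap i j f g v λ i≡j → i≢j (cong suc i≡j))

  modify-same : ∀ {A : Set} {n} i (f g f′ g′ : A → A) (v : Vec A n) → (∀ x → f (g x) ≡ f′ (g′ x)) →
                modify i f (modify i g v) ≡ modify i f′ (modify i g′ v)
  modify-same i       f g f′ g′ []      eq = refl
  modify-same zero    f g f′ g′ (x ∷ v) eq = cong (_∷ v) (eq x)
  modify-same (suc i) f g f′ g′ (x ∷ v) eq = cong (x ∷_) (modify-same i f g f′ g′ v eq)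

  modify-inverse : ∀ {A : Set} {n} i (f g : A → A) (v : Vec A n) → (∀ x → f (g x) ≡ x) →
                   modify i f (modify i g v) ≡ v
  modify-inverse i       f g []      eq = refl
  modify-inverse zero    f g (x ∷ v) eq = cong (_∷ v) (eq x)
  modify-inverse (suc i) f g (x ∷ v) eq = cong (x ∷_) (modify-inverse i f g v eq)

  inc dec : ∀ {m ℓ} → Vec (Vec ℕ ℓ) m → ℕ → ℕ → Vec (Vec ℕ ℓ) m
  inc M t i = modify t (modify i suc) M
  dec M t i = modify t (modify i pred) M

  dec-inc : ∀ {m ℓ} (M : Vec (Vec ℕ ℓ) m) t i → dec (inc M t i) t i ≡ M
  dec-inc M t i = modify-inverse t _ _ M λ r → modify-inverse i pred suc r λ _ → refl

  suc-pred-at : ∀ {ℓ} (r : Vec ℕ ℓ) i → 0 < at r i → modify i suc (modify i pred r) ≡ r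
  suc-pred-at (suc x ∷ r) zero    0<r = refl
  suc-pred-at (x ∷ r)     (suc i) 0<r = cong (x ∷_) (suc-pred-at r i 0<r)

  inc-dec : ∀ {m ℓ} (M : Vec (Vec ℕ ℓ) m) t i → 0 < entry M t i → inc (dec M t i) t i ≡ M
  inc-dec (r ∷ M) zero    i 0<M = cong (_∷ M) (suc-pred-at r i 0<M)
  inc-dec (r ∷ M) (suc t) i 0<M = cong (r ∷_) (inc-dec M t i 0<M)

  dec-inc-swap : ∀ {m ℓ} (M : Vec (Vec ℕ ℓ) m) t i t′ k → t ≢ t′ ⊎ i ≢ k →
                 dec (inc M t i) t′ k ≡ inc (dec M t′ k) t i
  dec-inc-swap M t i t′ k (inj₁ t≢t′) = modify-swap t′ t _ _ M (λ e → t≢t′ (sym e))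
  dec-inc-swap M t i t′ k (inj₂ i≢k) with t ℕP.≟ t′
  ... | yes refl = modify-same t _ _ _ _ M λ r → modify-swap k i pred suc r (λ e → i≢k (sym e))
  ... | no t≢t′ = modify-swap t′ t _ _ M (λ e → t≢t′ (sym e))

  at-modify : ∀ {ℓ} (r : Vec ℕ ℓ) i f → i < ℓ → at (modify i f r) i ≡ f (at r i)
  at-modify (x ∷ r) zero    f i<ℓ       = refl
  at-modify (x ∷ r) (suc i) f (s≤s i<ℓ) = at-modify r i f i<ℓ

  at-modify-other : ∀ {ℓ} (r : Vec ℕ ℓ) i j f → i ≢ j → at (modify i f r) j ≡ at r j
  at-modify-other []      i       j       f i≢j = refl
  at-modify-other (x ∷ r) zero    zero    f i≢j = contradiction refl i≢j
  at-modify-other (x ∷ r) zero    (suc j) f i≢j = refl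
  at-modify-other (x ∷ r) (suc i) zero    f i≢j = refl
  at-modify-other (x ∷ r) (suc i) (suc j) f i≢j = at-modify-other r i j f λ i≡j → i≢j (cong suc i≡j)

  entry-modify : ∀ {m ℓ} (M : Vec (Vec ℕ ℓ) m) t i f → t < m → i < ℓ →
                 entry (modify t (modify i f) M) t i ≡ f (entry M t i)
  entry-modify (r ∷ M) zero    i f t<m       i<ℓ = at-modify r i f i<ℓ
  entry-modify (r ∷ M) (suc t) i f (s≤s t<m) i<ℓ = entry-modify M t i f t<m i<ℓ

  entry-modify-other : ∀ {m ℓ} (M : Vec (Vec ℕ ℓ) m) t i t′ j f → t ≢ t′ ⊎ i ≢ j →
                       entry (modify t (modify i f) M) t′ j ≡ entry M t′ j
  entry-modify-other []      t       i t′       j f ne = refl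
  entry-modify-other (r ∷ M) zero    i zero     j f (inj₁ ne) = contradiction refl ne
  entry-modify-other (r ∷ M) zero    i zero     j f (inj₂ ne) = at-modify-other r i j f ne
  entry-modify-other (r ∷ M) zero    i (suc t′) j f ne = refl
  entry-modify-other (r ∷ M) (suc t) i zero     j f ne = refl
  entry-modify-other (r ∷ M) (suc t) i (suc t′) j f (inj₁ ne) = entry-modify-other M t i t′ j f (inj₁ λ e → ne (cong suc e))
  entry-modify-other (r ∷ M) (suc t) i (suc t′) j f (inj₂ ne) = entry-modify-other M t i t′ j f (inj₂ ne)

-- Matrix coefficients of Gelfand-Tsetlin type and their commutation.

module RaisingAndLowering where

  open Rationals
  open NaturalsInRationals
  open Arrays
  open import Data.Bool using (Bool; true; false; not; _∧_; T)
  open import Data.Bool.Properties using (∧-zeroʳ)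
  open import Data.Unit using (tt)
  open import Data.Rational using (ℚ; 0ℚ; 1ℚ; _+_; _*_; -_; _-_)
  open import Data.Rational.Properties as ℚP using ()
  open import Data.Nat as ℕ using (ℕ; zero; suc; pred; _≤_; _<_; s≤s; _≡ᵇ_)
  import Data.Nat.Properties as ℕP
  open import Data.Vec using (Vec)
  open import Relation.Nullary using (yes; no; contradiction)
  open import Tactic.RingSolver using (solve-∀)
  open import Relation.Binary using (tri<; tri≈; tri>)
  open import Data.Product using (_×_; _,_; proj₁; proj₂)
  open import Data.Sum using (_⊎_; inj₁; inj₂; [_,_]′)
  open import Relation.Binary.PropositionalEquality
  open ≡-Reasoning

  module Operators (n ℓ : ℕ) where

    State : Set
    State = Vec (Vec ℕ ℓ) (suc (suc n))

    -- A state is a chain of shapes λ^0, ..., λ^(n + 1), each obtained from the previous one by a vertical strip.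
    record Valid (M : State) : Set where
      field
        start : ∀ i → entry M 0 i ≡ 0
        step  : ∀ {t} → t < suc n → ∀ i → entry M (suc t) i ≡ entry M t i ⊎ entry M (suc t) i ≡ suc (entry M t i)
        dom   : ∀ t i → entry M t (suc i) ≤ entry M t i
    open Valid

    grows : State → ℕ → ℕ → Bool
    grows M t i = entry M (suc t) i ≡ᵇ suc (entry M t i)

    -- Shifted parts λ_i - i: distinct for a partition, so the denominators below do not vanish.
    part : State → ℕ → ℕ → ℚ
    part M t i = ι (entry M t i) - ι i

    upFlag downFlag : State → ℕ → ℕ → Bool
    upFlag   M u i = not (grows M u i) ∧ grows M (suc u) i
    downFlag M u i = grows M u i ∧ not (grows M (suc u) i)

    upFactor downFactor : State → ℕ → ℕ → ℕ → ℚ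
    upFactor   M u i j = 1ℚ + δ (grows M (suc u) j) * inv (part M (suc u) i - part M (suc u) j)
    downFactor M u i j = 1ℚ - δ (grows M u j) * inv (part M (suc u) i - part M (suc u) j)

    -- Gelfand–Tsetlin type matrix coefficients. `raise` moves a box of row i from step u + 1 to step u
    -- and `lower` moves it back; the products vanish when the result is not a chain of partitions.
    up down : State → ℕ → ℕ → ℚ
    up   M u i = δ (upFlag M u i) * ∏ ℓ (upFactor M u i)
    down M u i = δ (downFlag M u i) * ∏ ℓ (downFactor M u i)

    raise lower : State → ℕ → ℕ → State
    raise M u i = inc M (suc u) i
    lower M u i = dec M (suc u) i

    ≡ᵇ-refl : ∀ m → (m ≡ᵇ m) ≡ true
    ≡ᵇ-refl zero    = refl
    ≡ᵇ-refl (suc m) = ≡ᵇ-refl m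

    ≡ᵇ⇒≡ : ∀ a b → (a ≡ᵇ b) ≡ true → a ≡ b
    ≡ᵇ⇒≡ a b e = ℕP.≡ᵇ⇒≡ a b (subst T (sym e) tt)

    n≢ᵇ1+n : ∀ m → (m ≡ᵇ suc m) ≡ false
    n≢ᵇ1+n zero    = refl
    n≢ᵇ1+n (suc m) = n≢ᵇ1+n m

    grows⇒≡ : ∀ M t i → grows M t i ≡ true → entry M (suc t) i ≡ suc (entry M t i)
    grows⇒≡ M t i = ≡ᵇ⇒≡ _ _

    ¬grows⇒≡ : ∀ {M} → Valid M → ∀ {t} → t < suc n → ∀ i → grows M t i ≡ false → entry M (suc t) i ≡ entry M t i
    ¬grows⇒≡ {M} V {t} t<s i e with step V t<s i
    ... | inj₁ eq = eq
    ... | inj₂ eq with trans (sym e) (trans (cong (_≡ᵇ suc (entry M t i)) eq) (≡ᵇ-refl (entry M t i)))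
    ...   | ()

    ≡⇒grows : ∀ M t i → entry M (suc t) i ≡ suc (entry M t i) → grows M t i ≡ true
    ≡⇒grows M t i eq = trans (cong (_≡ᵇ suc (entry M t i)) eq) (≡ᵇ-refl (suc (entry M t i)))

    ≡⇒¬grows : ∀ M t i → entry M (suc t) i ≡ entry M t i → grows M t i ≡ false
    ≡⇒¬grows M t i eq = trans (cong (_≡ᵇ suc (entry M t i)) eq) (n≢ᵇ1+n (entry M t i))

    ∧-true : ∀ {p q} → p ∧ q ≡ true → p ≡ true × q ≡ true
    ∧-true {true} {true} e = refl , refl

    not-true : ∀ {p} → not p ≡ true → p ≡ false
    not-true {false} e = refl

    module _ {M : State} (V : Valid M) where

      strict : ∀ t {i j} → i < j → part M t i ≢ part M t j
      strict t {i} {j} i<j eq = ℕP.<⇒≢ bound (ι-injective (begin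
        ι (entry M t j ℕ.+ i)          ≡⟨ ι-+ (entry M t j) i ⟩
        ι (entry M t j) + ι i          ≡⟨ lem (ι (entry M t j)) (ι i) (ι j) ⟩
        part M t j + (ι i + ι j)       ≡⟨ cong (_+ (ι i + ι j)) eq ⟨
        part M t i + (ι i + ι j)       ≡⟨ lem′ (ι (entry M t i)) (ι i) (ι j) ⟩
        ι (entry M t i) + ι j          ≡⟨ ι-+ (entry M t i) j ⟨
        ι (entry M t i ℕ.+ j)          ∎))
        where
        antitone : ∀ {i j} → i ≤ j → entry M t j ≤ entry M t i
        antitone {i} {j} i≤j = go (ℕP.≤⇒≤′ i≤j)
          where
          go : ∀ {j} → i ℕ.≤′ j → entry M t j ≤ entry M t i
          go ℕ.≤′-refl     = ℕP.≤-refl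
          go (ℕ.≤′-step p) = ℕP.≤-trans (dom V t _) (go p)
        bound : entry M t j ℕ.+ i < entry M t i ℕ.+ j
        bound = ℕP.+-mono-≤-< (antitone (ℕP.<⇒≤ i<j)) i<j
        lem : ∀ a i j → a + i ≡ (a - j) + (i + j)
        lem = solve-∀ ringℚ
        lem′ : ∀ a i j → (a - i) + (i + j) ≡ a + j
        lem′ = solve-∀ ringℚ

      part-distinct : ∀ t {i j} → i ≢ j → part M t i ≢ part M t j
      part-distinct t {i} {j} i≢j with ℕP.<-cmp i j
      ... | tri< i<j _ _ = strict t i<j
      ... | tri≈ _ i≡j _ = contradiction i≡j i≢j
      ... | tri> _ _ j<i = λ eq → strict t j<i (sym eq)

    module _ (M : State) {u i : ℕ} (u<n : u < n) (i<ℓ : i < ℓ) where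

      raise-same : entry (raise M u i) (suc u) i ≡ suc (entry M (suc u) i)
      raise-same = entry-modify M (suc u) i suc (s≤s (ℕP.m<n⇒m<1+n u<n)) i<ℓ

      lower-same : entry (lower M u i) (suc u) i ≡ pred (entry M (suc u) i)
      lower-same = entry-modify M (suc u) i pred (s≤s (ℕP.m<n⇒m<1+n u<n)) i<ℓ

    module _ (M : State) (u i : ℕ) where

      raise-other : ∀ t j → suc u ≢ t ⊎ i ≢ j → entry (raise M u i) t j ≡ entry M t j
      raise-other t j = entry-modify-other M (suc u) i t j suc

      lower-other : ∀ t j → suc u ≢ t ⊎ i ≢ j → entry (lower M u i) t j ≡ entry M t j
      lower-other t j = entry-modify-other M (suc u) i t j pred

      grows-raise : ∀ t j → (suc u ≢ t × u ≢ t) ⊎ i ≢ j → grows (raise M u i) t j ≡ grows M t j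
      grows-raise t j (inj₁ (a , b)) = cong₂ (λ x y → x ≡ᵇ suc y)
        (raise-other (suc t) j (inj₁ λ e → b (ℕP.suc-injective e))) (raise-other t j (inj₁ a))
      grows-raise t j (inj₂ c) = cong₂ (λ x y → x ≡ᵇ suc y) (raise-other (suc t) j (inj₂ c)) (raise-other t j (inj₂ c))

      grows-lower : ∀ t j → (suc u ≢ t × u ≢ t) ⊎ i ≢ j → grows (lower M u i) t j ≡ grows M t j
      grows-lower t j (inj₁ (a , b)) = cong₂ (λ x y → x ≡ᵇ suc y)
        (lower-other (suc t) j (inj₁ λ e → b (ℕP.suc-injective e))) (lower-other t j (inj₁ a))
      grows-lower t j (inj₂ c) = cong₂ (λ x y → x ≡ᵇ suc y) (lower-other (suc t) j (inj₂ c)) (lower-other t j (inj₂ c))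

      part-raise : ∀ t j → suc u ≢ t ⊎ i ≢ j → part (raise M u i) t j ≡ part M t j
      part-raise t j c = cong (λ x → ι x - ι j) (raise-other t j c)

      part-lower : ∀ t j → suc u ≢ t ⊎ i ≢ j → part (lower M u i) t j ≡ part M t j
      part-lower t j c = cong (λ x → ι x - ι j) (lower-other t j c)

    -- If neither move affects the flag of the other, both sides vanish unless both moves are
    -- allowed, so the products have to be compared only then.
    gate : ∀ {p q p′ q′} X Y X′ Y′ → q′ ≡ q → p′ ≡ p → (p ≡ true → q ≡ true → X * Y′ ≡ Y * X′) →
           (δ p * X) * (δ q′ * Y′) ≡ (δ q * Y) * (δ p′ * X′)
    gate {true}  {true}  X Y X′ Y′ refl refl eq = trans (lem X Y′) (trans (eq refl refl) (sym (lem Y X′)))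
      where
      lem : ∀ a b → (1ℚ * a) * (1ℚ * b) ≡ a * b
      lem = solve-∀ ringℚ
    gate {true}  {false} X Y X′ Y′ refl refl eq = lem X Y X′ Y′
      where
      lem : ∀ X Y X′ Y′ → (1ℚ * X) * (0ℚ * Y′) ≡ (0ℚ * Y) * (1ℚ * X′)
      lem = solve-∀ ringℚ
    gate {false} {true}  X Y X′ Y′ refl refl eq = lem X Y X′ Y′
      where
      lem : ∀ X Y X′ Y′ → (0ℚ * X) * (1ℚ * Y′) ≡ (1ℚ * Y) * (0ℚ * X′)
      lem = solve-∀ ringℚ
    gate {false} {false} X Y X′ Y′ refl refl eq = lem X Y X′ Y′
      where
      lem : ∀ X Y X′ Y′ → (0ℚ * X) * (0ℚ * Y′) ≡ (0ℚ * Y) * (0ℚ * X′)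
      lem = solve-∀ ringℚ

    closed : ∀ {p q} X Y → (p ≡ true → q ≡ false) → (δ p * X) * (δ q * Y) ≡ 0ℚ
    closed {true}  X Y off rewrite off refl = lem X Y
      where
      lem : ∀ X Y → (1ℚ * X) * (0ℚ * Y) ≡ 0ℚ
      lem = solve-∀ ringℚ
    closed {false} {q} X Y off = lem X (δ q * Y)
      where
      lem : ∀ X Y → (0ℚ * X) * Y ≡ 0ℚ
      lem = solve-∀ ringℚ

    -- Both orders of the two moves lead to the same state, so equal path coefficients mean that the
    -- corresponding off-diagonal entry of the commutator vanishes.
    Commute : State → ℕ → ℕ → ℕ → ℕ → Set
    Commute M u i u′ k = up M u i * down (raise M u i) u′ k ≡ down M u′ k * up (lower M u′ k) u i

    upFactor-cong : ∀ {M M′} u i j → grows M (suc u) j ≡ grows M′ (suc u) j → part M (suc u) i ≡ part M′ (suc u) i →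
                    part M (suc u) j ≡ part M′ (suc u) j → upFactor M u i j ≡ upFactor M′ u i j
    upFactor-cong u i j e₁ e₂ e₃ = cong₂ (λ g d → 1ℚ + δ g * inv d) e₁ (cong₂ _-_ e₂ e₃)

    downFactor-cong : ∀ {M M′} u i j → grows M u j ≡ grows M′ u j → part M (suc u) i ≡ part M′ (suc u) i →
                      part M (suc u) j ≡ part M′ (suc u) j → downFactor M u i j ≡ downFactor M′ u i j
    downFactor-cong u i j e₁ e₂ e₃ = cong₂ (λ g d → 1ℚ - δ g * inv d) e₁ (cong₂ _-_ e₂ e₃)

    2+n≢n : ∀ x → suc (suc x) ≢ x
    2+n≢n x e = ℕP.<⇒≢ (ℕP.m<n⇒m<1+n (ℕP.n<1+n x)) (sym e)

    1+n≢n : ∀ x → suc x ≢ x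
    1+n≢n x e = ℕP.1+n≢n e

    n≢1+n : ∀ x → x ≢ suc x
    n≢1+n x e = ℕP.1+n≢n (sym e)

    ∏-change : ∀ {f g} k → k < ℓ → g k ≡ 1ℚ → (∀ {j} → j ≢ k → f j ≡ g j) → ∏ ℓ f ≡ ∏ ℓ g * f k
    ∏-change {f} {g} k k<ℓ gk≡1 eq = begin
      ∏ ℓ f          ≡⟨ ℚP.*-identityʳ (∏ ℓ f) ⟨
      ∏ ℓ f * 1ℚ     ≡⟨ cong (∏ ℓ f *_) gk≡1 ⟨
      ∏ ℓ f * g k    ≡⟨ ∏-exchange ℓ k k<ℓ eq ⟩
      ∏ ℓ g * f k    ∎

    factor-off : ∀ {b} x → b ≡ false → 1ℚ + δ b * x ≡ 1ℚ
    factor-off x refl = trans (cong (1ℚ +_) (ℚP.*-zeroˡ x)) (ℚP.+-identityʳ 1ℚ)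

    factor-off′ : ∀ {b} x → b ≡ false → 1ℚ - δ b * x ≡ 1ℚ
    factor-off′ x refl = trans (cong (λ z → 1ℚ - z) (ℚP.*-zeroˡ x)) refl

    module Interaction {M : State} (V : Valid M) {u i u′ k : ℕ} (u<n : u < n) (i<ℓ : i < ℓ) (u′<n : u′ < n) (k<ℓ : k < ℓ) where

      M⁺ = raise M u i
      M⁻ = lower M u′ k

      -- A move at `u` changes only the shape `suc u`, hence only the steps `u` and `suc u`. The
      -- coefficients at `u′` read none of these, and conversely.
      commute-far : u ≢ u′ → u′ ≢ suc u → u ≢ suc u′ → Commute M u i u′ k
      commute-far d₁ d₂ d₃ = gate _ _ _ _
        (cong₂ (λ p q → p ∧ not q) (grows-raise M u i u′ k (inj₁ ((λ e → d₂ (sym e)) , d₁)))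
                                   (grows-raise M u i (suc u′) k (inj₁ ((λ e → d₁ (ℕP.suc-injective e)) , d₃))))
        (cong₂ (λ p q → not p ∧ q) (grows-lower M u′ k u i (inj₁ ((λ e → d₃ (sym e)) , λ e → d₁ (sym e))))
                                   (grows-lower M u′ k (suc u) i (inj₁ ((λ e → d₁ (sym (ℕP.suc-injective e))) , d₂))))
        λ _ _ → trans (cong (∏ ℓ (upFactor M u i) *_) down≡) (trans (ℚP.*-comm (∏ ℓ (upFactor M u i)) (∏ ℓ (downFactor M u′ k)))
                                                                  (cong (∏ ℓ (downFactor M u′ k) *_) up≡))
        where
        sd : suc u ≢ suc u′
        sd e = d₁ (ℕP.suc-injective e)
        down≡ : ∏ ℓ (downFactor M⁺ u′ k) ≡ ∏ ℓ (downFactor M u′ k)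
        down≡ = ∏-cong ℓ λ {j} _ → downFactor-cong {M⁺} {M} u′ k j (grows-raise M u i u′ j (inj₁ ((λ e → d₂ (sym e)) , d₁)))
                  (part-raise M u i (suc u′) k (inj₁ sd)) (part-raise M u i (suc u′) j (inj₁ sd))
        up≡ : ∏ ℓ (upFactor M u i) ≡ ∏ ℓ (upFactor M⁻ u i)
        up≡ = ∏-cong ℓ λ {j} _ → sym (upFactor-cong {M⁻} {M} u i j
                (grows-lower M u′ k (suc u) j (inj₁ ((λ e → sd (sym e)) , d₂)))
                (part-lower M u′ k (suc u) i (inj₁ λ e → sd (sym e))) (part-lower M u′ k (suc u) j (inj₁ λ e → sd (sym e))))

      module Below (u≡1+u′ : u ≡ suc u′) where

        u≢u′ : u ≢ u′
        u≢u′ e = 1+n≢n u′ (trans (sym u≡1+u′) e)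
        u′≢1+u : u′ ≢ suc u
        u′≢1+u e = 2+n≢n u′ (sym (trans e (cong suc u≡1+u′)))

        -- The two moves share only the step `u`. Neither product reads it, and the two flags read
        -- it in the distinct rows `i` and `k`.
        commute-below : i ≢ k → Commute M u i u′ k
        commute-below i≢k = gate _ _ _ _
          (cong₂ (λ p q → p ∧ not q) (grows-raise M u i u′ k (inj₂ i≢k)) (grows-raise M u i (suc u′) k (inj₂ i≢k)))
          (cong₂ (λ p q → not p ∧ q) (grows-lower M u′ k u i (inj₂ λ e → i≢k (sym e)))
                                     (grows-lower M u′ k (suc u) i (inj₂ λ e → i≢k (sym e))))
          λ _ _ → trans (cong (∏ ℓ (upFactor M u i) *_) down≡) (trans (ℚP.*-comm (∏ ℓ (upFactor M u i)) (∏ ℓ (downFactor M u′ k)))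
                                                                    (cong (∏ ℓ (downFactor M u′ k) *_) up≡))
          where
          sd : suc u ≢ suc u′
          sd e = u≢u′ (ℕP.suc-injective e)
          down≡ : ∏ ℓ (downFactor M⁺ u′ k) ≡ ∏ ℓ (downFactor M u′ k)
          down≡ = ∏-cong ℓ λ {j} _ → downFactor-cong {M⁺} {M} u′ k j
                    (grows-raise M u i u′ j (inj₁ ((λ e → u′≢1+u (sym e)) , u≢u′)))
                    (part-raise M u i (suc u′) k (inj₁ sd)) (part-raise M u i (suc u′) j (inj₁ sd))
          up≡ : ∏ ℓ (upFactor M u i) ≡ ∏ ℓ (upFactor M⁻ u i)
          up≡ = ∏-cong ℓ λ {j} _ → sym (upFactor-cong {M⁻} {M} u i j
                  (grows-lower M u′ k (suc u) j (inj₁ ((λ e → sd (sym e)) , u′≢1+u)))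
                  (part-lower M u′ k (suc u) i (inj₁ λ e → sd (sym e))) (part-lower M u′ k (suc u) j (inj₁ λ e → sd (sym e))))

      module Above (u′≡1+u : u′ ≡ suc u) where

        ne : suc u′ ≢ suc u
        ne e = 1+n≢n u (trans (sym u′≡1+u) (ℕP.suc-injective e))

        -- Here each move removes one factor from the other product: lowering row `k` removes the
        -- factor of `k` for `i`, and raising row `i` removes the factor of `i` for `k`. The two
        -- lost factors agree, because both rows grow in step `suc u` and so have the same
        -- difference of shifted parts before and after it.
        commute-above : i ≢ k → Commute M u i u′ k
        commute-above i≢k = gate _ _ _ _
          (cong₂ (λ p q → p ∧ not q) (grows-raise M u i u′ k (inj₂ i≢k)) (grows-raise M u i (suc u′) k (inj₂ i≢k)))
          (cong₂ (λ p q → not p ∧ q) (grows-lower M u′ k u i (inj₂ λ e → i≢k (sym e)))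
                                     (grows-lower M u′ k (suc u) i (inj₂ λ e → i≢k (sym e))))
          main
          where
          k≢i : k ≢ i
          k≢i e = i≢k (sym e)
          main : upFlag M u i ≡ true → downFlag M u′ k ≡ true →
                 ∏ ℓ (upFactor M u i) * ∏ ℓ (downFactor M⁺ u′ k) ≡ ∏ ℓ (downFactor M u′ k) * ∏ ℓ (upFactor M⁻ u i)
          main fu fd = begin
            ∏ ℓ (upFactor M u i) * ∏ ℓ (downFactor M⁺ u′ k)
              ≡⟨ cong (_* D⁺) (∏-change k k<ℓ (factor-off {grows M⁻ (suc u) k} (inv (part M⁻ (suc u) i - part M⁻ (suc u) k)) gk⁻) (λ {j} j≢k → sym (upFactor-cong {M⁻} {M} u i j
                   (grows-lower M u′ k (suc u) j (inj₂ λ e → j≢k (sym e)))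
                   (part-lower M u′ k (suc u) i (inj₁ ne)) (part-lower M u′ k (suc u) j (inj₁ ne))))) ⟩
            (U⁻ * upFactor M u i k) * D⁺              ≡⟨ lem U⁻ (upFactor M u i k) D⁺ ⟩
            (D⁺ * upFactor M u i k) * U⁻              ≡⟨ cong (λ z → (D⁺ * z) * U⁻) same-factor ⟩
            (D⁺ * downFactor M u′ k i) * U⁻
              ≡⟨ cong (_* U⁻) (∏-change i i<ℓ (factor-off′ {grows M⁺ u′ i} (inv (part M⁺ (suc u′) k - part M⁺ (suc u′) i)) gi⁺) (λ {j} j≢i → sym (downFactor-cong {M⁺} {M} u′ k j
                   (grows-raise M u i u′ j (inj₂ λ e → j≢i (sym e)))
                   (part-raise M u i (suc u′) k (inj₁ λ e → ne (sym e))) (part-raise M u i (suc u′) j (inj₁ λ e → ne (sym e)))))) ⟨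
            ∏ ℓ (downFactor M u′ k) * U⁻ ∎
            where
            D⁺ = ∏ ℓ (downFactor M⁺ u′ k)
            U⁻ = ∏ ℓ (upFactor M⁻ u i)
            lem : ∀ a b c → (a * b) * c ≡ (c * b) * a
            lem = solve-∀ ringℚ
            gi : grows M (suc u) i ≡ true
            gi = proj₂ (∧-true fu)
            gk : grows M (suc u) k ≡ true
            gk = subst (λ t → grows M t k ≡ true) u′≡1+u (proj₁ (∧-true fd))
            gk⁻ : grows M⁻ (suc u) k ≡ false
            gk⁻ = ≡⇒¬grows M⁻ (suc u) k (begin
              entry M⁻ (suc (suc u)) k      ≡⟨ cong (λ t → entry M⁻ (suc t) k) u′≡1+u ⟨
              entry M⁻ (suc u′) k           ≡⟨ lower-same M u′<n k<ℓ ⟩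
              pred (entry M (suc u′) k)     ≡⟨ cong (λ t → pred (entry M (suc t) k)) u′≡1+u ⟩
              pred (entry M (suc (suc u)) k) ≡⟨ cong pred (grows⇒≡ M (suc u) k gk) ⟩
              entry M (suc u) k             ≡⟨ lower-other M u′ k (suc u) k (inj₁ ne) ⟨
              entry M⁻ (suc u) k            ∎)
            gi⁺ : grows M⁺ u′ i ≡ false
            gi⁺ = subst (λ t → grows M⁺ t i ≡ false) (sym u′≡1+u) (≡⇒¬grows M⁺ (suc u) i (begin
              entry M⁺ (suc (suc u)) i      ≡⟨ raise-other M u i (suc (suc u)) i (inj₁ λ e → n≢1+n _ e) ⟩
              entry M (suc (suc u)) i       ≡⟨ grows⇒≡ M (suc u) i gi ⟩
              suc (entry M (suc u) i)       ≡⟨ raise-same M u<n i<ℓ ⟨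
              entry M⁺ (suc u) i            ∎))
            same-factor : upFactor M u i k ≡ downFactor M u′ k i
            same-factor = begin
              1ℚ + δ (grows M (suc u) k) * inv (part M (suc u) i - part M (suc u) k)
                ≡⟨ cong₂ (λ g x → 1ℚ + δ g * x) gk (inv-swap (part M (suc u) i) (part M (suc u) k)) ⟩
              1ℚ + 1ℚ * (- inv (part M (suc u) k - part M (suc u) i))
                ≡⟨ cong (λ z → 1ℚ + 1ℚ * (- inv z)) (sym shift) ⟩
              1ℚ + 1ℚ * (- inv (part M (suc u′) k - part M (suc u′) i))
                ≡⟨ neg (inv (part M (suc u′) k - part M (suc u′) i)) ⟩
              1ℚ - 1ℚ * inv (part M (suc u′) k - part M (suc u′) i)
                ≡⟨ cong (λ g → 1ℚ - δ g * inv (part M (suc u′) k - part M (suc u′) i)) (trans (sym gi) (cong (λ t → grows M t i) (sym u′≡1+u))) ⟩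
              downFactor M u′ k i ∎
              where
              neg : ∀ a → 1ℚ + 1ℚ * (- a) ≡ 1ℚ - 1ℚ * a
              neg = solve-∀ ringℚ
              cancel : ∀ a b i k → ((1ℚ + a) - k) - ((1ℚ + b) - i) ≡ (a - k) - (b - i)
              cancel = solve-∀ ringℚ
              shift : part M (suc u′) k - part M (suc u′) i ≡ part M (suc u) k - part M (suc u) i
              shift = begin
                part M (suc u′) k - part M (suc u′) i
                  ≡⟨ cong (λ t → part M (suc t) k - part M (suc t) i) u′≡1+u ⟩
                part M (suc (suc u)) k - part M (suc (suc u)) i
                  ≡⟨ cong₂ (λ x y → (ι x - ι k) - (ι y - ι i)) (grows⇒≡ M (suc u) k gk) (grows⇒≡ M (suc u) i gi) ⟩
                (ι (suc (entry M (suc u) k)) - ι k) - (ι (suc (entry M (suc u) i)) - ι i)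
                  ≡⟨ cancel (ι (entry M (suc u) k)) (ι (entry M (suc u) i)) (ι i) (ι k) ⟩
                part M (suc u) k - part M (suc u) i ∎

    ∧-falseˡ : ∀ {p} q → p ≡ false → p ∧ q ≡ false
    ∧-falseˡ q refl = refl

    ∧-falseʳ : ∀ p {q} → q ≡ false → p ∧ q ≡ false
    ∧-falseʳ p refl = ∧-zeroʳ p

    module _ {M : State} (V : Valid M) {u i : ℕ} (u<n : u < n) (i<ℓ : i < ℓ) where

      private
        u<s : suc u < suc n
        u<s = s≤s u<n
        u<s′ : u < suc n
        u<s′ = ℕP.m<n⇒m<1+n u<n

      raise-grows : grows M u i ≡ false → grows (raise M u i) u i ≡ true
      raise-grows g = ≡⇒grows (raise M u i) u i (begin
        entry (raise M u i) (suc u) i   ≡⟨ raise-same M u<n i<ℓ ⟩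
        suc (entry M (suc u) i)         ≡⟨ cong suc (¬grows⇒≡ V u<s′ i g) ⟩
        suc (entry M u i)               ≡⟨ cong suc (raise-other M u i u i (inj₁ (1+n≢n u))) ⟨
        suc (entry (raise M u i) u i)   ∎)

      raise-¬grows : grows M (suc u) i ≡ true → grows (raise M u i) (suc u) i ≡ false
      raise-¬grows g = ≡⇒¬grows (raise M u i) (suc u) i (begin
        entry (raise M u i) (suc (suc u)) i   ≡⟨ raise-other M u i (suc (suc u)) i (inj₁ (n≢1+n (suc u))) ⟩
        entry M (suc (suc u)) i               ≡⟨ grows⇒≡ M (suc u) i g ⟩
        suc (entry M (suc u) i)               ≡⟨ raise-same M u<n i<ℓ ⟨
        entry (raise M u i) (suc u) i         ∎)

      lower-¬grows : grows M u i ≡ true → grows (lower M u i) u i ≡ false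
      lower-¬grows g = ≡⇒¬grows (lower M u i) u i (begin
        entry (lower M u i) (suc u) i   ≡⟨ lower-same M u<n i<ℓ ⟩
        pred (entry M (suc u) i)        ≡⟨ cong pred (grows⇒≡ M u i g) ⟩
        entry M u i                     ≡⟨ lower-other M u i u i (inj₁ (1+n≢n u)) ⟨
        entry (lower M u i) u i         ∎)

      lower-grows : grows M u i ≡ true → grows M (suc u) i ≡ false → grows (lower M u i) (suc u) i ≡ true
      lower-grows g g′ = ≡⇒grows (lower M u i) (suc u) i (begin
        entry (lower M u i) (suc (suc u)) i   ≡⟨ lower-other M u i (suc (suc u)) i (inj₁ (n≢1+n (suc u))) ⟩
        entry M (suc (suc u)) i               ≡⟨ ¬grows⇒≡ V u<s i g′ ⟩
        entry M (suc u) i                     ≡⟨ grows⇒≡ M u i g ⟩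
        suc (entry M u i)                     ≡⟨ cong (λ x → suc (pred x)) (grows⇒≡ M u i g) ⟨
        suc (pred (entry M (suc u) i))        ≡⟨ cong suc (lower-same M u<n i<ℓ) ⟨
        suc (entry (lower M u i) (suc u) i)   ∎)

    -- In one row at adjacent levels the first move makes the flag of the second fail, in either
    -- order, so both path coefficients are zero. The same holds for `commute-row-above`.
    commute-row-below : ∀ {M} → Valid M → ∀ {u i} → suc u < n → i < ℓ → Commute M (suc u) i u i
    commute-row-below {M} V {u} {i} u<n i<ℓ = trans
      (closed {upFlag M (suc u) i} (∏ ℓ (upFactor M (suc u) i)) (∏ ℓ (downFactor (raise M (suc u) i) u i))
        λ fu → ∧-falseʳ (grows (raise M (suc u) i) u i) (cong not (raise-grows V u<n i<ℓ (not-true (proj₁ (∧-true fu))))))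
      (sym (closed {downFlag M u i} (∏ ℓ (downFactor M u i)) (∏ ℓ (upFactor (lower M u i) (suc u) i))
        λ fd → ∧-falseˡ (grows (lower M u i) (suc (suc u)) i) (cong not (lower-grows V (ℕP.<-trans (ℕP.n<1+n u) u<n) i<ℓ (proj₁ (∧-true fd)) (not-true (proj₂ (∧-true {grows M u i} fd)))))))

    commute-row-above : ∀ {M} → Valid M → ∀ {u i} → suc u < n → i < ℓ → Commute M u i (suc u) i
    commute-row-above {M} V {u} {i} u<n i<ℓ = trans
      (closed {upFlag M u i} (∏ ℓ (upFactor M u i)) (∏ ℓ (downFactor (raise M u i) (suc u) i))
        λ fu → ∧-falseˡ (not (grows (raise M u i) (suc (suc u)) i)) (raise-¬grows V (ℕP.<-trans (ℕP.n<1+n u) u<n) i<ℓ (proj₂ (∧-true fu))))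
      (sym (closed {downFlag M (suc u) i} (∏ ℓ (downFactor M (suc u) i)) (∏ ℓ (upFactor (lower M (suc u) i) u i))
        λ fd → ∧-falseʳ (not (grows (lower M (suc u) i) u i)) (lower-¬grows V u<n i<ℓ (proj₁ (∧-true fd)))))

    module _ {M : State} (V : Valid M) {u i k : ℕ} (u<n : u < n) (i<ℓ : i < ℓ) (k<ℓ : k < ℓ) (i≢k : i ≢ k) where

      -- Each first move switches on one factor of the other product. The two new factors agree,
      -- since lengthening row `i` by one changes the difference of the shifted parts exactly as
      -- shortening row `k` does.
      commute-level : Commute M u i u k
      commute-level = gate _ _ _ _
        (cong₂ (λ p q → p ∧ not q) (grows-raise M u i u k (inj₂ i≢k)) (grows-raise M u i (suc u) k (inj₂ i≢k)))
        (cong₂ (λ p q → not p ∧ q) (grows-lower M u k u i (inj₂ k≢i)) (grows-lower M u k (suc u) i (inj₂ k≢i)))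
        main
        where
        k≢i : k ≢ i
        k≢i e = i≢k (sym e)
        M⁺ = raise M u i
        M⁻ = lower M u k
        pᵢ = part M (suc u) i
        pₖ = part M (suc u) k
        main : upFlag M u i ≡ true → downFlag M u k ≡ true →
               ∏ ℓ (upFactor M u i) * ∏ ℓ (downFactor M⁺ u k) ≡ ∏ ℓ (downFactor M u k) * ∏ ℓ (upFactor M⁻ u i)
        main fu fd = begin
          U * ∏ ℓ (downFactor M⁺ u k)
            ≡⟨ cong (U *_) (∏-change i i<ℓ (factor-off′ {grows M u i} (inv (pₖ - pᵢ)) (not-true (proj₁ (∧-true fu))))
                 (λ {j} j≢i → downFactor-cong {M⁺} {M} u k j (grows-raise M u i u j (inj₂ λ e → j≢i (sym e)))
                    (part-raise M u i (suc u) k (inj₂ i≢k)) (part-raise M u i (suc u) j (inj₂ λ e → j≢i (sym e))))) ⟩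
          U * (D * downFactor M⁺ u k i)    ≡⟨ lem U D (downFactor M⁺ u k i) ⟩
          D * (U * downFactor M⁺ u k i)    ≡⟨ cong (λ z → D * (U * z)) same-factor ⟩
          D * (U * upFactor M⁻ u i k)
            ≡⟨ cong (D *_) (∏-change k k<ℓ (factor-off {grows M (suc u) k} (inv (pᵢ - pₖ)) gk)
                 (λ {j} j≢k → upFactor-cong {M⁻} {M} u i j (grows-lower M u k (suc u) j (inj₂ λ e → j≢k (sym e)))
                    (part-lower M u k (suc u) i (inj₂ k≢i)) (part-lower M u k (suc u) j (inj₂ λ e → j≢k (sym e))))) ⟨
          D * ∏ ℓ (upFactor M⁻ u i) ∎
          where
          U = ∏ ℓ (upFactor M u i)
          D = ∏ ℓ (downFactor M u k)
          lem : ∀ a b c → a * (b * c) ≡ b * (a * c)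
          lem = solve-∀ ringℚ
          gk : grows M (suc u) k ≡ false
          gk = not-true (proj₂ (∧-true {grows M u k} fd))
          gk′ : grows M u k ≡ true
          gk′ = proj₁ (∧-true fd)
          p⁺ : part M⁺ (suc u) k - part M⁺ (suc u) i ≡ pₖ - pᵢ - 1ℚ
          p⁺ = trans (cong₂ _-_ (part-raise M u i (suc u) k (inj₂ i≢k)) (cong (λ x → ι x - ι i) (raise-same M u<n i<ℓ)))
                     (lem′ pₖ (ι (entry M (suc u) i)) (ι i))
            where
            lem′ : ∀ p a i → p - ((1ℚ + a) - i) ≡ p - (a - i) - 1ℚ
            lem′ = solve-∀ ringℚ
          p⁻ : part M⁻ (suc u) i - part M⁻ (suc u) k ≡ - (pₖ - pᵢ - 1ℚ)
          p⁻ = trans (cong₂ _-_ (part-lower M u k (suc u) i (inj₂ k≢i)) (cong (λ x → ι x - ι k) low))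
                     (trans (lem′ pᵢ (ι (entry M u k)) (ι k)) (cong (λ x → - ((ι x - ι k) - pᵢ - 1ℚ)) (sym (grows⇒≡ M u k gk′))))
            where
            low : entry M⁻ (suc u) k ≡ entry M u k
            low = trans (lower-same M u<n k<ℓ) (cong pred (grows⇒≡ M u k gk′))
            lem′ : ∀ p a k → p - (a - k) ≡ - (((1ℚ + a) - k) - p - 1ℚ)
            lem′ = solve-∀ ringℚ
          same-factor : downFactor M⁺ u k i ≡ upFactor M⁻ u i k
          same-factor = begin
            downFactor M⁺ u k i
              ≡⟨ cong₂ (λ g d → 1ℚ - δ g * inv d) (raise-grows V u<n i<ℓ (not-true (proj₁ (∧-true fu)))) p⁺ ⟩
            1ℚ - 1ℚ * inv (pₖ - pᵢ - 1ℚ)       ≡⟨ neg (inv (pₖ - pᵢ - 1ℚ)) ⟩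
            1ℚ + 1ℚ * (- inv (pₖ - pᵢ - 1ℚ))   ≡⟨ cong (λ z → 1ℚ + 1ℚ * z) (inv-neg (pₖ - pᵢ - 1ℚ)) ⟨
            1ℚ + 1ℚ * inv (- (pₖ - pᵢ - 1ℚ))
              ≡⟨ cong₂ (λ g d → 1ℚ + δ g * inv d) (lower-grows V u<n k<ℓ gk′ gk) p⁻ ⟨
            upFactor M⁻ u i k ∎
            where
            neg : ∀ a → 1ℚ - 1ℚ * a ≡ 1ℚ + 1ℚ * (- a)
            neg = solve-∀ ringℚ

    commute : ∀ {M} → Valid M → ∀ {u i u′ k} → u < n → i < ℓ → u′ < n → k < ℓ → u ≢ u′ ⊎ i ≢ k → Commute M u i u′ k
    commute {M} V {u} {i} {u′} {k} u<n i<ℓ u′<n k<ℓ d with u ℕP.≟ u′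
    ... | yes refl = commute-level V u<n i<ℓ k<ℓ ([ (λ ne → contradiction refl ne) , (λ x → x) ]′ d)
    ... | no u≢u′ with u ℕP.≟ suc u′ | i ℕP.≟ k
    ...   | yes refl | yes refl = commute-row-below V u<n i<ℓ
    ...   | yes refl | no i≢k   = Interaction.Below.commute-below V u<n i<ℓ u′<n k<ℓ refl i≢k
    ...   | no b     | i≟k with u′ ℕP.≟ suc u | i≟k
    ...     | yes refl | yes refl = commute-row-above V u′<n i<ℓ
    ...     | yes refl | no i≢k   = Interaction.Above.commute-above V u<n i<ℓ u′<n k<ℓ refl i≢k
    ...     | no a     | _        = Interaction.commute-far V u<n i<ℓ u′<n k<ℓ u≢u′ a b

    module Diagonal {M : State} (V : Valid M) {u : ℕ} (u<n : u < n) where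

      -- `ε i` is 1 if only the later of the two steps adds a box in row `i`, -1 if only the earlier
      -- one does, and 0 otherwise. The points `x` come from the shape before both steps, which no
      -- move at this level changes.
      ε x : ℕ → ℚ
      ε i = δ (grows M (suc u) i) - δ (grows M u i)
      x i = part M u i

      open PartialFractions ε x

      private
        u<s : suc u < suc n
        u<s = s≤s u<n
        u<s′ : u < suc n
        u<s′ = ℕP.m<n⇒m<1+n u<n

      part-suc : ∀ {t} j → grows M t j ≡ true → part M (suc t) j ≡ part M t j + 1ℚ
      part-suc {t} j g = trans (cong (λ y → ι y - ι j) (grows⇒≡ M t j g)) (lem (ι (entry M t j)) (ι j))
        where
        lem : ∀ a j → (1ℚ + a) - j ≡ (a - j) + 1ℚ
        lem = solve-∀ ringℚ

      part-stay : ∀ {t} j → t < suc n → grows M t j ≡ false → part M (suc t) j ≡ part M t j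
      part-stay j t<s g = cong (λ y → ι y - ι j) (¬grows⇒≡ V t<s j g)

      -- The factors are `y / (y - 1)` and its reciprocal. They belong to a row that grows in both
      -- steps, whose contribution thus agrees with `ε = 0`.
      diagonal-factor : ∀ {y} → y ≢ 0ℚ → y - 1ℚ ≢ 0ℚ → (1ℚ + inv (y - 1ℚ)) * (1ℚ - inv y) ≡ 1ℚ
      diagonal-factor {y} y≢0 y-1≢0 = begin
        (1ℚ + b) * (1ℚ - a)                        ≡⟨ lem y a b ⟩
        1ℚ + (b * (1ℚ - y * a) + a * ((y - 1ℚ) * b - 1ℚ))
          ≡⟨ cong₂ (λ p q → 1ℚ + (b * (1ℚ - p) + a * (q - 1ℚ))) (*-inv y≢0) (*-inv y-1≢0) ⟩
        1ℚ + (b * (1ℚ - 1ℚ) + a * (1ℚ - 1ℚ))       ≡⟨ lem′ a b ⟩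
        1ℚ                                         ∎
        where
        a = inv y
        b = inv (y - 1ℚ)
        lem : ∀ y a b → (1ℚ + b) * (1ℚ - a) ≡ 1ℚ + (b * (1ℚ - y * a) + a * ((y - 1ℚ) * b - 1ℚ))
        lem = solve-∀ ringℚ
        lem′ : ∀ a b → 1ℚ + (b * (1ℚ - 1ℚ) + a * (1ℚ - 1ℚ)) ≡ 1ℚ
        lem′ = solve-∀ ringℚ

      shift≢0 : ∀ {p q} → p ≢ q + 1ℚ → p - q - 1ℚ ≢ 0ℚ
      shift≢0 {p} {q} ne e = ne (trans (lem p q) (trans (cong (_+ (q + 1ℚ)) e) (ℚP.+-identityˡ (q + 1ℚ))))
        where
        lem : ∀ p q → p ≡ (p - q - 1ℚ) + (q + 1ℚ)
        lem = solve-∀ ringℚ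

      self-factor : ∀ b y → 1ℚ + b * inv (y - y) ≡ 1ℚ
      self-factor b y = trans (cong (λ z → 1ℚ + b * inv z) (ℚP.+-inverseʳ y)) (lem b)
        where
        lem : ∀ b → 1ℚ + b * 0ℚ ≡ 1ℚ
        lem = solve-∀ ringℚ

      self-factor′ : ∀ b y → 1ℚ - b * inv (y - y) ≡ 1ℚ
      self-factor′ b y = trans (cong (λ z → 1ℚ - b * inv z) (ℚP.+-inverseʳ y)) (lem b)
        where
        lem : ∀ b → 1ℚ - b * 0ℚ ≡ 1ℚ
        lem = solve-∀ ringℚ

      -- The product of the two factors contributed by a row j, once both are expressed through
      -- y = x i - x j and the growth bits c, d of row j below and above the shape.
      row : Bool → Bool → ℚ → ℚ
      row false false y = 1ℚ
      row false true  y = 1ℚ + inv y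
      row true  false y = 1ℚ - inv y
      row true  true  y = (1ℚ + inv (y - 1ℚ)) * (1ℚ - inv y)

      row≡ : ∀ c d y → y ≢ 0ℚ → (c ≡ true → d ≡ true → y - 1ℚ ≢ 0ℚ) → row c d y ≡ 1ℚ + (δ d - δ c) * inv y
      row≡ false false y _   _  = lem (inv y)
        where
        lem : ∀ v → 1ℚ ≡ 1ℚ + (0ℚ - 0ℚ) * v
        lem = solve-∀ ringℚ
      row≡ false true  y _   _  = lem (inv y)
        where
        lem : ∀ v → 1ℚ + v ≡ 1ℚ + (1ℚ - 0ℚ) * v
        lem = solve-∀ ringℚ
      row≡ true  false y _   _  = lem (inv y)
        where
        lem : ∀ v → 1ℚ - v ≡ 1ℚ + (0ℚ - 1ℚ) * v
        lem = solve-∀ ringℚ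
      row≡ true  true  y y≢0 ne = trans (diagonal-factor y≢0 (ne refl refl)) (lem (inv y))
        where
        lem : ∀ v → 1ℚ ≡ 1ℚ + (1ℚ - 1ℚ) * v
        lem = solve-∀ ringℚ

      row-cases : ∀ i j → x i ≢ x j → (grows M u j ≡ true → grows M (suc u) j ≡ true → x i - x j - 1ℚ ≢ 0ℚ) →
                  (1ℚ + δ (grows M (suc u) j) * inv (x i - part M (suc u) j)) * (1ℚ - δ (grows M u j) * inv (x i + 1ℚ - part M (suc u) j))
                    ≡ 1ℚ + ε j * inv (x i - x j)
      row-cases i j x≢ ne = trans (cases (grows M u j) (grows M (suc u) j) refl)
                                  (row≡ (grows M u j) (grows M (suc u) j) (x i - x j) (x-y≢0 x≢) ne)
        where
        cases : ∀ c d → grows M u j ≡ c →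
                (1ℚ + δ d * inv (x i - part M (suc u) j)) * (1ℚ - δ c * inv (x i + 1ℚ - part M (suc u) j)) ≡ row c d (x i - x j)
        cases false d e = trans (cong₂ (λ p q → (1ℚ + δ d * inv (x i - p)) * (1ℚ - 0ℚ * inv (x i + 1ℚ - q))) (part-stay j u<s′ e) (part-stay j u<s′ e)) (go d)
          where
          go : ∀ d → (1ℚ + δ d * inv (x i - x j)) * (1ℚ - 0ℚ * inv (x i + 1ℚ - x j)) ≡ row false d (x i - x j)
          go false = lem (inv (x i - x j)) (inv (x i + 1ℚ - x j))
            where
            lem : ∀ a b → (1ℚ + 0ℚ * a) * (1ℚ - 0ℚ * b) ≡ 1ℚ
            lem = solve-∀ ringℚ
          go true = lem (inv (x i - x j)) (inv (x i + 1ℚ - x j))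
            where
            lem : ∀ a b → (1ℚ + 1ℚ * a) * (1ℚ - 0ℚ * b) ≡ 1ℚ + a
            lem = solve-∀ ringℚ
        cases true d e = trans (cong₂ (λ p q → (1ℚ + δ d * inv p) * (1ℚ - 1ℚ * inv q))
                                      (trans (cong (λ z → x i - z) (part-suc j e)) (lem₁ (x i) (x j)))
                                      (trans (cong (λ z → x i + 1ℚ - z) (part-suc j e)) (lem₂ (x i) (x j)))) (go d)
          where
          lem₁ : ∀ a b → a - (b + 1ℚ) ≡ a - b - 1ℚ
          lem₁ = solve-∀ ringℚ
          lem₂ : ∀ a b → a + 1ℚ - (b + 1ℚ) ≡ a - b
          lem₂ = solve-∀ ringℚ
          go : ∀ d → (1ℚ + δ d * inv (x i - x j - 1ℚ)) * (1ℚ - 1ℚ * inv (x i - x j)) ≡ row true d (x i - x j)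
          go false = lem (inv (x i - x j - 1ℚ)) (inv (x i - x j))
            where
            lem : ∀ a b → (1ℚ + 0ℚ * a) * (1ℚ - 1ℚ * b) ≡ 1ℚ - b
            lem = solve-∀ ringℚ
          go true = lem (inv (x i - x j - 1ℚ)) (inv (x i - x j))
            where
            lem : ∀ a b → (1ℚ + 1ℚ * a) * (1ℚ - 1ℚ * b) ≡ (1ℚ + a) * (1ℚ - b)
            lem = solve-∀ ringℚ

      module Up {i : ℕ} (i<ℓ : i < ℓ) (c : grows M u i ≡ false) (d : grows M (suc u) i ≡ true) where

        M⁺ = raise M u i

        part⁺ : part M⁺ (suc u) i ≡ x i + 1ℚ
        part⁺ = trans (cong (λ y → ι y - ι i) (raise-same M u<n i<ℓ))
                      (trans (lem (ι (entry M (suc u) i)) (ι i)) (cong (_+ 1ℚ) (part-stay i u<s′ c)))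
          where
          lem : ∀ a j → (1ℚ + a) - j ≡ (a - j) + 1ℚ
          lem = solve-∀ ringℚ

        factor : ∀ j → upFactor M u i j * downFactor M⁺ u i j ≡ 1ℚ + ε j * inv (x i - x j)
        factor j with i ℕP.≟ j
        ... | yes refl = trans (cong₂ _*_ (self-factor (δ (grows M (suc u) i)) (part M (suc u) i))
                                          (self-factor′ (δ (grows M⁺ u i)) (part M⁺ (suc u) i)))
                               (sym (self-factor (ε i) (x i)))
        ... | no i≢j = trans
          (cong₂ _*_ (cong (λ p → 1ℚ + δ (grows M (suc u) j) * inv (p - part M (suc u) j)) (part-stay i u<s′ c))
                     (cong₂ (λ g p → 1ℚ - δ g * inv p) (grows-raise M u i u j (inj₂ i≢j))
                                                       (cong₂ _-_ part⁺ (part-raise M u i (suc u) j (inj₂ i≢j)))))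
          -- In the middle shape row `i` is unchanged while row `j` has grown once, so
          -- `x i = x j + 1` would make their shifted parts equal there.
          (row-cases i j (part-distinct V u i≢j) λ cj _ → shift≢0 {x i} {x j} λ e →
            part-distinct V (suc u) i≢j (trans (part-stay i u<s′ c) (trans e (sym (part-suc j cj)))))

        product : ∏ ℓ (upFactor M u i) * ∏ ℓ (downFactor M⁺ u i) ≡ ∏ ℓ (λ j → 1ℚ + ε j * inv (x i - x j))
        product = trans (sym (∏-* ℓ (upFactor M u i) (downFactor M⁺ u i))) (∏-cong ℓ λ {j} _ → factor j)

      module Down {i : ℕ} (i<ℓ : i < ℓ) (c : grows M u i ≡ true) (d : grows M (suc u) i ≡ false) where

        M⁻ = lower M u i

        part⁻ : part M⁻ (suc u) i ≡ x i
        part⁻ = cong (λ y → ι y - ι i) (trans (lower-same M u<n i<ℓ) (cong pred (grows⇒≡ M u i c)))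

        factor : ∀ j → upFactor M⁻ u i j * downFactor M u i j ≡ 1ℚ + ε j * inv (x i - x j)
        factor j with i ℕP.≟ j
        ... | yes refl = trans (cong₂ _*_ (self-factor (δ (grows M⁻ (suc u) i)) (part M⁻ (suc u) i))
                                          (self-factor′ (δ (grows M u i)) (part M (suc u) i)))
                               (sym (self-factor (ε i) (x i)))
        ... | no i≢j = trans
          (cong₂ _*_ (cong₂ (λ g p → 1ℚ + δ g * inv p) (grows-lower M u i (suc u) j (inj₂ i≢j))
                                                       (cong₂ _-_ part⁻ (part-lower M u i (suc u) j (inj₂ i≢j))))
                     (cong (λ p → 1ℚ - δ (grows M u j) * inv (p - part M (suc u) j)) (part-suc i c)))
          -- After both steps row `i` has grown once and row `j` twice, so `x i = x j + 1` would
          -- make their shifted parts equal in the last shape.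
          (row-cases i j (part-distinct V u i≢j) λ cj dj → shift≢0 {x i} {x j} λ e →
            part-distinct V (suc (suc u)) i≢j (trans (part-stay i u<s d) (trans (part-suc i c)
              (trans (cong (_+ 1ℚ) (trans e (sym (part-suc j cj)))) (sym (part-suc j dj))))))

        product : ∏ ℓ (downFactor M u i) * ∏ ℓ (upFactor M⁻ u i) ≡ ∏ ℓ (λ j → 1ℚ + ε j * inv (x i - x j))
        product = trans (ℚP.*-comm (∏ ℓ (downFactor M u i)) (∏ ℓ (upFactor M⁻ u i)))
                        (trans (sym (∏-* ℓ (upFactor M⁻ u i) (downFactor M u i))) (∏-cong ℓ λ {j} _ → factor j))

      -- At most one of the two round trips is open: raising and lowering back when `ε i` is 1, the
      -- opposite trip, with its sign, when `ε i` is -1, and neither when `ε i` is 0.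
      diagonal-term : ∀ {i} → i < ℓ → up M u i * down (raise M u i) u i - down M u i * up (lower M u i) u i ≡ residue ℓ i
      diagonal-term {i} i<ℓ = cases (grows M u i) (grows M (suc u) i) refl refl
        where
        M⁺ = raise M u i
        M⁻ = lower M u i
        U = ∏ ℓ (upFactor M u i)
        D = ∏ ℓ (downFactor M u i)
        U⁻ = ∏ ℓ (upFactor M⁻ u i)
        D⁺ = ∏ ℓ (downFactor M⁺ u i)
        R = ∏ ℓ (λ j → 1ℚ + ε j * inv (x i - x j))
        cases : ∀ c d → grows M u i ≡ c → grows M (suc u) i ≡ d →
                (δ (upFlag M u i) * U) * (δ (downFlag M⁺ u i) * D⁺) - (δ (downFlag M u i) * D) * (δ (upFlag M⁻ u i) * U⁻) ≡ ε i * R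
        cases false false ec ed rewrite ec | ed = lem U (down M⁺ u i) D (up M⁻ u i) R
          where
          lem : ∀ a b c d e → (0ℚ * a) * b - (0ℚ * c) * d ≡ (0ℚ - 0ℚ) * e
          lem = solve-∀ ringℚ
        cases true  true  ec ed rewrite ec | ed = lem U (down M⁺ u i) D (up M⁻ u i) R
          where
          lem : ∀ a b c d e → (0ℚ * a) * b - (0ℚ * c) * d ≡ (1ℚ - 1ℚ) * e
          lem = solve-∀ ringℚ
        cases false true  ec ed rewrite raise-grows V u<n i<ℓ ec | raise-¬grows V u<n i<ℓ ed | ec | ed =
          trans (lem U D⁺ D (up M⁻ u i)) (trans (Up.product i<ℓ ec ed) (lem′ R))
          where
          lem : ∀ a b c d → (1ℚ * a) * (1ℚ * b) - (0ℚ * c) * d ≡ a * b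
          lem = solve-∀ ringℚ
          lem′ : ∀ e → e ≡ (1ℚ - 0ℚ) * e
          lem′ = solve-∀ ringℚ
        cases true  false ec ed rewrite lower-¬grows V u<n i<ℓ ec | lower-grows V u<n i<ℓ ec ed | ec | ed =
          trans (lem U (down M⁺ u i) D U⁻) (trans (cong -_ (Down.product i<ℓ ec ed)) (lem′ R))
          where
          lem : ∀ a b c d → (0ℚ * a) * b - (1ℚ * c) * (1ℚ * d) ≡ - (c * d)
          lem = solve-∀ ringℚ
          lem′ : ∀ e → - e ≡ (0ℚ - 1ℚ) * e
          lem′ = solve-∀ ringℚ

      -- Summing all residues removes every dependence on the individual parts: only the difference
      -- between the box counts of the two steps remains.
      diagonal : ∑ ℓ (λ i → up M u i * down (raise M u i) u i - down M u i * up (lower M u i) u i) ≡ ∑ ℓ ε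
      diagonal = trans (∑-cong ℓ diagonal-term) (∑-residue ℓ λ _ _ → part-distinct V u)

      ε-second-difference : ∀ i → ε i ≡ ι (entry M (suc (suc u)) i) - (1ℚ + 1ℚ) * ι (entry M (suc u) i) + ι (entry M u i)
      ε-second-difference i = begin
        δ (grows M (suc u) i) - δ (grows M u i)  ≡⟨ cong₂ _-_ (bit u<s) (bit u<s′) ⟩
        (c - b) - (b - a)                        ≡⟨ lem a b c ⟩
        c - (1ℚ + 1ℚ) * b + a                    ∎
        where
        a = ι (entry M u i)
        b = ι (entry M (suc u) i)
        c = ι (entry M (suc (suc u)) i)
        lem : ∀ a b c → (c - b) - (b - a) ≡ c - (1ℚ + 1ℚ) * b + a
        lem = solve-∀ ringℚ
        bit : ∀ {t} → t < suc n → δ (grows M t i) ≡ ι (entry M (suc t) i) - ι (entry M t i)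
        bit {t} t<s = go (grows M t i) refl
          where
          go : ∀ b → grows M t i ≡ b → δ b ≡ ι (entry M (suc t) i) - ι (entry M t i)
          go false e = trans (sym (ℚP.+-inverseʳ (ι (entry M t i)))) (cong (λ z → ι z - ι (entry M t i)) (sym (¬grows⇒≡ V t<s i e)))
          go true  e = trans (lem′ (ι (entry M t i))) (cong (λ z → ι z - ι (entry M t i)) (sym (grows⇒≡ M t i e)))
            where
            lem′ : ∀ a → 1ℚ ≡ (1ℚ + a) - a
            lem′ = solve-∀ ringℚ

-- The commutator of the principal raising and lowering operators.

module PrincipalTriple where

  open Rationals
  open NaturalsInRationals
  open Arrays
  open RaisingAndLowering
  open import Data.Bool using (true; false; not; _∧_)
  open import Data.Rational using (ℚ; 0ℚ; 1ℚ; _+_; _*_; -_; _-_)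
  open import Data.Rational.Properties as ℚP using (_≟_)
  open import Data.Nat as ℕ using (ℕ; zero; suc; _≤_; _<_; z≤n; s≤s)
  import Data.Nat.Properties as ℕP
  open import Data.Vec using (Vec)
  open import Relation.Nullary using (yes; no)
  open import Tactic.RingSolver using (solve-∀)
  open import Data.Sum using (_⊎_; inj₁; inj₂)
  open import Relation.Binary.PropositionalEquality
  open ≡-Reasoning

  ∑ₙ : ℕ → (ℕ → ℕ) → ℕ
  ∑ₙ zero    f = 0
  ∑ₙ (suc n) f = ∑ₙ n f ℕ.+ f n

  ι-∑ : ∀ n f → ι (∑ₙ n f) ≡ ∑ n (λ i → ι (f i))
  ι-∑ zero    f = refl
  ι-∑ (suc n) f = trans (ι-+ (∑ₙ n f) (f n)) (cong (_+ ι (f n)) (ι-∑ n f))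

  ∑ₙ-cong : ∀ n {f g} → (∀ {i} → i < n → f i ≡ g i) → ∑ₙ n f ≡ ∑ₙ n g
  ∑ₙ-cong zero    eq = refl
  ∑ₙ-cong (suc n) eq = cong₂ ℕ._+_ (∑ₙ-cong n λ i<n → eq (ℕP.m<n⇒m<1+n i<n)) (eq ℕP.≤-refl)

  ∑ₙ-mono : ∀ n {f g} → (∀ {i} → i < n → f i ≤ g i) → ∑ₙ n f ≤ ∑ₙ n g
  ∑ₙ-mono zero    le = z≤n
  ∑ₙ-mono (suc n) le = ℕP.+-mono-≤ (∑ₙ-mono n λ i<n → le (ℕP.m<n⇒m<1+n i<n)) (le ℕP.≤-refl)

  ∑ₙ-suc : ∀ n {f g} k → k < n → g k ≡ suc (f k) → (∀ {i} → i ≢ k → g i ≡ f i) → ∑ₙ n g ≡ suc (∑ₙ n f)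
  ∑ₙ-suc (suc n) {f} {g} k k<1+n e off with k ℕP.≟ n
  ... | yes refl = trans (cong₂ ℕ._+_ (∑ₙ-cong n λ i<n → off (ℕP.<⇒≢ i<n)) e) (ℕP.+-suc (∑ₙ n f) (f n))
  ... | no k≢n   = cong₂ ℕ._+_ (∑ₙ-suc n k (ℕP.≤∧≢⇒< (ℕP.≤-pred k<1+n) k≢n) e off) (off λ n≡k → k≢n (sym n≡k))

  module Commutator (n ℓ : ℕ) (top : Vec ℕ ℓ) where

    open Operators n ℓ

    record Good (M : State) : Set where
      field
        valid : Valid M
        end   : ∀ i → entry M (suc n) i ≡ at top i
    open Good

    ∑∑ : (ℕ → ℕ → ℚ) → ℚ
    ∑∑ g = ∑ n λ u → ∑ ℓ λ i → g u i

    ∑∑-cong : ∀ {g h} → (∀ {u i} → u < n → i < ℓ → g u i ≡ h u i) → ∑∑ g ≡ ∑∑ h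
    ∑∑-cong eq = ∑-cong n λ u<n → ∑-cong ℓ λ i<ℓ → eq u<n i<ℓ

    ∑∑-+ : ∀ g h → ∑∑ (λ u i → g u i + h u i) ≡ ∑∑ g + ∑∑ h
    ∑∑-+ g h = trans (∑-cong n λ {u} _ → ∑-+ ℓ (g u) (h u)) (∑-+ n (λ u → ∑ ℓ (g u)) (λ u → ∑ ℓ (h u)))

    ∑∑-* : ∀ c g → ∑∑ (λ u i → c * g u i) ≡ c * ∑∑ g
    ∑∑-* c g = trans (∑-cong n λ {u} _ → ∑-*ˡ ℓ c (g u)) (∑-*ˡ n c (λ u → ∑ ℓ (g u)))

    ∑∑-single : ∀ {g u i} → u < n → i < ℓ → (∀ {u′ k} → u′ < n → k < ℓ → u ≢ u′ ⊎ i ≢ k → g u′ k ≡ 0ℚ) → ∑∑ g ≡ g u i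
    ∑∑-single {g} {u} {i} u<n i<ℓ off = trans
      (∑-single n u u<n λ u′<n u′≢u → ∑-zero ℓ λ k<ℓ → off u′<n k<ℓ (inj₁ λ e → u′≢u (sym e)))
      (∑-single ℓ i i<ℓ λ k<ℓ k≢i → off u<n k<ℓ (inj₂ λ e → k≢i (sym e)))

    ∑∑-swap : ∀ (g : ℕ → ℕ → ℕ → ℕ → ℚ) → ∑∑ (λ u i → ∑∑ (g u i)) ≡ ∑∑ (λ u′ k → ∑∑ (λ u i → g u i u′ k))
    ∑∑-swap g = begin
      ∑ n (λ u → ∑ ℓ (λ i → ∑ n (λ u′ → ∑ ℓ (g u i u′))))     ≡⟨ ∑-cong n (λ {u} _ → ∑-swap ℓ n (λ i u′ → ∑ ℓ (g u i u′))) ⟩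
      ∑ n (λ u → ∑ n (λ u′ → ∑ ℓ (λ i → ∑ ℓ (g u i u′))))     ≡⟨ ∑-cong n (λ {u} _ → ∑-cong n λ {u′} _ → ∑-swap ℓ ℓ (λ i k → g u i u′ k)) ⟩
      ∑ n (λ u → ∑ n (λ u′ → ∑ ℓ (λ k → ∑ ℓ (λ i → g u i u′ k)))) ≡⟨ ∑-swap n n (λ u u′ → ∑ ℓ (λ k → ∑ ℓ (λ i → g u i u′ k))) ⟩
      ∑ n (λ u′ → ∑ n (λ u → ∑ ℓ (λ k → ∑ ℓ (λ i → g u i u′ k)))) ≡⟨ ∑-cong n (λ {u′} _ → ∑-swap n ℓ (λ u k → ∑ ℓ (λ i → g u i u′ k))) ⟩
      ∑ n (λ u′ → ∑ ℓ (λ k → ∑ n (λ u → ∑ ℓ (λ i → g u i u′ k)))) ∎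

    -- With these weights E and F generate a principal sl₂: E F - F E acts on grade g as the scalar n |top| - 2 g.
    W : ℕ → ℚ
    W u = ι (suc u) * (ι (suc n) - ι (suc u))

    E F : (State → ℚ) → State → ℚ
    E f M = ∑∑ λ u i → up M u i * f (raise M u i)
    F f M = ∑∑ λ u i → W u * down M u i * f (lower M u i)

    H : State → ℚ
    H M = ∑ n λ u → W u * ∑ ℓ λ i → δ (grows M (suc u) i) - δ (grows M u i)

    -- Lowering an entry 0 does nothing, and raising it afterwards would not restore the state; this
    -- case has coefficient zero.
    down-positive : ∀ M {u i} → down M u i ≡ 0ℚ ⊎ 0 < entry M (suc u) i
    down-positive M {u} {i} = go (grows M u i) refl
      where
      go : ∀ b → grows M u i ≡ b → down M u i ≡ 0ℚ ⊎ 0 < entry M (suc u) i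
      go true  e = inj₂ (subst (0 <_) (sym (grows⇒≡ M u i e)) (s≤s z≤n))
      go false e = inj₁ (trans (cong (λ b → δ (b ∧ not (grows M (suc u) i)) * ∏ ℓ (downFactor M u i)) e) (ℚP.*-zeroˡ (∏ ℓ (downFactor M u i))))

    -- For two different moves the double sums agree term by term by `commute`; the weight `W`
    -- depends only on the level of the lowering move, so it is the same in both orders. The round
    -- trips remain and add up to `H` by `diagonal`.
    commutator : ∀ f {M} → Good M → E (F f) M ≡ F (E f) M + H M * f M
    commutator f {M} G = begin
      E (F f) M
        ≡⟨ ∑∑-cong (λ {u} {i} _ _ → sym (∑∑-* (up M u i) (λ u′ k → W u′ * down (raise M u i) u′ k * f (lower (raise M u i) u′ k)))) ⟩
      ∑∑ (λ u i → ∑∑ (X u i))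
        ≡⟨ ∑∑-cong (λ u<n i<ℓ → inner u<n i<ℓ) ⟩
      ∑∑ (λ u i → ∑∑ (Y u i) + Z u i)
        ≡⟨ ∑∑-+ (λ u i → ∑∑ (Y u i)) Z ⟩
      ∑∑ (λ u i → ∑∑ (Y u i)) + ∑∑ Z
        ≡⟨ cong₂ _+_ (∑∑-swap Y) diag ⟩
      ∑∑ (λ u′ k → ∑∑ (λ u i → Y u i u′ k)) + H M * f M
        ≡⟨ cong (_+ H M * f M) (∑∑-cong λ {u′} {k} _ _ → ∑∑-* (W u′ * down M u′ k) (λ u i → up (lower M u′ k) u i * f (raise (lower M u′ k) u i))) ⟩
      F (E f) M + H M * f M ∎
      where
      V = valid G
      X Y : ℕ → ℕ → ℕ → ℕ → ℚ
      X u i u′ k = up M u i * (W u′ * down (raise M u i) u′ k * f (lower (raise M u i) u′ k))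
      Y u i u′ k = W u′ * down M u′ k * (up (lower M u′ k) u i * f (raise (lower M u′ k) u i))
      Z : ℕ → ℕ → ℚ
      Z u i = W u * (up M u i * down (raise M u i) u i - down M u i * up (lower M u i) u i) * f M
      reorder : ∀ a w b c → a * (w * b * c) ≡ w * (a * b) * c
      reorder = solve-∀ ringℚ
      X≡Y : ∀ {u i u′ k} → u < n → i < ℓ → u′ < n → k < ℓ → u ≢ u′ ⊎ i ≢ k → X u i u′ k ≡ Y u i u′ k
      X≡Y {u} {i} {u′} {k} u<n i<ℓ u′<n k<ℓ d = begin
        X u i u′ k    ≡⟨ reorder (up M u i) (W u′) (down (raise M u i) u′ k) (f (lower (raise M u i) u′ k)) ⟩
        W u′ * (up M u i * down (raise M u i) u′ k) * f (lower (raise M u i) u′ k)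
          ≡⟨ cong₂ (λ p q → W u′ * p * q) (commute V u<n i<ℓ u′<n k<ℓ d)
                   (cong f (dec-inc-swap M (suc u) i (suc u′) k (shift d))) ⟩
        W u′ * (down M u′ k * up (lower M u′ k) u i) * f (raise (lower M u′ k) u i)
          ≡⟨ lem (W u′) (down M u′ k) (up (lower M u′ k) u i) (f (raise (lower M u′ k) u i)) ⟩
        Y u i u′ k ∎
        where
        shift : u ≢ u′ ⊎ i ≢ k → suc u ≢ suc u′ ⊎ i ≢ k
        shift (inj₁ ne) = inj₁ λ e → ne (ℕP.suc-injective e)
        shift (inj₂ ne) = inj₂ ne
        lem : ∀ w a b c → w * (a * b) * c ≡ w * a * (b * c)
        lem = solve-∀ ringℚ
      X-Y : ∀ {u i} → X u i u i - Y u i u i ≡ Z u i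
      X-Y {u} {i} = begin
        X u i u i - Y u i u i
          ≡⟨ cong₂ _-_ (cong (λ N → up M u i * (W u * down (raise M u i) u i * f N)) (dec-inc M (suc u) i)) back ⟩
        up M u i * (W u * down (raise M u i) u i * f M) - W u * down M u i * (up (lower M u i) u i * f M)
          ≡⟨ lem (up M u i) (W u) (down (raise M u i) u i) (f M) (down M u i) (up (lower M u i) u i) ⟩
        Z u i ∎
        where
        lem : ∀ a w b f c d → a * (w * b * f) - w * c * (d * f) ≡ w * (a * b - c * d) * f
        lem = solve-∀ ringℚ
        back : Y u i u i ≡ W u * down M u i * (up (lower M u i) u i * f M)
        back with down-positive M {u} {i}
        ... | inj₁ z = trans (cong (λ d → W u * d * (up (lower M u i) u i * f (raise (lower M u i) u i))) z)
                      (trans (vanish (W u) (up (lower M u i) u i * f (raise (lower M u i) u i)) (up (lower M u i) u i * f M))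
                             (cong (λ d → W u * d * (up (lower M u i) u i * f M)) (sym z)))
          where
          vanish : ∀ w a b → w * 0ℚ * a ≡ w * 0ℚ * b
          vanish = solve-∀ ringℚ
        ... | inj₂ p = cong (λ N → W u * down M u i * (up (lower M u i) u i * f N)) (inc-dec M (suc u) i p)
      inner : ∀ {u i} → u < n → i < ℓ → ∑∑ (X u i) ≡ ∑∑ (Y u i) + Z u i
      inner {u} {i} u<n i<ℓ = begin
        ∑∑ (X u i)                                         ≡⟨ ∑∑-cong (λ {u′} {k} _ _ → lem (X u i u′ k) (Y u i u′ k)) ⟩
        ∑∑ (λ u′ k → Y u i u′ k + (X u i u′ k - Y u i u′ k)) ≡⟨ ∑∑-+ (Y u i) (λ u′ k → X u i u′ k - Y u i u′ k) ⟩
        ∑∑ (Y u i) + ∑∑ (λ u′ k → X u i u′ k - Y u i u′ k)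
          ≡⟨ cong (∑∑ (Y u i) +_) (∑∑-single u<n i<ℓ λ {u′} {k} u′<n k<ℓ d →
               trans (cong (_- Y u i u′ k) (X≡Y u<n i<ℓ u′<n k<ℓ d)) (ℚP.+-inverseʳ (Y u i u′ k))) ⟩
        ∑∑ (Y u i) + (X u i u i - Y u i u i)                ≡⟨ cong (∑∑ (Y u i) +_) (X-Y {u} {i}) ⟩
        ∑∑ (Y u i) + Z u i ∎
        where
        lem : ∀ x y → x ≡ y + (x - y)
        lem = solve-∀ ringℚ
      diag : ∑∑ Z ≡ H M * f M
      diag = begin
        ∑∑ Z ≡⟨ ∑-cong n (λ {u} u<n → begin
          ∑ ℓ (Z u)   ≡⟨ ∑-cong ℓ (λ {i} _ → lem (W u) (D u i) (f M)) ⟩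
          ∑ ℓ (λ i → (f M * W u) * D u i)   ≡⟨ ∑-*ˡ ℓ (f M * W u) (D u) ⟩
          (f M * W u) * ∑ ℓ (D u)           ≡⟨ cong ((f M * W u) *_) (Diagonal.diagonal V u<n) ⟩
          (f M * W u) * ∑ ℓ (ε u)           ≡⟨ ℚP.*-assoc (f M) (W u) (∑ ℓ (ε u)) ⟩
          f M * (W u * ∑ ℓ (ε u))           ∎) ⟩
        ∑ n (λ u → f M * (W u * ∑ ℓ (ε u))) ≡⟨ ∑-*ˡ n (f M) (λ u → W u * ∑ ℓ (ε u)) ⟩
        f M * H M                           ≡⟨ ℚP.*-comm (f M) (H M) ⟩
        H M * f M ∎
        where
        D ε : ℕ → ℕ → ℚ
        D u i = up M u i * down (raise M u i) u i - down M u i * up (lower M u i) u i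
        ε u i = δ (grows M (suc u) i) - δ (grows M u i)
        lem : ∀ w d f → w * d * f ≡ (f * w) * d
        lem = solve-∀ ringℚ

    -- The total size of the intermediate shapes. It is the exponent of `q`, since a box lies in
    -- every shape from the step that adds it.
    grade : State → ℕ
    grade M = ∑ₙ n λ u → ∑ₙ ℓ λ i → entry M (suc u) i

    size : ℕ
    size = ∑ₙ ℓ (at top)

    -- With `s = suc n`, the weight `t (s - t)` is 0 at `t = s`, is `n` at `t = n` and has second
    -- difference -2. Summation by parts leaves `n` times the final parts and -2 times the
    -- intermediate ones.
    H-grade : ∀ {M} → Good M → H M ≡ ι (n ℕ.* size) - ι (2 ℕ.* grade M)
    H-grade {M} G = begin
      H M
        ≡⟨ ∑-cong n (λ {u} u<n → trans (cong (W u *_) (∑-cong ℓ λ {i} _ → Diagonal.ε-second-difference V u<n i)) (sym (∑-*ˡ ℓ (W u) (Δ u)))) ⟩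
      ∑ n (λ u → ∑ ℓ (λ i → W u * Δ u i))
        ≡⟨ ∑-swap n ℓ (λ u i → W u * Δ u i) ⟩
      ∑ ℓ (λ i → ∑ n (λ u → W u * Δ u i))
        ≡⟨ ∑-cong ℓ (λ {i} _ → trans (∑-second-difference (ι (suc n)) (λ t → ι (entry M t i)) n) (simplify i)) ⟩
      ∑ ℓ (λ i → ι n * ι (at top i) + (- (1ℚ + 1ℚ)) * ∑ n (λ u → ι (entry M (suc u) i)))
        ≡⟨ ∑-+ ℓ (λ i → ι n * ι (at top i)) (λ i → (- (1ℚ + 1ℚ)) * ∑ n (λ u → ι (entry M (suc u) i))) ⟩
      ∑ ℓ (λ i → ι n * ι (at top i)) + ∑ ℓ (λ i → (- (1ℚ + 1ℚ)) * ∑ n (λ u → ι (entry M (suc u) i)))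
        ≡⟨ cong₂ _+_ (trans (∑-*ˡ ℓ (ι n) (λ i → ι (at top i))) (trans (cong (ι n *_) (sym (ι-∑ ℓ (at top)))) (sym (ι-* n size))))
                     (trans (∑-*ˡ ℓ (- (1ℚ + 1ℚ)) (λ i → ∑ n (λ u → ι (entry M (suc u) i))))
                            (cong ((- (1ℚ + 1ℚ)) *_) (trans (∑-swap ℓ n (λ i u → ι (entry M (suc u) i)))
                              (sym (trans (ι-∑ n (λ u → ∑ₙ ℓ (λ i → entry M (suc u) i))) (∑-cong n λ {u} _ → ι-∑ ℓ (λ i → entry M (suc u) i))))))) ⟩
      ι (n ℕ.* size) + (- (1ℚ + 1ℚ)) * ι (grade M)
        ≡⟨ trans (lem (ι (n ℕ.* size)) (ι (grade M))) (cong (λ z → ι (n ℕ.* size) - z) (sym (ι-* 2 (grade M)))) ⟩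
      ι (n ℕ.* size) - ι (2 ℕ.* grade M) ∎
      where
      V = valid G
      Δ : ℕ → ℕ → ℚ
      Δ u i = ι (entry M (suc (suc u)) i) - (1ℚ + 1ℚ) * ι (entry M (suc u) i) + ι (entry M u i)
      lem : ∀ a g → a + (- (1ℚ + 1ℚ)) * g ≡ a - (1ℚ + (1ℚ + 0ℚ)) * g
      lem = solve-∀ ringℚ
      simplify : ∀ i → (ι n * (ι (suc n) - ι n)) * ι (entry M (suc n) i) - ((1ℚ + ι n) * (ι (suc n) - (1ℚ + ι n))) * ι (entry M n i)
                         + (ι (suc n) - 1ℚ) * ι (entry M 0 i) - (1ℚ + 1ℚ) * ∑ n (λ u → ι (entry M (suc u) i))
                       ≡ ι n * ι (at top i) + (- (1ℚ + 1ℚ)) * ∑ n (λ u → ι (entry M (suc u) i))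
      simplify i = trans
        (cong₂ (λ p q → (ι n * (ι (suc n) - ι n)) * ι p - ((1ℚ + ι n) * (ι (suc n) - (1ℚ + ι n))) * ι (entry M n i)
                         + (ι (suc n) - 1ℚ) * ι q - (1ℚ + 1ℚ) * ∑ n (λ u → ι (entry M (suc u) i)))
               (end G i) (Valid.start V i))
        (lem′ (ι n) (ι (at top i)) (ι (entry M n i)) (∑ n (λ u → ι (entry M (suc u) i))))
        where
        lem′ : ∀ n t m S → (n * ((1ℚ + n) - n)) * t - ((1ℚ + n) * ((1ℚ + n) - (1ℚ + n))) * m + ((1ℚ + n) - 1ℚ) * 0ℚ - (1ℚ + 1ℚ) * S
                         ≡ n * t + (- (1ℚ + 1ℚ)) * S
        lem′ = solve-∀ ringℚ

-- Injectivity towards the middle, and unimodal counts.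

module UnimodalCounts where

  open Rationals
  open NaturalsInRationals
  open Arrays
  open RaisingAndLowering
  open SlTwoLadder
  open CommonKernel
  open PrincipalTriple
  open import Data.Bool using (true; false; not; _∧_)
  open import Data.Rational using (ℚ; 0ℚ; 1ℚ; _+_; _*_; -_; _-_)
  open import Data.Rational.Properties as ℚP using (_≟_)
  open import Data.Nat as ℕ using (ℕ; zero; suc; pred; _≤_; _<_; z≤n; s≤s; _∸_)
  import Data.Nat.Properties as ℕP
  open import Data.List using (List; length; filter; lookup)
  open import Data.List.Membership.Propositional using (_∈_; _∉_)
  open import Data.List.Membership.Propositional.Properties using (∈-filter⁺; ∈-filter⁻)
  import Data.List.Relation.Unary.Any as Any
  open import Data.List.Relation.Unary.Any.Properties using (lookup-index)
  open import Data.List.Relation.Unary.Unique.Propositional using (Unique)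
  open import Data.List.Relation.Unary.Unique.Propositional.Properties using (filter⁺)
  open import Data.Vec using (Vec)
  open import Data.Vec.Properties using (≡-dec)
  open import Relation.Nullary using (¬_; yes; no; contradiction)
  open import Tactic.RingSolver using (solve-∀)
  open import Data.Empty using (⊥)
  open import Data.Product using (∃-syntax; _×_; _,_; proj₁; proj₂)
  open import Data.Sum using (_⊎_; inj₁; inj₂; map₂)
  open import Relation.Binary using (DecidableEquality)
  open import Relation.Binary.PropositionalEquality
  open ≡-Reasoning

  module Unimodality (n ℓ : ℕ) (top : Vec ℕ ℓ) where

    open Operators n ℓ
    open Commutator n ℓ top
    open Good
    open Valid

    _≟S_ : DecidableEquality State
    _≟S_ = ≡-dec (≡-dec ℕP._≟_)

    module _ {M : State} (G : Good M) {u i : ℕ} (u<n : u < n) (i<ℓ : i < ℓ) where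

      private
        V = valid G

      raise-valid : grows M u i ≡ false → grows M (suc u) i ≡ true →
                    (∀ j → i ≡ suc j → entry M (suc u) i < entry M (suc u) j) → Good (raise M u i)
      raise-valid c d room .valid .start j = trans (raise-other M u i 0 j (inj₁ λ ())) (start V j)
      raise-valid c d room .valid .step {t} t<s j with i ℕP.≟ j
      ... | no i≢j = subst₂ (λ x y → x ≡ y ⊎ x ≡ suc y) (sym (raise-other M u i (suc t) j (inj₂ i≢j)))
                            (sym (raise-other M u i t j (inj₂ i≢j))) (step V t<s j)
      ... | yes refl with t ℕP.≟ u | t ℕP.≟ suc u
      ...   | yes refl | _        = inj₂ (grows⇒≡ (raise M u i) u i (raise-grows V u<n i<ℓ c))
      ...   | no _     | yes refl = inj₁ (begin
          entry (raise M u i) (suc (suc u)) i   ≡⟨ raise-other M u i (suc (suc u)) i (inj₁ (n≢1+n (suc u))) ⟩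
          entry M (suc (suc u)) i               ≡⟨ grows⇒≡ M (suc u) i d ⟩
          suc (entry M (suc u) i)               ≡⟨ raise-same M u<n i<ℓ ⟨
          entry (raise M u i) (suc u) i         ∎)
      ...   | no t≢u   | no t≢1+u = subst₂ (λ x y → x ≡ y ⊎ x ≡ suc y)
                (sym (raise-other M u i (suc t) i (inj₁ λ e → t≢u (sym (ℕP.suc-injective e)))))
                (sym (raise-other M u i t i (inj₁ λ e → t≢1+u (sym e)))) (step V t<s i)
      raise-valid c d room .valid .dom t j with suc u ℕP.≟ t
      ... | no ne = subst₂ _≤_ (sym (raise-other M u i t (suc j) (inj₁ ne))) (sym (raise-other M u i t j (inj₁ ne))) (dom V t j)
      ... | yes refl with i ℕP.≟ suc j | i ℕP.≟ j
      ...   | yes refl | _ = subst₂ _≤_ (sym (raise-same M u<n i<ℓ)) (sym (raise-other M u i (suc u) j (inj₂ λ e → ℕP.1+n≢n e))) (room j refl)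
      ...   | no ne | yes refl = subst₂ _≤_ (sym (raise-other M u i (suc u) (suc i) (inj₂ ne))) (sym (raise-same M u<n i<ℓ))
                                   (ℕP.m≤n⇒m≤1+n (dom V (suc u) i))
      ...   | no ne | no ne′ = subst₂ _≤_ (sym (raise-other M u i (suc u) (suc j) (inj₂ ne)))
                                 (sym (raise-other M u i (suc u) j (inj₂ ne′))) (dom V (suc u) j)
      raise-valid c d room .end j = trans (raise-other M u i (suc n) j (inj₁ λ e → ℕP.<⇒≢ u<n (ℕP.suc-injective e))) (end G j)

      lower-valid : grows M u i ≡ true → grows M (suc u) i ≡ false →
                    entry M (suc u) (suc i) < entry M (suc u) i → Good (lower M u i)
      lower-valid c d room .valid .start j = trans (lower-other M u i 0 j (inj₁ λ ())) (start V j)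
      lower-valid c d room .valid .step {t} t<s j with i ℕP.≟ j
      ... | no i≢j = subst₂ (λ x y → x ≡ y ⊎ x ≡ suc y) (sym (lower-other M u i (suc t) j (inj₂ i≢j)))
                            (sym (lower-other M u i t j (inj₂ i≢j))) (step V t<s j)
      ... | yes refl with t ℕP.≟ u | t ℕP.≟ suc u
      ...   | yes refl | _        = inj₁ (begin
          entry (lower M u i) (suc u) i   ≡⟨ lower-same M u<n i<ℓ ⟩
          pred (entry M (suc u) i)        ≡⟨ cong pred (grows⇒≡ M u i c) ⟩
          entry M u i                     ≡⟨ lower-other M u i u i (inj₁ (1+n≢n u)) ⟨
          entry (lower M u i) u i         ∎)
      ...   | no _     | yes refl = inj₂ (grows⇒≡ (lower M u i) (suc u) i (lower-grows V u<n i<ℓ c d))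
      ...   | no t≢u   | no t≢1+u = subst₂ (λ x y → x ≡ y ⊎ x ≡ suc y)
                (sym (lower-other M u i (suc t) i (inj₁ λ e → t≢u (sym (ℕP.suc-injective e)))))
                (sym (lower-other M u i t i (inj₁ λ e → t≢1+u (sym e)))) (step V t<s i)
      lower-valid c d room .valid .dom t j with suc u ℕP.≟ t
      ... | no ne = subst₂ _≤_ (sym (lower-other M u i t (suc j) (inj₁ ne))) (sym (lower-other M u i t j (inj₁ ne))) (dom V t j)
      ... | yes refl with i ℕP.≟ j | i ℕP.≟ suc j
      ...   | yes refl | _ = subst₂ _≤_ (sym (lower-other M u i (suc u) (suc i) (inj₂ λ e → ℕP.1+n≢n (sym e))))
                                        (sym (lower-same M u<n i<ℓ)) (ℕP.pred-mono-≤ room)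
      ...   | no ne | yes refl = subst₂ _≤_ (sym (lower-same M u<n i<ℓ)) (sym (lower-other M u i (suc u) j (inj₂ ne)))
                                   (ℕP.≤-trans ℕP.pred[n]≤n (dom V (suc u) j))
      ...   | no ne | no ne′ = subst₂ _≤_ (sym (lower-other M u i (suc u) (suc j) (inj₂ ne′)))
                                 (sym (lower-other M u i (suc u) j (inj₂ ne))) (dom V (suc u) j)
      lower-valid c d room .end j = trans (lower-other M u i (suc n) j (inj₁ λ e → ℕP.<⇒≢ u<n (ℕP.suc-injective e))) (end G j)

      -- The row above has the same length, and since row `i` grows in the next step it must grow
      -- too. Its factor is 1 + 1/(-1), because shifted parts of equal neighbouring rows differ by
      -- one.
      up-blocked : ∀ j → i ≡ suc j → grows M (suc u) i ≡ true → entry M (suc u) i ≡ entry M (suc u) j → upFactor M u i j ≡ 0ℚ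
      up-blocked j refl d e = cong₂ (λ g p → 1ℚ + δ g * inv p) gj pj
        where
        above : suc (entry M (suc u) j) ≤ entry M (suc (suc u)) j
        above = subst (_≤ entry M (suc (suc u)) j) (trans (grows⇒≡ M (suc u) i d) (cong suc e)) (dom V (suc (suc u)) j)
        gj : grows M (suc u) j ≡ true
        gj with step V (s≤s u<n) j
        ... | inj₁ eq = contradiction (sym eq) (ℕP.<⇒≢ above)
        ... | inj₂ eq = ≡⇒grows M (suc u) j eq
        pj : part M (suc u) (suc j) - part M (suc u) j ≡ - 1ℚ
        pj = trans (cong (λ z → ι z - ι (suc j) - part M (suc u) j) e) (lem (ι (entry M (suc u) j)) (ι j))
          where
          lem : ∀ a j → (a - (1ℚ + j)) - (a - j) ≡ - 1ℚ
          lem = solve-∀ ringℚ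

      -- The mirror image of `up-blocked`: the row below, of equal length, also grew in this step,
      -- and its factor is 1 - 1/1.
      down-blocked : grows M u i ≡ true → entry M (suc u) (suc i) ≡ entry M (suc u) i → downFactor M u i (suc i) ≡ 0ℚ
      down-blocked c e = cong₂ (λ g p → 1ℚ - δ g * inv p) gj pj
        where
        below : entry M u (suc i) < entry M (suc u) (suc i)
        below = subst (entry M u (suc i) <_) (sym (trans e (grows⇒≡ M u i c))) (s≤s (dom V u i))
        gj : grows M u (suc i) ≡ true
        gj with step V (ℕP.m<n⇒m<1+n u<n) (suc i)
        ... | inj₁ eq = contradiction (sym eq) (ℕP.<⇒≢ below)
        ... | inj₂ eq = ≡⇒grows M u (suc i) eq
        pj : part M (suc u) i - part M (suc u) (suc i) ≡ 1ℚ
        pj = trans (cong (λ z → part M (suc u) i - (ι z - ι (suc i))) e) (lem (ι (entry M (suc u) i)) (ι i))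
          where
          lem : ∀ a j → (a - j) - (a - (1ℚ + j)) ≡ 1ℚ
          lem = solve-∀ ringℚ

      raise-good : up M u i ≡ 0ℚ ⊎ Good (raise M u i)
      raise-good = go (grows M u i) (grows M (suc u) i) refl refl
        where
        off : upFlag M u i ≡ false → up M u i ≡ 0ℚ
        off e = trans (cong (λ b → δ b * ∏ ℓ (upFactor M u i)) e) (ℚP.*-zeroˡ (∏ ℓ (upFactor M u i)))
        room : ∀ i′ → i ≡ i′ → up M u i ≡ 0ℚ ⊎ (∀ j → i ≡ suc j → entry M (suc u) i < entry M (suc u) j)
        room zero    refl = inj₂ λ j ()
        room (suc j) refl with grows M (suc u) i in d | entry M (suc u) i ℕP.≟ entry M (suc u) j
        ... | true  | yes e = inj₁ (trans (cong (δ (not (grows M u i) ∧ true) *_) (∏-zero ℓ {upFactor M u i} (ℕP.<-trans (ℕP.n<1+n j) i<ℓ) (up-blocked j refl d e)))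
                                          (ℚP.*-zeroʳ (δ (not (grows M u i) ∧ true))))
        ... | false | yes e = inj₁ (trans (cong (λ b → δ b * ∏ ℓ (upFactor M u i)) (∧-falseʳ (not (grows M u i)) refl)) (ℚP.*-zeroˡ (∏ ℓ (upFactor M u i))))
        ... | _     | no ne = inj₂ λ { .j refl → ℕP.≤∧≢⇒< (dom V (suc u) j) ne }
        go : ∀ c d → grows M u i ≡ c → grows M (suc u) i ≡ d → up M u i ≡ 0ℚ ⊎ Good (raise M u i)
        go true  d     ec ed = inj₁ (off (∧-falseˡ (grows M (suc u) i) (cong not ec)))
        go false false ec ed = inj₁ (off (∧-falseʳ (not (grows M u i)) ed))
        go false true  ec ed with room i refl
        ... | inj₁ z = inj₁ z
        ... | inj₂ r = inj₂ (raise-valid ec ed r)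

      lower-good : down M u i ≡ 0ℚ ⊎ Good (lower M u i)
      lower-good = go (grows M u i) (grows M (suc u) i) refl refl
        where
        off : downFlag M u i ≡ false → down M u i ≡ 0ℚ
        off e = trans (cong (λ b → δ b * ∏ ℓ (downFactor M u i)) e) (ℚP.*-zeroˡ (∏ ℓ (downFactor M u i)))
        go : ∀ c d → grows M u i ≡ c → grows M (suc u) i ≡ d → down M u i ≡ 0ℚ ⊎ Good (lower M u i)
        go false d     ec ed = inj₁ (off (∧-falseˡ (not (grows M (suc u) i)) ec))
        go true  true  ec ed = inj₁ (off (∧-falseʳ (grows M u i) (cong not ed)))
        go true  false ec ed with entry M (suc u) (suc i) ℕP.≟ entry M (suc u) i | suc i ℕP.<? ℓ
        ... | no ne | _ = inj₂ (lower-valid ec ed (ℕP.≤∧≢⇒< (dom V (suc u) i) ne))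
        ... | yes e | yes 1+i<ℓ = inj₁ (trans (cong (δ (downFlag M u i) *_) (∏-zero ℓ {downFactor M u i} 1+i<ℓ (down-blocked ec e))) (ℚP.*-zeroʳ (δ (downFlag M u i))))
        -- Below the last row all entries read as 0, so a positive last row can always be shortened.
        ... | yes e | no ¬1+i<ℓ = inj₂ (lower-valid ec ed (subst₂ _<_ (sym (entry-beyond M (suc u) (ℕP.≮⇒≥ ¬1+i<ℓ))) (sym (grows⇒≡ M u i ec)) (s≤s z≤n)))
          where
          open Data.Vec using ([]; _∷_)
          at-beyond : ∀ {k} (v : Vec ℕ k) {j} → k ≤ j → at v j ≡ 0
          at-beyond []      k≤j       = refl
          at-beyond (x ∷ v) (s≤s k≤j) = at-beyond v k≤j
          entry-beyond : ∀ {m k} (N : Vec (Vec ℕ k) m) t {j} → k ≤ j → entry N t j ≡ 0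
          entry-beyond []      t       k≤j = refl
          entry-beyond (r ∷ N) zero    k≤j = at-beyond r k≤j
          entry-beyond (r ∷ N) (suc t) k≤j = entry-beyond N t k≤j

      grade-raise : grade (raise M u i) ≡ suc (grade M)
      grade-raise = ∑ₙ-suc n u u<n
        (∑ₙ-suc ℓ i i<ℓ (raise-same M u<n i<ℓ) λ {j} j≢i → raise-other M u i (suc u) j (inj₂ λ e → j≢i (sym e)))
        λ {u′} u′≢u → ∑ₙ-cong ℓ λ {j} _ → raise-other M u i (suc u′) j (inj₁ λ e → u′≢u (sym (ℕP.suc-injective e)))

      grade-lower : 0 < entry M (suc u) i → grade M ≡ suc (grade (lower M u i))
      grade-lower p = ∑ₙ-suc n u u<n
        (∑ₙ-suc ℓ i i<ℓ (sym (trans (cong suc (lower-same M u<n i<ℓ)) (ℕP.suc-pred (entry M (suc u) i) {{ℕ.>-nonZero p}})))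
          λ {j} j≢i → sym (lower-other M u i (suc u) j (inj₂ λ e → j≢i (sym e))))
        λ {u′} u′≢u → ∑ₙ-cong ℓ λ {j} _ → sym (lower-other M u i (suc u′) j (inj₁ λ e → u′≢u (sym (ℕP.suc-injective e))))

    Supported : (State → ℚ) → (ℕ → Set) → Set
    Supported f P = ∀ {M} → Good M → ¬ P (grade M) → f M ≡ 0ℚ

    infix 4 _≈₀_
    _≈₀_ : (State → ℚ) → (State → ℚ) → Set
    _≈₀_ = _≃_ Good

    ∑∑-zero : ∀ {g} → (∀ {u i} → u < n → i < ℓ → g u i ≡ 0ℚ) → ∑∑ g ≡ 0ℚ
    ∑∑-zero z = ∑-zero n λ u<n → ∑-zero ℓ λ i<ℓ → z u<n i<ℓ

    scale-cong : ∀ c x y → c ≡ 0ℚ ⊎ x ≡ y → c * x ≡ c * y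
    scale-cong c x y (inj₁ refl) = trans (ℚP.*-zeroˡ x) (sym (ℚP.*-zeroˡ y))
    scale-cong c x y (inj₂ x≡y)  = cong (c *_) x≡y

    E-term : ∀ {f g : State → ℚ} {M} → Good M → ∀ {u i} → u < n → i < ℓ → (Good (raise M u i) → f (raise M u i) ≡ g (raise M u i)) →
             up M u i * f (raise M u i) ≡ up M u i * g (raise M u i)
    E-term {f} {g} {M} G {u} {i} u<n i<ℓ eq = scale-cong (up M u i) (f (raise M u i)) (g (raise M u i)) (map₂ eq (raise-good G u<n i<ℓ))

    F-term : ∀ {f g : State → ℚ} {M} → Good M → ∀ {u i} → u < n → i < ℓ →
             (0 < entry M (suc u) i → Good (lower M u i) → f (lower M u i) ≡ g (lower M u i)) →
             W u * down M u i * f (lower M u i) ≡ W u * down M u i * g (lower M u i)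
    F-term {f} {g} {M} G {u} {i} u<n i<ℓ eq = scale-cong (W u * down M u i) (f (lower M u i)) (g (lower M u i))
      (go (lower-good G u<n i<ℓ) (down-positive M {u} {i}))
      where
      off : down M u i ≡ 0ℚ → W u * down M u i ≡ 0ℚ
      off z = trans (cong (W u *_) z) (ℚP.*-zeroʳ (W u))
      go : down M u i ≡ 0ℚ ⊎ Good (lower M u i) → down M u i ≡ 0ℚ ⊎ 0 < entry M (suc u) i →
           W u * down M u i ≡ 0ℚ ⊎ f (lower M u i) ≡ g (lower M u i)
      go (inj₁ z)  _        = inj₁ (off z)
      go (inj₂ _)  (inj₁ z) = inj₁ (off z)
      go (inj₂ G′) (inj₂ p) = inj₂ (eq p G′)

    E-cong : ∀ {f g : State → ℚ} → f ≈₀ g → E f ≈₀ E g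
    E-cong {f} {g} eq G = ∑∑-cong λ u<n i<ℓ → E-term {f} {g} G u<n i<ℓ λ G′ → eq G′

    F-cong : ∀ {f g : State → ℚ} → f ≈₀ g → F f ≈₀ F g
    F-cong {f} {g} eq G = ∑∑-cong λ u<n i<ℓ → F-term {f} {g} G u<n i<ℓ λ _ G′ → eq G′

    E-zero : E (λ _ → 0ℚ) ≈₀ λ _ → 0ℚ
    E-zero {M} G = ∑∑-zero λ {u} {i} _ _ → ℚP.*-zeroʳ (up M u i)

    F-zero : F (λ _ → 0ℚ) ≈₀ λ _ → 0ℚ
    F-zero {M} G = ∑∑-zero λ {u} {i} _ _ → ℚP.*-zeroʳ (W u * down M u i)

    E-linear : ∀ M → Linear (λ f → E f M)
    E-linear M .Linear.linear c f g = trans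
      (∑∑-cong λ {u} {i} _ _ → lem (up M u i) (f (raise M u i)) c (g (raise M u i)))
      (trans (∑∑-+ (λ u i → up M u i * f (raise M u i)) (λ u i → c * (up M u i * g (raise M u i))))
             (cong (E f M +_) (∑∑-* c (λ u i → up M u i * g (raise M u i)))))
      where
      lem : ∀ a x c y → a * (x + c * y) ≡ a * x + c * (a * y)
      lem = solve-∀ ringℚ

    F-linear : ∀ M → Linear (λ f → F f M)
    F-linear M .Linear.linear c f g = trans
      (∑∑-cong λ {u} {i} _ _ → lem (W u * down M u i) (f (lower M u i)) c (g (lower M u i)))
      (trans (∑∑-+ (λ u i → W u * down M u i * f (lower M u i)) (λ u i → c * (W u * down M u i * g (lower M u i))))
             (cong (F f M +_) (∑∑-* c (λ u i → W u * down M u i * g (lower M u i)))))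
      where
      lem : ∀ a x c y → a * (x + c * y) ≡ a * x + c * (a * y)
      lem = solve-∀ ringℚ

    E-scale : ∀ c f → E (λ M → c * f M) ≈₀ λ M → c * E f M
    E-scale c f {M} G = trans (∑∑-cong λ {u} {i} _ _ → lem (up M u i) c (f (raise M u i))) (∑∑-* c (λ u i → up M u i * f (raise M u i)))
      where
      lem : ∀ a c y → a * (c * y) ≡ c * (a * y)
      lem = solve-∀ ringℚ

    F-scale : ∀ c f → F (λ M → c * f M) ≈₀ λ M → c * F f M
    F-scale c f {M} G = trans (∑∑-cong λ {u} {i} _ _ → lem (W u * down M u i) c (f (lower M u i))) (∑∑-* c (λ u i → W u * down M u i * f (lower M u i)))
      where
      lem : ∀ a c y → a * (c * y) ≡ c * (a * y)
      lem = solve-∀ ringℚ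

    -- The value of `E f` at a state reads `f` at states of grade one larger. So `E`, though built
    -- from `raise`, lowers the grade in which a function is supported, and `F` raises it.
    E-supported : ∀ {f : State → ℚ} {P Q : ℕ → Set} → (∀ {j} → P (suc j) → Q j) → Supported f P → Supported (E f) Q
    E-supported {f} {P} PQ supp {M} G ¬Q = trans
      (∑∑-cong λ {u} {i} u<n i<ℓ → E-term {f} {λ _ → 0ℚ} G u<n i<ℓ λ G′ → supp G′ λ p → ¬Q (PQ (subst P (grade-raise G u<n i<ℓ) p)))
      (E-zero G)

    F-supported : ∀ {f : State → ℚ} {P Q : ℕ → Set} → (∀ {j} → P j → Q (suc j)) → Supported f P → Supported (F f) Q
    F-supported {f} {P} {Q} PQ supp {M} G ¬Q = trans
      (∑∑-cong λ {u} {i} u<n i<ℓ → F-term {f} {λ _ → 0ℚ} G u<n i<ℓ λ pos G′ → supp G′ λ p → ¬Q (subst Q (sym (grade-lower G u<n i<ℓ pos)) (PQ p)))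
      (F-zero G)

    total : ℕ
    total = n ℕ.* size

    grade-bounded : ∀ {M} → Good M → grade M ≤ total
    grade-bounded {M} G = subst (grade M ≤_) (constant n size) (∑ₙ-mono n λ u<n → ∑ₙ-mono ℓ λ {i} _ → below (ℕP.<⇒≤ (s≤s u<n)))
      where
      constant : ∀ n c → ∑ₙ n (λ _ → c) ≡ n ℕ.* c
      constant zero    c = refl
      constant (suc n) c = trans (cong (ℕ._+ c) (constant n c)) (ℕP.+-comm (n ℕ.* c) c)
      grow : ∀ i {t} k → t ℕ.+ k ≡ suc n → entry M t i ≤ entry M (suc n) i
      grow i {t} zero    e = ℕP.≤-reflexive (cong (λ s → entry M s i) (trans (sym (ℕP.+-identityʳ t)) e))
      grow i {t} (suc k) e = ℕP.≤-trans (one-step (step (valid G) t<s i)) (grow i {suc t} k (trans (sym (ℕP.+-suc t k)) e))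
        where
        t<s : t < suc n
        t<s = subst (t <_) e (ℕP.m<m+n t (s≤s z≤n))
        one-step : ∀ {a b} → a ≡ b ⊎ a ≡ suc b → b ≤ a
        one-step (inj₁ refl) = ℕP.≤-refl
        one-step (inj₂ refl) = ℕP.n≤1+n _
      below : ∀ {t i} → t ≤ suc n → entry M t i ≤ at top i
      below {t} {i} t≤s = subst (entry M t i ≤_) (end G i) (grow i (suc n ∸ t) (ℕP.m+[n∸m]≡n t≤s))

    -- All terms are multiples of `c` by natural numbers and the first is nonzero, so nothing can
    -- cancel.
    partial-sums : ∀ (c : ℚ) (d : ℕ → ℕ) {h} → c ≢ 0ℚ → 0 < d 0 → (∀ m → h m ≡ c * ι (d m)) → ∀ i → ∑ (suc i) h ≢ 0ℚ
    partial-sums c d {h} c≢0 0<d eq i z = nonzero (*-nonzero c≢0 (begin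
      c * ι (∑ₙ (suc i) d)           ≡⟨ cong (c *_) (ι-∑ (suc i) d) ⟩
      c * ∑ (suc i) (λ m → ι (d m))  ≡⟨ ∑-*ˡ (suc i) c (λ m → ι (d m)) ⟨
      ∑ (suc i) (λ m → c * ι (d m))  ≡⟨ ∑-cong (suc i) (λ {m} _ → eq m) ⟨
      ∑ (suc i) h                    ≡⟨ z ⟩
      0ℚ                             ∎))
      where
      positive : ∀ i → 0 < ∑ₙ (suc i) d
      positive zero    = 0<d
      positive (suc i) = ℕP.≤-trans (positive i) (ℕP.m≤m+n (∑ₙ (suc i) d) (d (suc i)))
      nonzero : ι (∑ₙ (suc i) d) ≢ 0ℚ
      nonzero e = ℕP.<⇒≢ (positive i) (sym (ι-injective e))

    ι-∸ : ∀ {a b} → b ≤ a → ι a - ι b ≡ ι (a ∸ b)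
    ι-∸ {a} {b} b≤a = trans (cong (λ z → ι z - ι b) (sym (ℕP.m+[n∸m]≡n b≤a)))
                            (trans (cong (_- ι b) (ι-+ b (a ∸ b))) (lem (ι b) (ι (a ∸ b))))
      where
      lem : ∀ x y → (x + y) - x ≡ y
      lem = solve-∀ ringℚ

    -- The powers of `F` move `f` to grades `j + i` above the middle, where all commutator
    -- eigenvalues are negative. After `suc total` powers the grade exceeds its bound, so the power
    -- vanishes and the ladder descends to `f`.
    E-injective : ∀ {f : State → ℚ} j → total < 2 ℕ.* j → Supported f (_≡ j) → E f ≈₀ (λ _ → 0ℚ) → f ≈₀ λ _ → 0ℚ
    E-injective {f} j D<2j supp Ef≃0 = injective Good E F E-cong F-cong E-zero F-scale f h comm Ef≃0
      (partial-sums (- 1ℚ) (λ i → 2 ℕ.* (j ℕ.+ i) ∸ total) (λ ()) (ℕP.m<n⇒0<n∸m (subst (λ z → total < 2 ℕ.* z) (sym (ℕP.+-identityʳ j)) D<2j)) h≡)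
      (suc total) (λ G → supported (suc total) G λ e → ℕP.<⇒≱ (ℕP.<-≤-trans (ℕP.n<1+n total) (ℕP.m≤n+m (suc total) j)) (subst (_≤ total) e (grade-bounded G)))
      where
      h : ℕ → ℚ
      h i = ι total - ι (2 ℕ.* (j ℕ.+ i))
      h≡ : ∀ i → h i ≡ (- 1ℚ) * ι (2 ℕ.* (j ℕ.+ i) ∸ total)
      h≡ i = trans (lem (ι total) (ι (2 ℕ.* (j ℕ.+ i)))) (cong ((- 1ℚ) *_) (ι-∸ (ℕP.≤-trans (ℕP.<⇒≤ D<2j) (ℕP.*-monoʳ-≤ 2 (ℕP.m≤m+n j i)))))
        where
        lem : ∀ a b → a - b ≡ (- 1ℚ) * (b - a)
        lem = solve-∀ ringℚ
      supported : ∀ i → Supported (iterate Good F f i) (_≡ j ℕ.+ i)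
      supported zero G ne = supp G λ e → ne (trans e (sym (ℕP.+-identityʳ j)))
      supported (suc i) = F-supported {iterate Good F f i} {_≡ j ℕ.+ i} {_≡ j ℕ.+ suc i} (λ e → trans (cong suc e) (sym (ℕP.+-suc j i))) (supported i)
      comm : ∀ i → E (F (iterate Good F f i)) ≈₀ λ M → F (E (iterate Good F f i)) M + h i * iterate Good F f i M
      comm i {M} G = trans (commutator (iterate Good F f i) G) (cong (F (E (iterate Good F f i)) M +_) eigen)
        where
        eigen : H M * iterate Good F f i M ≡ h i * iterate Good F f i M
        eigen with grade M ℕP.≟ j ℕ.+ i
        ... | yes e = cong (_* iterate Good F f i M) (trans (H-grade G) (cong (λ g → ι total - ι (2 ℕ.* g)) e))
        ... | no ne = trans (cong (H M *_) (supported i G ne)) (trans (lem (H M) (h i)) (cong (h i *_) (sym (supported i G ne))))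
          where
          lem : ∀ a b → a * 0ℚ ≡ b * 0ℚ
          lem = solve-∀ ringℚ

    -- The same argument with the operators exchanged: `E` moves `f` down from a grade below the
    -- middle, and no grade is left after `suc j` powers. Reversing the commutator makes the
    -- eigenvalues negative here as well.
    F-injective : ∀ {f : State → ℚ} j → 2 ℕ.* j < total → Supported f (_≡ j) → F f ≈₀ (λ _ → 0ℚ) → f ≈₀ λ _ → 0ℚ
    F-injective {f} j 2j<D supp Ff≃0 = injective Good F E F-cong E-cong F-zero E-scale f h comm Ff≃0
      (partial-sums (- 1ℚ) (λ i → total ∸ 2 ℕ.* (j ∸ i)) (λ ()) (ℕP.m<n⇒0<n∸m 2j<D) h≡)
      (suc j) (λ {M} G → supported (suc j) G λ e → ℕP.<⇒≢ (ℕP.<-≤-trans (ℕP.n<1+n j) (ℕP.m≤n+m (suc j) (grade M))) (sym e))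
      where
      h : ℕ → ℚ
      -- The iterate lives in grade `j ∸ i`. For `i > j` no grade satisfies `g + i ≡ j`, the iterate
      -- is zero, and the truncated value still has the right sign.
      h i = - (ι total - ι (2 ℕ.* (j ∸ i)))
      h≡ : ∀ i → h i ≡ (- 1ℚ) * ι (total ∸ 2 ℕ.* (j ∸ i))
      h≡ i = trans (cong -_ (ι-∸ (ℕP.≤-trans (ℕP.*-monoʳ-≤ 2 (ℕP.m∸n≤m j i)) (ℕP.<⇒≤ 2j<D)))) (lem (ι (total ∸ 2 ℕ.* (j ∸ i))))
        where
        lem : ∀ a → - a ≡ (- 1ℚ) * a
        lem = solve-∀ ringℚ
      supported : ∀ i → Supported (iterate Good E f i) (λ g → g ℕ.+ i ≡ j)
      supported zero {M} G ne = supp G λ e → ne (trans (ℕP.+-identityʳ (grade M)) e)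
      supported (suc i) = E-supported {iterate Good E f i} {λ g → g ℕ.+ i ≡ j} {λ g → g ℕ.+ suc i ≡ j} (λ {g} e → trans (ℕP.+-suc g i) e) (supported i)
      comm : ∀ i → F (E (iterate Good E f i)) ≈₀ λ M → E (F (iterate Good E f i)) M + h i * iterate Good E f i M
      comm i {M} G = begin
        F (E g) M                                     ≡⟨ lem (F (E g) M) (H M * g M) ⟩
        (F (E g) M + H M * g M) - H M * g M           ≡⟨ cong (_- H M * g M) (commutator g G) ⟨
        E (F g) M - H M * g M                         ≡⟨ cong (λ z → E (F g) M - z) eigen ⟩
        E (F g) M - (ι total - ι (2 ℕ.* (j ∸ i))) * g M ≡⟨ lem′ (E (F g) M) (ι total - ι (2 ℕ.* (j ∸ i))) (g M) ⟩
        E (F g) M + h i * g M                         ∎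
        where
        g = iterate Good E f i
        lem : ∀ a b → a ≡ (a + b) - b
        lem = solve-∀ ringℚ
        lem′ : ∀ a b c → a - b * c ≡ a + (- b) * c
        lem′ = solve-∀ ringℚ
        eigen : H M * g M ≡ (ι total - ι (2 ℕ.* (j ∸ i))) * g M
        eigen with grade M ℕ.+ i ℕP.≟ j
        ... | yes e = cong (_* g M) (trans (H-grade G) (cong (λ k → ι total - ι (2 ℕ.* k))
                        (trans (sym (ℕP.m+n∸n≡m (grade M) i)) (cong (_∸ i) e))))
        ... | no ne = trans (cong (H M *_) (supported i G ne)) (trans (lem″ (H M) (ι total - ι (2 ℕ.* (j ∸ i))))
                        (cong ((ι total - ι (2 ℕ.* (j ∸ i))) *_) (sym (supported i G ne))))
          where
          lem″ : ∀ a b → a * 0ℚ ≡ b * 0ℚ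
          lem″ = solve-∀ ringℚ

    open Kernel _≟S_

    module Counting (all : List State) (unique : Unique all) (sound : ∀ {M} → M ∈ all → Good M) (complete : ∀ {M} → Good M → M ∈ all) where

      level : ℕ → List State
      level j = filter (λ M → grade M ℕP.≟ j) all

      count : ℕ → ℕ
      count j = length (level j)

      -- If level `j` had fewer states than level `i`, evaluating `A f` at the states of level `j`
      -- would give too few functionals, and some nonzero `f` on level `i` would be killed by all of
      -- them. As `A f` is supported on level `j`, it would vanish everywhere, against injectivity.
      injection : ∀ (A : (State → ℚ) → State → ℚ) → (∀ M → Linear (λ f → A f M)) → ∀ i j →
                  (∀ {f} → Supported f (_≡ i) → Supported (A f) (_≡ j)) →
                  (∀ {f} → Supported f (_≡ i) → A f ≈₀ (λ _ → 0ℚ) → f ≈₀ λ _ → 0ℚ) → count i ≤ count j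
      injection A lin i j shift inj = ℕP.≮⇒≥ λ lt → absurd (common-kernel (λ k f → A f (lookup (level j) k)) (λ k → lin (lookup (level j) k))
                                                (filter⁺ (λ M → grade M ℕP.≟ i) unique) lt)
        where
        absurd : ∃[ f ] (∃[ x ] x ∈ level i × f x ≢ 0ℚ) × (∀ {y} → y ∉ level i → f y ≡ 0ℚ) × (∀ k → A f (lookup (level j) k) ≡ 0ℚ) → ⊥
        absurd (f , (x , x∈ , fx≢0) , supp , ker) = fx≢0 (inj supported Af≃0 (sound (proj₁ (∈-filter⁻ (λ M → grade M ℕP.≟ i) x∈))))
          where
          supported : Supported f (_≡ i)
          supported G ne = supp λ M∈ → ne (proj₂ (∈-filter⁻ (λ M → grade M ℕP.≟ i) {xs = all} M∈))
          Af≃0 : A f ≈₀ λ _ → 0ℚ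
          Af≃0 {M} G with grade M ℕP.≟ j
          ... | no ne = shift supported G ne
          ... | yes e = trans (cong (A f) (lookup-index M∈)) (ker (Any.index M∈))
            where
            M∈ : M ∈ level j
            M∈ = ∈-filter⁺ (λ M → grade M ℕP.≟ j) (complete G) e

      count-rises : ∀ j → 2 ℕ.* j < total → count j ≤ count (suc j)
      count-rises j 2j<D = injection F F-linear j (suc j)
        (λ {f} → F-supported {f} {_≡ j} {_≡ suc j} (cong suc)) (λ {f} → F-injective {f} j 2j<D)

      count-falls : ∀ j → total < 2 ℕ.* suc j → count (suc j) ≤ count j
      count-falls j D<2j = injection E E-linear (suc j) j
        (λ {f} → E-supported {f} {_≡ suc j} {_≡ j} ℕP.suc-injective) (λ {f} → E-injective {f} (suc j) D<2j)

-- Vertical strips as 0-1 vectors.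

module VerticalStrips where

  open BenderKnuth
  open ListSums
  open import Data.Bool using (Bool; true; _∧_; T)
  open import Data.Nat using (ℕ; zero; suc; _+_; _≤_; _≤ᵇ_)
  import Data.Nat.Properties as ℕP
  open import Data.Nat.Tactic.RingSolver using (solve-∀)
  open import Data.Vec using (Vec; []; _∷_; zipWith)
  open import Data.List using (List; []; _∷_; _++_; map)
  open import Relation.Binary.PropositionalEquality
  open ≡-Reasoning

  open Nat using (guard)

  vsum : ∀ {ℓ} → Vec ℕ ℓ → ℕ
  vsum []      = 0
  vsum (a ∷ v) = a + vsum v

  infixl 6 _⊞_
  _⊞_ : ∀ {ℓ} → Vec ℕ ℓ → Vec ℕ ℓ → Vec ℕ ℓ
  _⊞_ = zipWith _+_

  vsum-⊞ : ∀ {ℓ} (u v : Vec ℕ ℓ) → vsum (u ⊞ v) ≡ vsum u + vsum v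
  vsum-⊞ []      []      = refl
  vsum-⊞ (a ∷ u) (b ∷ v) = trans (cong (a + b +_) (vsum-⊞ u v)) (lem a b (vsum u) (vsum v))
    where
    lem : ∀ a b c d → a + b + (c + d) ≡ a + c + (b + d)
    lem = solve-∀

  bits : ∀ ℓ → List (Vec ℕ ℓ)
  bits zero    = [] ∷ []
  bits (suc ℓ) = map (0 ∷_) (bits ℓ) ++ map (1 ∷_) (bits ℓ)

  dominated : ∀ {ℓ} → ℕ → Vec ℕ ℓ → Bool
  dominated p []      = true
  dominated p (a ∷ v) = (a ≤ᵇ p) ∧ dominated a v

  dominant : ∀ {ℓ} → Vec ℕ ℓ → Bool
  dominant []      = true
  dominant (a ∷ v) = dominated a v

  dominated⇒Dominant : ∀ {ℓ p} (v : Vec ℕ ℓ) → dominated p v ≡ true → Dominant p v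
  dominated⇒Dominant []      e = []
  dominated⇒Dominant {p = p} (a ∷ v) e with a ≤ᵇ p in le
  ... | true = ℕP.≤ᵇ⇒≤ a p (subst T (sym le) _) ∷ dominated⇒Dominant v e

  dominated-weaken : ∀ {ℓ p q} (v : Vec ℕ ℓ) → p ≤ q → Dominant p v → dominated q v ≡ true
  dominated-weaken []      p≤q []        = refl
  dominated-weaken (a ∷ v) p≤q (a≤p ∷ d) = cong₂ _∧_ (≤ᵇ-true (ℕP.≤-trans a≤p p≤q)) (dominated-weaken v ℕP.≤-refl d)

  Σ-bits : ∀ {ℓ} g → Nat.Σ (bits (suc ℓ)) g ≡ Nat.Σ (bits ℓ) (λ C → g (0 ∷ C)) + Nat.Σ (bits ℓ) (λ C → g (1 ∷ C))
  Σ-bits {ℓ} g = trans (Nat.Σ-++ (map (0 ∷_) (bits ℓ)) _) (cong₂ _+_ (Nat.Σ-map (0 ∷_) (bits ℓ)) (Nat.Σ-map (1 ∷_) (bits ℓ)))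

  pairSum : ∀ {ℓ} → ℕ → ℕ → Vec ℕ ℓ → (ℕ → ℕ → Vec ℕ ℓ → ℕ) → ℕ
  pairSum {ℓ} P Q κ Φ = Nat.Σ (bits ℓ) λ C → guard (dominated P (κ ⊞ C))
    (Nat.Σ (bits ℓ) λ D → guard (dominated Q (κ ⊞ C ⊞ D)) (Φ (vsum C) (vsum D) (κ ⊞ C ⊞ D)))

  -- Exchanges the order of choices: two whole strips, one after the other, become both strips row
  -- by row, the form in which the symmetry is proved.
  pairSum-twoStrips : ∀ {ℓ} P Q (κ : Vec ℕ ℓ) Φ → pairSum P Q κ Φ ≡ twoStrips P Q κ Φ
  pairSum-twoStrips P Q []      Φ = trans (ℕP.+-identityʳ _) (ℕP.+-identityʳ _)
  pairSum-twoStrips {suc ℓ} P Q (a ∷ κ) Φ = begin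
    pairSum P Q (a ∷ κ) Φ
      ≡⟨ Σ-bits (λ C → guard (dominated P ((a ∷ κ) ⊞ C)) (Nat.Σ (bits (suc ℓ)) λ D → guard (dominated Q ((a ∷ κ) ⊞ C ⊞ D)) (Φ (vsum C) (vsum D) ((a ∷ κ) ⊞ C ⊞ D)))) ⟩
    half 0 + half 1
      ≡⟨ cong₂ _+_ (half-split 0) (half-split 1) ⟩
    (quarter 0 0 + quarter 0 1) + (quarter 1 0 + quarter 1 1)
      ≡⟨ cong₂ _+_ (cong₂ _+_ (place (ℕP.+-identityʳ a) (trans (ℕP.+-identityʳ (a + 0)) (ℕP.+-identityʳ a)))
                              (place (ℕP.+-identityʳ a) (trans (ℕP.+-comm (a + 0) 1) (cong suc (ℕP.+-identityʳ a)))))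
                   (cong₂ _+_ (place (ℕP.+-comm a 1) (trans (ℕP.+-identityʳ (a + 1)) (ℕP.+-comm a 1)))
                              (place (ℕP.+-comm a 1) (trans (ℕP.+-comm (a + 1) 1) (cong suc (ℕP.+-comm a 1))))) ⟩
    twoStrips P Q (a ∷ κ) Φ ∎
    where
    half : ℕ → ℕ
    half c = Nat.Σ (bits ℓ) λ C → guard ((a + c ≤ᵇ P) ∧ dominated (a + c) (κ ⊞ C))
      (Nat.Σ (bits (suc ℓ)) λ D → guard (dominated Q ((a + c ∷ (κ ⊞ C)) ⊞ D)) (Φ (c + vsum C) (vsum D) ((a + c ∷ (κ ⊞ C)) ⊞ D)))
    quarter : ℕ → ℕ → ℕ
    quarter c d = guard ((a + c ≤ᵇ P) ∧ (a + c + d ≤ᵇ Q))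
      (pairSum (a + c) (a + c + d) κ (λ i j v → Φ (c + i) (d + j) (a + c + d ∷ v)))
    half-split : ∀ c → half c ≡ quarter c 0 + quarter c 1
    half-split c = begin
      half c
        ≡⟨ Nat.Σ-cong (bits ℓ) (λ C → trans (Nat.guard-∧ (a + c ≤ᵇ P) (dominated (a + c) (κ ⊞ C)) _)
             (cong (λ z → guard (a + c ≤ᵇ P) (guard (dominated (a + c) (κ ⊞ C)) z)) (Σ-bits {ℓ} (inner C)))) ⟩
      Nat.Σ (bits ℓ) (λ C → guard (a + c ≤ᵇ P) (guard (dominated (a + c) (κ ⊞ C)) (Nat.Σ (bits ℓ) (λ D → inner C (0 ∷ D)) + Nat.Σ (bits ℓ) (λ D → inner C (1 ∷ D)))))
        ≡⟨ Nat.Σ-cong (bits ℓ) (λ C → trans (cong (guard (a + c ≤ᵇ P)) (Nat.guard-+ (dominated (a + c) (κ ⊞ C)) _ _)) (Nat.guard-+ (a + c ≤ᵇ P) _ _)) ⟩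
      Nat.Σ (bits ℓ) (λ C → part C 0 + part C 1)
        ≡⟨ Nat.Σ-+ (bits ℓ) (λ C → part C 0) (λ C → part C 1) ⟩
      Nat.Σ (bits ℓ) (λ C → part C 0) + Nat.Σ (bits ℓ) (λ C → part C 1)
        ≡⟨ cong₂ _+_ (collect 0) (collect 1) ⟩
      quarter c 0 + quarter c 1 ∎
      where
      inner : Vec ℕ ℓ → Vec ℕ (suc ℓ) → ℕ
      inner C D = guard (dominated Q ((a + c ∷ (κ ⊞ C)) ⊞ D)) (Φ (c + vsum C) (vsum D) ((a + c ∷ (κ ⊞ C)) ⊞ D))
      part : Vec ℕ ℓ → ℕ → ℕ
      part C d = guard (a + c ≤ᵇ P) (guard (dominated (a + c) (κ ⊞ C)) (Nat.Σ (bits ℓ) (λ D → inner C (d ∷ D))))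
      collect : ∀ d → Nat.Σ (bits ℓ) (λ C → part C d) ≡ quarter c d
      collect d = trans (Nat.Σ-guard (bits ℓ) (a + c ≤ᵇ P) _) (trans (cong (guard (a + c ≤ᵇ P)) (trans
        (Nat.Σ-cong (bits ℓ) λ C → trans (cong (guard (dominated (a + c) (κ ⊞ C)))
             (trans (Nat.Σ-cong (bits ℓ) λ D → Nat.guard-∧ (a + c + d ≤ᵇ Q) (dominated (a + c + d) (κ ⊞ C ⊞ D)) _)
                    (Nat.Σ-guard (bits ℓ) (a + c + d ≤ᵇ Q) _)))
           (Nat.guard-swap (dominated (a + c) (κ ⊞ C)) (a + c + d ≤ᵇ Q) _))
        (Nat.Σ-guard (bits ℓ) (a + c + d ≤ᵇ Q) _)))
        (sym (Nat.guard-∧ (a + c ≤ᵇ P) (a + c + d ≤ᵇ Q) _)))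
    place : ∀ {c d x y} → a + c ≡ x → a + c + d ≡ y → quarter c d ≡
            guard ((x ≤ᵇ P) ∧ (y ≤ᵇ Q)) (twoStrips x y κ (λ i j v → Φ (c + i) (d + j) (y ∷ v)))
    place {c} {d} refl refl = cong (guard ((a + c ≤ᵇ P) ∧ (a + c + d ≤ᵇ Q))) (pairSum-twoStrips (a + c) (a + c + d) κ _)

-- Chains as walks; rotation of contents and residue classes.

module StripWalks where

  open BenderKnuth
  open ListSums
  open VerticalStrips
  open import Algebra.Bundles using (CommutativeSemiring)
  open import Data.Bool using (Bool; true; false; _∧_; T)
  open import Data.Nat using (ℕ; zero; suc; _+_; _*_; _∸_; _≤_; z≤n; s≤s; _≡ᵇ_; _%_)
  open import Data.Nat.DivMod using ([m+kn]%n≡m%n; %-distribˡ-+)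
  import Data.Nat.Properties as ℕP
  open import Data.Nat.Tactic.RingSolver using (solve-∀)
  open import Data.Vec using (Vec; []; _∷_; _∷ʳ_; replicate)
  open import Data.List using (List; []; _∷_; map; concatMap; filterᵇ)
  open import Data.List.Membership.Propositional using (_∈_)
  open import Data.List.Membership.Propositional.Properties using (∈-++⁻; ∈-map⁻)
  open import Data.Sum using (inj₁; inj₂)
  open import Data.Product using (_,_; _×_; ∃-syntax)
  open import Relation.Nullary using (contradiction)
  open import Level using (0ℓ)
  open import Relation.Binary.PropositionalEquality

  ∈-bits : ∀ {ℓ c} {C : Vec ℕ ℓ} → (c ∷ C) ∈ bits (suc ℓ) → c ≤ 1 × C ∈ bits ℓ
  ∈-bits {ℓ} c∈ with ∈-++⁻ (map (0 ∷_) (bits ℓ)) c∈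
  ... | inj₁ l with ∈-map⁻ (0 ∷_) l
  ...   | _ , C∈ , refl = z≤n , C∈
  ∈-bits {ℓ} c∈ | inj₂ r with ∈-map⁻ (1 ∷_) r
  ...   | _ , C∈ , refl = s≤s z≤n , C∈

  head₀ : ∀ {ℓ} → Vec ℕ ℓ → ℕ
  head₀ []      = 0
  head₀ (a ∷ v) = a

  dominated-dominant : ∀ {ℓ p} (v : Vec ℕ ℓ) → head₀ v ≤ p → dominated p v ≡ dominant v
  dominated-dominant []      le = refl
  dominated-dominant (a ∷ v) le = cong (_∧ dominated a v) (≤ᵇ-true le)

  walks : ∀ {ℓ} m → Vec ℕ ℓ → List (Vec (Vec ℕ ℓ) m)
  walks         zero    μ = [] ∷ []
  walks {ℓ = ℓ} (suc m) μ = concatMap (λ ν → map (ν ∷_) (walks m ν)) (filterᵇ dominant (map (μ ⊞_) (bits ℓ)))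

  content : ∀ {ℓ m} → Vec ℕ ℓ → Vec (Vec ℕ ℓ) m → Vec ℕ m
  content μ []      = []
  content μ (ν ∷ w) = vsum ν ∸ vsum μ ∷ content ν w

  final : ∀ {ℓ m} → Vec ℕ ℓ → Vec (Vec ℕ ℓ) m → Vec ℕ ℓ
  final μ []      = μ
  final μ (ν ∷ w) = final ν w

  module WalkSum (R : CommutativeSemiring 0ℓ 0ℓ) where

    open CommutativeSemiring R using (Carrier; _≈_) renaming (trans to ≈-trans; sym to ≈-sym; refl to ≈-refl; reflexive to ≈-reflexive; +-identityʳ to ⊕-identityʳ)
    open ListSum R

    walkSum : ∀ {ℓ} m → Vec ℕ ℓ → (Vec ℕ m → Vec ℕ ℓ → Carrier) → Carrier
    walkSum         zero    μ Φ = Φ [] μ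
    walkSum {ℓ = ℓ} (suc m) μ Φ = Σ (bits ℓ) λ C → guard (dominant (μ ⊞ C)) (walkSum m (μ ⊞ C) λ α e → Φ (vsum C ∷ α) e)

    -- The pointwise equation may assume that the contents account for the growth from `μ` to the
    -- endpoint, because the effect of a rotation on `stat` is known only through the total content.
    walkSum-cong : ∀ {ℓ} m (μ : Vec ℕ ℓ) {Φ Ψ} → (∀ α e → vsum μ + vsum α ≡ vsum e → Φ α e ≈ Ψ α e) → walkSum m μ Φ ≈ walkSum m μ Ψ
    walkSum-cong         zero    μ eq = eq [] μ (ℕP.+-identityʳ (vsum μ))
    walkSum-cong {ℓ = ℓ} (suc m) μ eq = Σ-cong (bits ℓ) λ C → guard-cong (dominant (μ ⊞ C)) λ _ → walkSum-cong m (μ ⊞ C) λ α e le →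
      eq (vsum C ∷ α) e (trans (sym (ℕP.+-assoc (vsum μ) (vsum C) (vsum α))) (trans (cong (_+ vsum α) (sym (vsum-⊞ μ C))) le))

    Σ-walks : ∀ {ℓ} m (μ : Vec ℕ ℓ) Φ → Σ (walks m μ) (λ w → Φ (content μ w) (final μ w)) ≈ walkSum m μ Φ
    Σ-walks         zero    μ Φ = ⊕-identityʳ _
    Σ-walks {ℓ = ℓ} (suc m) μ Φ = ≈-trans (Σ-concatMap _ (filterᵇ dominant (map (μ ⊞_) (bits ℓ)))) (≈-trans (Σ-filter dominant (map (μ ⊞_) (bits ℓ))) (≈-trans (Σ-map (μ ⊞_) (bits ℓ))
      (Σ-cong (bits ℓ) λ C → guard-cong (dominant (μ ⊞ C)) λ _ → ≈-trans (Σ-map ((μ ⊞ C) ∷_) (walks m (μ ⊞ C)))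
        (≈-trans (Σ-cong (walks m (μ ⊞ C)) λ w → ≈-reflexive (cong (λ x → Φ (x ∷ content (μ ⊞ C) w) (final (μ ⊞ C) w))
                    (trans (cong (_∸ vsum μ) (vsum-⊞ μ C)) (ℕP.m+n∸m≡n (vsum μ) (vsum C)))))
                 (Σ-walks m (μ ⊞ C) λ α e → Φ (vsum C ∷ α) e)))))

  module _ where

    open WalkSum ℕP.+-*-commutativeSemiring public
    open Nat using (guard)
    open ≡-Reasoning

    Φ-swap : ∀ {ℓ m} → (Vec ℕ (suc (suc m)) → Vec ℕ ℓ → ℕ) → Vec ℕ (suc (suc m)) → Vec ℕ ℓ → ℕ
    Φ-swap Φ (x ∷ y ∷ α) e = Φ (y ∷ x ∷ α) e

    -- The Bender–Knuth symmetry of the first two steps.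
    walkSum-swap : ∀ {ℓ} m (μ : Vec ℕ ℓ) Φ → dominant μ ≡ true → walkSum (suc (suc m)) μ Φ ≡ walkSum (suc (suc m)) μ (Φ-swap Φ)
    walkSum-swap {ℓ} m μ Φ dom = begin
      walkSum (suc (suc m)) μ Φ                 ≡⟨ to-pairs μ (λ x y ν → walkSum m ν (λ α → Φ (x ∷ y ∷ α))) ⟩
      pairSum (suc p) (suc (suc p)) μ (λ x y ν → walkSum m ν (λ α → Φ (x ∷ y ∷ α)))
        ≡⟨ pairSum-twoStrips (suc p) (suc (suc p)) μ _ ⟩
      twoStrips (suc p) (suc (suc p)) μ (λ x y ν → walkSum m ν (λ α → Φ (x ∷ y ∷ α)))
        ≡⟨ Symmetry.symmetric₂ (dom′ μ dom) _ ⟩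
      twoStrips (suc p) (suc (suc p)) μ (λ x y ν → walkSum m ν (λ α → Φ (y ∷ x ∷ α)))
        ≡⟨ pairSum-twoStrips (suc p) (suc (suc p)) μ _ ⟨
      pairSum (suc p) (suc (suc p)) μ (λ x y ν → walkSum m ν (λ α → Φ (y ∷ x ∷ α)))
        ≡⟨ to-pairs μ (λ x y ν → walkSum m ν (λ α → Φ (y ∷ x ∷ α))) ⟨
      walkSum (suc (suc m)) μ (Φ-swap Φ) ∎
      where
      p = head₀ μ
      dom′ : ∀ {ℓ} (μ : Vec ℕ ℓ) → dominant μ ≡ true → Dominant (head₀ μ) μ
      dom′ []      d = []
      dom′ (a ∷ μ) d = ℕP.≤-refl ∷ dominated⇒Dominant μ d
      head-bound : ∀ {ℓ} (κ : Vec ℕ ℓ) {C p} → C ∈ bits ℓ → head₀ κ ≤ p → head₀ (κ ⊞ C) ≤ suc p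
      head-bound []      {[]}    C∈ le = z≤n
      head-bound (a ∷ κ) {c ∷ C} {p} C∈ le with ∈-bits C∈
      ... | c≤1 , _ = subst (_≤ suc p) (ℕP.+-comm c a) (ℕP.+-mono-≤ c≤1 le)
      -- One strip lengthens the first row by at most 1 and two strips by at most 2, so these bounds
      -- exclude nothing and dominance is all that is left.
      to-pairs : ∀ {ℓ} (μ : Vec ℕ ℓ) (Φ : ℕ → ℕ → Vec ℕ ℓ → ℕ) →
        Nat.Σ (bits ℓ) (λ C → guard (dominant (μ ⊞ C)) (Nat.Σ (bits ℓ) λ D → guard (dominant (μ ⊞ C ⊞ D)) (Φ (vsum C) (vsum D) (μ ⊞ C ⊞ D))))
        ≡ pairSum (suc (head₀ μ)) (suc (suc (head₀ μ))) μ Φ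
      to-pairs {ℓ} μ Φ = Nat.Σ-cong∈ (bits ℓ) λ {C} C∈ → cong₂ guard (sym (dominated-dominant (μ ⊞ C) (head-bound μ C∈ ℕP.≤-refl)))
        (Nat.Σ-cong∈ (bits ℓ) λ {D} D∈ → cong (λ b → guard b (Φ (vsum C) (vsum D) (μ ⊞ C ⊞ D)))
          (sym (dominated-dominant (μ ⊞ C ⊞ D) (head-bound (μ ⊞ C) D∈ (head-bound μ C∈ ℕP.≤-refl)))))

    rotate : ∀ {m} → Vec ℕ (suc m) → Vec ℕ (suc m)
    rotate (x ∷ α) = α ∷ʳ x

    -- A cyclic shift is a product of adjacent transpositions: exchange the first two contents, take
    -- one step, and rotate the remaining contents.
    walkSum-rotate : ∀ {ℓ} m (μ : Vec ℕ ℓ) Φ → dominant μ ≡ true → walkSum (suc m) μ (λ α → Φ (rotate α)) ≡ walkSum (suc m) μ Φ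
    walkSum-rotate zero    μ Φ dom = walkSum-cong 1 μ {λ α → Φ (rotate α)} {Φ} λ { (x ∷ []) e _ → refl }
    walkSum-rotate {ℓ} (suc m) μ Φ dom = begin
      walkSum (suc (suc m)) μ (λ α → Φ (rotate α))            ≡⟨ walkSum-swap m μ (λ α → Φ (rotate α)) dom ⟩
      walkSum (suc (suc m)) μ (Φ-swap (λ α → Φ (rotate α)))   ≡⟨ walkSum-cong (suc (suc m)) μ {Φ-swap (λ α → Φ (rotate α))} {Φ-tail} (λ { (x ∷ y ∷ α) e _ → refl }) ⟩
      walkSum (suc (suc m)) μ Φ-tail
        ≡⟨ Nat.Σ-cong (bits ℓ) (λ C → Nat.guard-cong (dominant (μ ⊞ C)) λ d → walkSum-rotate m (μ ⊞ C) (λ β → Φ (vsum C ∷ β)) d) ⟩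
      walkSum (suc (suc m)) μ Φ ∎
      where
      Φ-tail : Vec ℕ (suc (suc m)) → Vec ℕ ℓ → ℕ
      Φ-tail (x ∷ β) = Φ (x ∷ rotate β)

    -- A step that is followed by m more steps carries the weight q ^ m.
    stat : ∀ {m} → Vec ℕ m → ℕ
    stat         []      = 0
    stat {suc m} (x ∷ α) = m * x + stat α

    stat-∷ʳ : ∀ {m} (α : Vec ℕ m) x → stat (α ∷ʳ x) ≡ stat α + vsum α
    stat-∷ʳ         []      x = refl
    stat-∷ʳ {suc m} (y ∷ α) x = trans (cong (y + m * y +_) (stat-∷ʳ α x)) (lem y (m * y) (stat α) (vsum α))
      where
      lem : ∀ y z s v → y + z + (s + v) ≡ z + s + (y + v)
      lem = solve-∀

    -- The first content loses its factor `m` and every other content gains 1, so the statistic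
    -- changes by the total content up to a multiple of `suc m`.
    stat-rotate : ∀ {m} (α : Vec ℕ (suc m)) → ∃[ k ] stat α + vsum α ≡ stat (rotate α) + k * suc m
    stat-rotate {m} (x ∷ α) = x , trans (lem m x (stat α) (vsum α)) (cong (_+ x * suc m) (sym (stat-∷ʳ α x)))
      where
      lem : ∀ m x s v → m * x + s + (x + v) ≡ s + v + x * (1 + m)
      lem = solve-∀

    -- Adding `c * n` completes `c` to the multiple `c * suc n` of the modulus, so `c * n` acts as
    -- its additive inverse.
    +-cancel-% : ∀ a b c n → (a + c) % suc n ≡ (b + c) % suc n → a % suc n ≡ b % suc n
    +-cancel-% a b c n e = begin
      a % suc n                          ≡⟨ [m+kn]%n≡m%n a c (suc n) ⟨
      (a + c * suc n) % suc n            ≡⟨ cong (_% suc n) (lem a c n) ⟩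
      ((a + c) + c * n) % suc n          ≡⟨ %-distribˡ-+ (a + c) (c * n) (suc n) ⟩
      ((a + c) % suc n + (c * n) % suc n) % suc n  ≡⟨ cong (λ z → (z + (c * n) % suc n) % suc n) e ⟩
      ((b + c) % suc n + (c * n) % suc n) % suc n  ≡⟨ %-distribˡ-+ (b + c) (c * n) (suc n) ⟨
      ((b + c) + c * n) % suc n          ≡⟨ cong (_% suc n) (lem b c n) ⟨
      (b + c * suc n) % suc n            ≡⟨ [m+kn]%n≡m%n b c (suc n) ⟩
      b % suc n                          ∎
      where
      lem : ∀ a c n → a + c * (1 + n) ≡ (a + c) + c * n
      lem = solve-∀

    ≡ᵇ-cong⇔ : ∀ {a b c d} → (a ≡ b → c ≡ d) → (c ≡ d → a ≡ b) → (a ≡ᵇ b) ≡ (c ≡ᵇ d)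
    ≡ᵇ-cong⇔ {a} {b} {c} {d} f g with a ≡ᵇ b in e₁ | c ≡ᵇ d in e₂
    ... | true  | true  = refl
    ... | false | false = refl
    ... | true  | false = contradiction (ℕP.≡⇒≡ᵇ c d (f (ℕP.≡ᵇ⇒≡ a b (subst T (sym e₁) _)))) (λ t → subst T e₂ t)
    ... | false | true  = contradiction (ℕP.≡⇒≡ᵇ a b (g (ℕP.≡ᵇ⇒≡ c d (subst T (sym e₂) _)))) (λ t → subst T e₁ t)

    residueSum : ∀ {ℓ} n → (Vec ℕ ℓ → Bool) → ℕ → ℕ
    residueSum {ℓ} n is i = walkSum (suc n) (replicate ℓ 0) λ α e → guard (is e) (guard (stat α % suc n ≡ᵇ i % suc n) 1)

    vsum-0 : ∀ ℓ → vsum (replicate ℓ 0) ≡ 0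
    vsum-0 zero    = refl
    vsum-0 (suc ℓ) = vsum-0 ℓ

    dominant-0 : ∀ ℓ → dominant (replicate ℓ 0) ≡ true
    dominant-0 zero    = refl
    dominant-0 (suc ℓ) = go ℓ
      where
      go : ∀ ℓ → dominated 0 (replicate ℓ 0) ≡ true
      go zero    = refl
      go (suc ℓ) = go ℓ

    -- Rotation keeps the endpoint and, by `stat-rotate`, carries weight `i` to weight `i + r`
    -- modulo `suc n`.
    residueSum-shift : ∀ {ℓ} n (is : Vec ℕ ℓ → Bool) r → (∀ e → is e ≡ true → vsum e ≡ r) → ∀ i →
                       residueSum n is i ≡ residueSum n is (i + r)
    residueSum-shift {ℓ} n is r size i = trans
      (walkSum-cong (suc n) (replicate ℓ 0) λ α e total → Nat.guard-cong (is e) λ ise →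
        cong (λ b → guard b 1) (shifted α (trans (cong (_+ vsum α) (sym (vsum-0 ℓ))) (trans total (size e ise)))))
      (walkSum-rotate n (replicate ℓ 0) (λ α e → guard (is e) (guard (stat α % suc n ≡ᵇ (i + r) % suc n) 1)) (dominant-0 ℓ))
      where
      shifted : ∀ α → vsum α ≡ r → (stat α % suc n ≡ᵇ i % suc n) ≡ (stat (rotate α) % suc n ≡ᵇ (i + r) % suc n)
      shifted α refl with stat-rotate α
      ... | k , e = ≡ᵇ-cong⇔
        (λ eq → trans (sym step) (trans (%-distribˡ-+ (stat α) r (suc n))
          (trans (cong (λ z → (z + r % suc n) % suc n) eq) (sym (%-distribˡ-+ i r (suc n))))))
        (λ eq → +-cancel-% (stat α) i r n (trans step eq))
        where
        step : (stat α + r) % suc n ≡ stat (rotate α) % suc n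
        step = trans (cong (_% suc n) e) ([m+kn]%n≡m%n (stat (rotate α)) k (suc n))

-- Dividing unimodal sequences by q-integers.

module Division where

  open BenderKnuth using (module Nat)
  open Nat using (guard)
  open StripWalks using (+-cancel-%)
  open PrincipalTriple using (∑ₙ; ∑ₙ-cong; ∑ₙ-mono)
  open import Data.Bool using (Bool; true; false; T)
  open import Data.Nat using (ℕ; zero; suc; _+_; _*_; _∸_; _≤_; _<_; z≤n; s≤s; _≡ᵇ_; _%_)
  open import Data.Nat.DivMod using (m<n⇒m%n≡m; [m+n]%n≡m%n)
  import Data.Nat.Properties as ℕP
  open import Data.Nat.Tactic.RingSolver using (solve-∀)
  open import Data.Sum using (inj₁; inj₂)
  open import Relation.Nullary using (contradiction)
  open import Relation.Binary.PropositionalEquality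
  open ≡-Reasoning

  delay : (ℕ → ℕ) → ℕ → ℕ
  delay f zero    = 0
  delay f (suc m) = f m

  shift : ℕ → (ℕ → ℕ) → ℕ → ℕ
  shift zero    f = f
  shift (suc k) f = delay (shift k f)

  -- Multiplication by `[k]_q` on coefficient sequences, as `shift k` is multiplication by `q^k`.
  window : ℕ → (ℕ → ℕ) → ℕ → ℕ
  window zero    f m = 0
  window (suc k) f m = window k f m + shift k f m

  delay-cong : ∀ {f g} → (∀ m → f m ≡ g m) → ∀ m → delay f m ≡ delay g m
  delay-cong eq zero    = refl
  delay-cong eq (suc m) = eq m

  shift-cong : ∀ k {f g} → (∀ m → f m ≡ g m) → ∀ m → shift k f m ≡ shift k g m
  shift-cong zero    eq = eq
  shift-cong (suc k) eq = delay-cong (shift-cong k eq)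

  window-cong : ∀ k {f g} → (∀ m → f m ≡ g m) → ∀ m → window k f m ≡ window k g m
  window-cong zero    eq m = refl
  window-cong (suc k) eq m = cong₂ _+_ (window-cong k eq m) (shift-cong k eq m)

  delay-+ : ∀ f g m → delay (λ m → f m + g m) m ≡ delay f m + delay g m
  delay-+ f g zero    = refl
  delay-+ f g (suc m) = refl

  shift-+ : ∀ k f g m → shift k (λ m → f m + g m) m ≡ shift k f m + shift k g m
  shift-+ zero    f g m = refl
  shift-+ (suc k) f g m = trans (delay-cong (shift-+ k f g) m) (delay-+ (shift k f) (shift k g) m)

  window-+ : ∀ k f g m → window k (λ m → f m + g m) m ≡ window k f m + window k g m
  window-+ zero    f g m = refl
  window-+ (suc k) f g m = trans (cong₂ _+_ (window-+ k f g m) (shift-+ k f g m))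
                                 (lem (window k f m) (window k g m) (shift k f m) (shift k g m))
    where
    lem : ∀ a b c d → a + b + (c + d) ≡ a + c + (b + d)
    lem = solve-∀

  shift-shift : ∀ j k f m → shift j (shift k f) m ≡ shift (j + k) f m
  shift-shift zero    k f m = refl
  shift-shift (suc j) k f m = delay-cong (shift-shift j k f) m

  -- This is `[k + j]_q = [j]_q + q^j [k]_q`.
  window-split : ∀ j k f m → window (k + j) f m ≡ window j f m + window k (shift j f) m
  window-split j zero    f m = sym (ℕP.+-identityʳ (window j f m))
  window-split j (suc k) f m = begin
    window (k + j) f m + shift (k + j) f m
      ≡⟨ cong₂ _+_ (window-split j k f m) (sym (shift-shift k j f m)) ⟩
    window j f m + window k (shift j f) m + shift k (shift j f) m
      ≡⟨ ℕP.+-assoc (window j f m) (window k (shift j f) m) (shift k (shift j f) m) ⟩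
    window j f m + (window k (shift j f) m + shift k (shift j f) m) ∎

  shift-here : ∀ k f m → shift k f (k + m) ≡ f m
  shift-here zero    f m = refl
  shift-here (suc k) f m = shift-here k f m

  shift-before : ∀ k f m → m < k → shift k f m ≡ 0
  shift-before (suc k) f zero    _         = refl
  shift-before (suc k) f (suc m) (s≤s m<k) = shift-before k f m m<k

  ∑ₙ-split : ∀ m n f → ∑ₙ (n + m) f ≡ ∑ₙ m f + ∑ₙ n (λ y → f (y + m))
  ∑ₙ-split m zero    f = sym (ℕP.+-identityʳ (∑ₙ m f))
  ∑ₙ-split m (suc n) f = trans (cong (_+ f (n + m)) (∑ₙ-split m n f)) (ℕP.+-assoc (∑ₙ m f) (∑ₙ n (λ y → f (y + m))) (f (n + m)))

  ∑ₙ-zero : ∀ n {f} → (∀ {i} → i < n → f i ≡ 0) → ∑ₙ n f ≡ 0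
  ∑ₙ-zero zero    z = refl
  ∑ₙ-zero (suc n) z = cong₂ _+_ (∑ₙ-zero n λ i<n → z (ℕP.m<n⇒m<1+n i<n)) (z ℕP.≤-refl)

  guard-mono : ∀ b {x y} → (b ≡ true → x ≤ y) → guard b x ≤ guard b y
  guard-mono true  le = le refl
  guard-mono false le = z≤n

  -- With modulus a = suc a′, the sequence q with [d] p = [a] q is
  -- (1 - q^d) p / (1 - q^a): partial sums of p over residue classes, minus their d-shift.
  module Quotient (a′ d : ℕ) (p : ℕ → ℕ) where

    a : ℕ
    a = suc a′

    same : ℕ → ℕ → Bool
    same x i = x % a ≡ᵇ i % a

    same-+ : ∀ x i c → same (x + c) (i + c) ≡ same x i
    same-+ x i c = StripWalks.≡ᵇ-cong⇔ (+-cancel-% x i c a′)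
      λ e → trans (%-distribˡ-+ x c a) (trans (cong (λ z → (z + c % a) % a) e) (sym (%-distribˡ-+ i c a)))
      where
      open import Data.Nat.DivMod using (%-distribˡ-+)

    same-refl : ∀ i → same i i ≡ true
    same-refl i = go (i % a)
      where
      go : ∀ m → (m ≡ᵇ m) ≡ true
      go zero    = refl
      go (suc m) = go m

    A q : ℕ → ℕ
    A j = ∑ₙ (suc j) λ x → guard (same x j) (p x)
    q j = A j ∸ shift d A j

    module Balanced (D : ℕ) (d≤a : d ≤ suc a′)
      (rises : ∀ x → 2 * x < D → p x ≤ p (suc x)) (falls : ∀ x → D < 2 * suc x → p (suc x) ≤ p x)
      (vanish : ∀ x → D < x → p x ≡ 0)
      (balanced : ∀ L → D < L → ∀ i → ∑ₙ L (λ x → guard (same x i) (p x)) ≡ ∑ₙ L (λ x → guard (same x (i + d)) (p x)))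
      where

      rises* : ∀ k x → 2 * (k + x) ≤ D → p x ≤ p (k + x)
      rises* zero    x le = ℕP.≤-refl
      rises* (suc k) x le = ℕP.≤-trans (rises* k x (ℕP.<⇒≤ lt)) (rises (k + x) lt)
        where
        lt : 2 * (k + x) < D
        lt = ℕP.<-≤-trans (ℕP.*-monoʳ-< 2 (ℕP.n<1+n (k + x))) le

      falls* : ∀ k x → D < 2 * suc x → p (k + x) ≤ p x
      falls* zero    x lt = ℕP.≤-refl
      falls* (suc k) x lt = ℕP.≤-trans (falls (k + x) (ℕP.<-≤-trans lt (ℕP.*-monoʳ-≤ 2 (s≤s (ℕP.m≤n+m x k))))) (falls* k x lt)

      -- Each index `x` up to `i` of the class is matched with `x + d`, which does not pass the
      -- middle, so the terms can only increase.
      A-low : ∀ i → 2 * (i + d) ≤ D → A i ≤ A (i + d)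
      A-low i le = ℕP.≤-trans (∑ₙ-mono (suc i) λ {x} x≤i → subst (λ b → guard (same x i) (p x) ≤ guard b (p (x + d))) (sym (same-+ x i d))
          (guard-mono (same x i) λ _ → subst (λ z → p x ≤ p z) (ℕP.+-comm d x)
            (rises* d x (ℕP.≤-trans (ℕP.*-monoʳ-≤ 2 (subst (_≤ i + d) (ℕP.+-comm x d) (ℕP.+-monoˡ-≤ d (ℕP.≤-pred x≤i)))) le))))
        (ℕP.≤-trans (ℕP.m≤n+m (∑ₙ (suc i) λ y → guard (same (y + d) (i + d)) (p (y + d))) (∑ₙ d λ x → guard (same x (i + d)) (p x)))
          (ℕP.≤-reflexive (sym (∑ₙ-split d (suc i) λ x → guard (same x (i + d)) (p x)))))

      tail : ℕ → ℕ → ℕ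
      tail i n = ∑ₙ n λ y → guard (same (y + suc i) i) (p (y + suc i))

      tail-index : ∀ y i → same (y + suc i) i ≡ true → a ≤ suc y
      tail-index y i e = ℕP.≮⇒≥ λ y+1<a → contradiction (trans (sym (m<n⇒m%n≡m y+1<a)) (+-cancel-% (suc y) 0 i a′
        (trans (cong (_% a) (sym (ℕP.+-suc y i))) (ℕP.≡ᵇ⇒≡ _ _ (subst T (sym e) _))))) λ ()

      -- The complements are compared instead: both full class sums agree by `balanced`, and a term
      -- `p y` beyond `i` bounds `p (y + d)` beyond `i + d`, as `y` lies past the middle. The last
      -- point holds because the class next meets `i + a`, which is at least `i + d`.
      A-high : ∀ i → D < 2 * (i + d) → A i ≤ A (i + d)
      A-high i lt = ℕP.+-cancelʳ-≤ (tail (i + d) n) (A i) (A (i + d)) (ℕP.≤-trans (ℕP.+-monoʳ-≤ (A i) tails)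
        (ℕP.≤-reflexive (begin
          A i + tail i (d + n)          ≡⟨ ∑ₙ-split (suc i) (d + n) (λ x → guard (same x i) (p x)) ⟨
          U i (d + n + suc i)           ≡⟨ balanced (d + n + suc i) big i ⟩
          U (i + d) (d + n + suc i)     ≡⟨ cong (U (i + d)) (lem d n i) ⟩
          U (i + d) (n + suc (i + d))   ≡⟨ ∑ₙ-split (suc (i + d)) n (λ x → guard (same x (i + d)) (p x)) ⟩
          A (i + d) + tail (i + d) n    ∎)))
        where
        U : ℕ → ℕ → ℕ
        U i L = ∑ₙ L (λ x → guard (same x i) (p x))
        n = suc D
        lem : ∀ d n i → d + n + (1 + i) ≡ n + (1 + (i + d))
        lem = solve-∀
        big : D < d + n + suc i
        big = ℕP.≤-trans (ℕP.m≤n+m n d) (ℕP.m≤m+n (d + n) (suc i))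
        tails : tail (i + d) n ≤ tail i (d + n)
        tails = ℕP.≤-trans (∑ₙ-mono n λ {y} _ → subst (λ b → guard b (p (y + suc (i + d))) ≤ guard (same (y + suc i) i) (p (y + suc i))) (sym (shifted y))
            (guard-mono (same (y + suc i) i) λ e → subst (λ z → p z ≤ p (y + suc i)) (lem₂ d y i)
              (falls* d (y + suc i) (ℕP.<-≤-trans lt (ℕP.*-monoʳ-≤ 2 (ℕP.≤-trans (ℕP.+-monoʳ-≤ i (ℕP.≤-trans d≤a (tail-index y i e)))
                (ℕP.≤-trans (ℕP.≤-reflexive (lem₃ i y)) (ℕP.n≤1+n (y + suc i)))))))))
          (ℕP.≤-trans (ℕP.m≤m+n (tail i n) _) (ℕP.≤-reflexive (trans (sym (∑ₙ-split n d λ y → guard (same (y + suc i) i) (p (y + suc i)))) refl)))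
          where
          shifted : ∀ y → same (y + suc (i + d)) (i + d) ≡ same (y + suc i) i
          shifted y = trans (cong (λ z → same z (i + d)) (lem₁ y i d)) (same-+ (y + suc i) i d)
            where
            lem₁ : ∀ y i d → y + (1 + (i + d)) ≡ y + (1 + i) + d
            lem₁ = solve-∀
          lem₂ : ∀ d y i → d + (y + (1 + i)) ≡ y + (1 + (i + d))
          lem₂ = solve-∀
          lem₃ : ∀ i y → i + (1 + y) ≡ y + (1 + i)
          lem₃ = solve-∀

      A-mono : ∀ i → A i ≤ A (i + d)
      A-mono i with ℕP.≤-<-connex (2 * (i + d)) D
      ... | inj₁ le = A-low i le
      ... | inj₂ lt = A-high i lt

      shift-A≤A : ∀ j → shift d A j ≤ A j
      shift-A≤A j with ℕP.≤-<-connex d j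
      ... | inj₂ j<d = subst (_≤ A j) (sym (shift-before d A j j<d)) z≤n
      ... | inj₁ d≤j = subst (λ z → shift d A z ≤ A z) (ℕP.m+[n∸m]≡n d≤j)
                         (subst (_≤ A (d + (j ∸ d))) (sym (shift-here d A (j ∸ d))) (subst (λ z → A (j ∸ d) ≤ A z) (ℕP.+-comm (j ∸ d) d) (A-mono (j ∸ d))))

      q+shift : ∀ j → q j + shift d A j ≡ A j
      q+shift j = ℕP.m∸n+n≡m (shift-A≤A j)

      -- The recurrence of the power series `p / (1 - q^a)`.
      A-step : ∀ j → A j ≡ p j + shift a A j
      A-step j with ℕP.≤-<-connex a j
      ... | inj₂ j<a = begin
        ∑ₙ j (λ x → guard (same x j) (p x)) + guard (same j j) (p j)
          ≡⟨ cong₂ _+_ (∑ₙ-zero j λ {x} x<j → cong (λ b → guard b (p x)) (other x<j)) (cong (λ b → guard b (p j)) (same-refl j)) ⟩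
        p j                   ≡⟨ ℕP.+-identityʳ (p j) ⟨
        p j + 0               ≡⟨ cong (p j +_) (shift-before a A j j<a) ⟨
        p j + shift a A j     ∎
        where
        other : ∀ {x} → x < j → same x j ≡ false
        other {x} x<j with same x j in e
        ... | false = refl
        ... | true  = contradiction (trans (sym (m<n⇒m%n≡m (ℕP.<-trans x<j j<a))) (trans (ℕP.≡ᵇ⇒≡ _ _ (subst T (sym e) _)) (m<n⇒m%n≡m j<a))) (ℕP.<⇒≢ x<j)
      ... | inj₁ a≤j = subst (λ z → A z ≡ p z + shift a A z) (trans (ℕP.+-comm a i) (ℕP.m∸n+n≡m a≤j)) (begin
        ∑ₙ (suc a′ + i) f + f (a + i)
          ≡⟨ cong₂ _+_ (trans (cong (λ z → ∑ₙ z f) (sym (ℕP.+-suc a′ i))) (∑ₙ-split (suc i) a′ f)) (cong (λ b → guard b (p (a + i))) (same-refl (a + i))) ⟩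
        (∑ₙ (suc i) f + ∑ₙ a′ (λ y → f (y + suc i))) + p (a + i)
          ≡⟨ cong₂ (λ x y → (x + y) + p (a + i)) (∑ₙ-cong (suc i) λ {x} _ → cong (λ b → guard b (p x)) (period x)) (∑ₙ-zero a′ gap) ⟩
        (A i + 0) + p (a + i)          ≡⟨ lem (A i) (p (a + i)) ⟩
        p (a + i) + A i                ≡⟨ cong (p (a + i) +_) (shift-here a A i) ⟨
        p (a + i) + shift a A (a + i)  ∎)
        where
        i = j ∸ a
        f : ℕ → ℕ
        f x = guard (same x (a + i)) (p x)
        period : ∀ x → same x (a + i) ≡ same x i
        period x = cong (x % a ≡ᵇ_) (trans (cong (_% a) (ℕP.+-comm a i)) ([m+n]%n≡m%n i a))
        gap : ∀ {y} → y < a′ → f (y + suc i) ≡ 0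
        gap {y} y<a′ with same (y + suc i) (a + i) in e
        ... | false = refl
        ... | true  = contradiction (tail-index y i (trans (sym (period (y + suc i))) e)) (ℕP.<⇒≱ (s≤s y<a′))
        lem : ∀ x y → (x + 0) + y ≡ y + x
        lem = solve-∀

      -- Both `A = p + q^a A` and `A = q + q^d A` are substituted into the two decompositions of
      -- `[a + d]` applied to `A`; the parts that still contain `A` cancel. This is multiplication
      -- by `1 - q^a` and `1 - q^d` without subtraction.
      window-p≡window-q : ∀ m → window d p m ≡ window a q m
      window-p≡window-q m = ℕP.+-cancelʳ-≡ (window d (shift a A) m + window a (shift d A) m) (window d p m) (window a q m) (begin
        window d p m + (window d (shift a A) m + window a (shift d A) m)
          ≡⟨ ℕP.+-assoc (window d p m) (window d (shift a A) m) (window a (shift d A) m) ⟨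
        window d p m + window d (shift a A) m + window a (shift d A) m
          ≡⟨ cong (_+ window a (shift d A) m) (trans (window-cong d A-step m) (window-+ d p (shift a A) m)) ⟨
        window d A m + window a (shift d A) m
          ≡⟨ window-split d a A m ⟨
        window (a + d) A m
          ≡⟨ cong (λ k → window k A m) (ℕP.+-comm a d) ⟩
        window (d + a) A m
          ≡⟨ window-split a d A m ⟩
        window a A m + window d (shift a A) m
          ≡⟨ cong (_+ window d (shift a A) m) (trans (sym (window-cong a q+shift m)) (window-+ a q (shift d A) m)) ⟩
        window a q m + window a (shift d A) m + window d (shift a A) m
          ≡⟨ lem (window a q m) (window a (shift d A) m) (window d (shift a A) m) ⟩
        window a q m + (window d (shift a A) m + window a (shift d A) m) ∎)
        where
        lem : ∀ x y z → x + y + z ≡ x + (z + y)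
        lem = solve-∀

      -- From there on `A j` and `A (j ∸ d)` are both full class sums, hence equal by `balanced`; so
      -- the quotient is a polynomial and not just a power series.
      q-vanish : ∀ j → D + d ≤ j → q j ≡ 0
      q-vanish j le = trans (cong (A j ∸_) eq) (ℕP.n∸n≡0 (A j))
        where
        i = j ∸ d
        i+d≡j : i + d ≡ j
        i+d≡j = ℕP.m∸n+n≡m (ℕP.≤-trans (ℕP.m≤n+m d D) le)
        D≤i : D ≤ i
        D≤i = subst (_≤ i) (ℕP.m+n∸n≡m D d) (ℕP.∸-monoˡ-≤ d le)
        eq : shift d A j ≡ A j
        eq = begin
          shift d A j           ≡⟨ cong (shift d A) (trans (sym i+d≡j) (ℕP.+-comm i d)) ⟩
          shift d A (d + i)     ≡⟨ shift-here d A i ⟩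
          A i                   ≡⟨ ℕP.+-identityʳ (A i) ⟨
          A i + 0
            ≡⟨ cong (A i +_) (∑ₙ-zero d λ {y} _ → trans (cong (guard (same (y + suc i) i)) (vanish (y + suc i) (ℕP.≤-trans (s≤s D≤i) (ℕP.m≤n+m (suc i) y)))) (Nat.guard-vanish (same (y + suc i) i) refl)) ⟨
          A i + tail i d        ≡⟨ ∑ₙ-split (suc i) d (λ x → guard (same x i) (p x)) ⟨
          ∑ₙ (d + suc i) (λ x → guard (same x i) (p x))
            ≡⟨ balanced (d + suc i) (ℕP.≤-trans (s≤s D≤i) (ℕP.m≤n+m (suc i) d)) i ⟩
          ∑ₙ (d + suc i) (λ x → guard (same x (i + d)) (p x))
            ≡⟨ cong (λ L → ∑ₙ L (λ x → guard (same x (i + d)) (p x))) (trans (ℕP.+-suc d i) (cong suc (ℕP.+-comm d i))) ⟩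
          A (i + d)             ≡⟨ cong A i+d≡j ⟩
          A j                   ∎

-- Polynomials up to equality of coefficients, truncated by degree.

module PolynomialSemiring where

  open import Defs
  open ListSums
  open VerticalStrips using (vsum; vsum-⊞; _⊞_)
  open import Algebra.Bundles using (CommutativeSemiring)
  open import Algebra.Structures.Biased using (IsCommutativeSemiringˡ)
  open import Data.Bool using (true; false; if_then_else_)
  open import Data.Nat as ℕ using (ℕ; _≤_; _∸_)
  import Data.Nat.Properties as ℕP
  open import Data.Integer as ℤ using (ℤ)
  import Data.Integer.Properties as ℤP
  open import Data.List using (List; []; _∷_; _++_; map)
  open import Data.List.Properties using (++-identityʳ; ++-assoc)
  open import Data.Vec using (Vec; []; _∷_; replicate; zipWith)
  open import Data.Vec.Properties using (≡-dec; zipWith-comm; zipWith-assoc; zipWith-identityˡ)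
  open import Data.List.Membership.Propositional using (_∈_)
  open import Relation.Binary using (IsEquivalence)
  open import Data.Product using (_×_; _,_; proj₁; proj₂; ∃-syntax)
  open import Data.Sum using (_⊎_; inj₁; inj₂)
  open import Relation.Nullary using (yes; no; contradiction; Dec; does)
  open import Relation.Nullary.Decidable using (dec-false; map′; _×-dec_)
  open import Level using (0ℓ)
  open import Relation.Binary.PropositionalEquality
  open ≡-Reasoning

  module ℤΣ = ListSum ℤP.+-*-commutativeSemiring

  module _ {N : ℕ} where

    _≟M_ : (m μ : Mono N) → Dec (m ≡ μ)
    (a , u) ≟M (b , v) = map′ (λ { (refl , refl) → refl }) (λ { refl → refl , refl }) ((a ℕP.≟ b) ×-dec ≡-dec ℕP._≟_ u v)

    indicator : Mono N → Mono N → ℤ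
    indicator μ m = if does (m ≟M μ) then ℤ.+ 1 else ℤ.+ 0

    indicator-cong : ∀ {μ ν m m′} → (m ≡ μ → m′ ≡ ν) → (m′ ≡ ν → m ≡ μ) → indicator μ m ≡ indicator ν m′
    indicator-cong {μ} {ν} {m} {m′} f g = cong (if_then ℤ.+ 1 else ℤ.+ 0) (go (m ≟M μ) (m′ ≟M ν))
      where
      go : (p : Dec (m ≡ μ)) (q : Dec (m′ ≡ ν)) → does p ≡ does q
      go (yes _) (yes _) = refl
      go (no _)  (no _)  = refl
      go (yes e) (no ne) = contradiction (f e) ne
      go (no ne) (yes e) = contradiction (g e) ne

    -- Pairing with a test function. Coefficients are pairings with indicators, and a product pairs
    -- as a nested pairing, so the ring laws reduce to laws of `monoMul`.
    eval : Poly N → (Mono N → ℤ) → ℤ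
    eval p φ = ℤΣ.Σ p λ t → proj₁ t ℤ.* φ (proj₂ t)

    coeff-eval : ∀ p μ → coeff p μ ≡ eval p (indicator μ)
    coeff-eval []            μ = refl
    coeff-eval ((c , m) ∷ p) μ = cong₂ ℤ._+_ (go (does (m ≟M μ))) (coeff-eval p μ)
      where
      go : ∀ b → (if b then c else ℤ.+ 0) ≡ c ℤ.* (if b then ℤ.+ 1 else ℤ.+ 0)
      go true  = sym (ℤP.*-identityʳ c)
      go false = sym (ℤP.*-zeroʳ c)

    eval-cong : ∀ p {φ ψ} → (∀ m → φ m ≡ ψ m) → eval p φ ≡ eval p ψ
    eval-cong p eq = ℤΣ.Σ-cong p λ t → cong (proj₁ t ℤ.*_) (eq (proj₂ t))

    eval-⊗ : ∀ p r φ → eval (p ⊗ r) φ ≡ eval p (λ m → eval r (λ m′ → φ (monoMul m m′)))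
    eval-⊗ p r φ = trans (ℤΣ.Σ-cartesian (λ s t → (proj₁ s ℤ.* proj₁ t , monoMul (proj₂ s) (proj₂ t))) p r) (ℤΣ.Σ-cong p λ s → trans
      (ℤΣ.Σ-cong r λ t → ℤP.*-assoc (proj₁ s) (proj₁ t) _) (ℤΣ.Σ-*ˡ r (proj₁ s) _))

    degree : Mono N → ℕ
    degree μ = vsum (proj₂ μ)

    degree-mul : ∀ m μ → degree (monoMul m μ) ≡ degree m ℕ.+ degree μ
    degree-mul (a , u) (b , v) = vsum-⊞ u v

    ⊞-cancel : ∀ {n} (u v w : Vec ℕ n) → u ⊞ v ≡ u ⊞ w → v ≡ w
    ⊞-cancel []      []      []      e = refl
    ⊞-cancel (a ∷ u) (b ∷ v) (c ∷ w) e = cong₂ _∷_ (ℕP.+-cancelˡ-≡ a b c (cong Data.Vec.head e)) (⊞-cancel u v w (cong Data.Vec.tail e))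

    monoMul-cancel : ∀ (m μ ν : Mono N) → monoMul m μ ≡ monoMul m ν → μ ≡ ν
    monoMul-cancel (a , u) (b , v) (c , w) e = cong₂ _,_ (ℕP.+-cancelˡ-≡ a b c (cong proj₁ e)) (⊞-cancel u v w (cong proj₂ e))

    monoMul-comm : ∀ (m μ : Mono N) → monoMul m μ ≡ monoMul μ m
    monoMul-comm (a , u) (b , v) = cong₂ _,_ (ℕP.+-comm a b) (zipWith-comm ℕP.+-comm u v)

    monoMul-assoc : ∀ (m μ ν : Mono N) → monoMul (monoMul m μ) ν ≡ monoMul m (monoMul μ ν)
    monoMul-assoc (a , u) (b , v) (c , w) = cong₂ _,_ (ℕP.+-assoc a b c) (zipWith-assoc ℕP.+-assoc u v w)

    monoMul-identityˡ : ∀ (m : Mono N) → monoMul (0 , replicate N 0) m ≡ m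
    monoMul-identityˡ (a , u) = cong (a ,_) (zipWith-identityˡ ℕP.+-identityˡ u)

    -- Truncated subtraction of exponents; divisibility is tested by multiplying back.
    monoDiv : Mono N → Mono N → Mono N
    monoDiv (b , v) (a , u) = (b ∸ a , zipWith _∸_ v u)

    monoDiv-mul : ∀ m ν → monoDiv (monoMul m ν) m ≡ ν
    monoDiv-mul (a , u) (b , v) = cong₂ _,_ (ℕP.m+n∸m≡n a b) (go u v)
      where
      go : ∀ {n} (u v : Vec ℕ n) → zipWith _∸_ (u ⊞ v) u ≡ v
      go []      []      = refl
      go (a ∷ u) (b ∷ v) = cong₂ _∷_ (ℕP.m+n∸m≡n a b) (go u v)

    -- Multiplication by `m` is injective on monomials, so `μ` has one preimage or none.
    indicator-mul : ∀ μ m → (∃[ ν ] monoMul m ν ≡ μ × (∀ m′ → indicator μ (monoMul m m′) ≡ indicator ν m′))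
                          ⊎ (∀ m′ → indicator μ (monoMul m m′) ≡ ℤ.+ 0)
    indicator-mul μ m with monoMul m (monoDiv μ m) ≟M μ
    ... | yes e = inj₁ (monoDiv μ m , e , λ m′ → indicator-cong {μ} {monoDiv μ m} {monoMul m m′} {m′}
                    (λ e′ → monoMul-cancel m m′ (monoDiv μ m) (trans e′ (sym e))) (λ e′ → trans (cong (monoMul m) e′) e))
    ... | no ne = inj₂ λ m′ → cong (if_then ℤ.+ 1 else ℤ.+ 0) (dec-false (monoMul m m′ ≟M μ)
                    λ e → ne (subst (λ z → monoMul m (monoDiv z m) ≡ z) e (cong (monoMul m) (monoDiv-mul m m′))))

    eval-zero : ∀ r {φ} → (∀ m → φ m ≡ ℤ.+ 0) → eval r φ ≡ ℤ.+ 0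
    eval-zero r z = ℤΣ.Σ-zero r λ {t} _ → trans (cong (proj₁ t ℤ.*_) (z (proj₂ t))) (ℤP.*-zeroʳ (proj₁ t))

    -- A coefficient of the product reads `r` only at quotients of `μ` by monomials of `p`. Hence
    -- products respect the truncation, and a homogeneous `p` sees only one degree of `r`.
    ⊗-congʳ : ∀ p {r r′} μ → (∀ {t ν} → t ∈ p → monoMul (proj₂ t) ν ≡ μ → coeff r ν ≡ coeff r′ ν) →
              coeff (p ⊗ r) μ ≡ coeff (p ⊗ r′) μ
    ⊗-congʳ p {r} {r′} μ eq = begin
      coeff (p ⊗ r) μ                                          ≡⟨ trans (coeff-eval (p ⊗ r) μ) (eval-⊗ p r (indicator μ)) ⟩
      eval p (λ m → eval r (λ m′ → indicator μ (monoMul m m′)))  ≡⟨ ℤΣ.Σ-cong∈ p (λ {t} t∈ → cong (proj₁ t ℤ.*_) (term (proj₂ t) (eq t∈))) ⟩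
      eval p (λ m → eval r′ (λ m′ → indicator μ (monoMul m m′))) ≡⟨ trans (coeff-eval (p ⊗ r′) μ) (eval-⊗ p r′ (indicator μ)) ⟨
      coeff (p ⊗ r′) μ                                         ∎
      where
      term : ∀ m → (∀ {ν} → monoMul m ν ≡ μ → coeff r ν ≡ coeff r′ ν) →
             eval r (λ m′ → indicator μ (monoMul m m′)) ≡ eval r′ (λ m′ → indicator μ (monoMul m m′))
      term m eq with indicator-mul μ m
      ... | inj₂ z = trans (eval-zero r z) (sym (eval-zero r′ z))
      ... | inj₁ (ν , e , same) = begin
        eval r (λ m′ → indicator μ (monoMul m m′))    ≡⟨ eval-cong r same ⟩
        eval r (indicator ν)                          ≡⟨ coeff-eval r ν ⟨
        coeff r ν                                     ≡⟨ eq e ⟩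
        coeff r′ ν                                    ≡⟨ coeff-eval r′ ν ⟩
        eval r′ (indicator ν)                         ≡⟨ eval-cong r′ same ⟨
        eval r′ (λ m′ → indicator μ (monoMul m m′))   ∎

    coeff-⊕ : ∀ (p r : Poly N) μ → coeff (p ⊕ r) μ ≡ coeff p μ ℤ.+ coeff r μ
    coeff-⊕ []      r μ = sym (ℤP.+-identityˡ (coeff r μ))
    coeff-⊕ (t ∷ p) r μ = trans (cong (λ z → (if monoEq? (proj₂ t) μ then proj₁ t else ℤ.+ 0) ℤ.+ z) (coeff-⊕ p r μ))
                                (sym (ℤP.+-assoc (if monoEq? (proj₂ t) μ then proj₁ t else ℤ.+ 0) (coeff p μ) (coeff r μ)))

    ⊗-comm : ∀ (p r : Poly N) μ → coeff (p ⊗ r) μ ≡ coeff (r ⊗ p) μ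
    ⊗-comm p r μ = begin
      coeff (p ⊗ r) μ   ≡⟨ coeff-eval (p ⊗ r) μ ⟩
      eval (p ⊗ r) φ    ≡⟨ ℤΣ.Σ-cartesian _ p r ⟩
      ℤΣ.Σ p (λ s → ℤΣ.Σ r (λ t → proj₁ s ℤ.* proj₁ t ℤ.* φ (monoMul (proj₂ s) (proj₂ t))))
        ≡⟨ ℤΣ.Σ-swap p r _ ⟩
      ℤΣ.Σ r (λ t → ℤΣ.Σ p (λ s → proj₁ s ℤ.* proj₁ t ℤ.* φ (monoMul (proj₂ s) (proj₂ t))))
        ≡⟨ ℤΣ.Σ-cong r (λ t → ℤΣ.Σ-cong p λ s → cong₂ (λ c m → c ℤ.* φ m) (ℤP.*-comm (proj₁ s) (proj₁ t)) (monoMul-comm (proj₂ s) (proj₂ t))) ⟩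
      ℤΣ.Σ r (λ t → ℤΣ.Σ p (λ s → proj₁ t ℤ.* proj₁ s ℤ.* φ (monoMul (proj₂ t) (proj₂ s))))
        ≡⟨ ℤΣ.Σ-cartesian _ r p ⟨
      eval (r ⊗ p) φ    ≡⟨ coeff-eval (r ⊗ p) μ ⟨
      coeff (r ⊗ p) μ   ∎
      where
      φ = indicator μ

    ⊗-assoc : ∀ (p r s : Poly N) μ → coeff ((p ⊗ r) ⊗ s) μ ≡ coeff (p ⊗ (r ⊗ s)) μ
    ⊗-assoc p r s μ = begin
      coeff ((p ⊗ r) ⊗ s) μ   ≡⟨ trans (coeff-eval ((p ⊗ r) ⊗ s) μ) (eval-⊗ (p ⊗ r) s φ) ⟩
      eval (p ⊗ r) (λ m → eval s (λ m′ → φ (monoMul m m′)))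
        ≡⟨ eval-⊗ p r _ ⟩
      eval p (λ m → eval r (λ n → eval s (λ m′ → φ (monoMul (monoMul m n) m′))))
        ≡⟨ eval-cong p (λ m → trans (eval-cong r λ n → eval-cong s λ m′ → cong φ (monoMul-assoc m n m′)) (sym (eval-⊗ r s (λ k → φ (monoMul m k))))) ⟩
      eval p (λ m → eval (r ⊗ s) (λ k → φ (monoMul m k)))
        ≡⟨ trans (coeff-eval (p ⊗ (r ⊗ s)) μ) (eval-⊗ p (r ⊗ s) φ) ⟨
      coeff (p ⊗ (r ⊗ s)) μ   ∎
      where
      φ = indicator μ

    ⊗-identityˡ : ∀ (p : Poly N) μ → coeff (one ⊗ p) μ ≡ coeff p μ
    ⊗-identityˡ p μ = begin
      coeff (one ⊗ p) μ       ≡⟨ trans (coeff-eval (one ⊗ p) μ) (eval-⊗ one p φ) ⟩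
      ℤ.+ 1 ℤ.* eval p (λ m → φ (monoMul (0 , replicate N 0) m)) ℤ.+ ℤ.+ 0
        ≡⟨ trans (ℤP.+-identityʳ _) (ℤP.*-identityˡ _) ⟩
      eval p (λ m → φ (monoMul (0 , replicate N 0) m))
        ≡⟨ eval-cong p (λ m → cong φ (monoMul-identityˡ m)) ⟩
      eval p φ                ≡⟨ coeff-eval p μ ⟨
      coeff p μ               ∎
      where
      φ = indicator μ

    ⊗-distribʳ : ∀ (s p r : Poly N) → (p ⊕ r) ⊗ s ≡ (p ⊗ s) ⊕ (r ⊗ s)
    ⊗-distribʳ s []      r = refl
    ⊗-distribʳ s (t ∷ p) r = trans (cong (map _ s ++_) (⊗-distribʳ s p r)) (sym (++-assoc (map _ s) (p ⊗ s) (r ⊗ s)))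

  -- Monomials of x-degree more than B are ignored, so that for symmetric functions of degree B
  -- shapes with B rows suffice, whatever the number N of variables.
  module Truncated (N B : ℕ) where

    infix 4 _≈ᵀ_
    record _≈ᵀ_ (p r : Poly N) : Set where
      constructor agree
      field
        at-degree : ∀ μ → degree μ ≤ B → coeff p μ ≡ coeff r μ
    open _≈ᵀ_ public

    ⊗-congˡᵀ : ∀ p {r r′} → r ≈ᵀ r′ → p ⊗ r ≈ᵀ p ⊗ r′
    ⊗-congˡᵀ p {r} {r′} eq = agree λ μ μ≤B → ⊗-congʳ p {r} {r′} μ λ {t} {ν} _ e → at-degree eq ν
      (ℕP.≤-trans (ℕP.m≤n+m (degree ν) (degree (proj₂ t))) (ℕP.≤-trans (ℕP.≤-reflexive (trans (sym (degree-mul (proj₂ t) ν)) (cong degree e))) μ≤B))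

    ⊗-commᵀ : ∀ p r → p ⊗ r ≈ᵀ r ⊗ p
    ⊗-commᵀ p r = agree λ μ _ → ⊗-comm {N} p r μ

    transᵀ : ∀ {p r s} → p ≈ᵀ r → r ≈ᵀ s → p ≈ᵀ s
    transᵀ e f = agree λ μ le → trans (at-degree e μ le) (at-degree f μ le)

    R : CommutativeSemiring 0ℓ 0ℓ
    R = record
      { Carrier = Poly N
      ; _≈_ = _≈ᵀ_
      ; _+_ = _⊕_
      ; _*_ = _⊗_
      ; 0# = []
      ; 1# = one
      ; isCommutativeSemiring = IsCommutativeSemiringˡ.isCommutativeSemiring (record
        { +-isCommutativeMonoid = record
          { isMonoid = record
            { isSemigroup = record
              { isMagma = record
                { isEquivalence = isEq
                ; ∙-cong = λ {p} {p′} {r} {r′} e f → agree λ μ le →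
                    trans (coeff-⊕ {N} p r μ) (trans (cong₂ ℤ._+_ (at-degree e μ le) (at-degree f μ le)) (sym (coeff-⊕ {N} p′ r′ μ)))
                }
              ; assoc = λ p r s → reflexiveᵀ (++-assoc p r s)
              }
            ; identity = (λ p → reflᵀ) , (λ p → reflexiveᵀ (++-identityʳ p))
            }
          ; comm = λ p r → agree λ μ _ → trans (coeff-⊕ {N} p r μ) (trans (ℤP.+-comm (coeff p μ) (coeff r μ)) (sym (coeff-⊕ {N} r p μ)))
          }
        ; *-isCommutativeMonoid = record
          { isMonoid = record
            { isSemigroup = record
              { isMagma = record
                { isEquivalence = isEq
                ; ∙-cong = λ {p} {p′} {r} {r′} e f → transᵀ (⊗-congˡᵀ p f) (transᵀ (⊗-commᵀ p r′) (transᵀ (⊗-congˡᵀ r′ e) (⊗-commᵀ r′ p′)))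
                }
              ; assoc = λ p r s → agree λ μ _ → ⊗-assoc {N} p r s μ
              }
            ; identity = (λ p → agree λ μ _ → ⊗-identityˡ {N} p μ) , (λ p → transᵀ (⊗-commᵀ p one) (agree λ μ _ → ⊗-identityˡ {N} p μ))
            }
          ; comm = ⊗-commᵀ
          }
        ; distribʳ = λ s p r → reflexiveᵀ (⊗-distribʳ {N} s p r)
        ; zeroˡ = λ p → reflᵀ
        })
      }
      where
      reflᵀ : ∀ {p} → p ≈ᵀ p
      reflᵀ = agree λ _ _ → refl
      reflexiveᵀ : ∀ {p r} → p ≡ r → p ≈ᵀ r
      reflexiveᵀ refl = reflᵀ
      isEq : IsEquivalence _≈ᵀ_
      isEq = record { refl = reflᵀ ; sym = λ e → agree λ μ le → sym (at-degree e μ le) ; trans = transᵀ }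

-- The dual Pieri rule by branching over the variables.

module PieriRule where

  open BenderKnuth using (Dominant; []; _∷_; ≤ᵇ-true; ≤ᵇ-false)
  open ListSums
  open VerticalStrips using (vsum; _⊞_; bits)
  open StripWalks using (head₀)
  open import Algebra.Bundles using (CommutativeSemiring)
  open import Data.Bool using (Bool; true; false)
  open import Data.Nat as ℕ using (ℕ; zero; suc; _≤_; _<_; z≤n; s≤s; _≤ᵇ_; _≡ᵇ_)
  import Data.Nat.Properties as ℕP
  open import Data.Fin using (Fin; fromℕ; inject₁)
  open import Data.List using (List; map)
  open import Data.Vec using (Vec; []; _∷_)
  open import Data.Product using (_×_; _,_)
  open import Data.Sum using (_⊎_; inj₁; inj₂)
  open import Function using (_∘_)
  open import Level using (0ℓ)
  open import Relation.Binary.PropositionalEquality as ≡ using (_≡_)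

  data HasAscent : ∀ {ℓ} → Vec ℕ ℓ → Set where
    here  : ∀ {ℓ a b} {v : Vec ℕ ℓ} → a < b → HasAscent (a ∷ b ∷ v)
    there : ∀ {ℓ a} {v : Vec ℕ ℓ} → HasAscent v → HasAscent (a ∷ v)

  lastRow : ∀ {ℓ} → Vec ℕ (suc ℓ) → ℕ
  lastRow (a ∷ [])    = a
  lastRow (a ∷ b ∷ v) = lastRow (b ∷ v)

  dominant-or-ascent : ∀ {ℓ} (v : Vec ℕ ℓ) → Dominant (head₀ v) v ⊎ HasAscent v
  dominant-or-ascent []      = inj₁ []
  dominant-or-ascent (a ∷ []) = inj₁ (ℕP.≤-refl ∷ [])
  dominant-or-ascent (a ∷ b ∷ v) with ℕP.≤-<-connex b a | dominant-or-ascent (b ∷ v)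
  ... | inj₂ a<b | _            = inj₂ (here a<b)
  ... | inj₁ _   | inj₂ bad     = inj₂ (there bad)
  ... | inj₁ b≤a | inj₁ (_ ∷ d) = inj₁ (ℕP.≤-refl ∷ (b≤a ∷ d))

  allZero : ∀ {ℓ} → Vec ℕ ℓ → Bool
  allZero []          = true
  allZero (zero ∷ v)  = allZero v
  allZero (suc _ ∷ v) = false

  module Schur (R : CommutativeSemiring 0ℓ 0ℓ) where

    open CommutativeSemiring R
    open ListSum R
    open import Relation.Binary.Reasoning.Setoid setoid
    open import Algebra.Solver.Ring.NaturalCoefficients.Default R using (solve; _:=_; _:+_; _:*_; con)

    pow : Carrier → ℕ → Carrier
    pow y zero    = 1#
    pow y (suc n) = y * pow y n

    -- Σ_{ρ ≤ a} x^(a - ρ) f(ρ), in Horner form.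
    hsum : Carrier → ℕ → (ℕ → Carrier) → Carrier
    hsum x zero    f = f 0
    hsum x (suc a) f = f (suc a) + x * hsum x a f

    hsum-cong : ∀ x a {f g} → (∀ {ρ} → ρ ≤ a → f ρ ≈ g ρ) → hsum x a f ≈ hsum x a g
    hsum-cong x zero    eq = eq z≤n
    hsum-cong x (suc a) eq = +-cong (eq ℕP.≤-refl) (*-congˡ (hsum-cong x a λ ρ≤a → eq (ℕP.m≤n⇒m≤1+n ρ≤a)))

    hsum-+ : ∀ x a f g → hsum x a (λ ρ → f ρ + g ρ) ≈ hsum x a f + hsum x a g
    hsum-+ x zero    f g = refl
    hsum-+ x (suc a) f g = begin
      f (suc a) + g (suc a) + x * hsum x a (λ ρ → f ρ + g ρ)     ≈⟨ +-congˡ (*-congˡ (hsum-+ x a f g)) ⟩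
      f (suc a) + g (suc a) + x * (hsum x a f + hsum x a g)
        ≈⟨ solve 5 (λ f g x a b → f :+ g :+ x :* (a :+ b) := (f :+ x :* a) :+ (g :+ x :* b)) refl (f (suc a)) (g (suc a)) x (hsum x a f) (hsum x a g) ⟩
      hsum x (suc a) f + hsum x (suc a) g                        ∎

    hsum-*ˡ : ∀ x a c f → hsum x a (λ ρ → c * f ρ) ≈ c * hsum x a f
    hsum-*ˡ x zero    c f = refl
    hsum-*ˡ x (suc a) c f = trans (+-congˡ (*-congˡ (hsum-*ˡ x a c f)))
      (solve 4 (λ c f x h → c :* f :+ x :* (c :* h) := c :* (f :+ x :* h)) refl c (f (suc a)) x (hsum x a f))

    hsum-zero : ∀ x a {f} → (∀ {ρ} → ρ ≤ a → f ρ ≈ 0#) → hsum x a f ≈ 0#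
    hsum-zero x a {f} z = begin
      hsum x a f                  ≈⟨ hsum-cong x a (λ le → trans (z le) (sym (zeroˡ 0#))) ⟩
      hsum x a (λ _ → 0# * 0#)    ≈⟨ hsum-*ˡ x a 0# (λ _ → 0#) ⟩
      0# * hsum x a (λ _ → 0#)    ≈⟨ zeroˡ _ ⟩
      0#                          ∎

    hsum-Σ : ∀ {A : Set} x a (xs : List A) (g : ℕ → A → Carrier) → hsum x a (λ ρ → Σ xs (g ρ)) ≈ Σ xs (λ C → hsum x a (λ ρ → g ρ C))
    hsum-Σ x zero    xs g = refl
    hsum-Σ x (suc a) xs g = begin
      Σ xs (g (suc a)) + x * hsum x a (λ ρ → Σ xs (g ρ))                    ≈⟨ +-congˡ (*-congˡ (hsum-Σ x a xs g)) ⟩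
      Σ xs (g (suc a)) + x * Σ xs (λ C → hsum x a (λ ρ → g ρ C))            ≈⟨ +-congˡ (Σ-*ˡ xs x _) ⟨
      Σ xs (g (suc a)) + Σ xs (λ C → x * hsum x a (λ ρ → g ρ C))            ≈⟨ Σ-+ xs (g (suc a)) _ ⟨
      Σ xs (λ C → hsum x (suc a) (λ ρ → g ρ C))                             ∎

    hsum-shift : ∀ x a {f} → f 0 ≈ 0# → hsum x (suc a) f ≈ hsum x a (f ∘ suc)
    hsum-shift x zero    z = trans (+-congˡ (trans (*-congˡ z) (zeroʳ x))) (+-identityʳ _)
    hsum-shift x (suc a) z = +-congˡ (*-congˡ (hsum-shift x a z))

    -- The sum over all ρ interlacing v of x^(|v| - |ρ|) g(ρ): branching from N + 1 to N variables.
    branch : ∀ {ℓ} → Carrier → Vec ℕ ℓ → (Vec ℕ ℓ → Carrier) → Carrier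
    branch x []      g = g []
    branch x (a ∷ v) g = hsum x a λ ρ → guard (head₀ v ≤ᵇ ρ) (branch x v (g ∘ (ρ ∷_)))

    branch-cong : ∀ {ℓ p} x {v : Vec ℕ ℓ} {g h} → Dominant p v → (∀ {κ} → Dominant p κ → g κ ≈ h κ) → branch x v g ≈ branch x v h
    branch-cong x []        eq = eq []
    branch-cong x {a ∷ v} (a≤p ∷ d) eq = hsum-cong x a λ {ρ} ρ≤a → guard-cong (head₀ v ≤ᵇ ρ) λ le →
      branch-cong x (narrow d le) λ dκ → eq (ℕP.≤-trans ρ≤a a≤p ∷ dκ)
      where
      narrow : ∀ {ℓ a ρ} {v : Vec ℕ ℓ} → Dominant a v → (head₀ v ≤ᵇ ρ) ≡ true → Dominant ρ v
      narrow []                le = []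
      narrow {ρ = ρ} {b ∷ v} (_ ∷ d) le = ℕP.≤ᵇ⇒≤ b ρ (≡.subst Data.Bool.T (≡.sym le) _) ∷ d

    branch-cong′ : ∀ {ℓ} x (v : Vec ℕ ℓ) {g h} → (∀ κ → g κ ≈ h κ) → branch x v g ≈ branch x v h
    branch-cong′ x []      eq = eq []
    branch-cong′ x (a ∷ v) eq = hsum-cong x a λ {ρ} _ → guard-cong (head₀ v ≤ᵇ ρ) λ _ → branch-cong′ x v λ κ → eq (ρ ∷ κ)

    branch-+ : ∀ {ℓ} x (v : Vec ℕ ℓ) g h → branch x v (λ κ → g κ + h κ) ≈ branch x v g + branch x v h
    branch-+ x []      g h = refl
    branch-+ x (a ∷ v) g h = trans (hsum-cong x a λ {ρ} _ → trans (guard-cong (head₀ v ≤ᵇ ρ) λ _ → branch-+ x v (g ∘ (ρ ∷_)) (h ∘ (ρ ∷_)))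
                                                               (guard-+ (head₀ v ≤ᵇ ρ) _ _))
                                   (hsum-+ x a _ _)

    branch-*ˡ : ∀ {ℓ} x (v : Vec ℕ ℓ) c g → branch x v (λ κ → c * g κ) ≈ c * branch x v g
    branch-*ˡ x []      c g = refl
    branch-*ˡ x (a ∷ v) c g = trans (hsum-cong x a λ {ρ} _ → trans (guard-cong (head₀ v ≤ᵇ ρ) λ _ → branch-*ˡ x v c (g ∘ (ρ ∷_)))
                                                                 (guard-*ˡ (head₀ v ≤ᵇ ρ) c _))
                                    (hsum-*ˡ x a c _)

    branch-zero : ∀ {ℓ} x (v : Vec ℕ ℓ) {g} → (∀ κ → g κ ≈ 0#) → branch x v g ≈ 0#
    branch-zero x []      z = z []
    branch-zero x (a ∷ v) z = hsum-zero x a λ {ρ} _ → guard-vanish (head₀ v ≤ᵇ ρ) (branch-zero x v λ κ → z (ρ ∷ κ))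

    -- Interlacing would require a row length that is at most `a` and at least `b > a`.
    branch-ascent : ∀ {ℓ} x {v : Vec ℕ ℓ} {g} → HasAscent v → branch x v g ≈ 0#
    branch-ascent x {a ∷ b ∷ v} {g} (here a<b) = hsum-zero x a λ {ρ} ρ≤a →
      reflexive (≡.cong (λ c → guard c (branch x (b ∷ v) (g ∘ (ρ ∷_)))) (≤ᵇ-false (ℕP.≤-<-trans ρ≤a a<b)))
    branch-ascent x {a ∷ v} (there bad) = hsum-zero x a λ {ρ} _ →
      guard-vanish (head₀ v ≤ᵇ ρ) (branch-ascent x bad)

    -- Local commutation of adding a vertical strip (parameter y) with removing a horizontal strip
    -- (parameter x).
    module Local (x y : Carrier) where

      stripThenBranch : ∀ {ℓ} → Vec ℕ ℓ → (Vec ℕ ℓ → Carrier) → Carrier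
      stripThenBranch []      g = g []
      stripThenBranch (a ∷ v) g = hsum x a λ κ → guard (head₀ v ≤ᵇ κ)
        (stripThenBranch v (g ∘ (κ ∷_)) + y * stripThenBranch v (g ∘ (suc κ ∷_)))

      -- The summands in which the first row receives c boxes.
      branchThenStrip : ∀ {ℓ} → ℕ → Vec ℕ (suc ℓ) → (Vec ℕ (suc ℓ) → Carrier) → Carrier
      branchThenStrip c (a ∷ [])    g = pow y c * hsum x (c ℕ.+ a) (λ ρ → g (ρ ∷ []))
      branchThenStrip c (a ∷ b ∷ v) g = pow y c *
        (hsum x (c ℕ.+ a) (λ ρ → guard (b ≤ᵇ ρ) (branchThenStrip 0 (b ∷ v) (g ∘ (ρ ∷_)))) +
         hsum x (c ℕ.+ a) (λ ρ → guard (suc b ≤ᵇ ρ) (branchThenStrip 1 (b ∷ v) (g ∘ (ρ ∷_)))))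

      -- The two boundary conditions behind the commutation: `g` vanishes when a row exceeds the one
      -- above by one box, and `x * y` kills `g` on a nonempty last row, where a further row would
      -- be needed.
      Supported : ∀ {ℓ} → (Vec ℕ (suc ℓ) → Carrier) → Set
      Supported {zero}  g = ∀ a → 0 < a → (x * y) * g (a ∷ []) ≈ 0#
      Supported {suc ℓ} g = (∀ a w → g (a ∷ suc a ∷ w) ≈ 0#) × (∀ a → Supported (g ∘ (a ∷_)))

      branchThenStrip-zero : ∀ {ℓ} c (v : Vec ℕ (suc ℓ)) {g} → (∀ κ → g κ ≈ 0#) → branchThenStrip c v g ≈ 0#
      branchThenStrip-zero c (a ∷ [])    z = trans (*-congˡ (hsum-zero x (c ℕ.+ a) λ {ρ} _ → z (ρ ∷ []))) (zeroʳ (pow y c))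
      branchThenStrip-zero c (a ∷ b ∷ v) z = trans (*-congˡ (trans (+-cong
        (hsum-zero x (c ℕ.+ a) λ {ρ} _ → guard-vanish (b ≤ᵇ ρ) (branchThenStrip-zero 0 (b ∷ v) λ κ → z (ρ ∷ κ)))
        (hsum-zero x (c ℕ.+ a) λ {ρ} _ → guard-vanish (suc b ≤ᵇ ρ) (branchThenStrip-zero 1 (b ∷ v) λ κ → z (ρ ∷ κ)))) (+-identityˡ 0#))) (zeroʳ (pow y c))

      -- The added box costs `y`. The leading Horner term vanishes by hypothesis, and the rest is
      -- `x` times the sum for the original length.
      first-row : ∀ {ℓ} h (w : Vec ℕ ℓ) {g} → (∀ κ → g (suc h ∷ κ) ≈ 0#) →
                  branchThenStrip 1 (h ∷ w) g ≈ (x * y) * branchThenStrip 0 (h ∷ w) g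
      first-row h [] {g} z = begin
        (y * 1#) * (g (suc h ∷ []) + x * hsum x h (λ ρ → g (ρ ∷ [])))   ≈⟨ *-congˡ (+-congʳ (z [])) ⟩
        (y * 1#) * (0# + x * hsum x h (λ ρ → g (ρ ∷ [])))
          ≈⟨ solve 3 (λ x y s → (y :* con 1) :* (con 0 :+ x :* s) := (x :* y) :* (con 1 :* s)) refl x y (hsum x h (λ ρ → g (ρ ∷ []))) ⟩
        (x * y) * (1# * hsum x h (λ ρ → g (ρ ∷ [])))                    ∎
      first-row h (b ∷ w) {g} z = begin
        (y * 1#) * ((guard (b ≤ᵇ suc h) (branchThenStrip 0 (b ∷ w) (g ∘ (suc h ∷_))) + x * A) +
                    (guard (suc b ≤ᵇ suc h) (branchThenStrip 1 (b ∷ w) (g ∘ (suc h ∷_))) + x * B))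
          ≈⟨ *-congˡ (+-cong (+-congʳ (guard-vanish (b ≤ᵇ suc h) (branchThenStrip-zero 0 (b ∷ w) z)))
                             (+-congʳ (guard-vanish (suc b ≤ᵇ suc h) (branchThenStrip-zero 1 (b ∷ w) z)))) ⟩
        (y * 1#) * ((0# + x * A) + (0# + x * B))
          ≈⟨ solve 4 (λ x y a b → (y :* con 1) :* ((con 0 :+ x :* a) :+ (con 0 :+ x :* b)) := (x :* y) :* (con 1 :* (a :+ b))) refl x y A B ⟩
        (x * y) * (1# * (A + B)) ∎
        where
        A = hsum x h (λ ρ → guard (b ≤ᵇ ρ) (branchThenStrip 0 (b ∷ w) (g ∘ (ρ ∷_))))
        B = hsum x h (λ ρ → guard (suc b ≤ᵇ ρ) (branchThenStrip 1 (b ∷ w) (g ∘ (ρ ∷_))))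

      guard-split : ∀ h ρ z → guard (h ≤ᵇ ρ) z ≈ guard (suc h ≤ᵇ ρ) z + guard (h ≡ᵇ ρ) z
      guard-split zero    zero    z = sym (+-identityˡ z)
      guard-split zero    (suc ρ) z = sym (+-identityʳ z)
      guard-split (suc h) zero    z = sym (+-identityˡ 0#)
      guard-split (suc h) (suc ρ) z = trans (reflexive (≡.cong (λ b → guard b z) (suc≤ᵇsuc h ρ))) (guard-split h ρ z)
        where
        suc≤ᵇsuc : ∀ h ρ → (suc h ≤ᵇ suc ρ) ≡ (h ≤ᵇ ρ)
        suc≤ᵇsuc zero    ρ = ≡.refl
        suc≤ᵇsuc (suc h) ρ = ≡.refl

      -- The interlacing first row `κ` is at least the next row `h`. For `κ > h` the next row may
      -- take a box or not. For `κ = h` a full additional box would create the ascent `h, suc h`,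
      -- where `g` vanishes, so `first-row` reduces that case to `x * y` times the case without a
      -- box. This bookkeeping produces exactly the factor `1# + x * y`.
      commutation : ∀ {ℓ p} {v : Vec ℕ (suc ℓ)} → Dominant p v → ∀ {g} → Supported g →
                    (1# + x * y) * stripThenBranch v g ≈ branchThenStrip 0 v g + branchThenStrip 1 v g
      commutation {v = a ∷ []} _ {g} supp = begin
        (1# + x * y) * hsum x a (λ κ → G κ + y * G (suc κ))    ≈⟨ *-congˡ (trans (hsum-+ x a G _) (+-congˡ (hsum-*ˡ x a y (G ∘ suc)))) ⟩
        (1# + x * y) * (S + y * hs)
          ≈⟨ solve 4 (λ x y S hs → (con 1 :+ x :* y) :* (S :+ y :* hs) := (S :+ y :* hs :+ (y :* x) :* S) :+ y :* ((x :* y) :* hs)) refl x y S hs ⟩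
        (S + y * hs + (y * x) * S) + y * ((x * y) * hs)         ≈⟨ +-cong (+-congʳ (+-congˡ (top a))) (*-congˡ (trans (sym (hsum-*ˡ x a (x * y) (G ∘ suc))) (hsum-zero x a λ {ρ} _ → supp (suc ρ) (s≤s z≤n)))) ⟩
        (S + y * G (suc a) + (y * x) * S) + y * 0#
          ≈⟨ solve 4 (λ x y S t → (S :+ y :* t :+ (y :* x) :* S) :+ y :* con 0 := con 1 :* S :+ (y :* con 1) :* (t :+ x :* S)) refl x y S (G (suc a)) ⟩
        1# * S + (y * 1#) * (G (suc a) + x * S)                 ∎
        where
        G : ℕ → Carrier
        G ρ = g (ρ ∷ [])
        S = hsum x a G
        hs = hsum x a (G ∘ suc)
        top : ∀ a → y * hsum x a (G ∘ suc) ≈ y * G (suc a)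
        top zero    = refl
        top (suc a) = begin
          y * (G (suc (suc a)) + x * hsum x a (G ∘ suc))
            ≈⟨ solve 4 (λ x y t h → y :* (t :+ x :* h) := y :* t :+ (x :* y) :* h) refl x y (G (suc (suc a))) (hsum x a (G ∘ suc)) ⟩
          y * G (suc (suc a)) + (x * y) * hsum x a (G ∘ suc)
            ≈⟨ +-congˡ (trans (sym (hsum-*ˡ x a (x * y) (G ∘ suc))) (hsum-zero x a λ {ρ} _ → supp (suc ρ) (s≤s z≤n))) ⟩
          y * G (suc (suc a)) + 0#   ≈⟨ +-identityʳ _ ⟩
          y * G (suc (suc a))        ∎
      commutation {v = a ∷ h ∷ w} (a≤p ∷ (h≤a ∷ d)) {g} (nd , supp) = begin
        (1# + x * y) * hsum x a (λ κ → guard (h ≤ᵇ κ) (L κ + y * L (suc κ)))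
          ≈⟨ *-congˡ left ⟩
        (1# + x * y) * ((S₁ L + pt L) + y * (L (suc a) + x * S₁ L))
          ≈⟨ solve 5 (λ x y s p t → (con 1 :+ x :* y) :* ((s :+ p) :+ y :* (t :+ x :* s))
                 := ((con 1 :+ x :* y) :* s :+ (con 1 :+ x :* y) :* p) :+ y :* ((con 1 :+ x :* y) :* t :+ x :* ((con 1 :+ x :* y) :* s))) refl x y (S₁ L) (pt L) (L (suc a)) ⟩
        ((1# + x * y) * S₁ L + (1# + x * y) * pt L) + y * ((1# + x * y) * L (suc a) + x * ((1# + x * y) * S₁ L))
          ≈⟨ +-cong (+-cong S₁-step pt-step) (*-congˡ (+-cong (IH (suc a)) (*-congˡ S₁-step))) ⟩
        ((S₁ R₀ + S₁ R₁) + (pt R₀ + (x * y) * pt R₀)) + y * ((R₀ (suc a) + R₁ (suc a)) + x * (S₁ R₀ + S₁ R₁))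
          ≈⟨ solve 7 (λ x y s₀ s₁ p t₀ t₁ → ((s₀ :+ s₁) :+ (p :+ (x :* y) :* p)) :+ y :* ((t₀ :+ t₁) :+ x :* (s₀ :+ s₁))
                 := con 1 :* ((s₀ :+ p) :+ s₁) :+ (y :* con 1) :* ((t₀ :+ x :* (s₀ :+ p)) :+ (t₁ :+ x :* s₁))) refl x y (S₁ R₀) (S₁ R₁) (pt R₀) (R₀ (suc a)) (R₁ (suc a)) ⟩
        1# * ((S₁ R₀ + pt R₀) + S₁ R₁) + (y * 1#) * ((R₀ (suc a) + x * (S₁ R₀ + pt R₀)) + (R₁ (suc a) + x * S₁ R₁))
          ≈⟨ +-cong (*-congˡ (+-congʳ (sym (split R₀)))) (*-congˡ (+-cong (+-cong (open-guard (≤ᵇ-true (ℕP.m≤n⇒m≤1+n h≤a)) (R₀ (suc a))) (*-congˡ (sym (split R₀))))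
                                                          (+-congʳ (open-guard (≤ᵇ-true (s≤s h≤a)) (R₁ (suc a)))))) ⟩
        branchThenStrip 0 (a ∷ h ∷ w) g + branchThenStrip 1 (a ∷ h ∷ w) g ∎
        where
        v = h ∷ w
        L R₀ R₁ : ℕ → Carrier
        L κ = stripThenBranch v (g ∘ (κ ∷_))
        R₀ ρ = branchThenStrip 0 v (g ∘ (ρ ∷_))
        R₁ ρ = branchThenStrip 1 v (g ∘ (ρ ∷_))
        S₁ pt : (ℕ → Carrier) → Carrier
        S₁ F = hsum x a (λ ρ → guard (suc h ≤ᵇ ρ) (F ρ))
        pt F = hsum x a (λ ρ → guard (h ≡ᵇ ρ) (F ρ))
        open-guard : ∀ {b} → b ≡ true → ∀ z → z ≈ guard b z
        open-guard ≡.refl z = refl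
        split : ∀ F → hsum x a (λ ρ → guard (h ≤ᵇ ρ) (F ρ)) ≈ S₁ F + pt F
        split F = trans (hsum-cong x a λ {ρ} _ → guard-split h ρ (F ρ)) (hsum-+ x a _ _)
        IH : ∀ κ → (1# + x * y) * L κ ≈ R₀ κ + R₁ κ
        IH κ = commutation (ℕP.≤-refl ∷ d) (supp κ)
        left : hsum x a (λ κ → guard (h ≤ᵇ κ) (L κ + y * L (suc κ))) ≈ (S₁ L + pt L) + y * (L (suc a) + x * S₁ L)
        left = begin
          hsum x a (λ κ → guard (h ≤ᵇ κ) (L κ + y * L (suc κ)))
            ≈⟨ hsum-cong x a (λ {κ} _ → trans (guard-+ (h ≤ᵇ κ) (L κ) (y * L (suc κ))) (+-congˡ (guard-*ˡ (h ≤ᵇ κ) y (L (suc κ))))) ⟩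
          hsum x a (λ κ → guard (h ≤ᵇ κ) (L κ) + y * guard (h ≤ᵇ κ) (L (suc κ)))
            ≈⟨ trans (hsum-+ x a _ _) (+-cong (split L) (hsum-*ˡ x a y _)) ⟩
          (S₁ L + pt L) + y * hsum x a (λ κ → guard (h ≤ᵇ κ) (L (suc κ)))
            ≈⟨ +-congˡ (*-congˡ (hsum-cong x a λ {κ} _ → reflexive (≡.cong (λ b → guard b (L (suc κ))) (≤ᵇ-suc h κ)))) ⟩
          (S₁ L + pt L) + y * hsum x a ((λ ρ → guard (suc h ≤ᵇ ρ) (L ρ)) ∘ suc)
            ≈⟨ +-congˡ (*-congˡ (sym (hsum-shift x a {λ ρ → guard (suc h ≤ᵇ ρ) (L ρ)} refl))) ⟩
          (S₁ L + pt L) + y * (guard (suc h ≤ᵇ suc a) (L (suc a)) + x * S₁ L)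
            ≈⟨ +-congˡ (*-congˡ (+-congʳ (sym (open-guard (≤ᵇ-true (s≤s h≤a)) (L (suc a)))))) ⟩
          (S₁ L + pt L) + y * (L (suc a) + x * S₁ L) ∎
          where
          ≤ᵇ-suc : ∀ h κ → (h ≤ᵇ κ) ≡ (suc h ≤ᵇ suc κ)
          ≤ᵇ-suc zero    κ = ≡.refl
          ≤ᵇ-suc (suc h) κ = ≡.refl
        S₁-step : (1# + x * y) * S₁ L ≈ S₁ R₀ + S₁ R₁
        S₁-step = trans (sym (hsum-*ˡ x a (1# + x * y) _)) (trans (hsum-cong x a λ {ρ} _ →
          trans (sym (guard-*ˡ (suc h ≤ᵇ ρ) (1# + x * y) (L ρ))) (trans (guard-cong (suc h ≤ᵇ ρ) λ _ → IH ρ) (guard-+ (suc h ≤ᵇ ρ) (R₀ ρ) (R₁ ρ))))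
          (hsum-+ x a _ _))
        pt-step : (1# + x * y) * pt L ≈ pt R₀ + (x * y) * pt R₀
        pt-step = trans (sym (hsum-*ˡ x a (1# + x * y) _)) (trans (hsum-cong x a λ {ρ} _ →
          trans (sym (guard-*ˡ (h ≡ᵇ ρ) (1# + x * y) (L ρ))) (trans (guard-cong (h ≡ᵇ ρ) λ e → trans (IH ρ) (+-congˡ (at-h ρ e)))
            (trans (guard-+ (h ≡ᵇ ρ) (R₀ ρ) ((x * y) * R₀ ρ)) (+-congˡ (guard-*ˡ (h ≡ᵇ ρ) (x * y) (R₀ ρ))))))
          (trans (hsum-+ x a _ _) (+-congˡ (hsum-*ˡ x a (x * y) _))))
          where
          at-h : ∀ ρ → (h ≡ᵇ ρ) ≡ true → R₁ ρ ≈ (x * y) * R₀ ρ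
          at-h ρ e with ℕP.≡ᵇ⇒≡ h ρ (≡.subst Data.Bool.T (≡.sym e) _)
          ... | ≡.refl = first-row h w λ κ → nd h κ

      Σ-bits : ∀ {ℓ} g → Σ (bits (suc ℓ)) g ≈ Σ (bits ℓ) (λ C → g (0 ∷ C)) + Σ (bits ℓ) (λ C → g (1 ∷ C))
      Σ-bits {ℓ} g = trans (Σ-++ (map (0 ∷_) (bits ℓ)) _) (+-cong (Σ-map (0 ∷_) (bits ℓ)) (Σ-map (1 ∷_) (bits ℓ)))

      strips : ∀ {ℓ} → (Vec ℕ ℓ → Carrier) → Vec ℕ ℓ → Carrier
      strips {ℓ} g κ = Σ (bits ℓ) λ C → pow y (vsum C) * g (κ ⊞ C)

      strips-∷ : ∀ {ℓ} (g : Vec ℕ (suc ℓ) → Carrier) a κ → strips g (a ∷ κ) ≈ strips (g ∘ (a ∷_)) κ + y * strips (g ∘ (suc a ∷_)) κ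
      strips-∷ {ℓ} g a κ = trans (Σ-bits {ℓ} _) (+-cong
        (Σ-cong (bits ℓ) λ C → *-congˡ (reflexive (≡.cong (λ b → g (b ∷ (κ ⊞ C))) (ℕP.+-identityʳ a))))
        (trans (Σ-cong (bits ℓ) λ C → trans (*-assoc y _ _) (*-congˡ (*-congˡ (reflexive (≡.cong (λ b → g (b ∷ (κ ⊞ C))) (ℕP.+-comm a 1))))))
               (Σ-*ˡ (bits ℓ) y _)))

      branch-strips : ∀ {ℓ} (v : Vec ℕ ℓ) g → branch x v (strips g) ≈ stripThenBranch v g
      branch-strips []      g = trans (+-identityʳ _) (*-identityˡ (g []))
      branch-strips (a ∷ v) g = hsum-cong x a λ {κ} _ → guard-cong (head₀ v ≤ᵇ κ) λ _ → begin
        branch x v (λ κ′ → strips g (κ ∷ κ′))                                          ≈⟨ branch-cong′ x v (strips-∷ g κ) ⟩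
        branch x v (λ κ′ → strips (g ∘ (κ ∷_)) κ′ + y * strips (g ∘ (suc κ ∷_)) κ′)
          ≈⟨ trans (branch-+ x v _ _) (+-cong (branch-strips v (g ∘ (κ ∷_))) (trans (branch-*ˡ x v y _) (*-congˡ (branch-strips v (g ∘ (suc κ ∷_)))))) ⟩
        stripThenBranch v (g ∘ (κ ∷_)) + y * stripThenBranch v (g ∘ (suc κ ∷_))        ∎

      strips-branch-head : ∀ {ℓ} c a (v : Vec ℕ ℓ) g →
        pow y c * Σ (bits ℓ) (λ C → pow y (vsum C) * branch x (c ℕ.+ a ∷ (v ⊞ C)) g) ≈ branchThenStrip c (a ∷ v) g
      strips-branch-head c a []      g = *-congˡ (trans (+-identityʳ _) (*-identityˡ _))
      strips-branch-head {suc ℓ} c a (b ∷ v) g = *-congˡ (trans (Σ-bits {ℓ} _) (+-cong (half 0) (half 1)))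
        where
        half : ∀ d → Σ (bits ℓ) (λ C → pow y (d ℕ.+ vsum C) * branch x (c ℕ.+ a ∷ b ℕ.+ d ∷ (v ⊞ C)) g)
                   ≈ hsum x (c ℕ.+ a) (λ ρ → guard (d ℕ.+ b ≤ᵇ ρ) (branchThenStrip d (b ∷ v) (g ∘ (ρ ∷_))))
        half d = begin
          Σ (bits ℓ) (λ C → pow y (d ℕ.+ vsum C) * hsum x (c ℕ.+ a) (λ ρ → guard (b ℕ.+ d ≤ᵇ ρ) (branch x (b ℕ.+ d ∷ (v ⊞ C)) (g ∘ (ρ ∷_)))))
            ≈⟨ Σ-cong (bits ℓ) (λ C → hsum-*ˡ x (c ℕ.+ a) (pow y (d ℕ.+ vsum C)) _) ⟨
          Σ (bits ℓ) (λ C → hsum x (c ℕ.+ a) (λ ρ → pow y (d ℕ.+ vsum C) * guard (b ℕ.+ d ≤ᵇ ρ) (branch x (b ℕ.+ d ∷ (v ⊞ C)) (g ∘ (ρ ∷_)))))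
            ≈⟨ hsum-Σ x (c ℕ.+ a) (bits ℓ) _ ⟨
          hsum x (c ℕ.+ a) (λ ρ → Σ (bits ℓ) (λ C → pow y (d ℕ.+ vsum C) * guard (b ℕ.+ d ≤ᵇ ρ) (branch x (b ℕ.+ d ∷ (v ⊞ C)) (g ∘ (ρ ∷_)))))
            ≈⟨ hsum-cong x (c ℕ.+ a) (λ {ρ} _ → begin
              Σ (bits ℓ) (λ C → pow y (d ℕ.+ vsum C) * guard (b ℕ.+ d ≤ᵇ ρ) (branch x (b ℕ.+ d ∷ (v ⊞ C)) (g ∘ (ρ ∷_))))
                ≈⟨ Σ-cong (bits ℓ) (λ C → guard-*ˡ (b ℕ.+ d ≤ᵇ ρ) (pow y (d ℕ.+ vsum C)) _) ⟨
              Σ (bits ℓ) (λ C → guard (b ℕ.+ d ≤ᵇ ρ) (pow y (d ℕ.+ vsum C) * branch x (b ℕ.+ d ∷ (v ⊞ C)) (g ∘ (ρ ∷_))))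
                ≈⟨ Σ-guard (bits ℓ) (b ℕ.+ d ≤ᵇ ρ) _ ⟩
              guard (b ℕ.+ d ≤ᵇ ρ) (Σ (bits ℓ) (λ C → pow y (d ℕ.+ vsum C) * branch x (b ℕ.+ d ∷ (v ⊞ C)) (g ∘ (ρ ∷_))))
                ≈⟨ guard-cong (b ℕ.+ d ≤ᵇ ρ) (λ _ → trans (Σ-cong (bits ℓ) λ C → trans (*-cong (pow-+ d (vsum C)) (reflexive (≡.cong (λ z → branch x (z ∷ (v ⊞ C)) (g ∘ (ρ ∷_))) (ℕP.+-comm b d)))) (*-assoc _ _ _))
                       (trans (Σ-*ˡ (bits ℓ) (pow y d) _) (strips-branch-head d b v (g ∘ (ρ ∷_))))) ⟩
              guard (b ℕ.+ d ≤ᵇ ρ) (branchThenStrip d (b ∷ v) (g ∘ (ρ ∷_)))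
                ≈⟨ reflexive (≡.cong (λ z → guard (z ≤ᵇ ρ) (branchThenStrip d (b ∷ v) (g ∘ (ρ ∷_)))) (ℕP.+-comm b d)) ⟩
              guard (d ℕ.+ b ≤ᵇ ρ) (branchThenStrip d (b ∷ v) (g ∘ (ρ ∷_))) ∎) ⟩
          hsum x (c ℕ.+ a) (λ ρ → guard (d ℕ.+ b ≤ᵇ ρ) (branchThenStrip d (b ∷ v) (g ∘ (ρ ∷_)))) ∎
          where
          pow-+ : ∀ m n → pow y (m ℕ.+ n) ≈ pow y m * pow y n
          pow-+ zero    n = sym (*-identityˡ _)
          pow-+ (suc m) n = trans (*-congˡ (pow-+ m n)) (sym (*-assoc y _ _))

      strips-branch : ∀ {ℓ} (v : Vec ℕ (suc ℓ)) g → strips (λ κ → branch x κ g) v ≈ branchThenStrip 0 v g + branchThenStrip 1 v g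
      strips-branch {ℓ} (a ∷ v) g = trans (strips-∷ (λ κ → branch x κ g) a v) (+-cong
        (trans (sym (*-identityˡ _)) (strips-branch-head 0 a v g))
        (trans (*-congʳ (sym (*-identityʳ y))) (strips-branch-head 1 a v g)))

      supported : ∀ {ℓ} (g : Vec ℕ (suc ℓ) → Carrier) → (∀ {κ} → HasAscent κ → g κ ≈ 0#) → (∀ κ → 0 < lastRow κ → (x * y) * g κ ≈ 0#) → Supported g
      supported {zero}  g bad low a 0<a = low (a ∷ []) 0<a
      supported {suc ℓ} g bad low = (λ a w → bad (here (ℕP.n<1+n a)))
        , λ a → supported (g ∘ (a ∷_)) (λ b → bad (there b)) λ { (b ∷ κ) 0<l → low (a ∷ b ∷ κ) 0<l }

    -- Schur polynomials by iterated branching, so that the Pieri rule can go by induction on the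
    -- variables. Indices that are not weakly decreasing are allowed and give 0, which lets strips
    -- range over all bit vectors.
    schurSum : ∀ {ℓ} N → (Fin N → Carrier) → Vec ℕ ℓ → Carrier
    schurSum zero    xs v = guard (allZero v) 1#
    schurSum (suc N) xs v = branch (xs (fromℕ N)) v (schurSum N (xs ∘ inject₁))

    schurSum-ascent : ∀ {ℓ} N xs {v : Vec ℕ ℓ} → HasAscent v → schurSum N xs v ≈ 0#
    schurSum-ascent zero    xs bad = reflexive (≡.cong (λ b → guard b 1#) (allZero-ascent bad))
      where
      allZero-ascent : ∀ {ℓ} {v : Vec ℕ ℓ} → HasAscent v → allZero v ≡ false
      allZero-ascent {v = zero ∷ suc b ∷ v} (here a<b)  = ≡.refl
      allZero-ascent {v = suc a ∷ b ∷ v}    (here a<b)  = ≡.refl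
      allZero-ascent {v = zero ∷ v}         (there bad) = allZero-ascent bad
      allZero-ascent {v = suc a ∷ v}        (there bad) = ≡.refl
    schurSum-ascent (suc N) xs bad = branch-ascent (xs (fromℕ N)) bad

    elementary : ∀ N → (Fin N → Carrier) → Carrier → Carrier
    elementary zero    xs y = 1#
    elementary (suc N) xs y = (1# + xs (fromℕ N) * y) * elementary N (xs ∘ inject₁) y

    module _ {ℓ : ℕ} (Variable : Carrier → Set)
             (bottom : ∀ N {x} {xs : Fin N → Carrier} → Variable x → (∀ i → Variable (xs i)) →
                       ∀ {κ : Vec ℕ (suc ℓ)} → Dominant (head₀ κ) κ → 0 < lastRow κ → x * schurSum N xs κ ≈ 0#) where

      -- Branching reduces to the rule for one variable less, and `commutation` moves the strip out
      -- of the branching at the cost of the factor `1# + x * y`, the one that the last variable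
      -- contributes to `elementary`. The assumption `bottom` supplies the boundary condition at the
      -- last row.
      pieri : ∀ N {xs} y → (∀ i → Variable (xs i)) → {μ : Vec ℕ (suc ℓ)} → Dominant (head₀ μ) μ →
              elementary N xs y * schurSum N xs μ ≈ Local.strips 0# y (schurSum N xs) μ
      pieri zero    y vars {μ} d = trans (*-identityˡ _) (base μ)
        where
        base : ∀ {ℓ} (μ : Vec ℕ ℓ) → guard (allZero μ) 1# ≈ Local.strips 0# y (λ v → guard (allZero v) 1#) μ
        base []          = sym (trans (+-identityʳ _) (*-identityʳ _))
        base {suc ℓ} (zero ∷ μ)  = sym (trans (Local.strips-∷ 0# y (λ v → guard (allZero v) 1#) 0 μ)
          (trans (+-cong (sym (base μ)) (trans (*-congˡ (Σ-zero (bits ℓ) λ _ → zeroʳ _)) (zeroʳ y))) (+-identityʳ _)))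
        base {suc ℓ} (suc a ∷ μ) = sym (trans (Local.strips-∷ 0# y (λ v → guard (allZero v) 1#) (suc a) μ)
          (trans (+-cong (Σ-zero (bits ℓ) λ _ → zeroʳ _) (trans (*-congˡ (Σ-zero (bits ℓ) λ _ → zeroʳ _)) (zeroʳ y))) (+-identityʳ 0#)))
      pieri (suc N) {xs} y vars {μ} d = begin
        ((1# + x * y) * elementary N xs′ y) * branch x μ (schurSum N xs′)
          ≈⟨ *-assoc _ _ _ ⟩
        (1# + x * y) * (elementary N xs′ y * branch x μ (schurSum N xs′))
          ≈⟨ *-congˡ (branch-*ˡ x μ (elementary N xs′ y) (schurSum N xs′)) ⟨
        (1# + x * y) * branch x μ (λ κ → elementary N xs′ y * schurSum N xs′ κ)
          ≈⟨ *-congˡ (branch-cong x d λ {κ} dκ → pieri N y (λ i → vars (inject₁ i)) (tighten dκ)) ⟩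
        (1# + x * y) * branch x μ (strips (schurSum N xs′))
          ≈⟨ *-congˡ (branch-strips μ (schurSum N xs′)) ⟩
        (1# + x * y) * stripThenBranch μ (schurSum N xs′)
          ≈⟨ commutation d (supported (schurSum N xs′) (schurSum-ascent N xs′) low) ⟩
        branchThenStrip 0 μ (schurSum N xs′) + branchThenStrip 1 μ (schurSum N xs′)
          ≈⟨ strips-branch μ (schurSum N xs′) ⟨
        strips (schurSum (suc N) xs) μ ∎
        where
        x = xs (fromℕ N)
        xs′ = xs ∘ inject₁
        open Local x y
        tighten : ∀ {ℓ p} {κ : Vec ℕ ℓ} → Dominant p κ → Dominant (head₀ κ) κ
        tighten []      = []
        tighten (_ ∷ d) = ℕP.≤-refl ∷ d
        low : ∀ κ → 0 < lastRow κ → (x * y) * schurSum N xs′ κ ≈ 0#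
        low κ 0<l with dominant-or-ascent κ
        ... | inj₂ bad = trans (*-congˡ (schurSum-ascent N xs′ bad)) (zeroʳ _)
        ... | inj₁ dom = begin
          (x * y) * schurSum N xs′ κ   ≈⟨ solve 3 (λ x y s → (x :* y) :* s := y :* (x :* s)) refl x y (schurSum N xs′ κ) ⟩
          y * (x * schurSum N xs′ κ)   ≈⟨ *-congˡ (bottom N (vars (fromℕ N)) (λ i → vars (inject₁ i)) dom 0<l) ⟩
          y * 0#                       ≈⟨ zeroʳ y ⟩
          0#                           ∎

-- Semistandard tableaux and the branching rule.

module TableauBranching where

  open import Defs using (words; fillings; rowOK; colOK; isSSYT)
  open BenderKnuth using (≤ᵇ-true; ≤ᵇ-false)
  open ListSums
  open PieriRule
  open StripWalks using (head₀)
  open import Algebra.Bundles using (CommutativeSemiring)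
  open import Data.Bool using (Bool; true; false; _∧_)
  open import Data.Bool.Properties using (∧-assoc)
  open import Data.Nat as ℕ using (ℕ; zero; suc; _≤_; _<_; _≤ᵇ_; _<ᵇ_)
  import Data.Nat.Properties as ℕP
  open import Data.Fin using (Fin; zero; suc; fromℕ; inject₁; toℕ)
  open import Data.Fin.Properties using (toℕ-inject₁; toℕ-fromℕ; toℕ<n)
  open import Data.List using (List; []; _∷_; _++_; map; replicate; length; tabulate; allFin; filterᵇ)
  open import Data.Vec using (Vec; []; _∷_; toList)
  open import Function using (_∘_; id)
  open import Relation.Nullary using (contradiction)
  open import Level using (0ℓ)
  open import Relation.Binary.PropositionalEquality as ≡ using (_≡_)

  <ᵇ-true : ∀ {a b} → a < b → (a <ᵇ b) ≡ true
  <ᵇ-true {a} {b} lt with a <ᵇ b | ℕP.<⇒<ᵇ lt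
  ... | true | _ = ≡.refl

  <ᵇ-false : ∀ {a b} → b ≤ a → (a <ᵇ b) ≡ false
  <ᵇ-false {a} {b} le with a <ᵇ b in e
  ... | false = ≡.refl
  ... | true  = contradiction (ℕP.<ᵇ⇒< a b (≡.subst Data.Bool.T (≡.sym e) _)) (ℕP.≤⇒≯ le)

  module _ {N : ℕ} where

    top : Fin (suc N)
    top = fromℕ N

    inject-< : ∀ (a : Fin N) → toℕ (inject₁ a) < toℕ top
    inject-< a = ≡.subst₂ _<_ (≡.sym (toℕ-inject₁ a)) (≡.sym (toℕ-fromℕ N)) (toℕ<n a)

    -- Every weakly increasing row over `suc N` letters arises once in this way: its smaller letters
    -- followed by copies of the largest.
    extend : ℕ → List (Fin N) → List (Fin (suc N))
    extend k r = map inject₁ r ++ replicate k top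

    headOK : ∀ {M} → Fin M → List (Fin M) → Bool
    headOK a []      = true
    headOK a (b ∷ r) = toℕ a ≤ᵇ toℕ b

    rowOK-∷ : ∀ {M} (a : Fin M) r → rowOK (a ∷ r) ≡ headOK a r ∧ rowOK r
    rowOK-∷ a []      = ≡.refl
    rowOK-∷ a (b ∷ r) = ≡.refl

    headOK-extend : ∀ a k r → headOK (inject₁ a) (extend k r) ≡ headOK a r
    headOK-extend a zero    []      = ≡.refl
    headOK-extend a (suc k) []      = ≤ᵇ-true (ℕP.<⇒≤ (inject-< a))
    headOK-extend a k       (b ∷ r) = ≡.cong₂ _≤ᵇ_ (toℕ-inject₁ a) (toℕ-inject₁ b)

    -- An entry below the largest letter is impossible, so the whole lower row must fit under the
    -- smaller letters of the upper row: this is the interlacing condition.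
    colOK-extend : ∀ j k (p r : List (Fin N)) → colOK (extend j p) (extend k r) ≡ colOK p r ∧ (length r ℕ.+ k ≤ᵇ length p)
    colOK-extend j       zero    []      []      = colOK-[] (extend j [])
      where
      colOK-[] : ∀ {M} (r : List (Fin M)) → colOK r [] ≡ true
      colOK-[] []      = ≡.refl
      colOK-[] (a ∷ r) = ≡.refl
    colOK-extend j       zero    (a ∷ p) []      = ≡.refl
    colOK-extend zero    (suc k) []      []      = ≡.refl
    colOK-extend (suc j) (suc k) []      []      = ≡.cong (_∧ colOK (replicate j top) (replicate k top)) (<ᵇ-false (ℕP.≤-refl {toℕ top}))
    colOK-extend j       (suc k) (a ∷ p) []      = ≡.trans (≡.cong₂ _∧_ (<ᵇ-true (inject-< a)) (colOK-extend j k p []))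
                                                           (≡.cong₂ _∧_ (col p) (suc≤ k (length p)))
      where
      col : ∀ {M} (p : List (Fin M)) → colOK p [] ≡ true
      col []      = ≡.refl
      col (a ∷ p) = ≡.refl
      suc≤ : ∀ m n → (m ≤ᵇ n) ≡ (suc m ≤ᵇ suc n)
      suc≤ zero    n = ≡.refl
      suc≤ (suc m) n = ≡.refl
    colOK-extend zero    k       []      (b ∷ r) = ≡.refl
    colOK-extend (suc j) k       []      (b ∷ r) = ≡.cong (_∧ colOK (replicate j top) (extend k r)) (<ᵇ-false (ℕP.<⇒≤ (inject-< b)))
    colOK-extend j       k       (a ∷ p) (b ∷ r) = ≡.trans (≡.cong₂ _∧_ (≡.cong₂ _<ᵇ_ (toℕ-inject₁ a) (toℕ-inject₁ b)) (colOK-extend j k p r))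
      (≡.trans (≡.sym (∧-assoc (toℕ a <ᵇ toℕ b) (colOK p r) _)) (≡.cong (((toℕ a <ᵇ toℕ b) ∧ colOK p r) ∧_) (suc≤ (length r ℕ.+ k) (length p))))
      where
      suc≤ : ∀ m n → (m ≤ᵇ n) ≡ (suc m ≤ᵇ suc n)
      suc≤ zero    n = ≡.refl
      suc≤ (suc m) n = ≡.refl

  module Tableaux (R : CommutativeSemiring 0ℓ 0ℓ) where

    open CommutativeSemiring R
    open ListSum R
    open Schur R
    open import Relation.Binary.Reasoning.Setoid setoid

    antidiag : ℕ → (ℕ → ℕ → Carrier) → Carrier
    antidiag zero    h = h 0 0
    antidiag (suc m) h = h 0 (suc m) + antidiag m (λ a b → h (suc a) b)

    antidiag-cong : ∀ m {h g} → (∀ a b → a ℕ.+ b ≡ m → h a b ≈ g a b) → antidiag m h ≈ antidiag m g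
    antidiag-cong zero    eq = eq 0 0 ≡.refl
    antidiag-cong (suc m) eq = +-cong (eq 0 (suc m) ≡.refl) (antidiag-cong m λ a b e → eq (suc a) b (≡.cong suc e))

    antidiag-last : ∀ m h → antidiag (suc m) h ≈ antidiag m (λ a b → h a (suc b)) + h (suc m) 0
    antidiag-last zero    h = refl
    antidiag-last (suc m) h = trans (+-congˡ (antidiag-last m (λ a b → h (suc a) b))) (sym (+-assoc _ _ _))

    antidiag-*ˡ : ∀ m c h → antidiag m (λ a b → c * h a b) ≈ c * antidiag m h
    antidiag-*ˡ zero    c h = refl
    antidiag-*ˡ (suc m) c h = trans (+-congˡ (antidiag-*ˡ m c (λ a b → h (suc a) b))) (sym (distribˡ c _ _))

    antidiag-Σ : ∀ {A : Set} m (xs : List A) (h : ℕ → ℕ → A → Carrier) → antidiag m (λ a b → Σ xs (h a b)) ≈ Σ xs (λ x → antidiag m (λ a b → h a b x))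
    antidiag-Σ zero    xs h = refl
    antidiag-Σ (suc m) xs h = trans (+-congˡ (antidiag-Σ m xs (λ a b → h (suc a) b))) (sym (Σ-+ xs _ _))

    antidiag-hsum : ∀ x m f → antidiag m (λ a b → pow x b * f a) ≈ hsum x m f
    antidiag-hsum x zero    f = *-identityˡ (f 0)
    antidiag-hsum x (suc m) f = begin
      antidiag (suc m) (λ a b → pow x b * f a)                        ≈⟨ antidiag-last m (λ a b → pow x b * f a) ⟩
      antidiag m (λ a b → x * pow x b * f a) + 1# * f (suc m)
        ≈⟨ +-cong (trans (antidiag-cong m λ a b _ → *-assoc x (pow x b) (f a)) (trans (antidiag-*ˡ m x _) (*-congˡ (antidiag-hsum x m f)))) (*-identityˡ _) ⟩
      x * hsum x m f + f (suc m)                                      ≈⟨ +-comm _ _ ⟩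
      hsum x (suc m) f                                                ∎

    Σ-tabulate-last : ∀ {A : Set} {N} (g : Fin (suc N) → A) f →
                      Σ (tabulate g) f ≈ Σ (tabulate (g ∘ inject₁)) f + f (g (fromℕ N))
    Σ-tabulate-last {N = zero}  g f = +-comm _ _
    Σ-tabulate-last {N = suc N} g f = trans (+-congˡ (Σ-tabulate-last (g ∘ suc) f)) (sym (+-assoc _ _ _))

    Σ-tabulate : ∀ {A : Set} {N} (g : Fin N → A) f → Σ (tabulate g) f ≈ Σ (allFin N) (f ∘ g)
    Σ-tabulate {N = zero}  g f = refl
    Σ-tabulate {N = suc N} g f = +-congˡ (trans (Σ-tabulate (g ∘ suc) f) (sym (Σ-tabulate suc (f ∘ g))))

    Σ-allFin : ∀ N f → Σ (allFin (suc N)) f ≈ Σ (allFin N) (f ∘ inject₁) + f (fromℕ N)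
    Σ-allFin N f = trans (Σ-tabulate-last id f) (+-congʳ (Σ-tabulate inject₁ f))

    rowWeight : ∀ {N} → (Fin N → Carrier) → List (Fin N) → Carrier
    rowWeight xs []      = 1#
    rowWeight xs (i ∷ r) = xs i * rowWeight xs r

    weightOf : ∀ {N} → (Fin N → Carrier) → List (List (Fin N)) → Carrier
    weightOf xs []      = 1#
    weightOf xs (r ∷ T) = rowWeight xs r * weightOf xs T

    rowWeight-extend : ∀ {N} (xs : Fin (suc N) → Carrier) k r → rowWeight xs (extend k r) ≈ rowWeight (xs ∘ inject₁) r * pow (xs (fromℕ N)) k
    rowWeight-extend xs zero    []      = sym (*-identityˡ _)
    rowWeight-extend xs (suc k) []      = trans (*-congˡ (trans (rowWeight-extend xs k []) (*-identityˡ _))) (sym (*-identityˡ _))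
    rowWeight-extend xs k       (i ∷ r) = trans (*-congˡ (rowWeight-extend xs k r)) (sym (*-assoc _ _ _))

    -- The sum over the tableaux with row lengths ls whose first row satisfies c.
    rowsFrom : ∀ N → (Fin N → Carrier) → (List (Fin N) → Bool) → List ℕ → Carrier
    rowsFrom N xs c []       = 1#
    rowsFrom N xs c (l ∷ ls) = Σ (words N l) λ r → guard (rowOK r) (guard (c r) (rowWeight xs r * rowsFrom N xs (colOK r) ls))

    rowsFrom-fillings : ∀ N xs ls → Σ (filterᵇ isSSYT (fillings N ls)) (weightOf xs) ≈ rowsFrom N xs (λ _ → true) ls
    rowsFrom-fillings N xs ls = trans (Σ-filter isSSYT (fillings N ls)) (first ls)
      where
      below : ∀ r ls → Σ (fillings N ls) (λ T → guard (isSSYT (r ∷ T)) (weightOf xs T)) ≈ guard (rowOK r) (rowsFrom N xs (colOK r) ls)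
      below r []       = +-identityʳ _
      below r (l ∷ ls) = begin
        Σ (fillings N (l ∷ ls)) (λ T → guard (isSSYT (r ∷ T)) (weightOf xs T))
          ≈⟨ Σ-cartesian _∷_ (words N l) (fillings N ls) ⟩
        Σ (words N l) (λ r′ → Σ (fillings N ls) (λ T → guard (rowOK r ∧ colOK r r′ ∧ isSSYT (r′ ∷ T)) (rowWeight xs r′ * weightOf xs T)))
          ≈⟨ Σ-cong (words N l) (λ r′ → trans
               (Σ-cong (fillings N ls) λ T → trans (guard-∧ (rowOK r) _ _) (guard-cong (rowOK r) λ _ → trans (guard-∧ (colOK r r′) _ _)
                  (guard-cong (colOK r r′) λ _ → guard-*ˡ (isSSYT (r′ ∷ T)) (rowWeight xs r′) (weightOf xs T))))
               (trans (Σ-guard (fillings N ls) (rowOK r) _) (guard-cong (rowOK r) λ _ → trans (Σ-guard (fillings N ls) (colOK r r′) _)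
                  (trans (guard-cong (colOK r r′) λ _ → trans (Σ-*ˡ (fillings N ls) (rowWeight xs r′) _) (trans (*-congˡ (below r′ ls)) (sym (guard-*ˡ (rowOK r′) _ _))))
                         (guard-swap (colOK r r′) (rowOK r′) _))))) ⟩
        Σ (words N l) (λ r′ → guard (rowOK r) (guard (rowOK r′) (guard (colOK r r′) (rowWeight xs r′ * rowsFrom N xs (colOK r′) ls))))
          ≈⟨ Σ-guard (words N l) (rowOK r) _ ⟩
        guard (rowOK r) (rowsFrom N xs (colOK r) (l ∷ ls)) ∎
      first : ∀ ls → Σ (fillings N ls) (λ T → guard (isSSYT T) (weightOf xs T)) ≈ rowsFrom N xs (λ _ → true) ls
      first []       = +-identityʳ _
      first (l ∷ ls) = trans (Σ-cartesian _∷_ (words N l) (fillings N ls)) (Σ-cong (words N l) λ r → trans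
        (Σ-cong (fillings N ls) λ T → guard-*ˡ (isSSYT (r ∷ T)) (rowWeight xs r) (weightOf xs T))
        (trans (Σ-*ˡ (fillings N ls) (rowWeight xs r) _) (trans (*-congˡ (below r ls)) (sym (guard-*ˡ (rowOK r) _ _)))))

    row-split : ∀ N l (F : List (Fin (suc N)) → Carrier) →
      Σ (words (suc N) l) (λ r → guard (rowOK r) (F r)) ≈ antidiag l (λ ρ k → Σ (words N ρ) (λ r → guard (rowOK r) (F (extend k r))))
    row-split N zero    F = refl
    row-split N (suc l) F = begin
      Σ (words (suc N) (suc l)) (λ r → guard (rowOK r) (F r))
        ≈⟨ Σ-cartesian _∷_ (allFin (suc N)) (words (suc N) l) ⟩
      Σ (allFin (suc N)) (λ a → Σ (words (suc N) l) (λ w → guard (rowOK (a ∷ w)) (F (a ∷ w))))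
        ≈⟨ Σ-allFin N _ ⟩
      Σ (allFin N) (λ a → Σ (words (suc N) l) (λ w → guard (rowOK (inject₁ a ∷ w)) (F (inject₁ a ∷ w)))) + Σ (words (suc N) l) (λ w → guard (rowOK (top {N} ∷ w)) (F (top ∷ w)))
        ≈⟨ trans (+-cong (Σ-cong (allFin N) low) (trans (high l (λ w → F (top ∷ w))) (sym (+-identityʳ _)))) (+-comm _ _) ⟩
      (F (replicate (suc l) top) + 0#) + Σ (allFin N) (λ a → antidiag l (λ ρ k → Σ (words N ρ) (λ r → guard (rowOK (a ∷ r)) (F (extend k (a ∷ r))))))
        ≈⟨ +-congˡ (trans (sym (antidiag-Σ l (allFin N) _)) (antidiag-cong l λ ρ k _ → sym (Σ-cartesian _∷_ (allFin N) (words N ρ)))) ⟩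
      antidiag (suc l) (λ ρ k → Σ (words N ρ) (λ r → guard (rowOK r) (F (extend k r)))) ∎
      where
      low : ∀ a → Σ (words (suc N) l) (λ w → guard (rowOK (inject₁ a ∷ w)) (F (inject₁ a ∷ w)))
                ≈ antidiag l (λ ρ k → Σ (words N ρ) (λ r → guard (rowOK (a ∷ r)) (F (extend k (a ∷ r)))))
      low a = begin
        Σ (words (suc N) l) (λ w → guard (rowOK (inject₁ a ∷ w)) (F (inject₁ a ∷ w)))
          ≈⟨ Σ-cong (words (suc N) l) (λ w → trans (reflexive (≡.cong (λ b → guard b (F (inject₁ a ∷ w))) (rowOK-∷ {N} (inject₁ a) w)))
               (trans (guard-∧ (headOK {N} (inject₁ a) w) (rowOK w) _) (guard-swap (headOK {N} (inject₁ a) w) (rowOK w) _))) ⟩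
        Σ (words (suc N) l) (λ w → guard (rowOK w) (guard (headOK {N} (inject₁ a) w) (F (inject₁ a ∷ w))))
          ≈⟨ row-split N l _ ⟩
        antidiag l (λ ρ k → Σ (words N ρ) (λ r → guard (rowOK r) (guard (headOK {N} (inject₁ a) (extend k r)) (F (inject₁ a ∷ extend k r)))))
          ≈⟨ antidiag-cong l (λ ρ k _ → Σ-cong (words N ρ) λ r → trans (guard-cong (rowOK r) λ _ → reflexive (≡.cong (λ b → guard b (F (extend k (a ∷ r)))) (headOK-extend a k r)))
               (trans (guard-swap (rowOK r) (headOK {N} a r) _) (trans (sym (guard-∧ (headOK {N} a r) (rowOK r) _)) (reflexive (≡.cong (λ b → guard b (F (extend k (a ∷ r)))) (≡.sym (rowOK-∷ {N} a r))))))) ⟩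
        antidiag l (λ ρ k → Σ (words N ρ) (λ r → guard (rowOK (a ∷ r)) (F (extend k (a ∷ r))))) ∎
      -- After the largest letter a weakly increasing word is constant.
      high : ∀ l (G : List (Fin (suc N)) → Carrier) → Σ (words (suc N) l) (λ w → guard (rowOK (top {N} ∷ w)) (G w)) ≈ G (replicate l top)
      high zero    G = +-identityʳ _
      high (suc l) G = begin
        Σ (words (suc N) (suc l)) (λ w → guard (rowOK (top {N} ∷ w)) (G w))
          ≈⟨ Σ-cartesian _∷_ (allFin (suc N)) (words (suc N) l) ⟩
        Σ (allFin (suc N)) (λ a → Σ (words (suc N) l) (λ w → guard ((toℕ (top {N}) ≤ᵇ toℕ a) ∧ rowOK (a ∷ w)) (G (a ∷ w))))
          ≈⟨ Σ-allFin N _ ⟩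
        Σ (allFin N) (λ a → Σ (words (suc N) l) (λ w → guard ((toℕ (top {N}) ≤ᵇ toℕ (inject₁ a)) ∧ rowOK (inject₁ a ∷ w)) (G (inject₁ a ∷ w))))
          + Σ (words (suc N) l) (λ w → guard ((toℕ (top {N}) ≤ᵇ toℕ (top {N})) ∧ rowOK (top {N} ∷ w)) (G (top ∷ w)))
          ≈⟨ +-cong (Σ-zero (allFin N) λ {a} _ → Σ-zero (words (suc N) l) λ {w} _ → reflexive (≡.cong (λ b → guard (b ∧ rowOK (inject₁ a ∷ w)) (G (inject₁ a ∷ w))) (≤ᵇ-false (inject-< a))))
                    (Σ-cong (words (suc N) l) λ w → reflexive (≡.cong (λ b → guard (b ∧ rowOK (top {N} ∷ w)) (G (top ∷ w))) (≤ᵇ-true (ℕP.≤-refl {toℕ (top {N})})))) ⟩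
        0# + Σ (words (suc N) l) (λ w → guard (rowOK (top {N} ∷ w)) (G (top ∷ w)))  ≈⟨ +-identityˡ _ ⟩
        Σ (words (suc N) l) (λ w → guard (rowOK (top {N} ∷ w)) (G (top ∷ w)))       ≈⟨ high l (λ w → G (top ∷ w)) ⟩
        G (replicate (suc l) top) ∎

    branch-Σ : ∀ {A : Set} {ℓ} x (v : Vec ℕ ℓ) (xs : List A) (g : A → Vec ℕ ℓ → Carrier) → branch x v (λ κ → Σ xs (λ r → g r κ)) ≈ Σ xs (λ r → branch x v (g r))
    branch-Σ x v []       g = branch-zero x v λ _ → refl
    branch-Σ x v (r ∷ xs) g = trans (branch-+ x v _ _) (+-congˡ (branch-Σ x v xs g))

    branch-guard : ∀ {ℓ} x (v : Vec ℕ ℓ) b g → branch x v (λ κ → guard b (g κ)) ≈ guard b (branch x v g)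
    branch-guard x v true  g = refl
    branch-guard x v false g = branch-zero x v λ _ → refl

    length-words : ∀ {N} ρ {F G : List (Fin N) → Carrier} → (∀ r → length r ≡ ρ → F r ≈ G r) → Σ (words N ρ) F ≈ Σ (words N ρ) G
    length-words {N} zero    eq = +-congʳ (eq [] ≡.refl)
    length-words {N} (suc ρ) eq = trans (Σ-cartesian _∷_ (allFin N) (words N ρ)) (trans
      (Σ-cong (allFin N) λ a → length-words ρ λ r e → eq (a ∷ r) (≡.cong suc e)) (sym (Σ-cartesian _∷_ (allFin N) (words N ρ))))

    module _ {N : ℕ} (xs : Fin (suc N) → Carrier) where

      private
        x = xs (fromℕ N)
        xs′ = xs ∘ inject₁

      -- Serves the first row and the rows below at once: `c′` is what the constraint `c` says about
      -- the smaller letters, and `b` is the interlacing condition it leaves behind.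
      row-step : ∀ {ℓ} a (v : Vec ℕ ℓ) (c : List (Fin (suc N)) → Bool) (c′ : List (Fin N) → Bool) b →
        (∀ k r → length r ℕ.+ k ≡ a → c (extend k r) ≡ c′ r ∧ b) →
        (∀ k r → rowsFrom (suc N) xs (colOK (extend k r)) (toList v) ≈ guard (head₀ v ≤ᵇ length r) (branch x v (λ κ → rowsFrom N xs′ (colOK r) (toList κ)))) →
        rowsFrom (suc N) xs c (a ∷ toList v) ≈ guard b (branch x (a ∷ v) (λ κ → rowsFrom N xs′ c′ (toList κ)))
      row-step a v c c′ b c-extend IH = begin
        Σ (words (suc N) a) (λ r → guard (rowOK r) (guard (c r) (rowWeight xs r * rowsFrom (suc N) xs (colOK r) (toList v))))
          ≈⟨ row-split N a _ ⟩
        antidiag a (λ ρ k → Σ (words N ρ) (λ r → guard (rowOK r) (guard (c (extend k r)) (rowWeight xs (extend k r) * rowsFrom (suc N) xs (colOK (extend k r)) (toList v)))))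
          ≈⟨ antidiag-cong a (λ ρ k e → trans (length-words ρ λ r le → term ρ k r le e) (pull ρ k)) ⟩
        antidiag a (λ ρ k → pow x k * guard b (f ρ))
          ≈⟨ antidiag-hsum x a _ ⟩
        hsum x a (λ ρ → guard b (f ρ))
          ≈⟨ hsum-guard b ⟩
        guard b (hsum x a f)
          ≈⟨ guard-cong b (λ _ → hsum-cong x a λ {ρ} _ → guard-cong (head₀ v ≤ᵇ ρ) λ _ → sym (branch-Σ x v (words N ρ) _)) ⟩
        guard b (branch x (a ∷ v) (λ κ → rowsFrom N xs′ c′ (toList κ))) ∎
        where
        inner : List (Fin N) → Carrier
        inner r = branch x v (λ κ → guard (rowOK r) (guard (c′ r) (rowWeight xs′ r * rowsFrom N xs′ (colOK r) (toList κ))))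
        f : ℕ → Carrier
        f ρ = guard (head₀ v ≤ᵇ ρ) (Σ (words N ρ) inner)
        hsum-guard : ∀ b → hsum x a (λ ρ → guard b (f ρ)) ≈ guard b (hsum x a f)
        hsum-guard true  = refl
        hsum-guard false = hsum-zero x a λ _ → refl
        term : ∀ ρ k r → length r ≡ ρ → ρ ℕ.+ k ≡ a →
               guard (rowOK r) (guard (c (extend k r)) (rowWeight xs (extend k r) * rowsFrom (suc N) xs (colOK (extend k r)) (toList v)))
               ≈ pow x k * guard b (guard (head₀ v ≤ᵇ ρ) (inner r))
        term ρ k r ≡.refl e = begin
          guard (rowOK r) (guard (c (extend k r)) (rowWeight xs (extend k r) * rowsFrom (suc N) xs (colOK (extend k r)) (toList v)))
            ≈⟨ guard-cong (rowOK r) (λ _ → trans (reflexive (≡.cong (λ d → guard d _) (c-extend k r e))) (trans (guard-∧ (c′ r) b _)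
                 (guard-cong (c′ r) λ _ → guard-cong b λ _ → *-cong (rowWeight-extend xs k r) (IH k r)))) ⟩
          guard (rowOK r) (guard (c′ r) (guard b ((w * pow x k) * guard h br)))
            ≈⟨ guard-cong (rowOK r) (λ _ → guard-cong (c′ r) λ _ → guard-cong b λ _ → trans (*-congʳ (*-comm w (pow x k))) (trans (*-assoc (pow x k) w _)
                 (*-congˡ (trans (sym (guard-*ˡ h w br)) (guard-cong h λ _ → sym (branch-*ˡ x v w _)))))) ⟩
          guard (rowOK r) (guard (c′ r) (guard b (pow x k * guard h (branch x v (λ κ → w * rowsFrom N xs′ (colOK r) (toList κ))))))
            ≈⟨ trans (guard-cong (rowOK r) λ _ → trans (guard-cong (c′ r) λ _ → guard-*ˡ b (pow x k) _) (guard-*ˡ (c′ r) (pow x k) _)) (guard-*ˡ (rowOK r) (pow x k) _) ⟩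
          pow x k * guard (rowOK r) (guard (c′ r) (guard b (guard h (branch x v (λ κ → w * rowsFrom N xs′ (colOK r) (toList κ))))))
            ≈⟨ *-congˡ (trans (guard-cong (rowOK r) λ _ → trans (guard-swap (c′ r) b _) (guard-cong b λ _ → guard-swap (c′ r) h _))
                 (trans (guard-swap (rowOK r) b _) (guard-cong b λ _ → trans (guard-swap (rowOK r) h _) (guard-cong h λ _ →
                   trans (guard-cong (rowOK r) λ _ → sym (branch-guard x v (c′ r) _)) (sym (branch-guard x v (rowOK r) _)))))) ⟩
          pow x k * guard b (guard h (inner r)) ∎
          where
          w = rowWeight xs′ r
          h = head₀ v ≤ᵇ length r
          br = branch x v (λ κ → rowsFrom N xs′ (colOK r) (toList κ))
        pull : ∀ ρ k → Σ (words N ρ) (λ r → pow x k * guard b (guard (head₀ v ≤ᵇ ρ) (inner r))) ≈ pow x k * guard b (f ρ)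
        pull ρ k = trans (Σ-*ˡ (words N ρ) (pow x k) _) (*-congˡ (trans (Σ-guard (words N ρ) b _) (guard-cong b λ _ → Σ-guard (words N ρ) (head₀ v ≤ᵇ ρ) _)))

      rowsFrom-column : ∀ {ℓ} (v : Vec ℕ ℓ) k r →
        rowsFrom (suc N) xs (colOK (extend k r)) (toList v) ≈ guard (head₀ v ≤ᵇ length r) (branch x v (λ κ → rowsFrom N xs′ (colOK r) (toList κ)))
      rowsFrom-column []      k r = refl
      rowsFrom-column (a ∷ v) k r = row-step a v (colOK (extend k r)) (colOK r) (a ≤ᵇ length r)
        (λ j s e → ≡.trans (colOK-extend k j r s) (≡.cong (λ z → colOK r s ∧ (z ≤ᵇ length r)) e)) (rowsFrom-column v)

      rowsFrom-first : ∀ {ℓ} (v : Vec ℕ ℓ) →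
        rowsFrom (suc N) xs (λ _ → true) (toList v) ≈ branch x v (λ κ → rowsFrom N xs′ (λ _ → true) (toList κ))
      rowsFrom-first []      = refl
      rowsFrom-first (a ∷ v) = row-step a v (λ _ → true) (λ _ → true) true (λ _ _ _ → ≡.refl) (rowsFrom-column v)

    rowsFrom-schurSum : ∀ {ℓ} N xs (v : Vec ℕ ℓ) → rowsFrom N xs (λ _ → true) (toList v) ≈ schurSum N xs v
    rowsFrom-schurSum zero    xs v = none (λ _ → true) ≡.refl v
      where
      none : ∀ {ℓ} c → c [] ≡ true → (v : Vec ℕ ℓ) → rowsFrom 0 xs c (toList v) ≈ guard (allZero v) 1#
      none c e []          = refl
      none c e (zero ∷ v)  = trans (+-identityʳ _) (trans (reflexive (≡.cong (λ b → guard b (1# * rowsFrom 0 xs (colOK []) (toList v))) e)) (trans (*-identityˡ _) (none (colOK []) ≡.refl v)))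
      none c e (suc a ∷ v) = refl
    rowsFrom-schurSum (suc N) xs v = trans (rowsFrom-first xs v) (branch-cong′ (xs (fromℕ N)) v (rowsFrom-schurSum N (xs ∘ inject₁)))

-- Walks are the chains on which the operators act.

module ChainsOfShapes where

  open BenderKnuth using (Dominant; []; _∷_; module Nat)
  open ListSums
  open Arrays
  open RaisingAndLowering
  open PrincipalTriple
  open UnimodalCounts
  open VerticalStrips
  open StripWalks
  open Division
  open import Algebra.Bundles using (CommutativeSemiring)
  open import Level using (0ℓ)
  open import Data.Bool using (Bool; true; false; T; T?)
  open import Data.Nat using (ℕ; zero; suc; _+_; _*_; _∸_; _≤_; _<_; z≤n; s≤s; _≡ᵇ_; _%_)
  import Data.Nat.Properties as ℕP
  open import Data.Nat.Tactic.RingSolver using (solve-∀)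
  open import Data.Vec using (Vec; []; _∷_; replicate)
  open import Data.Vec.Properties using (≡-dec; ∷-injectiveˡ; ∷-injectiveʳ)
  open import Data.List using (List; []; _∷_; map; filterᵇ; filter; length)
  open import Data.List.Membership.Propositional using (_∈_; find)
  open import Data.List.Membership.Propositional.Properties using (∈-++⁺ˡ; ∈-++⁺ʳ; ∈-map⁺; ∈-map⁻; ∈-concatMap⁺; ∈-concatMap⁻; ∈-filter⁺; ∈-filter⁻)
  open import Data.List.Relation.Unary.Any as Any using (here; there)
  open import Data.List.Relation.Unary.All as All using (All; [])
  import Data.List.Relation.Unary.All.Properties as AllP
  open import Data.List.Relation.Unary.AllPairs as AllPairs using ([]; _∷_)
  import Data.List.Relation.Unary.AllPairs.Properties as AllPairsP
  open import Data.List.Relation.Unary.Unique.Propositional using (Unique)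
  open import Data.List.Relation.Unary.Unique.Propositional.Properties using (map⁺; ++⁺; concat⁺; filter⁺)
  open import Data.Sum using (_⊎_; inj₁; inj₂)
  open import Data.Product using (_,_; _×_; ∃-syntax; proj₂)
  open import Relation.Nullary using (¬_; yes; no; contradiction; does)
  open import Relation.Binary.PropositionalEquality
  open ≡-Reasoning
  open Nat using (guard)

  zeros : ∀ {ℓ} → Vec ℕ ℓ
  zeros {ℓ} = replicate ℓ 0

  at-⊞ : ∀ {ℓ} (u v : Vec ℕ ℓ) i → at (u ⊞ v) i ≡ at u i + at v i
  at-⊞ []      []      i       = refl
  at-⊞ (a ∷ u) (b ∷ v) zero    = refl
  at-⊞ (a ∷ u) (b ∷ v) (suc i) = at-⊞ u v i

  at-zeros : ∀ ℓ i → at (zeros {ℓ}) i ≡ 0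
  at-zeros zero    i       = refl
  at-zeros (suc ℓ) zero    = refl
  at-zeros (suc ℓ) (suc i) = at-zeros ℓ i

  at-injective : ∀ {ℓ} (u v : Vec ℕ ℓ) → (∀ i → at u i ≡ at v i) → u ≡ v
  at-injective []      []      eq = refl
  at-injective (a ∷ u) (b ∷ v) eq = cong₂ _∷_ (eq 0) (at-injective u v λ i → eq (suc i))

  bits-at : ∀ {ℓ} {C : Vec ℕ ℓ} → C ∈ bits ℓ → ∀ i → at C i ≡ 0 ⊎ at C i ≡ 1
  bits-at {C = []}    C∈ i = inj₁ refl
  bits-at {C = c ∷ C} C∈ zero with ∈-bits C∈
  ... | z≤n     , _ = inj₁ refl
  ... | s≤s z≤n , _ = inj₂ refl
  bits-at {C = c ∷ C} C∈ (suc i) = bits-at (proj₂ (∈-bits C∈)) i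

  difference : ∀ {ℓ} (u v : Vec ℕ ℓ) → (∀ i → at v i ≡ at u i ⊎ at v i ≡ suc (at u i)) → ∃[ C ] C ∈ bits ℓ × v ≡ u ⊞ C
  difference []      []      eq = [] , here refl , refl
  difference {suc ℓ} (a ∷ u) (b ∷ v) eq with difference u v (λ i → eq (suc i)) | eq 0
  ... | C , C∈ , e | inj₁ refl = 0 ∷ C , ∈-++⁺ˡ (∈-map⁺ (0 ∷_) C∈) , cong₂ _∷_ (sym (ℕP.+-identityʳ a)) e
  ... | C , C∈ , e | inj₂ refl = 1 ∷ C , ∈-++⁺ʳ (map (0 ∷_) (bits ℓ)) (∈-map⁺ (1 ∷_) C∈) , cong₂ _∷_ (ℕP.+-comm 1 a) e

  Dominant⇒at : ∀ {ℓ p} {v : Vec ℕ ℓ} → Dominant p v → ∀ i → at v (suc i) ≤ at v i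
  Dominant⇒at []                    i       = z≤n
  Dominant⇒at (_ ∷ [])              i       = z≤n
  Dominant⇒at (_ ∷ (b≤a ∷ d))       zero    = b≤a
  Dominant⇒at (_ ∷ d@(_ ∷ _))       (suc i) = Dominant⇒at d i

  dominant⇒at : ∀ {ℓ} (v : Vec ℕ ℓ) → dominant v ≡ true → ∀ i → at v (suc i) ≤ at v i
  dominant⇒at []      d i = z≤n
  dominant⇒at (a ∷ v) d i = Dominant⇒at (ℕP.≤-refl {a} ∷ dominated⇒Dominant v d) i

  at⇒dominant : ∀ {ℓ} (v : Vec ℕ ℓ) → (∀ i → at v (suc i) ≤ at v i) → dominant v ≡ true
  at⇒dominant []      le = refl
  at⇒dominant (a ∷ v) le = dominated-weaken v ℕP.≤-refl (go a v le)
    where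
    go : ∀ {ℓ} a (v : Vec ℕ ℓ) → (∀ i → at (a ∷ v) (suc i) ≤ at (a ∷ v) i) → Dominant a v
    go a []      le = []
    go a (b ∷ v) le = le 0 ∷ go b v (λ i → le (suc i))

  data IsWalk {ℓ : ℕ} : ∀ {m} → Vec ℕ ℓ → Vec (Vec ℕ ℓ) m → Set where
    []   : ∀ {μ} → IsWalk μ []
    step : ∀ {m μ C} {w : Vec (Vec ℕ ℓ) m} → C ∈ bits ℓ → dominant (μ ⊞ C) ≡ true → IsWalk (μ ⊞ C) w → IsWalk μ (μ ⊞ C ∷ w)

  ∈-walks⁻ : ∀ {ℓ} m {μ : Vec ℕ ℓ} {w} → w ∈ walks m μ → IsWalk μ w
  ∈-walks⁻ zero    {w = []} w∈ = []
  ∈-walks⁻ {ℓ} (suc m) {μ} w∈ with find (∈-concatMap⁻ (λ ν → map (ν ∷_) (walks m ν)) {xs = filterᵇ dominant (map (μ ⊞_) (bits ℓ))} w∈)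
  ... | ν , ν∈ , w∈ν with ∈-map⁻ (ν ∷_) w∈ν | ∈-filter⁻ (λ v → T? (dominant v)) {xs = map (μ ⊞_) (bits ℓ)} ν∈
  ...   | w , w∈′ , refl | ν∈′ , dom with ∈-map⁻ (μ ⊞_) ν∈′
  ...     | C , C∈ , refl = step C∈ (T⇒≡ dom) (∈-walks⁻ m w∈′)
    where
    T⇒≡ : ∀ {b} → T b → b ≡ true
    T⇒≡ {true} _ = refl

  ∈-walks⁺ : ∀ {ℓ} m {μ : Vec ℕ ℓ} {w : Vec (Vec ℕ ℓ) m} → IsWalk μ w → w ∈ walks m μ
  ∈-walks⁺ zero    []              = here refl
  ∈-walks⁺ {ℓ} (suc m) {μ} (step {C = C} C∈ d w) = ∈-concatMap⁺ (λ ν → map (ν ∷_) (walks m ν))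
    (Any.map (λ { refl → ∈-map⁺ ((μ ⊞ C) ∷_) (∈-walks⁺ m w) })
      (∈-filter⁺ (λ v → T? (dominant v)) (∈-map⁺ (μ ⊞_) C∈) (subst T (sym d) _)))

  bits-unique : ∀ ℓ → Unique (bits ℓ)
  bits-unique zero    = [] ∷ []
  bits-unique (suc ℓ) = ++⁺ (map⁺ ∷-injectiveʳ (bits-unique ℓ)) (map⁺ ∷-injectiveʳ (bits-unique ℓ)) disjoint
    where
    disjoint : ∀ {v} → ¬ (v ∈ map (0 ∷_) (bits ℓ) × v ∈ map (1 ∷_) (bits ℓ))
    disjoint (p , q) with ∈-map⁻ (0 ∷_) p | ∈-map⁻ (1 ∷_) q
    ... | _ , _ , refl | _ , _ , ()

  ⊞-cancelˡ : ∀ {ℓ} (u : Vec ℕ ℓ) {v w} → u ⊞ v ≡ u ⊞ w → v ≡ w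
  ⊞-cancelˡ []      {[]}    {[]}    e = refl
  ⊞-cancelˡ (a ∷ u) {b ∷ v} {c ∷ w} e = cong₂ _∷_ (ℕP.+-cancelˡ-≡ a b c (∷-injectiveˡ e)) (⊞-cancelˡ u (∷-injectiveʳ e))

  walks-unique : ∀ {ℓ} m (μ : Vec ℕ ℓ) → Unique (walks m μ)
  walks-unique         zero    μ = [] ∷ []
  walks-unique {ℓ = ℓ} (suc m) μ = concat⁺
    (AllP.map⁺ (All.universal (λ ν → map⁺ ∷-injectiveʳ (walks-unique m ν)) (filterᵇ dominant (map (μ ⊞_) (bits ℓ)))))
    (AllPairsP.map⁺ (AllPairs.map disjoint (filter⁺ (λ v → T? (dominant v)) (map⁺ (⊞-cancelˡ μ) (bits-unique ℓ)))))
    where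
    disjoint : ∀ {ν ν′} → ν ≢ ν′ → ∀ {w} → ¬ (w ∈ map (ν ∷_) (walks m ν) × w ∈ map (ν′ ∷_) (walks m ν′))
    disjoint {ν} {ν′} ne (p , q) with ∈-map⁻ (ν ∷_) p | ∈-map⁻ (ν′ ∷_) q
    ... | _ , _ , refl | _ , _ , e = ne (∷-injectiveˡ e)

  entry-final : ∀ {ℓ m} (μ : Vec ℕ ℓ) (w : Vec (Vec ℕ ℓ) m) i → entry (μ ∷ w) m i ≡ at (final μ w) i
  entry-final μ []      i = refl
  entry-final μ (ν ∷ w) i = entry-final ν w i

  vsum-at : ∀ {ℓ} (v : Vec ℕ ℓ) → ∑ₙ ℓ (at v) ≡ vsum v
  vsum-at []      = refl
  vsum-at {suc ℓ} (a ∷ v) = trans (peel ℓ (at (a ∷ v))) (cong (a +_) (vsum-at v))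
    where
    peel : ∀ n f → ∑ₙ (suc n) f ≡ f 0 + ∑ₙ n (λ i → f (suc i))
    peel zero    f = sym (ℕP.+-identityʳ (f 0))
    peel (suc n) f = trans (cong (_+ f (suc n)) (peel n f)) (ℕP.+-assoc (f 0) (∑ₙ n (λ i → f (suc i))) (f (suc n)))

  interior : ∀ {ℓ m} → Vec (Vec ℕ ℓ) (suc m) → ℕ
  interior (ν ∷ [])     = 0
  interior (ν ∷ ν′ ∷ w) = vsum ν + interior (ν′ ∷ w)

  ∑-interior : ∀ {ℓ m} (w : Vec (Vec ℕ ℓ) (suc m)) → ∑ₙ m (λ u → ∑ₙ ℓ (entry w u)) ≡ interior w
  ∑-interior (ν ∷ [])     = refl
  ∑-interior {ℓ} {suc m} (ν ∷ ν′ ∷ w) = trans (peel m (λ u → ∑ₙ ℓ (entry (ν ∷ ν′ ∷ w) u))) (cong₂ _+_ (vsum-at ν) (∑-interior (ν′ ∷ w)))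
    where
    peel : ∀ n f → ∑ₙ (suc n) f ≡ f 0 + ∑ₙ n (λ i → f (suc i))
    peel zero    f = sym (ℕP.+-identityʳ (f 0))
    peel (suc n) f = trans (cong (_+ f (suc n)) (peel n f)) (ℕP.+-assoc (f 0) (∑ₙ n (λ i → f (suc i))) (f (suc n)))

  -- A box lies in every shape from its step on, and the last shape is not counted; this is the
  -- weight that `stat` gives it. The boxes of `μ` are counted `m` times.
  stat-interior : ∀ {ℓ m} {μ : Vec ℕ ℓ} {w : Vec (Vec ℕ ℓ) (suc m)} → IsWalk μ w → stat (content μ w) + m * vsum μ ≡ interior w
  stat-interior {m = zero}  {μ} (step _ _ []) = refl
  stat-interior {m = suc m} {μ} (step {C = C} {w = w@(ν′ ∷ w′)} _ _ walk) = begin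
    suc m * (vsum (μ ⊞ C) ∸ vsum μ) + stat (content (μ ⊞ C) w) + suc m * vsum μ
      ≡⟨ cong (λ x → suc m * x + stat (content (μ ⊞ C) w) + suc m * vsum μ) (trans (cong (_∸ vsum μ) (vsum-⊞ μ C)) (ℕP.m+n∸m≡n (vsum μ) (vsum C))) ⟩
    suc m * vsum C + stat (content (μ ⊞ C) w) + suc m * vsum μ
      ≡⟨ lem m (vsum C) (stat (content (μ ⊞ C) w)) (vsum μ) ⟩
    (vsum μ + vsum C) + (stat (content (μ ⊞ C) w) + m * (vsum μ + vsum C))
      ≡⟨ cong (λ x → x + (stat (content (μ ⊞ C) w) + m * x)) (vsum-⊞ μ C) ⟨
    vsum (μ ⊞ C) + (stat (content (μ ⊞ C) w) + m * vsum (μ ⊞ C))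
      ≡⟨ cong (vsum (μ ⊞ C) +_) (stat-interior walk) ⟩
    vsum (μ ⊞ C) + interior w ∎
    where
    lem : ∀ m c s v → (1 + m) * c + s + (1 + m) * v ≡ (v + c) + (s + m * (v + c))
    lem = solve-∀

  module WalkStates (n ℓ : ℕ) (shape : Vec ℕ ℓ) where

    open Operators n ℓ
    open Commutator n ℓ shape
    open Unimodality n ℓ shape

    _≟V_ : (u v : Vec ℕ ℓ) → _
    _≟V_ = ≡-dec ℕP._≟_

    isShape : Vec ℕ ℓ → Bool
    isShape e = does (e ≟V shape)

    all : List State
    all = map (zeros ∷_) (filter (λ w → final zeros w ≟V shape) (walks (suc n) zeros))

    all-unique : Unique all
    all-unique = map⁺ ∷-injectiveʳ (filter⁺ (λ w → final zeros w ≟V shape) (walks-unique (suc n) zeros))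

    walk-valid : ∀ {m} {μ : Vec ℕ ℓ} {w : Vec (Vec ℕ ℓ) m} → dominant μ ≡ true → IsWalk μ w →
      (∀ {t} → t < m → ∀ i → entry (μ ∷ w) (suc t) i ≡ entry (μ ∷ w) t i ⊎ entry (μ ∷ w) (suc t) i ≡ suc (entry (μ ∷ w) t i)) ×
      (∀ t i → entry (μ ∷ w) t (suc i) ≤ entry (μ ∷ w) t i)
    walk-valid {μ = μ} d [] = (λ ()) , λ { zero i → dominant⇒at μ d i ; (suc t) i → z≤n }
    walk-valid {μ = μ} d (step {C = C} C∈ d′ walk) with walk-valid d′ walk
    ... | steps , doms = (λ { {zero} _ i → first i ; {suc t} (s≤s lt) i → steps lt i }) , λ { zero i → dominant⇒at μ d i ; (suc t) i → doms t i }
      where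
      first : ∀ i → at (μ ⊞ C) i ≡ at μ i ⊎ at (μ ⊞ C) i ≡ suc (at μ i)
      first i with bits-at C∈ i
      ... | inj₁ e = inj₁ (trans (at-⊞ μ C i) (trans (cong (at μ i +_) e) (ℕP.+-identityʳ (at μ i))))
      ... | inj₂ e = inj₂ (trans (at-⊞ μ C i) (trans (cong (at μ i +_) e) (ℕP.+-comm (at μ i) 1)))

    sound : ∀ {M} → M ∈ all → Good M
    sound M∈ with ∈-map⁻ (zeros ∷_) M∈
    ... | w , w∈ , refl with ∈-filter⁻ (λ w → final zeros w ≟V shape) {xs = walks (suc n) zeros} w∈
    ...   | w∈′ , end≡ with walk-valid (dominant-0 ℓ) (∈-walks⁻ (suc n) w∈′)
    ...     | steps , doms = record
      { valid = record { start = at-zeros ℓ ; step = steps ; dom = doms }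
      ; end = λ i → trans (entry-final zeros w i) (cong (λ v → at v i) end≡) }

    valid-walk : ∀ {m} (μ : Vec ℕ ℓ) (w : Vec (Vec ℕ ℓ) m) →
      (∀ {t} → t < m → ∀ i → entry (μ ∷ w) (suc t) i ≡ entry (μ ∷ w) t i ⊎ entry (μ ∷ w) (suc t) i ≡ suc (entry (μ ∷ w) t i)) →
      (∀ t i → entry (μ ∷ w) t (suc i) ≤ entry (μ ∷ w) t i) → IsWalk μ w
    valid-walk μ []      steps doms = []
    valid-walk μ (ν ∷ w) steps doms with difference μ ν (λ i → steps (s≤s z≤n) i)
    ... | C , C∈ , refl = step C∈ (at⇒dominant (μ ⊞ C) (doms 1)) (valid-walk (μ ⊞ C) w (λ lt → steps (s≤s lt)) (λ t → doms (suc t)))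

    complete : ∀ {M} → Good M → M ∈ all
    complete {μ ∷ w} G with at-injective μ zeros (λ i → trans (Valid.start (Good.valid G) i) (sym (at-zeros ℓ i)))
    ... | refl = ∈-map⁺ (zeros ∷_) (∈-filter⁺ (λ w → final zeros w ≟V shape)
      (∈-walks⁺ (suc n) (valid-walk zeros w (Valid.step (Good.valid G)) (Valid.dom (Good.valid G))))
      (at-injective (final zeros w) shape λ i → trans (sym (entry-final zeros w i)) (Good.end G i)))

    grade-stat : ∀ {w} → w ∈ walks (suc n) zeros → grade (zeros ∷ w) ≡ stat (content zeros w)
    grade-stat {w} w∈ = begin
      grade (zeros ∷ w)                                ≡⟨ ∑-interior w ⟩
      interior w                                       ≡⟨ stat-interior (∈-walks⁻ (suc n) w∈) ⟨
      stat (content zeros w) + n * vsum (zeros {ℓ})    ≡⟨ cong (λ z → stat (content zeros w) + n * z) (vsum-0 ℓ) ⟩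
      stat (content zeros w) + n * 0                   ≡⟨ trans (cong (stat (content zeros w) +_) (ℕP.*-zeroʳ n)) (ℕP.+-identityʳ _) ⟩
      stat (content zeros w)                           ∎

    open Counting all all-unique sound complete public using (level; count; count-rises; count-falls)

    count-Σ : ∀ j → count j ≡ Nat.Σ all (λ M → guard (grade M ≡ᵇ j) 1)
    count-Σ j = go all
      where
      go : ∀ Ms → length (filter (λ M → grade M ℕP.≟ j) Ms) ≡ Nat.Σ Ms (λ M → guard (grade M ≡ᵇ j) 1)
      go []       = refl
      go (M ∷ Ms) with grade M ≡ᵇ j
      ... | true  = cong suc (go Ms)
      ... | false = go Ms

    module _ (R : CommutativeSemiring 0ℓ 0ℓ) where

      open CommutativeSemiring R using (Carrier; _≈_) renaming (trans to ≈-trans; sym to ≈-sym; refl to ≈-refl; reflexive to ≈-reflexive; +-congˡ to ⊕-congˡ; +-identityˡ to ⊕-identityˡ)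
      open ListSum R renaming (guard to guardᴿ)

      -- Stated over any semiring, since it is applied to natural numbers for the residue classes
      -- and to polynomials for the powers of `q`.
      Σ-all : ∀ (F : ℕ → Carrier) → Σ all (λ M → F (grade M)) ≈ Σ (walks (suc n) zeros) (λ w → guardᴿ (isShape (final zeros w)) (F (stat (content zeros w))))
      Σ-all F = ≈-trans (Σ-map (zeros ∷_) (filter (λ w → final zeros w ≟V shape) (walks (suc n) zeros)))
        (≈-trans (go (walks (suc n) zeros)) (Σ-cong∈ (walks (suc n) zeros) λ {w} w∈ → guard-cong (isShape (final zeros w)) λ _ → ≈-reflexive (cong F (grade-stat w∈))))
        where
        go : ∀ ws → Σ (filter (λ w → final zeros w ≟V shape) ws) (λ w → F (grade (zeros ∷ w))) ≈ Σ ws (λ w → guardᴿ (isShape (final zeros w)) (F (grade (zeros ∷ w))))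
        go []       = ≈-refl
        go (w ∷ ws) with does (final zeros w ≟V shape)
        ... | true  = ⊕-congˡ (go ws)
        ... | false = ≈-trans (go ws) (≈-sym (⊕-identityˡ _))

    ∑ₙ-+ : ∀ m f g → ∑ₙ m (λ x → f x + g x) ≡ ∑ₙ m f + ∑ₙ m g
    ∑ₙ-+ zero    f g = refl
    ∑ₙ-+ (suc m) f g = trans (cong (_+ (f m + g m)) (∑ₙ-+ m f g)) (lem (∑ₙ m f) (∑ₙ m g) (f m) (g m))
      where
      lem : ∀ a b c d → a + b + (c + d) ≡ a + c + (b + d)
      lem = solve-∀

    ∑ₙ-point : ∀ L (c : ℕ → Bool) g → g < L → ∑ₙ L (λ x → guard (c x) (guard (g ≡ᵇ x) 1)) ≡ guard (c g) 1
    ∑ₙ-point (suc L) c g g<1+L with g ℕP.≟ L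
    ... | yes refl = cong₂ _+_ (∑ₙ-zero g λ {x} x<g → trans (cong (guard (c x)) (cong (λ b → guard b 1) (other x<g))) (Nat.guard-vanish (c x) refl)) (cong (guard (c g)) (cong (λ b → guard b 1) (≡ᵇ-refl g)))
      where
      other : ∀ {x} → x < g → (g ≡ᵇ x) ≡ false
      other {x} x<g with g ≡ᵇ x in e
      ... | false = refl
      ... | true  = contradiction (sym (≡ᵇ⇒≡ g x e)) (ℕP.<⇒≢ x<g)
    ... | no g≢L  = trans (cong₂ _+_ (∑ₙ-point L c g (ℕP.≤∧≢⇒< (ℕP.≤-pred g<1+L) g≢L)) (trans (cong (guard (c L)) (cong (λ b → guard b 1) other)) (Nat.guard-vanish (c L) refl))) (ℕP.+-identityʳ _)
      where
      other : (g ≡ᵇ L) ≡ false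
      other with g ≡ᵇ L in e
      ... | false = refl
      ... | true  = contradiction (≡ᵇ⇒≡ g L e) g≢L

    ∑ₙ-count : ∀ L (c : ℕ → Bool) → total < L → ∑ₙ L (λ x → guard (c x) (count x)) ≡ Nat.Σ all (λ M → guard (c (grade M)) 1)
    ∑ₙ-count L c D<L = trans (∑ₙ-cong L λ {x} _ → cong (guard (c x)) (count-Σ x)) (go all λ M∈ → ℕP.≤-<-trans (grade-bounded (sound M∈)) D<L)
      where
      go : ∀ Ms → (∀ {M} → M ∈ Ms → grade M < L) → ∑ₙ L (λ x → guard (c x) (Nat.Σ Ms (λ M → guard (grade M ≡ᵇ x) 1))) ≡ Nat.Σ Ms (λ M → guard (c (grade M)) 1)
      go []       lt = ∑ₙ-zero L λ {x} _ → Nat.guard-vanish (c x) refl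
      go (M ∷ Ms) lt = trans (∑ₙ-cong L λ {x} _ → Nat.guard-+ (c x) (guard (grade M ≡ᵇ x) 1) _)
        (trans (∑ₙ-+ L _ _) (cong₂ _+_ (∑ₙ-point L c (grade M) (lt (here refl))) (go Ms λ M∈ → lt (there M∈))))

    count-vanish : ∀ x → total < x → count x ≡ 0
    count-vanish x D<x = trans (count-Σ x) (Nat.Σ-zero all λ {M} M∈ → cong (λ b → guard b 1) (other (ℕP.≤-<-trans (grade-bounded (sound M∈)) D<x)))
      where
      other : ∀ {g} → g < x → (g ≡ᵇ x) ≡ false
      other {g} lt with g ≡ᵇ x in e
      ... | false = refl
      ... | true  = contradiction (≡ᵇ⇒≡ g x e) (ℕP.<⇒≢ lt)

    -- Translates class sums of the graded counts into sums over walks, where the rotation symmetry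
    -- is available.
    class-count : ∀ L → total < L → ∀ i → ∑ₙ L (λ x → guard (x % suc n ≡ᵇ i % suc n) (count x)) ≡ residueSum n isShape i
    class-count L D<L i = trans (∑ₙ-count L (λ x → x % suc n ≡ᵇ i % suc n) D<L)
      (trans (Σ-all ℕP.+-*-commutativeSemiring (λ g → guard (g % suc n ≡ᵇ i % suc n) 1)) (Σ-walks (suc n) zeros (λ α e → guard (isShape e) (guard (stat α % suc n ≡ᵇ i % suc n) 1))))

    residueSum-size : ∀ i → residueSum n isShape i ≡ residueSum n isShape (i + vsum shape)
    residueSum-size = residueSum-shift n isShape (vsum shape) λ e eq → cong vsum (from-does e eq)
      where
      from-does : ∀ e → isShape e ≡ true → e ≡ shape
      from-does e eq with e ≟V shape
      ... | yes p = p

    residueSum-period : ∀ i → residueSum n isShape i ≡ residueSum n isShape (i + suc n)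
    residueSum-period i = cong (λ z → walkSum (suc n) zeros (λ α e → guard (isShape e) (guard (stat α % suc n ≡ᵇ z) 1))) (sym ([m+n]%n≡m%n i (suc n)))
      where
      open import Data.Nat.DivMod using ([m+n]%n≡m%n)

    module Shape (d : ℕ) (d≤s : d ≤ suc n) (period : ∀ i → residueSum n isShape i ≡ residueSum n isShape (i + d)) where

      open Quotient.Balanced n d count total d≤s count-rises count-falls count-vanish
        (λ L D<L i → trans (class-count L D<L i) (trans (period i) (sym (class-count L D<L (i + d))))) public
        using (window-p≡window-q; q-vanish)

-- Coefficient lists as sums of terms.

module CoefficientLists where

  open import Defs
  open import Data.Nat
  open import Data.Integer as ℤ using (ℤ)
  open import Data.List using (List; []; _∷_)
  open import Data.Vec using (replicate)
  open import Data.Product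
  open import Relation.Binary.PropositionalEquality

  terms : ∀ N → ℕ → List ℕ → Poly N
  terms N i []       = []
  terms N i (a ∷ as) = (ℤ.+ a , (i , replicate N 0)) ∷ terms N (suc i) as

  -- The helper in the where block of qPoly cannot be named. The placeholder is solved by that helper, because
  -- abstracting 1 and a ∷ as in `link` turns its occurrence there into a pattern.
  mutual
    qPolyFrom : ∀ N → List ℕ → ℕ → List ℕ → Poly N
    qPolyFrom N c i as = _

    link : ∀ N a as → qPoly N (a ∷ as) ≡ (ℤ.+ a , (0 , replicate N 0)) ∷ qPolyFrom N (a ∷ as) 1 as
    link N a as with 1 | a ∷ as
    ... | w | c = refl

  go-terms : ∀ N c i as → qPolyFrom N c i as ≡ terms N i as
  go-terms N c i []       = refl
  go-terms N c i (a ∷ as) = cong (_ ∷_) (go-terms N c (suc i) as)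

  qPoly-terms : ∀ N c → qPoly N c ≡ terms N 0 c
  qPoly-terms N []       = refl
  qPoly-terms N (a ∷ as) = trans (link N a as) (cong (_ ∷_) (go-terms N (a ∷ as) 1 as))

-- The dual Cauchy identity, and polynomials in q as coefficient sequences.

module DualCauchyIdentity where

  open BenderKnuth using (Dominant; []; _∷_)
  open ListSums
  open PieriRule
  open VerticalStrips using (vsum; _⊞_; bits; dominant; dominated⇒Dominant; dominated-weaken)
  open StripWalks using (head₀; stat; dominant-0; module WalkSum)
  open Division using (delay; shift; window)
  open import Algebra.Bundles using (CommutativeSemiring)
  open import Data.Bool using (Bool; true; false; if_then_else_)
  open import Data.Nat as ℕ using (ℕ; zero; suc; _≤_; _<_; s≤s; _≡ᵇ_)
  import Data.Nat.Properties as ℕP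
  open import Data.Fin using (Fin; fromℕ; inject₁)
  open import Data.List using (List; []; _∷_)
  open import Data.List.Membership.Propositional using (_∈_)
  open import Data.List.Relation.Unary.Any using (here; there)
  open import Data.Vec using (Vec; []; _∷_; replicate)
  open import Data.Sum using (inj₁; inj₂)
  open import Function using (_∘_)
  open import Relation.Nullary using (contradiction)
  open import Level using (0ℓ)
  open import Relation.Binary.PropositionalEquality as ≡ using (_≡_)

  dominant⇒Dominant : ∀ {ℓ} (v : Vec ℕ ℓ) → dominant v ≡ true → Dominant (head₀ v) v
  dominant⇒Dominant []      e = []
  dominant⇒Dominant (a ∷ v) e = ℕP.≤-refl ∷ dominated⇒Dominant v e

  ¬dominant⇒HasAscent : ∀ {ℓ} (v : Vec ℕ ℓ) → dominant v ≡ false → HasAscent v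
  ¬dominant⇒HasAscent v e with dominant-or-ascent v
  ... | inj₂ bad = bad
  ¬dominant⇒HasAscent (a ∷ v) e | inj₁ (_ ∷ d) = contradiction (≡.trans (≡.sym e) (dominated-weaken v ℕP.≤-refl d)) λ ()

  module DualCauchy (R : CommutativeSemiring 0ℓ 0ℓ) (q : CommutativeSemiring.Carrier R) where

    open CommutativeSemiring R hiding (zero)
    open ListSum R
    open Schur R
    open WalkSum R
    open import Relation.Binary.Reasoning.Setoid setoid

    pow-+ : ∀ y m n → pow y (m ℕ.+ n) ≈ pow y m * pow y n
    pow-+ y zero    n = sym (*-identityˡ _)
    pow-+ y (suc m) n = trans (*-congˡ (pow-+ y m n)) (sym (*-assoc y _ _))

    pow-1# : ∀ n → pow 1# n ≈ 1#
    pow-1# zero    = refl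
    pow-1# (suc n) = trans (*-identityˡ _) (pow-1# n)

    pow-distrib : ∀ y z n → pow (y * z) n ≈ pow y n * pow z n
    pow-distrib y z zero    = sym (*-identityˡ 1#)
    pow-distrib y z (suc n) = trans (*-congˡ (pow-distrib y z n)) (*-interchange y z (pow y n) (pow z n))

    pow-* : ∀ m n → pow (pow q m) n ≈ pow q (m ℕ.* n)
    pow-* zero    n = pow-1# n
    pow-* (suc m) n = trans (pow-distrib q (pow q m) n) (trans (*-congˡ (pow-* m n)) (sym (pow-+ q n (m ℕ.* n))))

    walkSum-*ˡ : ∀ {ℓ} m (μ : Vec ℕ ℓ) c Φ → walkSum m μ (λ α e → c * Φ α e) ≈ c * walkSum m μ Φ
    walkSum-*ˡ         zero    μ c Φ = refl
    walkSum-*ˡ {ℓ = ℓ} (suc m) μ c Φ = trans (Σ-cong (bits ℓ) λ C → trans (guard-cong (dominant (μ ⊞ C)) λ _ →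
      walkSum-*ˡ m (μ ⊞ C) c (λ α → Φ (vsum C ∷ α))) (guard-*ˡ (dominant (μ ⊞ C)) c _)) (Σ-*ˡ (bits ℓ) c _)

    -- The sum over all `r` of `e_r[X[m]_q]`, as a product.
    generating : ∀ {N} → (Fin N → Carrier) → ℕ → Carrier
    generating {N} xs zero    = 1#
    generating {N} xs (suc m) = elementary N xs (pow q m) * generating xs m

    module _ {ℓ : ℕ} (Variable : Carrier → Set)
             (bottom : ∀ N {x} {xs : Fin N → Carrier} → Variable x → (∀ i → Variable (xs i)) →
                       ∀ {κ : Vec ℕ (suc ℓ)} → Dominant (head₀ κ) κ → 0 < lastRow κ → x * schurSum N xs κ ≈ 0#) where

      -- The factor with the largest power of `q` is applied first, so a box of the first strip
      -- carries `q^m` when `m` strips follow, in agreement with `stat`.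
      iterated-pieri : ∀ {N} {xs : Fin N → Carrier} → (∀ i → Variable (xs i)) → ∀ m (μ : Vec ℕ (suc ℓ)) → dominant μ ≡ true →
        generating xs m * schurSum N xs μ ≈ walkSum m μ (λ α e → pow q (stat α) * schurSum N xs e)
      iterated-pieri vars zero    μ d = refl
      iterated-pieri {N} {xs} vars (suc m) μ d = begin
        (elementary N xs y * generating xs m) * S μ     ≈⟨ trans (*-congʳ (*-comm _ _)) (*-assoc _ _ _) ⟩
        generating xs m * (elementary N xs y * S μ)     ≈⟨ *-congˡ (pieri Variable bottom N y vars (dominant⇒Dominant μ d)) ⟩
        generating xs m * Σ (bits (suc ℓ)) (λ C → pow y (vsum C) * S (μ ⊞ C))
          ≈⟨ Σ-*ˡ (bits (suc ℓ)) (generating xs m) _ ⟨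
        Σ (bits (suc ℓ)) (λ C → generating xs m * (pow y (vsum C) * S (μ ⊞ C)))
          ≈⟨ Σ-cong (bits (suc ℓ)) term ⟩
        walkSum (suc m) μ (λ α e → pow q (stat α) * S e) ∎
        where
        y = pow q m
        S = schurSum N xs
        term : ∀ C → generating xs m * (pow y (vsum C) * S (μ ⊞ C)) ≈
                     guard (dominant (μ ⊞ C)) (walkSum m (μ ⊞ C) (λ α e → pow q (m ℕ.* vsum C ℕ.+ stat α) * S e))
        term C with dominant (μ ⊞ C) in dom
        -- The rule ranges over all bit vectors; those that do not lead to a partition contribute 0
        -- and match the closed guard.
        ... | false = trans (*-congˡ (trans (*-congˡ (schurSum-ascent N xs (¬dominant⇒HasAscent (μ ⊞ C) dom))) (zeroʳ _))) (zeroʳ _)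
        ... | true  = begin
          generating xs m * (pow y (vsum C) * S (μ ⊞ C))    ≈⟨ *-swap _ _ _ ⟩
          pow y (vsum C) * (generating xs m * S (μ ⊞ C))    ≈⟨ *-cong (pow-* m (vsum C)) (iterated-pieri vars m (μ ⊞ C) dom) ⟩
          pow q (m ℕ.* vsum C) * walkSum m (μ ⊞ C) (λ α e → pow q (stat α) * S e)
            ≈⟨ walkSum-*ˡ m (μ ⊞ C) (pow q (m ℕ.* vsum C)) _ ⟨
          walkSum m (μ ⊞ C) (λ α e → pow q (m ℕ.* vsum C) * (pow q (stat α) * S e))
            ≈⟨ walkSum-cong m (μ ⊞ C) (λ α e _ → trans (sym (*-assoc _ _ _)) (*-congʳ (sym (pow-+ q (m ℕ.* vsum C) (stat α))))) ⟩
          walkSum m (μ ⊞ C) (λ α e → pow q (m ℕ.* vsum C ℕ.+ stat α) * S e) ∎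

      schurSum-zeros : ∀ {ℓ} N xs → schurSum {ℓ} N xs (replicate ℓ 0) ≈ 1#
      schurSum-zeros {zero}  zero    xs = refl
      schurSum-zeros {suc ℓ} zero    xs = schurSum-zeros {ℓ} zero xs
      schurSum-zeros {ℓ}     (suc N) xs = trans (branch-zeros ℓ (schurSum N (xs ∘ inject₁))) (schurSum-zeros N (xs ∘ inject₁))
        where
        branch-zeros : ∀ ℓ g → branch (xs (fromℕ N)) (replicate ℓ 0) g ≈ g (replicate ℓ 0)
        branch-zeros zero          g = refl
        branch-zeros (suc zero)    g = refl
        branch-zeros (suc (suc ℓ)) g = branch-zeros (suc ℓ) (g ∘ (0 ∷_))

      dual-cauchy : ∀ {N} {xs : Fin N → Carrier} → (∀ i → Variable (xs i)) → ∀ m →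
        generating xs m ≈ walkSum m (replicate (suc ℓ) 0) (λ α e → pow q (stat α) * schurSum N xs e)
      dual-cauchy {N} {xs} vars m = begin
        generating xs m                                            ≈⟨ *-identityʳ _ ⟨
        generating xs m * 1#                                       ≈⟨ *-congˡ (schurSum-zeros N xs) ⟨
        generating xs m * schurSum N xs (replicate (suc ℓ) 0)      ≈⟨ iterated-pieri vars m (replicate (suc ℓ) 0) (dominant-0 (suc ℓ)) ⟩
        walkSum m (replicate (suc ℓ) 0) (λ α e → pow q (stat α) * schurSum N xs e) ∎

    infixl 8 _•_
    _•_ : ℕ → Carrier → Carrier
    zero  • x = 0#
    suc n • x = x + n • x

    •-+ : ∀ m n x → (m ℕ.+ n) • x ≈ m • x + n • x
    •-+ zero    n x = sym (+-identityˡ _)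
    •-+ (suc m) n x = trans (+-congˡ (•-+ m n x)) (sym (+-assoc x (m • x) (n • x)))

    *-• : ∀ y n x → y * n • x ≈ n • (y * x)
    *-• y zero    x = zeroʳ y
    *-• y (suc n) x = trans (distribˡ y x (n • x)) (+-congˡ (*-• y n x))

    series : (ℕ → ℕ) → ℕ → Carrier
    series f zero    = 0#
    series f (suc L) = series f L + f L • pow q L

    series-cong : ∀ {f g} L → (∀ j → f j ≡ g j) → series f L ≈ series g L
    series-cong zero    eq = refl
    series-cong (suc L) eq = +-cong (series-cong L eq) (reflexive (≡.cong (_• pow q L) (eq L)))

    series-+ : ∀ f g L → series (λ j → f j ℕ.+ g j) L ≈ series f L + series g L
    series-+ f g zero    = sym (+-identityˡ 0#)
    series-+ f g (suc L) = trans (+-cong (series-+ f g L) (•-+ (f L) (g L) (pow q L))) (interchange _ _ _ _)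

    series-zero : ∀ L → series (λ _ → 0) L ≈ 0#
    series-zero zero    = refl
    series-zero (suc L) = trans (+-congʳ (series-zero L)) (+-identityˡ 0#)

    series-extend : ∀ f L c → (∀ j → L ≤ j → f j ≡ 0) → series f (c ℕ.+ L) ≈ series f L
    series-extend f L zero    z = refl
    series-extend f L (suc c) z = trans (+-cong (series-extend f L c z) (reflexive (≡.cong (_• pow q (c ℕ.+ L)) (z (c ℕ.+ L) (ℕP.m≤n+m L c))))) (+-identityʳ _)

    series-delay : ∀ f L → q * series f L ≈ series (delay f) (suc L)
    series-delay f zero    = trans (zeroʳ q) (sym (+-identityˡ 0#))
    series-delay f (suc L) = trans (distribˡ q _ _) (+-cong (series-delay f L) (*-• q (f L) (pow q L)))

    series-shift : ∀ t f L → pow q t * series f L ≈ series (shift t f) (t ℕ.+ L)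
    series-shift zero    f L = *-identityˡ _
    series-shift (suc t) f L = trans (*-assoc q _ _) (trans (*-congˡ (series-shift t f L)) (series-delay (shift t f) (t ℕ.+ L)))

    shift-vanish : ∀ t {f L} → (∀ j → L ≤ j → f j ≡ 0) → ∀ j → t ℕ.+ L ≤ j → shift t f j ≡ 0
    shift-vanish zero    z j       le       = z j le
    shift-vanish (suc t) z (suc j) (s≤s le) = shift-vanish t z j le

    window-vanish : ∀ k {f L} → (∀ j → L ≤ j → f j ≡ 0) → ∀ j → k ℕ.+ L ≤ j → window k f j ≡ 0
    window-vanish zero    z j le = ≡.refl
    window-vanish (suc k) z j le = ≡.cong₂ ℕ._+_ (window-vanish k z j (ℕP.<⇒≤ le)) (shift-vanish k z j (ℕP.<⇒≤ le))

    geometric : ℕ → Carrier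
    geometric zero    = 0#
    geometric (suc k) = geometric k + pow q k

    -- The vanishing of `f` from `L` on guarantees that cutting the product at length `k + L` loses
    -- nothing.
    geometric-series : ∀ k {f L} → (∀ j → L ≤ j → f j ≡ 0) → geometric k * series f L ≈ series (window k f) (k ℕ.+ L)
    geometric-series zero    {f} {L} z = trans (zeroˡ _) (sym (series-zero L))
    geometric-series (suc k) {f} {L} z = begin
      (geometric k + pow q k) * series f L                              ≈⟨ distribʳ _ _ _ ⟩
      geometric k * series f L + pow q k * series f L                   ≈⟨ +-cong (geometric-series k z) (series-shift k f L) ⟩
      series (window k f) (k ℕ.+ L) + series (shift k f) (k ℕ.+ L)      ≈⟨ series-+ (window k f) (shift k f) (k ℕ.+ L) ⟨
      series (window (suc k) f) (k ℕ.+ L)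
        ≈⟨ series-extend (window (suc k) f) (k ℕ.+ L) 1 (λ j le → ≡.cong₂ ℕ._+_ (window-vanish k z j le) (shift-vanish k z j le)) ⟨
      series (window (suc k) f) (suc k ℕ.+ L)                           ∎

    Σ-pow : ∀ {A : Set} (xs : List A) L (g : A → ℕ) → (∀ {x} → x ∈ xs → g x < L) →
            Σ xs (λ x → pow q (g x)) ≈ series (λ j → ListSum.Σ ℕP.+-*-commutativeSemiring xs (λ x → if g x ≡ᵇ j then 1 else 0)) L
    Σ-pow []       L g lt = sym (series-zero L)
    Σ-pow (x ∷ xs) L g lt = trans (+-cong (sym (point L (lt (here ≡.refl)))) (Σ-pow xs L g λ x∈ → lt (there x∈))) (sym (series-+ _ _ L))
      where
      low : ∀ L → L ≤ g x → series (λ j → if g x ≡ᵇ j then 1 else 0) L ≈ 0#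
      low zero    le = refl
      low (suc L) le with g x ≡ᵇ L in e
      ... | true  = contradiction (ℕP.≡ᵇ⇒≡ (g x) L (≡.subst Data.Bool.T (≡.sym e) _)) (λ e′ → ℕP.<⇒≢ le (≡.sym e′))
      ... | false = trans (+-identityʳ _) (low L (ℕP.<⇒≤ le))
      point : ∀ L → g x < L → series (λ j → if g x ≡ᵇ j then 1 else 0) L ≈ pow q (g x)
      point (suc L) g<1+L with g x ≡ᵇ L in e
      ... | true  = trans (+-cong (low L (ℕP.≤-reflexive (≡.sym e′))) (+-identityʳ _)) (trans (+-identityˡ _) (reflexive (≡.cong (pow q) (≡.sym e′))))
        where e′ = ℕP.≡ᵇ⇒≡ (g x) L (≡.subst Data.Bool.T (≡.sym e) _)
      ... | false = trans (+-identityʳ _) (point L (ℕP.≤∧≢⇒< (ℕP.≤-pred g<1+L) λ g≡L → ≡.subst Data.Bool.T e (ℕP.≡⇒≡ᵇ (g x) L g≡L)))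

-- The q-alphabet and Schur polynomials as concrete polynomials.

module AlphabetExpansion where

  open import Defs hiding (_≈_)
  open BenderKnuth using (Dominant; []; _∷_)
  open ListSums
  open VerticalStrips using (vsum; _⊞_)
  open StripWalks
  open PieriRule
  open TableauBranching
  open DualCauchyIdentity
  open PolynomialSemiring
  open ChainsOfShapes using (zeros)
  open CoefficientLists using (terms; qPoly-terms)
  open import Algebra.Bundles using (CommutativeSemiring)
  open import Data.Bool using (true; false; if_then_else_; T)
  open import Data.Nat as ℕ using (ℕ; zero; suc; _≤_; _<_; z≤n; s≤s; _≤ᵇ_)
  import Data.Nat.Properties as ℕP
  open import Data.Integer as ℤ using (ℤ)
  import Data.Integer.Properties as ℤP
  open import Data.Fin using (Fin; zero; suc; fromℕ; inject₁)
  open import Data.List using (List; []; _∷_; _++_; _∷ʳ_; map; concatMap; allFin; upTo; tabulate; filterᵇ; foldr; length)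
  open import Data.List.Properties using (upTo-∷ʳ; map-++; concatMap-++; length-map; length-upTo; ++-identityʳ)
  open import Data.List.Relation.Unary.Any using (here)
  open import Data.List.Relation.Unary.All as All using (All; []; _∷_)
  import Data.List.Relation.Unary.All.Properties as AllP
  open import Data.List.Relation.Unary.Linked using ([]; _∷_)
  open import Data.Vec using (Vec; []; _∷_; toList; zipWith)
  open import Data.Vec.Properties using (zipWith-identityˡ; zipWith-identityʳ; zipWith-assoc)
  open import Data.Product using (_,_; proj₂)
  open import Function using (_∘_; id)
  open import Relation.Nullary using (yes; no; contradiction)
  open import Relation.Binary.PropositionalEquality as ≡ using (_≡_; _≢_)

  Homogeneous : ∀ {N} → ℕ → Poly N → Set
  Homogeneous d = All (λ t → degree (proj₂ t) ≡ d)

  -- Stops at the first zero; in a dominant vector only zeros follow, so nothing of the partition is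
  -- lost.
  strip : ∀ {ℓ} → Vec ℕ ℓ → List ℕ
  strip []          = []
  strip (zero ∷ v)  = []
  strip (suc a ∷ v) = suc a ∷ strip v

  vsum-unitVec : ∀ {M} (i : Fin M) → vsum (unitVec i) ≡ 1
  vsum-unitVec {suc M} zero    = ≡.cong suc (tab-0 M)
    where
    tab-0 : ∀ N → vsum (Data.Vec.tabulate {n = N} (λ _ → 0)) ≡ 0
    tab-0 zero    = ≡.refl
    tab-0 (suc N) = tab-0 N
  vsum-unitVec {suc M} (suc i) = vsum-unitVec i

  module _ {N : ℕ} where

    coeff-homogeneous : ∀ {d} (p : Poly N) μ → Homogeneous d p → degree μ ≢ d → coeff p μ ≡ ℤ.+ 0
    coeff-homogeneous []            μ []      ne = ≡.refl
    coeff-homogeneous ((c , m) ∷ p) μ (e ∷ h) ne with m ≟M μ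
    ... | yes ≡.refl = contradiction e ne
    ... | no  m≢μ    = ≡.trans (≡.cong₂ (λ b z → (if b then c else ℤ.+ 0) ℤ.+ z) (dec-false (m ≟M μ) m≢μ) (coeff-homogeneous p μ h ne)) ≡.refl
      where
      open import Relation.Nullary.Decidable using (dec-false)

    homogeneous-⊗ : ∀ {c d} {p r : Poly N} → Homogeneous c p → Homogeneous d r → Homogeneous (c ℕ.+ d) (p ⊗ r)
    homogeneous-⊗ []                 hr = []
    homogeneous-⊗ {p = (_ , m) ∷ p} (e ∷ hp) hr = AllP.++⁺ (AllP.map⁺ (All.map (λ {t} e′ → ≡.trans (degree-mul m (proj₂ t)) (≡.cong₂ ℕ._+_ e e′)) hr)) (homogeneous-⊗ hp hr)

    homogeneous-one : Homogeneous 0 (one {N})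
    homogeneous-one = vsum-0 N ∷ []

    qInt-homogeneous : ∀ k → Homogeneous 0 (qInt N k)
    qInt-homogeneous k = AllP.map⁺ (All.universal (λ j → vsum-0 N) (upTo k))

    elem-homogeneous : ∀ r {A : Poly N} → Homogeneous 1 A → Homogeneous r (elem r A)
    elem-homogeneous zero    h       = homogeneous-one
    elem-homogeneous (suc r) []      = []
    elem-homogeneous (suc r) {t ∷ A} (e ∷ h) = AllP.++⁺ (homogeneous-⊗ {p = t ∷ []} (e ∷ []) (elem-homogeneous r h)) (elem-homogeneous (suc r) h)

    alphabet-homogeneous : ∀ s → Homogeneous 1 (alphabet N s)
    alphabet-homogeneous s = AllP.concat⁺ (AllP.map⁺ (All.universal (λ j → AllP.map⁺ (All.universal (λ i → vsum-unitVec i) (allFin N))) (upTo s)))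

    expand : Poly N → Poly N
    expand []      = one
    expand (t ∷ A) = ((t ∷ []) ⊗ expand A) ⊕ expand A

    degree-of-sum : ∀ (m ν μ : Mono N) {d e} → degree m ≡ d → monoMul m ν ≡ μ → degree μ ≡ d ℕ.+ e → degree ν ≡ e
    degree-of-sum m ν μ {d} {e} ≡.refl ≡.refl eq = ℕP.+-cancelˡ-≡ d (degree ν) e (≡.trans (≡.sym (degree-mul m ν)) eq)

    -- Every letter has degree 1, so among the elementary functions summed in `expand` only the one
    -- of index `r` reaches degree `r`.
    elem-expand : ∀ r {A : Poly N} → Homogeneous 1 A → ∀ μ → degree μ ≡ r → coeff (elem r A) μ ≡ coeff (expand A) μ
    elem-expand zero    {[]}    h       μ e = ≡.refl
    elem-expand zero    {t ∷ A} (e₁ ∷ h) μ e = ≡.sym (≡.trans (coeff-⊕ ((t ∷ []) ⊗ expand A) (expand A) μ)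
      (≡.trans (≡.cong₂ ℤ._+_ (no-constant (expand A)) (≡.sym (elem-expand 0 h μ e))) (ℤP.+-identityˡ _)))
      where
      no-constant : ∀ p → coeff ((t ∷ []) ⊗ p) μ ≡ ℤ.+ 0
      no-constant p = ⊗-congʳ (t ∷ []) {p} {[]} μ λ { {_} {ν} (here ≡.refl) eq → contradiction (≡.trans (≡.sym e) (≡.trans (≡.cong degree (≡.sym eq)) (≡.trans (degree-mul (proj₂ t) ν) (≡.cong (ℕ._+ degree ν) e₁)))) λ () }
    elem-expand (suc r) {[]}    h       μ e = ≡.sym (coeff-homogeneous one μ homogeneous-one λ e′ → contradiction (≡.trans (≡.sym e) e′) λ ())
    elem-expand (suc r) {t ∷ A} (e₁ ∷ h) μ e = ≡.trans (coeff-⊕ ((t ∷ []) ⊗ elem r A) (elem (suc r) A) μ)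
      (≡.trans (≡.cong₂ ℤ._+_
        (⊗-congʳ (t ∷ []) {elem r A} {expand A} μ λ { {_} {ν} (here ≡.refl) eq → elem-expand r h ν (degree-of-sum (proj₂ t) ν μ e₁ eq e) })
        (elem-expand (suc r) h μ e))
      (≡.sym (coeff-⊕ ((t ∷ []) ⊗ expand A) (expand A) μ)))

  module Concrete (N B : ℕ) where

    open Truncated N B
    open CommutativeSemiring R hiding (zero)
    open ListSum R
    open Schur R
    open Tableaux R
    open import Relation.Binary.Reasoning.Setoid setoid

    monomial : ℕ → Vec ℕ N → Poly N
    monomial j v = (ℤ.+ 1 , (j , v)) ∷ []

    q : Poly N
    q = monomial 1 zeros

    open DualCauchy R q

    x : Fin N → Poly N
    x i = monomial 0 (unitVec i)

    pow-q : ∀ j → pow q j ≡ monomial j zeros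
    pow-q zero    = ≡.refl
    pow-q (suc j) = ≡.trans (≡.cong (q ⊗_) (pow-q j)) (≡.cong (monomial (suc j)) (zipWith-identityˡ ℕP.+-identityˡ zeros))

    qInt-geometric : ∀ k → qInt N k ≡ geometric k
    qInt-geometric zero    = ≡.refl
    qInt-geometric (suc k) = ≡.trans (≡.cong (map _) (≡.sym (upTo-∷ʳ k))) (≡.trans (map-++ _ (upTo k) (k ∷ []))
      (≡.cong₂ _++_ (qInt-geometric k) (≡.sym (pow-q k))))

    multiple : ∀ a L → ((ℤ.+ a , (L , zeros)) ∷ []) ≈ a • pow q L
    multiple a L = trans (go a) (reflexive (≡.cong (a •_) (≡.sym (pow-q L))))
      where
      term : ℕ → Poly N
      term a = (ℤ.+ a , (L , zeros)) ∷ []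
      go : ∀ a → term a ≈ a • monomial L zeros
      go zero    = agree λ μ _ → zero-term (monoEq? (L , zeros) μ)
        where
        zero-term : ∀ b → (if b then ℤ.+ 0 else ℤ.+ 0) ℤ.+ ℤ.+ 0 ≡ ℤ.+ 0
        zero-term true  = ≡.refl
        zero-term false = ≡.refl
      go (suc a) = trans (agree λ μ _ → ≡.trans (split (monoEq? (L , zeros) μ)) (≡.sym (coeff-⊕ (term 1) (term a) μ))) (+-congˡ (go a))
        where
        split : ∀ b → (if b then ℤ.+ suc a else ℤ.+ 0) ℤ.+ ℤ.+ 0 ≡ ((if b then ℤ.+ 1 else ℤ.+ 0) ℤ.+ ℤ.+ 0) ℤ.+ ((if b then ℤ.+ a else ℤ.+ 0) ℤ.+ ℤ.+ 0)
        split false = ≡.refl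
        split true  = ≡.cong ℤ.+_ (ℕP.+-assoc 1 a 0)

    terms-∷ʳ : ∀ i as a → terms N i (as ∷ʳ a) ≡ terms N i as ++ ((ℤ.+ a , (length as ℕ.+ i , zeros)) ∷ [])
    terms-∷ʳ i []       a = ≡.refl
    terms-∷ʳ i (b ∷ as) a = ≡.cong (_ ∷_) (≡.trans (terms-∷ʳ (suc i) as a) (≡.cong (λ j → terms N (suc i) as ++ ((ℤ.+ a , (j , zeros)) ∷ [])) (ℕP.+-suc (length as) i)))

    qPoly-series : ∀ f L → qPoly N (map f (upTo L)) ≈ series f L
    qPoly-series f L = trans (reflexive (qPoly-terms N (map f (upTo L)))) (go L)
      where
      go : ∀ L → terms N 0 (map f (upTo L)) ≈ series f L
      go zero    = refl
      go (suc L) = trans (reflexive (≡.trans (≡.cong (terms N 0) (≡.trans (≡.cong (map f) (≡.sym (upTo-∷ʳ L))) (map-++ f (upTo L) (L ∷ []))))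
          (≡.trans (terms-∷ʳ 0 (map f (upTo L)) (f L)) (≡.cong (λ j → terms N 0 (map f (upTo L)) ++ ((ℤ.+ f L , (j , zeros)) ∷ []))
            (≡.trans (ℕP.+-identityʳ _) (≡.trans (length-map f (upTo L)) (length-upTo L)))))))
        (+-cong (go L) (multiple (f L) L))

    addRow : List (Fin N) → Vec ℕ N → Vec ℕ N
    addRow r v = foldr (λ i v → zipWith ℕ._+_ (unitVec i) v) v r

    rowWeight-monomial : ∀ r v → rowWeight x r ⊗ monomial 0 v ≡ monomial 0 (addRow r v)
    rowWeight-monomial r v = ≡.trans (≡.cong (_⊗ monomial 0 v) (single r)) (≡.cong (monomial 0) (add r))
      where
      single : ∀ r → rowWeight x r ≡ monomial 0 (addRow r zeros)
      single []      = ≡.refl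
      single (i ∷ r) = ≡.cong (x i ⊗_) (single r)
      add : ∀ r → addRow r zeros ⊞ v ≡ addRow r v
      add []      = zipWith-identityˡ ℕP.+-identityˡ v
      add (i ∷ r) = ≡.trans (zipWith-assoc ℕP.+-assoc (unitVec i) (addRow r zeros) v) (≡.cong (unitVec i ⊞_) (add r))

    weightOf-monomial : ∀ T → weightOf x T ≡ monomial 0 (weight T)
    weightOf-monomial []      = ≡.refl
    weightOf-monomial (r ∷ T) = ≡.trans (≡.cong (rowWeight x r ⊗_) (weightOf-monomial T)) (rowWeight-monomial r (weight T))

    schur-rowsFrom : ∀ ls → schur N ls ≈ rowsFrom N x (λ _ → true) ls
    schur-rowsFrom ls = trans (reflexive (go (filterᵇ isSSYT (fillings N ls)))) (rowsFrom-fillings N x ls)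
      where
      go : ∀ Ts → map (λ T → (ℤ.+ 1 , (0 , weight T))) Ts ≡ Σ Ts (weightOf x)
      go []       = ≡.refl
      go (T ∷ Ts) = ≡.cong₂ _++_ (≡.sym (weightOf-monomial T)) (go Ts)

    -- A row of length zero has one filling, of weight 1, and imposes nothing on the rows below it,
    -- which are empty as well.
    rowsFrom-strip : ∀ {ℓ p} {v : Vec ℕ ℓ} → Dominant p v → ∀ c → c [] ≡ true → rowsFrom N x c (toList v) ≈ rowsFrom N x c (strip v)
    rowsFrom-strip []                    c e = refl
    rowsFrom-strip {v = suc a ∷ v} (_ ∷ d) c e = Σ-cong (words N (suc a)) λ r → guard-cong (rowOK r) λ _ → guard-cong (c r) λ _ →
      *-congˡ {x = rowWeight x r} (rowsFrom-strip d (colOK r) (col r))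
      where
      col : ∀ r → colOK {N} r [] ≡ true
      col []      = ≡.refl
      col (a ∷ r) = ≡.refl
    rowsFrom-strip {v = zero ∷ v} (_ ∷ d) c e = empty (z≤n ∷ d) c e
      where
      empty : ∀ {ℓ} {v : Vec ℕ ℓ} → Dominant 0 v → ∀ c → c [] ≡ true → rowsFrom N x c (toList v) ≈ 1#
      empty []          c e = refl
      empty {v = _ ∷ v} (z≤n ∷ d) c e = trans (+-identityʳ (guard (c []) (1# * below))) (trans (reflexive (≡.cong (λ b → guard b (1# * below)) e))
                                          (trans (*-identityˡ below) (empty d (colOK []) ≡.refl)))
        where
        below = rowsFrom N x (colOK []) (toList v)

    schur-strip : ∀ {ℓ p} {v : Vec ℕ ℓ} → Dominant p v → schur N (strip v) ≈ schurSum N x v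
    schur-strip {v = v} d = trans (schur-rowsFrom (strip v)) (trans (sym (rowsFrom-strip d (λ _ → true) ≡.refl)) (rowsFrom-schurSum N x v))

    Homogeneous-hsum : ∀ {y} a {f : ℕ → Poly N} {e} → Homogeneous 1 y → (∀ {ρ} → ρ ≤ a → Homogeneous (e ℕ.+ ρ) (f ρ)) → Homogeneous (e ℕ.+ a) (hsum y a f)
    Homogeneous-hsum zero    hy hf = hf z≤n
    Homogeneous-hsum (suc a) {e = e} hy hf = AllP.++⁺ (hf ℕP.≤-refl)
      (All.map (λ p → ≡.trans p (≡.sym (ℕP.+-suc e a))) (homogeneous-⊗ hy (Homogeneous-hsum a {e = e} hy λ le → hf (ℕP.m≤n⇒m≤1+n le))))

    guard-homogeneous : ∀ {d} b {p : Poly N} → Homogeneous d p → Homogeneous d (guard b p)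
    guard-homogeneous true  h = h
    guard-homogeneous false h = []

    Homogeneous-branch : ∀ {ℓ y} (v : Vec ℕ ℓ) {g e} → Homogeneous 1 y → (∀ κ → Homogeneous (e ℕ.+ vsum κ) (g κ)) → Homogeneous (e ℕ.+ vsum v) (branch y v g)
    Homogeneous-branch []      hy hg = hg []
    Homogeneous-branch (a ∷ v) {g} {e} hy hg = All.map (λ p → ≡.trans p (lem e (vsum v) a))
      (Homogeneous-hsum a {e = e ℕ.+ vsum v} hy λ {ρ} _ → guard-homogeneous (head₀ v ≤ᵇ ρ)
        (All.map (λ p → ≡.trans p (lem′ e ρ (vsum v))) (Homogeneous-branch v {e = e ℕ.+ ρ} hy λ κ →
          All.map (λ p → ≡.trans p (≡.sym (ℕP.+-assoc e ρ (vsum κ)))) (hg (ρ ∷ κ)))))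
      where
      open import Data.Nat.Tactic.RingSolver using (solve-∀)
      lem : ∀ e v a → e ℕ.+ v ℕ.+ a ≡ e ℕ.+ (a ℕ.+ v)
      lem = solve-∀
      lem′ : ∀ e ρ v → e ℕ.+ ρ ℕ.+ v ≡ e ℕ.+ v ℕ.+ ρ
      lem′ = solve-∀

    schurSum-homogeneous : ∀ {ℓ} M (xs : Fin M → Poly N) → (∀ i → Homogeneous 1 (xs i)) → ∀ (v : Vec ℕ ℓ) → Homogeneous (vsum v) (schurSum M xs v)
    schurSum-homogeneous zero    xs h v with allZero v in e
    ... | true  = ≡.subst (λ d → Homogeneous d one) (≡.sym (zero-sum v e)) homogeneous-one
      where
      zero-sum : ∀ {ℓ} (v : Vec ℕ ℓ) → allZero v ≡ true → vsum v ≡ 0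
      zero-sum []         e = ≡.refl
      zero-sum (zero ∷ v) e = zero-sum v e
    ... | false = []
    schurSum-homogeneous (suc M) xs h v = Homogeneous-branch v {e = 0} (h (fromℕ M)) (schurSum-homogeneous M (xs ∘ inject₁) (h ∘ inject₁))

    Variable : Poly N → Set
    Variable = Homogeneous 1

    last-bound : ∀ {ℓ p} {κ : Vec ℕ (suc ℓ)} → Dominant p κ → 0 < lastRow κ → suc ℓ ≤ vsum κ
    last-bound {κ = a ∷ []}    _       0<l = ≡.subst (0 <_) (≡.sym (ℕP.+-identityʳ a)) 0<l
    last-bound {κ = a ∷ b ∷ κ} (_ ∷ (b≤a ∷ d)) 0<l = ℕP.+-mono-≤ (ℕP.≤-trans (first-positive d′ 0<l) b≤a) (last-bound d′ 0<l)
      where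
      d′ : Dominant b (b ∷ κ)
      d′ = ℕP.≤-refl ∷ d
      first-positive : ∀ {ℓ p b} {κ : Vec ℕ ℓ} → Dominant p (b ∷ κ) → 0 < lastRow (b ∷ κ) → 0 < b
      first-positive {κ = []}    _                   0<l = 0<l
      first-positive {κ = c ∷ κ} (_ ∷ (c≤b ∷ d)) 0<l = ℕP.≤-trans (first-positive {κ = κ} (ℕP.≤-refl ∷ d) 0<l) c≤b

    high-degree : ∀ {d p} → Homogeneous d p → B < d → p ≈ 0#
    high-degree {d} {p} h B<d = agree λ μ le → coeff-homogeneous p μ h λ e → ℕP.<⇒≱ B<d (≡.subst (_≤ B) e le)

    -- A nonempty last row forces `κ` to have at least `B` boxes, so one more variable passes the
    -- degree up to which polynomials are compared. The shapes with an additional row are discarded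
    -- in this way.
    bottom : ∀ {ℓ} → B ≤ suc ℓ → ∀ M {y} {xs : Fin M → Poly N} → Variable y → (∀ i → Variable (xs i)) →
             ∀ {κ : Vec ℕ (suc ℓ)} → Dominant (head₀ κ) κ → 0 < lastRow κ → y * schurSum M xs κ ≈ 0#
    bottom B≤ℓ M {y} {xs} hy hxs {κ} d 0<l = high-degree (homogeneous-⊗ hy (schurSum-homogeneous M xs hxs κ)) (s≤s (ℕP.≤-trans B≤ℓ (last-bound d 0<l)))

    variables : ∀ i → Variable (x i)
    variables i = vsum-unitVec i ∷ []

    Π : ∀ {A : Set} → List A → (A → Poly N) → Poly N
    Π []       f = 1#
    Π (a ∷ as) f = f a * Π as f

    Π-last : ∀ {A : Set} {M} (g : Fin (suc M) → A) f → Π (tabulate g) f ≈ f (g (fromℕ M)) * Π (tabulate (g ∘ inject₁)) f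
    Π-last {M = zero}  g f = refl
    Π-last {M = suc M} g f = trans (*-congˡ {x = f (g zero)} (Π-last (g ∘ suc) f)) (*-swap (f (g zero)) (f (g (suc (fromℕ M)))) (Π (tabulate (g ∘ suc ∘ inject₁)) f))

    elementary-Π : ∀ M (g : Fin M → Fin N) y → elementary M (x ∘ g) y ≈ Π (tabulate g) (λ i → 1# + x i * y)
    elementary-Π zero    g y = refl
    elementary-Π (suc M) g y = trans (*-congˡ {x = 1# + x (g (fromℕ M)) * y} (elementary-Π M (g ∘ inject₁) y)) (sym (Π-last g (λ i → 1# + x i * y)))

    expand-++ : ∀ A C → expand (A ++ C) ≈ expand A * expand C
    expand-++ []      C = sym (*-identityˡ (expand C))
    expand-++ (t ∷ A) C = trans (+-cong (*-congˡ {x = t ∷ []} (expand-++ A C)) (expand-++ A C))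
      (trans (+-congʳ {x = expand A * expand C} (sym (*-assoc (t ∷ []) (expand A) (expand C)))) (sym (distribʳ (expand C) ((t ∷ []) * expand A) (expand A))))

    expand-letters : ∀ j is → expand (map (λ i → (ℤ.+ 1 , (j , unitVec i))) is) ≈ Π is (λ i → 1# + x i * pow q j)
    expand-letters j []       = refl
    expand-letters j (i ∷ is) = begin
      monomial j (unitVec i) * E + E             ≈⟨ +-comm (monomial j (unitVec i) * E) E ⟩
      E + monomial j (unitVec i) * E             ≈⟨ +-congʳ (*-identityˡ E) ⟨
      1# * E + monomial j (unitVec i) * E        ≈⟨ distribʳ E 1# (monomial j (unitVec i)) ⟨
      (1# + monomial j (unitVec i)) * E
        ≈⟨ *-cong {x = 1# + monomial j (unitVec i)} {y = 1# + x i * pow q j} (+-congˡ {x = 1#} (reflexive (≡.trans (≡.cong (monomial j) (≡.sym (zipWith-identityʳ ℕP.+-identityʳ (unitVec i)))) (≡.cong (x i ⊗_) (≡.sym (pow-q j)))))) (expand-letters j is) ⟩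
      Π (i ∷ is) (λ i → 1# + x i * pow q j)      ∎
      where
      E = expand (map (λ i → (ℤ.+ 1 , (j , unitVec i))) is)

    expand-alphabet : ∀ s → expand (alphabet N s) ≈ generating x s
    expand-alphabet zero    = refl
    expand-alphabet (suc s) = begin
      expand (alphabet N (suc s))                           ≈⟨ reflexive (≡.cong expand (≡.trans (≡.cong (concatMap letters) (≡.sym (upTo-∷ʳ s))) (concatMap-++ letters (upTo s) (s ∷ [])))) ⟩
      expand (alphabet N s ++ (letters s ++ []))            ≈⟨ expand-++ (alphabet N s) (letters s ++ []) ⟩
      expand (alphabet N s) * expand (letters s ++ [])
        ≈⟨ *-cong (expand-alphabet s) (trans (reflexive (≡.cong expand (++-identityʳ (letters s)))) (trans (expand-letters s (allFin N)) (sym (elementary-Π N id (pow q s))))) ⟩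
      generating x s * elementary N x (pow q s)             ≈⟨ *-comm (generating x s) (elementary N x (pow q s)) ⟩
      generating x (suc s)                                  ∎
      where
      letters : ℕ → Poly N
      letters j = map (λ i → (ℤ.+ 1 , (j , unitVec i))) (allFin N)

-- The Schur expansion and its coefficients.

module SchurExpansion where

  open import Defs hiding (_≈_)
  import Defs
  open BenderKnuth using (Dominant; []; _∷_)
  open ListSums
  open VerticalStrips using (vsum; dominant)
  open StripWalks
  open Division using (window; module Quotient)
  open PrincipalTriple
  open UnimodalCounts
  open PieriRule
  open DualCauchyIdentity
  open PolynomialSemiring
  open ChainsOfShapes
  open CoefficientLists using (terms; qPoly-terms)
  open AlphabetExpansion
  open import Algebra.Bundles using (CommutativeSemiring)
  open import Data.Bool using (true; false)
  open import Data.Nat as ℕ using (ℕ; zero; suc; _≤_; _<_; z≤n; s≤s)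
  import Data.Nat.Properties as ℕP
  open import Data.Nat.ListAction using (sum)
  open import Data.Nat.Coprimality using (Coprime; coprime-Bézout)
  open import Data.Nat.GCD using (module Bézout)
  open import Data.Nat.Tactic.RingSolver using (solve-∀)
  open import Data.Integer as ℤ using (ℤ)
  open import Data.List using (List; []; _∷_; _++_; map; upTo; filter; deduplicate)
  open import Data.List.Membership.Propositional using (_∈_)
  open import Data.List.Membership.Propositional.Properties using (∈-map⁺; ∈-map⁻; ∈-filter⁺; ∈-filter⁻; ∈-deduplicate⁺; ∈-deduplicate⁻)
  open import Data.List.Relation.Unary.Any using (here; there)
  open import Data.List.Relation.Unary.All as All using (All; []; _∷_)
  import Data.List.Relation.Unary.All.Properties as AllP
  open import Data.List.Relation.Unary.AllPairs using (_∷_)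
  open import Data.List.Relation.Unary.Linked using (Linked; []; [-]; _∷_)
  open import Data.List.Relation.Unary.Unique.Propositional using (Unique)
  open import Data.List.Relation.Unary.Unique.DecPropositional.Properties using (deduplicate-!)
  open import Data.Vec using (Vec; []; _∷_)
  open import Data.Vec.Properties using (≡-dec)
  open import Data.Product using (Σ; _×_; _,_; proj₁; proj₂)
  open import Relation.Binary using (DecidableEquality)
  open import Relation.Nullary using (yes; no; does)
  open import Relation.Nullary.Decidable using (dec-true; dec-false)
  open import Relation.Binary.PropositionalEquality as ≡ using (_≡_; _≢_)

  final-dominant : ∀ {ℓ m} {μ : Vec ℕ ℓ} {w : Vec (Vec ℕ ℓ) m} → dominant μ ≡ true → IsWalk μ w → dominant (final μ w) ≡ true
  final-dominant d []            = d
  final-dominant d (step _ d′ w) = final-dominant d′ w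

  strip-positive : ∀ {ℓ} (v : Vec ℕ ℓ) → All (0 <_) (strip v)
  strip-positive []          = []
  strip-positive (zero ∷ v)  = []
  strip-positive (suc a ∷ v) = s≤s z≤n ∷ strip-positive v

  strip-linked : ∀ {ℓ p} {v : Vec ℕ ℓ} → Dominant p v → Linked (λ a b → b ≤ a) (strip v)
  strip-linked []                            = []
  strip-linked {v = zero ∷ v}          _     = []
  strip-linked {v = suc a ∷ []}        _     = [-]
  strip-linked {v = suc a ∷ zero ∷ v}  _     = [-]
  strip-linked {v = suc a ∷ suc b ∷ v} (_ ∷ d@(b≤a ∷ _)) = b≤a ∷ strip-linked d

  strip-sum : ∀ {ℓ p} {v : Vec ℕ ℓ} → Dominant p v → sum (strip v) ≡ vsum v
  strip-sum []                      = ≡.refl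
  strip-sum {v = suc a ∷ v} (_ ∷ d) = ≡.cong (suc a ℕ.+_) (strip-sum d)
  strip-sum {v = zero ∷ v}  (_ ∷ d) = ≡.sym (empty d)
    where
    empty : ∀ {ℓ} {v : Vec ℕ ℓ} → Dominant 0 v → vsum v ≡ 0
    empty []        = ≡.refl
    empty (z≤n ∷ d) = empty d

  -- The parameter `periodic` carries all the arithmetic: the class sums have period `suc ℓ` by
  -- rotation and period `suc n` by definition, and from these it yields period `d`.
  module Expansion (n ℓ d : ℕ) (d≤s : d ≤ suc n)
    (periodic : ∀ (U : ℕ → ℕ) → (∀ i → U i ≡ U (i ℕ.+ suc ℓ)) → (∀ i → U i ≡ U (i ℕ.+ suc n)) → ∀ i → U i ≡ U (i ℕ.+ d)) where

    r s : ℕ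
    r = suc ℓ
    s = suc n

    _≟V_ : DecidableEquality (Vec ℕ r)
    _≟V_ = ≡-dec ℕP._≟_

    paths : List (Vec (Vec ℕ r) s)
    paths = walks s zeros

    -- Collected from the endpoints of chains, so that partitions need not be enumerated; a
    -- partition that no chain reaches would have coefficient zero.
    shapes : List (Vec ℕ r)
    shapes = deduplicate _≟V_ (map (final zeros) (filter (λ w → vsum (final zeros w) ℕP.≟ r) paths))

    shapes-unique : Unique shapes
    shapes-unique = deduplicate-! _≟V_ _

    shapes-complete : ∀ {w} → w ∈ paths → vsum (final zeros w) ≡ r → final zeros w ∈ shapes
    shapes-complete w∈ e = ∈-deduplicate⁺ _≟V_ (∈-map⁺ (final zeros) (∈-filter⁺ (λ w → vsum (final zeros w) ℕP.≟ r) w∈ e))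

    shapes-sound : ∀ {v} → v ∈ shapes → vsum v ≡ r × dominant v ≡ true
    shapes-sound v∈ with ∈-map⁻ (final zeros) (∈-deduplicate⁻ _≟V_ (map (final zeros) (filter (λ w → vsum (final zeros w) ℕP.≟ r) paths)) v∈)
    ... | w , w∈ , ≡.refl with ∈-filter⁻ (λ w → vsum (final zeros w) ℕP.≟ r) {xs = paths} w∈
    ...   | w∈′ , e = e , final-dominant (dominant-0 r) (∈-walks⁻ s w∈′)

    module At (v : Vec ℕ r) where
      open WalkStates n r v public
      open Unimodality n r v public using (grade-bounded)
      open Commutator n r v public using (grade)
      D : ℕ
      D = Unimodality.total n r v
      quotient : ℕ → ℕ
      quotient = Quotient.q n d count

    -- The list is complete, since the quotient vanishes from `D + d` on by `q-vanish`.
    coefficients : Vec ℕ r → List ℕ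
    coefficients v = map (At.quotient v) (upTo (At.D v ℕ.+ d))

    expansion : List (List ℕ × List ℕ)
    expansion = map (λ v → (strip v , coefficients v)) shapes

    expansion-partitions : All (λ p → IsPartitionOf r (proj₁ p)) expansion
    expansion-partitions = AllP.map⁺ (All.tabulate λ {v} v∈ → let dom = dominant⇒Dominant v (proj₂ (shapes-sound v∈)) in
      strip-positive v , strip-linked dom , ≡.trans (strip-sum dom) (proj₁ (shapes-sound v∈)))

    module Ring (N B : ℕ) where

      open Concrete N B public
      open CommutativeSemiring (Truncated.R N B) hiding (zero) public
      open ListSum (Truncated.R N B) renaming (Σ to ∑) public
      open Schur (Truncated.R N B) public
      open DualCauchy (Truncated.R N B) q public
      open import Relation.Binary.Reasoning.Setoid setoid

      S : Vec ℕ r → Poly N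
      S v = schurSum N x v

      -- The polynomial `G_λ(q)` for `λ = v`.
      multiplicity : Vec ℕ r → Poly N
      multiplicity v = ∑ paths λ w → guard (does (final zeros w ≟V v)) (pow q (stat (content zeros w)))

      multiplicity-series : ∀ v → multiplicity v ≈ series (At.count v) (suc (At.D v))
      multiplicity-series v = trans (sym (At.Σ-all v (Truncated.R N B) (pow q)))
        (trans (Σ-pow (At.all v) (suc (At.D v)) (At.grade v) λ M∈ → s≤s (At.grade-bounded v (At.sound v M∈)))
               (series-cong (suc (At.D v)) λ j → ≡.sym (At.count-Σ v j)))

      divided : ∀ {v} → v ∈ shapes → geometric d * multiplicity v ≈ geometric s * qPoly N (coefficients v)
      divided {v} v∈ = begin
        geometric d * multiplicity v                       ≈⟨ *-congˡ {x = geometric d} (multiplicity-series v) ⟩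
        geometric d * series count (suc D)                 ≈⟨ geometric-series d vanish ⟩
        -- Padding with `n` zero coefficients brings both sides to the common length `s + (D + d)`.
        series (window d count) (d ℕ.+ suc D)              ≈⟨ series-extend (window d count) (d ℕ.+ suc D) n (window-vanish d vanish) ⟨
        series (window d count) (n ℕ.+ (d ℕ.+ suc D))      ≈⟨ series-cong (n ℕ.+ (d ℕ.+ suc D)) window-p≡window-q ⟩
        series (window s quotient) (n ℕ.+ (d ℕ.+ suc D))   ≈⟨ reflexive (≡.cong (series (window s quotient)) (lem n d D)) ⟩
        series (window s quotient) (s ℕ.+ (D ℕ.+ d))       ≈⟨ geometric-series s q-vanish ⟨
        geometric s * series quotient (D ℕ.+ d)            ≈⟨ *-congˡ {x = geometric s} (sym (qPoly-series quotient (D ℕ.+ d))) ⟩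
        geometric s * qPoly N (coefficients v)             ∎
        where
        open At v
        open Shape d d≤s (periodic (residueSum n isShape)
          (λ i → ≡.trans (residueSum-size i) (≡.cong (λ z → residueSum n isShape (i ℕ.+ z)) (proj₁ (shapes-sound v∈)))) residueSum-period)
        vanish : ∀ j → suc D ≤ j → count j ≡ 0
        vanish j = count-vanish j
        lem : ∀ n d D → n ℕ.+ (d ℕ.+ (1 ℕ.+ D)) ≡ 1 ℕ.+ n ℕ.+ (D ℕ.+ d)
        lem = solve-∀

      pick : ∀ {vs} → Unique vs → ∀ {e} → e ∈ vs → ∀ (F : Vec ℕ r → Poly N) → ∑ vs (λ v → guard (does (e ≟V v)) (F v)) ≈ F e
      pick {v ∷ vs} (v∉ ∷ u) {e} (here ≡.refl) F = trans (+-cong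
        (reflexive (≡.cong (λ b → guard b (F v)) (dec-true (v ≟V v) ≡.refl)))
        (Σ-zero vs λ {v′} v′∈ → reflexive (≡.cong (λ b → guard b (F v′)) (dec-false (v ≟V v′) (All.lookup v∉ v′∈))))) (+-identityʳ (F v))
      pick {v ∷ vs} (v∉ ∷ u) {e} (there e∈) F = trans (+-cong
        (reflexive (≡.cong (λ b → guard b (F v)) (dec-false (e ≟V v) λ { ≡.refl → All.lookup v∉ e∈ ≡.refl })))
        (pick u e∈ F)) (+-identityˡ (F e))

      term : Vec (Vec ℕ r) s → Poly N
      term w = pow q (stat (content zeros w)) * S (final zeros w)

      group : ∑ paths (λ w → guard (does (vsum (final zeros w) ℕP.≟ r)) (term w)) ≈ ∑ shapes (λ v → multiplicity v * S v)
      group = begin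
        ∑ paths (λ w → guard (does (vsum (final zeros w) ℕP.≟ r)) (term w))
          ≈⟨ Σ-cong∈ paths (λ {w} w∈ → distribute w∈) ⟩
        ∑ paths (λ w → ∑ shapes (λ v → guard (does (final zeros w ≟V v)) (pow q (stat (content zeros w))) * S v))
          ≈⟨ Σ-swap paths shapes (λ w v → guard (does (final zeros w ≟V v)) (pow q (stat (content zeros w))) * S v) ⟩
        ∑ shapes (λ v → ∑ paths (λ w → guard (does (final zeros w ≟V v)) (pow q (stat (content zeros w))) * S v))
          ≈⟨ Σ-cong shapes (λ v → Σ-*ʳ paths (S v) (λ w → guard (does (final zeros w ≟V v)) (pow q (stat (content zeros w))))) ⟩
        ∑ shapes (λ v → multiplicity v * S v) ∎
        where
        guard-*ʳ : ∀ b y z → guard b y * z ≈ guard b (y * z)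
        guard-*ʳ true  y z = refl
        guard-*ʳ false y z = refl
        distribute : ∀ {w} → w ∈ paths → guard (does (vsum (final zeros w) ℕP.≟ r)) (term w)
                   ≈ ∑ shapes (λ v → guard (does (final zeros w ≟V v)) (pow q (stat (content zeros w))) * S v)
        distribute {w} w∈ = trans (cases (vsum (final zeros w) ℕP.≟ r))
          (sym (Σ-cong shapes λ v → guard-*ʳ (does (final zeros w ≟V v)) (pow q (stat (content zeros w))) (S v)))
          where
          open import Relation.Nullary using (Dec)
          cases : (p : Dec (vsum (final zeros w) ≡ r)) → guard (does p) (term w)
                ≈ ∑ shapes (λ v → guard (does (final zeros w ≟V v)) (pow q (stat (content zeros w)) * S v))
          cases (yes e) = sym (pick shapes-unique (shapes-complete w∈ e) (λ v → pow q (stat (content zeros w)) * S v))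
          cases (no ne) = sym (Σ-zero shapes λ {v} v∈ → reflexive (≡.cong (λ b → guard b (pow q (stat (content zeros w)) * S v))
            (dec-false (final zeros w ≟V v) λ { ≡.refl → ne (proj₁ (shapes-sound v∈)) })))

      expansion-Σ : schurExpansion N expansion ≈ ∑ shapes (λ v → qPoly N (coefficients v) * S v)
      expansion-Σ = trans (reflexive (go shapes)) (Σ-cong∈ shapes λ {v} v∈ → *-congˡ {x = qPoly N (coefficients v)} (schur-strip (dominant⇒Dominant v (proj₂ (shapes-sound v∈)))))
        where
        go : ∀ vs → schurExpansion N (map (λ v → (strip v , coefficients v)) vs) ≡ ∑ vs (λ v → qPoly N (coefficients v) * schur N (strip v))
        go []       = ≡.refl
        go (v ∷ vs) = ≡.cong ((qPoly N (coefficients v) ⊗ schur N (strip v)) ++_) (go vs)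

      divided-sum : qInt N d * ∑ paths (λ w → guard (does (vsum (final zeros w) ℕP.≟ r)) (term w)) ≈ qInt N s * schurExpansion N expansion
      divided-sum = begin
        qInt N d * ∑ paths (λ w → guard (does (vsum (final zeros w) ℕP.≟ r)) (term w))
          ≈⟨ *-cong {x = qInt N d} (reflexive (qInt-geometric d)) group ⟩
        geometric d * ∑ shapes (λ v → multiplicity v * S v)
          ≈⟨ Σ-*ˡ shapes (geometric d) (λ v → multiplicity v * S v) ⟨
        ∑ shapes (λ v → geometric d * (multiplicity v * S v))
          ≈⟨ Σ-cong∈ shapes (λ {v} v∈ → trans (sym (*-assoc (geometric d) (multiplicity v) (S v)))
               (trans (*-congʳ {x = S v} (divided v∈)) (*-assoc (geometric s) (qPoly N (coefficients v)) (S v)))) ⟩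
        ∑ shapes (λ v → geometric s * (qPoly N (coefficients v) * S v))
          ≈⟨ Σ-*ˡ shapes (geometric s) (λ v → qPoly N (coefficients v) * S v) ⟩
        geometric s * ∑ shapes (λ v → qPoly N (coefficients v) * S v)
          ≈⟨ *-cong {x = geometric s} (reflexive (≡.sym (qInt-geometric s))) (sym expansion-Σ) ⟩
        qInt N s * schurExpansion N expansion ∎

      expand-paths : B ≤ r → expand (alphabet N s) ≈ ∑ paths term
      expand-paths B≤r = trans (expand-alphabet s) (trans (dual-cauchy Variable (bottom B≤r) variables s)
        (sym (WalkSum.Σ-walks (Truncated.R N B) s (zeros {r}) (λ α e → pow q (stat α) * schurSum N x e))))

    module _ (N : ℕ) where

      A : Poly N
      A = alphabet N s

      coeff-∑ : ∀ {X : Set} B (xs : List X) (F G : X → Poly N) μ → (∀ w → coeff (F w) μ ≡ coeff (G w) μ) →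
                coeff (Ring.∑ N B xs F) μ ≡ coeff (Ring.∑ N B xs G) μ
      coeff-∑ B []       F G μ eq = ≡.refl
      coeff-∑ B (w ∷ xs) F G μ eq = ≡.trans (coeff-⊕ (F w) (Ring.∑ N B xs F) μ)
        (≡.trans (≡.cong₂ ℤ._+_ (eq w) (coeff-∑ B xs F G μ eq)) (≡.sym (coeff-⊕ (G w) (Ring.∑ N B xs G) μ)))

      pow-q-homogeneous : ∀ B j → Homogeneous 0 (Ring.pow N B (Ring.q N B) j)
      pow-q-homogeneous B j = ≡.subst (Homogeneous 0) (≡.sym (Ring.pow-q N B j)) (vsum-0 N ∷ [])

      term-homogeneous : ∀ B w → Homogeneous (vsum (final zeros w)) (Ring.term N B w)
      term-homogeneous B w = homogeneous-⊗ (pow-q-homogeneous B (stat (content zeros w))) (Ring.schurSum-homogeneous N B N (Ring.x N B) (Ring.variables N B) (final zeros w))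

      -- Truncation at `r` makes shapes with `r` rows exact in degree `r`. As `qInt` has `x`-degree
      -- 0, `elem` may be replaced by the full product, and chains of other sizes may be dropped,
      -- without touching this degree.
      on-degree : ∀ μ → degree μ ≡ r → coeff (qInt N d ⊗ elem r A) μ ≡ coeff (qInt N s ⊗ schurExpansion N expansion) μ
      on-degree μ e = begin
        coeff (qInt N d ⊗ elem r A) μ
          ≡⟨ ⊗-congʳ (qInt N d) {elem r A} {expand A} μ (λ {t} {ν} t∈ eq → elem-expand r (alphabet-homogeneous s) ν (level t∈ eq)) ⟩
        coeff (qInt N d ⊗ expand A) μ
          ≡⟨ Truncated.at-degree {N} {r} (*-congˡ {x = qInt N d} (expand-paths ℕP.≤-refl)) μ (ℕP.≤-reflexive e) ⟩
        coeff (qInt N d ⊗ ∑ paths term) μ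
          ≡⟨ ⊗-congʳ (qInt N d) {∑ paths term} {selected} μ (λ {t} {ν} t∈ eq → coeff-∑ r paths term _ ν λ w → select w ν (level t∈ eq)) ⟩
        coeff (qInt N d ⊗ selected) μ
          ≡⟨ Truncated.at-degree {N} {r} divided-sum μ (ℕP.≤-reflexive e) ⟩
        coeff (qInt N s ⊗ schurExpansion N expansion) μ ∎
        where
        open Ring N r
        open ≡.≡-Reasoning
        selected : Poly N
        selected = ∑ paths (λ w → guard (does (vsum (final zeros w) ℕP.≟ r)) (term w))
        level : ∀ {t ν} → t ∈ qInt N d → monoMul (proj₂ t) ν ≡ μ → degree ν ≡ r
        level {t} {ν} t∈ eq = degree-of-sum (proj₂ t) ν μ (All.lookup (qInt-homogeneous d) t∈) eq e
        select : ∀ w ν → degree ν ≡ r → coeff (term w) ν ≡ coeff (guard (does (vsum (final zeros w) ℕP.≟ r)) (term w)) ν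
        select w ν eν = go (vsum (final zeros w) ℕP.≟ r)
          where
          open import Relation.Nullary using (Dec)
          go : (p : Dec (vsum (final zeros w) ≡ r)) → coeff (term w) ν ≡ coeff (guard (does p) (term w)) ν
          go (yes _) = ≡.refl
          go (no ne) = coeff-homogeneous (term w) ν (term-homogeneous r w) λ e′ → ne (≡.trans (≡.sym e′) eν)

      -- Both sides are homogeneous of degree `r`, so both coefficients are 0. The truncation is put
      -- at the degree of `μ` itself, so that the right side may be rewritten there with `schurSum`.
      off-degree : ∀ μ → degree μ ≢ r → coeff (qInt N d ⊗ elem r A) μ ≡ coeff (qInt N s ⊗ schurExpansion N expansion) μ
      off-degree μ ne = ≡.trans
        (coeff-homogeneous (qInt N d ⊗ elem r A) μ (homogeneous-⊗ (qInt-homogeneous d) (elem-homogeneous r (alphabet-homogeneous s))) ne)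
        (≡.sym (≡.trans (Truncated.at-degree {N} {B} (*-congˡ {x = qInt N s} expansion-Σ) μ ℕP.≤-refl)
          (coeff-homogeneous (qInt N s ⊗ ∑ shapes (λ v → qPoly N (coefficients v) * S v)) μ
            (homogeneous-⊗ (qInt-homogeneous s) (sum-homogeneous shapes λ v∈ → v∈)) ne)))
        where
        B = degree μ
        open Ring N B
        terms-homogeneous : ∀ i as → Homogeneous 0 (terms N i as)
        terms-homogeneous i []       = []
        terms-homogeneous i (a ∷ as) = vsum-0 N ∷ terms-homogeneous (suc i) as
        sum-homogeneous : ∀ vs → (∀ {v} → v ∈ vs → v ∈ shapes) → Homogeneous r (∑ vs (λ v → qPoly N (coefficients v) * S v))
        sum-homogeneous []       sub = []
        sum-homogeneous (v ∷ vs) sub = AllP.++⁺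
          (≡.subst (λ e → Homogeneous e (qPoly N (coefficients v) * S v)) (proj₁ (shapes-sound (sub (here ≡.refl))))
            (homogeneous-⊗ (≡.subst (Homogeneous 0) (≡.sym (qPoly-terms N (coefficients v))) (terms-homogeneous 0 (coefficients v)))
                           (schurSum-homogeneous N x variables v)))
          (sum-homogeneous vs λ v∈ → sub (there v∈))

      identity : Defs._≈_ (qInt N d ⊗ elem r A) (qInt N s ⊗ schurExpansion N expansion)
      identity μ with degree μ ℕP.≟ r
      ... | yes e = on-degree μ e
      ... | no ne = off-degree μ ne

  iterate-period : ∀ (U : ℕ → ℕ) c → (∀ i → U i ≡ U (i ℕ.+ c)) → ∀ t i → U i ≡ U (i ℕ.+ t ℕ.* c)
  iterate-period U c p zero    i = ≡.cong U (≡.sym (ℕP.+-identityʳ i))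
  iterate-period U c p (suc t) i = ≡.trans (p i) (≡.trans (iterate-period U c p t (i ℕ.+ c)) (≡.cong U (ℕP.+-assoc i c (t ℕ.* c))))

  -- A Bézout relation writes `k` as a difference of multiples of `k * m` and `k * n`: go forward by
  -- the larger multiple and compare with `i + k` moved forward by the smaller one.
  bezout-period : ∀ {m n} k → Coprime m n → ∀ (U : ℕ → ℕ) → (∀ i → U i ≡ U (i ℕ.+ k ℕ.* n)) → (∀ i → U i ≡ U (i ℕ.+ k ℕ.* m)) → ∀ i → U i ≡ U (i ℕ.+ k)
  bezout-period {m} {n} k c U pn pm i with coprime-Bézout c
  ... | Bézout.+- x y e = ≡.trans (iterate-period U (k ℕ.* m) pm x i)
          (≡.trans (≡.cong U (combine x m y n e)) (≡.sym (iterate-period U (k ℕ.* n) pn y (i ℕ.+ k))))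
    where
    combine : ∀ x m y n → 1 ℕ.+ y ℕ.* n ≡ x ℕ.* m → i ℕ.+ x ℕ.* (k ℕ.* m) ≡ i ℕ.+ k ℕ.+ y ℕ.* (k ℕ.* n)
    combine x m y n e = ≡.trans (lem i k x m) (≡.trans (≡.cong (λ z → i ℕ.+ k ℕ.* z) (≡.sym e)) (lem′ i k y n))
      where
      lem : ∀ i k x m → i ℕ.+ x ℕ.* (k ℕ.* m) ≡ i ℕ.+ k ℕ.* (x ℕ.* m)
      lem = solve-∀
      lem′ : ∀ i k y n → i ℕ.+ k ℕ.* (1 ℕ.+ y ℕ.* n) ≡ i ℕ.+ k ℕ.+ y ℕ.* (k ℕ.* n)
      lem′ = solve-∀
  ... | Bézout.-+ x y e = ≡.trans (iterate-period U (k ℕ.* n) pn y i)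
          (≡.trans (≡.cong U (combine y n x m e)) (≡.sym (iterate-period U (k ℕ.* m) pm x (i ℕ.+ k))))
    where
    combine : ∀ x m y n → 1 ℕ.+ y ℕ.* n ≡ x ℕ.* m → i ℕ.+ x ℕ.* (k ℕ.* m) ≡ i ℕ.+ k ℕ.+ y ℕ.* (k ℕ.* n)
    combine x m y n e = ≡.trans (lem i k x m) (≡.trans (≡.cong (λ z → i ℕ.+ k ℕ.* z) (≡.sym e)) (lem′ i k y n))
      where
      lem : ∀ i k x m → i ℕ.+ x ℕ.* (k ℕ.* m) ≡ i ℕ.+ k ℕ.* (x ℕ.* m)
      lem = solve-∀
      lem′ : ∀ i k y n → i ℕ.+ k ℕ.* (1 ℕ.+ y ℕ.* n) ≡ i ℕ.+ k ℕ.+ y ℕ.* (k ℕ.* n)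
      lem′ = solve-∀

-- The case of coprime `m` and `n`.

open import Defs
open import Data.Nat using (ℕ; _*_; _≤_)
open import Data.Nat using (suc; _+_)
open import Data.Nat.Properties using (m≤m*n)
open import Data.Nat.Coprimality using (Coprime)
open import Data.List using (List)
open import Data.List.Relation.Unary.All using (All)
open import Data.Product using (Σ; _×_; proj₁)
open import Data.Product using (_,_)
open SchurExpansion using (module Expansion; bezout-period)

theorem2p1 : (m n k : ℕ) → 1 ≤ m → 1 ≤ n → Coprime m n → 1 ≤ k →
    Σ (List (List ℕ × List ℕ)) (λ L →
    All (λ p → IsPartitionOf (k * n) (proj₁ p)) L ×
    ((N : ℕ) → (qInt N k ⊗ elem (k * n) (alphabet N (k * m)))
    ≈ (qInt N (k * m) ⊗ schurExpansion N L)))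
theorem2p1 (suc m) (suc n) (suc k) _ _ coprime _ = expansion , expansion-partitions , identity
  where
  -- After the pattern match the first two arguments are the predecessors of the products for `s`
  -- and `r`, whose successors reduce to `suc k * suc m` and `suc k * suc n`.
  open Expansion (m + k * suc m) (n + k * suc n) (suc k) (m≤m*n (suc k) (suc m)) (bezout-period (suc k) coprime)
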